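{- Let $\mathbb{F}$ be a prime field and let $f \in \mathbb{F}[x_1,\ldots,x_n]$ be a quartic polynomial ($\deg(f)=4$) with $\mathrm{bias}(f)=\delta$. Then there exist $4c = \mathrm{poly}(|\mathbb{F}|/\delta)$ polynomials $\{\ell_i,q_i,q'_i,g_i\}_{i=1}^{c}$, where the $\ell_i$ are linear, the $q_i$ and $q'_i$ are quadratic and the $g_i$ are cubic, such that $$f = \sum_{j=1}^{c} \ell_j \cdot g_j + \sum_{j=1}^{c} q_j \cdot q'_j .$$
   Context: For $f:\mathbb{F}^n\to\mathbb{F}$, $\mathrm{bias}(f) = \left|\mathbb{E}_{a \in \mathbb{F}^n}[\omega^{f(a)}]\right|$ with $\omega = e^{2\pi i/|\mathbb{F}|}$. Polynomials are identified with the functions $\mathbb{F}^n\to\mathbb{F}$ they define (i.e. one works modulo $x_i^{p}-x_i$, $p=|\mathbb{F}|$), and the degree of a function is the least degree of a polynomial representing it. In the conclusion, "linear", "quadratic", "cubic" mean degree at most $1,2,3$ (linear functions may have a constant term). $\mathrm{poly}(|\mathbb{F}|/\delta)$ denotes a quantity bounded by $P(|\mathbb{F}|/\delta)$ for a fixed polynomial $P$ independent of $\mathbb{F}$, $n$, $f$, $\delta$. -}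

module Defs where

open import Algebra.Bundles.Raw using (RawSemiring)
import Algebra.Definitions.RawSemiring as RawSemiringDefinitions
open import Data.Fin.Base using (Fin; toℕ)
open import Data.Integer.Base as ℤ using (+_; -[1+_])
open import Data.List.Base as List using (List; []; _∷_)
open import Data.List.Relation.Unary.All using (All)
open import Data.Nat.Base as ℕ using (ℕ; zero; suc; NonZero)
import Data.Integer.Properties as ℤₚ
import Data.Nat.Properties as ℕₚ
open import Data.Nat.DivMod using (_mod_)
open import Data.Product.Base using (Σ-syntax; ∃-syntax; _×_; _,_)
open import Data.Rational.Base as ℚ using (ℚ; 0ℚ; 1ℚ; ½; _/_)
import Data.Rational.Properties as ℚₚ
open import Data.Rational.Solver using (module +-*-Solver)
import Data.Rational.Unnormalised.Base as ℚᵘ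
import Data.Rational.Unnormalised.Properties as ℚᵘₚ
open import Data.Sum.Base using (inj₁; inj₂)
open import Data.Vec.Base as Vec using (Vec; []; _∷_; lookup)
open import Level using (0ℓ)
open import Relation.Binary.PropositionalEquality
open import Relation.Nullary.Negation using (¬_)

-- Distinct sequences may denote the same real: equality of reals is _≃_, not _≡_.

CauchySeq : (ℕ → ℚ) → Set
CauchySeq x = ∀ ε → 0ℚ ℚ.< ε →
  ∃[ N ] ∀ {m n} → N ℕ.≤ m → N ℕ.≤ n → ℚ.∣ x m ℚ.- x n ∣ ℚ.≤ ε

record ℝ : Set where
  constructor mkℝ
  field
    seq    : ℕ → ℚ
    cauchy : CauchySeq seq

open ℝ public

infix 4 _≃_ _≤_ _<_

_≃_ _≤_ _<_ : ℝ → ℝ → Set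
x ≃ y = ∀ ε → 0ℚ ℚ.< ε →
  ∃[ N ] ∀ n → N ℕ.≤ n → ℚ.∣ seq x n ℚ.- seq y n ∣ ℚ.≤ ε
x ≤ y = ∀ ε → 0ℚ ℚ.< ε →
  ∃[ N ] ∀ n → N ℕ.≤ n → seq x n ℚ.≤ seq y n ℚ.+ ε
x < y = ∃[ ε ] 0ℚ ℚ.< ε ×
  ∃[ N ] ∀ n → N ℕ.≤ n → seq x n ℚ.+ ε ℚ.≤ seq y n

triangle : ∀ a b c → ℚ.∣ a ℚ.- c ∣ ℚ.≤ ℚ.∣ a ℚ.- b ∣ ℚ.+ ℚ.∣ b ℚ.- c ∣
triangle a b c = subst (λ z → ℚ.∣ z ∣ ℚ.≤ ℚ.∣ a ℚ.- b ∣ ℚ.+ ℚ.∣ b ℚ.- c ∣)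
  (solve 3 (λ a b c → (a :- b) :+ (b :- c) := a :- c) refl a b c)
  (ℚₚ.∣p+q∣≤∣p∣+∣q∣ (a ℚ.- b) (b ℚ.- c))
  where open +-*-Solver

∣-∣-comm : ∀ a b → ℚ.∣ a ℚ.- b ∣ ≡ ℚ.∣ b ℚ.- a ∣
∣-∣-comm a b = trans (cong ℚ.∣_∣ (solve 2 (λ a b → a :- b := :- (b :- a)) refl a b))
                     (ℚₚ.∣-p∣≡∣p∣ (b ℚ.- a))
  where open +-*-Solver

half-pos : ∀ {ε} → 0ℚ ℚ.< ε → 0ℚ ℚ.< ½ ℚ.* ε
half-pos {ε} 0<ε = ℚₚ.positive⁻¹ (½ ℚ.* ε) {{ℚₚ.pos*pos⇒pos ½ ε {{ℚ.positive 0<ε}}}}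

half+half : ∀ ε → ½ ℚ.* ε ℚ.+ ½ ℚ.* ε ≡ ε
half+half ε = trans (sym (ℚₚ.*-distribʳ-+ ε ½ ½)) (ℚₚ.*-identityˡ ε)

*-mono-≤₀ : ∀ {a b c d} → 0ℚ ℚ.≤ b → 0ℚ ℚ.≤ c → a ℚ.≤ b → c ℚ.≤ d →
            a ℚ.* c ℚ.≤ b ℚ.* d
*-mono-≤₀ {b = b} {c} 0≤b 0≤c a≤b c≤d =
  ℚₚ.≤-trans (ℚₚ.*-monoʳ-≤-nonNeg c {{ℚ.nonNegative 0≤c}} a≤b)
             (ℚₚ.*-monoˡ-≤-nonNeg b {{ℚ.nonNegative 0≤b}} c≤d)

partialSum : (ℕ → ℚ) → ℕ → ℚ
partialSum u zero    = ℚ.∣ u 0 ∣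
partialSum u (suc n) = partialSum u n ℚ.+ ℚ.∣ u (suc n) ∣

0≤partialSum : ∀ u n → 0ℚ ℚ.≤ partialSum u n
0≤partialSum u zero    = ℚₚ.0≤∣p∣ (u 0)
0≤partialSum u (suc n) = ℚₚ.+-mono-≤ (0≤partialSum u n) (ℚₚ.0≤∣p∣ (u (suc n)))

x≤x+y : ∀ {x y} → 0ℚ ℚ.≤ y → x ℚ.≤ x ℚ.+ y
x≤x+y {x} {y} 0≤y = subst (ℚ._≤ x ℚ.+ y) (ℚₚ.+-identityʳ x) (ℚₚ.+-monoʳ-≤ x 0≤y)

x≤y+x : ∀ {x y} → 0ℚ ℚ.≤ y → x ℚ.≤ y ℚ.+ x
x≤y+x {x} {y} 0≤y = subst (ℚ._≤ y ℚ.+ x) (ℚₚ.+-identityˡ x) (ℚₚ.+-monoˡ-≤ x 0≤y)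

term≤partialSum : ∀ u {k n} → k ℕ.≤′ n → ℚ.∣ u k ∣ ℚ.≤ partialSum u n
term≤partialSum u {zero}  ℕ.≤′-refl = ℚₚ.≤-refl
term≤partialSum u {suc k} ℕ.≤′-refl = x≤y+x (0≤partialSum u k)
term≤partialSum u (ℕ.≤′-step {n} k≤n) =
  ℚₚ.≤-trans (term≤partialSum u k≤n) (x≤x+y (ℚₚ.0≤∣p∣ (u (suc n))))

0≤1 : 0ℚ ℚ.≤ 1ℚ
0≤1 = ℚₚ.nonNegative⁻¹ 1ℚ

0<1 : 0ℚ ℚ.< 1ℚ
0<1 = ℚₚ.positive⁻¹ 1ℚ

bounded : ∀ x → ∃[ B ] 0ℚ ℚ.< B × (∀ n → ℚ.∣ seq x n ∣ ℚ.≤ B)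
bounded x with cauchy x 1ℚ 0<1
... | N , close = 1ℚ ℚ.+ S , ℚₚ.+-mono-<-≤ 0<1 (0≤partialSum u N) , bound
  where
  u = seq x
  S = partialSum u N
  bound : ∀ n → ℚ.∣ u n ∣ ℚ.≤ 1ℚ ℚ.+ S
  bound n with ℕₚ.≤-total n N
  ... | inj₁ n≤N = ℚₚ.≤-trans (term≤partialSum u (ℕₚ.≤⇒≤′ n≤N)) (x≤y+x 0≤1)
  ... | inj₂ N≤n = begin
    ℚ.∣ u n ∣                         ≡⟨ cong ℚ.∣_∣ (solve 2 (λ a b → a := (a :- b) :+ b) refl (u n) (u N)) ⟩
    ℚ.∣ (u n ℚ.- u N) ℚ.+ u N ∣       ≤⟨ ℚₚ.∣p+q∣≤∣p∣+∣q∣ (u n ℚ.- u N) (u N) ⟩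
    ℚ.∣ u n ℚ.- u N ∣ ℚ.+ ℚ.∣ u N ∣   ≤⟨ ℚₚ.+-mono-≤ (close N≤n ℕₚ.≤-refl) (term≤partialSum u (ℕₚ.≤⇒≤′ ℕₚ.≤-refl)) ⟩
    1ℚ ℚ.+ S                          ∎
    where
    open ℚₚ.≤-Reasoning
    open +-*-Solver

fromℚ : ℚ → ℝ
fromℚ q = mkℝ (λ _ → q) λ ε 0<ε → 0 , λ _ _ →
  subst (λ z → ℚ.∣ z ∣ ℚ.≤ ε) (sym (ℚₚ.+-inverseʳ q)) (ℚₚ.<⇒≤ 0<ε)

fromℕ : ℕ → ℝ
fromℕ n = fromℚ (+ n / 1)

0ℝ 1ℝ : ℝ
0ℝ = fromℚ 0ℚ
1ℝ = fromℚ 1ℚ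

infixl 6 _+_ _-_
infixl 7 _*_
infix  8 -_

-_ : ℝ → ℝ
- x = mkℝ (λ n → ℚ.- seq x n) λ ε 0<ε →
  let N , close = cauchy x ε 0<ε in
  N , λ {m} {n} N≤m N≤n → subst (ℚ._≤ ε)
    (trans (∣-∣-comm (seq x m) (seq x n))
           (cong ℚ.∣_∣ (solve 2 (λ a b → b :- a := (:- a) :- (:- b)) refl (seq x m) (seq x n))))
    (close N≤m N≤n)
  where open +-*-Solver

_+_ : ℝ → ℝ → ℝ
x + y = mkℝ (λ n → seq x n ℚ.+ seq y n) cauchy-+
  where
  cauchy-+ : CauchySeq (λ n → seq x n ℚ.+ seq y n)
  cauchy-+ ε 0<ε with cauchy x (½ ℚ.* ε) (half-pos 0<ε) | cauchy y (½ ℚ.* ε) (half-pos 0<ε)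
  ... | M , closeˣ | N , closeʸ = M ℕ.⊔ N , λ {m} {n} ≤m ≤n → begin
    ℚ.∣ (seq x m ℚ.+ seq y m) ℚ.- (seq x n ℚ.+ seq y n) ∣
      ≡⟨ cong ℚ.∣_∣ (solve 4 (λ a b c d → (a :+ b) :- (c :+ d) := (a :- c) :+ (b :- d)) refl
           (seq x m) (seq y m) (seq x n) (seq y n)) ⟩
    ℚ.∣ (seq x m ℚ.- seq x n) ℚ.+ (seq y m ℚ.- seq y n) ∣
      ≤⟨ ℚₚ.∣p+q∣≤∣p∣+∣q∣ (seq x m ℚ.- seq x n) (seq y m ℚ.- seq y n) ⟩
    ℚ.∣ seq x m ℚ.- seq x n ∣ ℚ.+ ℚ.∣ seq y m ℚ.- seq y n ∣
      ≤⟨ ℚₚ.+-mono-≤ (closeˣ (ℕₚ.m⊔n≤o⇒m≤o M N ≤m) (ℕₚ.m⊔n≤o⇒m≤o M N ≤n))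
                     (closeʸ (ℕₚ.m⊔n≤o⇒n≤o M N ≤m) (ℕₚ.m⊔n≤o⇒n≤o M N ≤n)) ⟩
    ½ ℚ.* ε ℚ.+ ½ ℚ.* ε
      ≡⟨ half+half ε ⟩
    ε ∎
    where
    open ℚₚ.≤-Reasoning
    open +-*-Solver

_-_ : ℝ → ℝ → ℝ
x - y = x + (- y)

_*_ : ℝ → ℝ → ℝ
x * y = mkℝ (λ n → seq x n ℚ.* seq y n) cauchy-*
  where
  cauchy-* : CauchySeq (λ n → seq x n ℚ.* seq y n)
  cauchy-* ε 0<ε with bounded x | bounded y
  ... | A , 0<A , boundˣ | B , 0<B , boundʸ = result
    where
    C = A ℚ.+ B
    instance
      C-pos : ℚ.Positive C
      C-pos = ℚ.positive (ℚₚ.+-mono-< 0<A 0<B)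
      C-nonZero : ℚ.NonZero C
      C-nonZero = ℚₚ.pos⇒nonZero C
    η = ε ℚ.* ℚ.1/ C
    0<η : 0ℚ ℚ.< η
    0<η = ℚₚ.positive⁻¹ η {{ℚₚ.pos*pos⇒pos ε {{ℚ.positive 0<ε}} (ℚ.1/ C) {{ℚₚ.1/pos⇒pos C}}}}
    result : ∃[ N ] ∀ {m n} → N ℕ.≤ m → N ℕ.≤ n →
      ℚ.∣ seq x m ℚ.* seq y m ℚ.- seq x n ℚ.* seq y n ∣ ℚ.≤ ε
    result with cauchy x η 0<η | cauchy y η 0<η
    ... | M , closeˣ | N , closeʸ = M ℕ.⊔ N , λ {m} {n} ≤m ≤n →
      let a = seq x m ; b = seq y m ; c = seq x n ; d = seq y n in begin
      ℚ.∣ a ℚ.* b ℚ.- c ℚ.* d ∣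
        ≡⟨ cong ℚ.∣_∣ (solve 4 (λ a b c d → a :* b :- c :* d := a :* (b :- d) :+ d :* (a :- c)) refl a b c d) ⟩
      ℚ.∣ a ℚ.* (b ℚ.- d) ℚ.+ d ℚ.* (a ℚ.- c) ∣
        ≤⟨ ℚₚ.∣p+q∣≤∣p∣+∣q∣ (a ℚ.* (b ℚ.- d)) (d ℚ.* (a ℚ.- c)) ⟩
      ℚ.∣ a ℚ.* (b ℚ.- d) ∣ ℚ.+ ℚ.∣ d ℚ.* (a ℚ.- c) ∣
        ≡⟨ cong₂ ℚ._+_ (ℚₚ.∣p*q∣≡∣p∣*∣q∣ a (b ℚ.- d)) (ℚₚ.∣p*q∣≡∣p∣*∣q∣ d (a ℚ.- c)) ⟩
      ℚ.∣ a ∣ ℚ.* ℚ.∣ b ℚ.- d ∣ ℚ.+ ℚ.∣ d ∣ ℚ.* ℚ.∣ a ℚ.- c ∣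
        ≤⟨ ℚₚ.+-mono-≤
             (*-mono-≤₀ (ℚₚ.<⇒≤ 0<A) (ℚₚ.0≤∣p∣ (b ℚ.- d)) (boundˣ m)
               (closeʸ (ℕₚ.m⊔n≤o⇒n≤o M N ≤m) (ℕₚ.m⊔n≤o⇒n≤o M N ≤n)))
             (*-mono-≤₀ (ℚₚ.<⇒≤ 0<B) (ℚₚ.0≤∣p∣ (a ℚ.- c)) (boundʸ n)
               (closeˣ (ℕₚ.m⊔n≤o⇒m≤o M N ≤m) (ℕₚ.m⊔n≤o⇒m≤o M N ≤n))) ⟩
      A ℚ.* η ℚ.+ B ℚ.* η
        ≡⟨ solve 4 (λ A B e i → A :* (e :* i) :+ B :* (e :* i) := e :* ((A :+ B) :* i)) refl A B ε (ℚ.1/ C) ⟩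
      ε ℚ.* (C ℚ.* ℚ.1/ C)
        ≡⟨ cong (ε ℚ.*_) (ℚₚ.*-inverseʳ C) ⟩
      ε ℚ.* 1ℚ
        ≡⟨ ℚₚ.*-identityʳ ε ⟩
      ε ∎
      where
      open ℚₚ.≤-Reasoning
      open +-*-Solver

-- Coefficients are listed from the constant term upwards.
evalℝ : List ℝ → ℝ → ℝ
evalℝ []       x = 0ℝ
evalℝ (a ∷ as) x = a + x * evalℝ as x

1/_! : ℕ → ℚ
1/ zero  ! = 1ℚ
1/ suc n ! = 1/ n ! ℚ.* (+ 1 / suc n)

powℚ : ℚ → ℕ → ℚ
powℚ x zero    = 1ℚ
powℚ x (suc n) = powℚ x n ℚ.* x

0≤1/! : ∀ n → 0ℚ ℚ.≤ 1/ n !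
0≤1/! zero    = 0≤1
0≤1/! (suc n) = ℚₚ.nonNegative⁻¹ (1/ suc n !)
  {{ℚₚ.nonNeg*nonNeg⇒nonNeg (1/ n !) {{ℚ.nonNegative (0≤1/! n)}}
      (+ 1 / suc n) {{ℚₚ.normalize-nonNeg 1 (suc n)}}}}

0≤powℚ : ∀ {x} → 0ℚ ℚ.≤ x → ∀ n → 0ℚ ℚ.≤ powℚ x n
0≤powℚ     0≤x zero    = 0≤1
0≤powℚ {x} 0≤x (suc n) = ℚₚ.nonNegative⁻¹ (powℚ x (suc n))
  {{ℚₚ.nonNeg*nonNeg⇒nonNeg (powℚ x n) {{ℚ.nonNegative (0≤powℚ 0≤x n)}}
      x {{ℚ.nonNegative 0≤x}}}}

-- The terms with index below n.
expPartial : (ℕ → ℚ) → ℚ → ℕ → ℚ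
expPartial a x zero    = 0ℚ
expPartial a x (suc n) = expPartial a x n ℚ.+ a n ℚ.* (powℚ x n ℚ.* 1/ n !)

∣expTerm∣≤ : ∀ {a : ℕ → ℚ} {x b} → (∀ j → ℚ.∣ a j ∣ ℚ.≤ 1ℚ) → ℚ.∣ x ∣ ℚ.≤ b → 0ℚ ℚ.≤ b →
  ∀ j → ℚ.∣ a j ℚ.* (powℚ x j ℚ.* 1/ j !) ∣ ℚ.≤ powℚ b j ℚ.* 1/ j !
∣expTerm∣≤ {a} {x} {b} ∣a∣≤1 ∣x∣≤b 0≤b j = begin
  ℚ.∣ a j ℚ.* (powℚ x j ℚ.* 1/ j !) ∣
    ≡⟨ ℚₚ.∣p*q∣≡∣p∣*∣q∣ (a j) (powℚ x j ℚ.* 1/ j !) ⟩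
  ℚ.∣ a j ∣ ℚ.* ℚ.∣ powℚ x j ℚ.* 1/ j ! ∣
    ≤⟨ ℚₚ.*-monoʳ-≤-nonNeg ℚ.∣ powℚ x j ℚ.* 1/ j ! ∣
         {{ℚₚ.∣-∣-nonNeg (powℚ x j ℚ.* 1/ j !)}} (∣a∣≤1 j) ⟩
  1ℚ ℚ.* ℚ.∣ powℚ x j ℚ.* 1/ j ! ∣
    ≡⟨ ℚₚ.*-identityˡ ℚ.∣ powℚ x j ℚ.* 1/ j ! ∣ ⟩
  ℚ.∣ powℚ x j ℚ.* 1/ j ! ∣
    ≡⟨ ℚₚ.∣p*q∣≡∣p∣*∣q∣ (powℚ x j) (1/ j !) ⟩
  ℚ.∣ powℚ x j ∣ ℚ.* ℚ.∣ 1/ j ! ∣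
    ≡⟨ cong (ℚ.∣ powℚ x j ∣ ℚ.*_) (ℚₚ.0≤p⇒∣p∣≡p (0≤1/! j)) ⟩
  ℚ.∣ powℚ x j ∣ ℚ.* 1/ j !
    ≤⟨ ℚₚ.*-monoʳ-≤-nonNeg (1/ j !) {{ℚ.nonNegative (0≤1/! j)}} (∣powℚ∣≤ j) ⟩
  powℚ b j ℚ.* 1/ j ! ∎
  where
  open ℚₚ.≤-Reasoning
  ∣powℚ∣≤ : ∀ j → ℚ.∣ powℚ x j ∣ ℚ.≤ powℚ b j
  ∣powℚ∣≤ zero    = ℚₚ.≤-refl
  ∣powℚ∣≤ (suc j) = subst (ℚ._≤ powℚ b j ℚ.* b) (sym (ℚₚ.∣p*q∣≡∣p∣*∣q∣ (powℚ x j) x))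
    (*-mono-≤₀ (0≤powℚ 0≤b j) (ℚₚ.0≤∣p∣ x) (∣powℚ∣≤ j) ∣x∣≤b)

≤fromℕ : ∀ q → q ℚ.≤ + ℤ.∣ ℚ.↥ q ∣ / 1
≤fromℕ q@record{} = ℚₚ.toℚᵘ-cancel-≤ (ℚᵘₚ.≤-respʳ-≃
  (ℚᵘₚ.≃-sym (ℚₚ.toℚᵘ-fromℚᵘ (ℚᵘ.mkℚᵘ (+ ℤ.∣ ℚ.↥ q ∣) 0)))
  (ℚᵘ.*≤* (ℤₚ.≤-trans (ℤₚ.≤-reflexive (ℤₚ.*-identityʳ (ℚ.↥ q)))
    (ℤₚ.≤-trans (i≤+∣i∣ (ℚ.↥ q)) (ℤₚ.≤-trans (ℤ.+≤+ (ℕₚ.m≤m*n ℤ.∣ ℚ.↥ q ∣ (ℚ.↧ₙ q)))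
      (ℤₚ.≤-reflexive (ℤₚ.pos-* ℤ.∣ ℚ.↥ q ∣ (ℚ.↧ₙ q))))))))
  where
  i≤+∣i∣ : ∀ i → i ℤ.≤ + ℤ.∣ i ∣
  i≤+∣i∣ (+ n)    = ℤₚ.≤-refl
  i≤+∣i∣ -[1+ n ] = ℤ.-≤+

quotient≤½ : ∀ {m n} → 2 ℕ.* m ℕ.≤ suc n → (+ m / 1) ℚ.* (+ 1 / suc n) ℚ.≤ ½
quotient≤½ {m} {n} 2m≤n = ℚₚ.toℚᵘ-cancel-≤ (ℚᵘₚ.≤-respˡ-≃
  (ℚᵘₚ.≃-sym (ℚᵘₚ.≃-trans (ℚₚ.toℚᵘ-homo-* (+ m / 1) (+ 1 / suc n))
    (ℚᵘₚ.*-cong (ℚₚ.toℚᵘ-fromℚᵘ (ℚᵘ.mkℚᵘ (+ m) 0)) (ℚₚ.toℚᵘ-fromℚᵘ (ℚᵘ.mkℚᵘ (+ 1) n)))))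
  (ℚᵘ.*≤* (subst₂ ℤ._≤_
    (trans (ℤₚ.pos-* m 2) (cong (ℤ._* + 2) (sym (ℤₚ.*-identityʳ (+ m)))))
    (trans (cong +_ (sym (ℕₚ.+-identityʳ (suc n)))) (sym (ℤₚ.*-identityˡ (+ (suc n ℕ.+ 0)))))
    (ℤ.+≤+ (ℕₚ.≤-trans (ℕₚ.≤-reflexive (ℕₚ.*-comm m 2)) 2m≤n)))))

halve≤ : ∀ n → (+ suc (suc n) / 1) ℚ.* ½ ℚ.≤ + suc n / 1
halve≤ n = ℚₚ.toℚᵘ-cancel-≤ (ℚᵘₚ.≤-respʳ-≃
  (ℚᵘₚ.≃-sym (ℚₚ.toℚᵘ-fromℚᵘ (ℚᵘ.mkℚᵘ (+ suc n) 0)))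
  (ℚᵘₚ.≤-respˡ-≃
    (ℚᵘₚ.≃-sym (ℚᵘₚ.≃-trans (ℚₚ.toℚᵘ-homo-* (+ suc (suc n) / 1) ½)
      (ℚᵘₚ.*-congʳ (ℚₚ.toℚᵘ-fromℚᵘ (ℚᵘ.mkℚᵘ (+ suc (suc n)) 0)))))
    (ℚᵘ.*≤* (subst₂ ℤ._≤_
      (sym (trans (ℤₚ.*-identityʳ (+ suc (suc n) ℤ.* + 1)) (ℤₚ.*-identityʳ (+ suc (suc n)))))
      (ℤₚ.pos-* (suc n) 2)
      (ℤ.+≤+ (ℕ.s≤s (ℕ.s≤s (ℕₚ.m≤m*n n 2))))))))

-- A series dominated by Σ bʲ / j! has small tails, uniformly in its sum.
module Tail {a : ℕ → ℚ} (∣a∣≤1 : ∀ j → ℚ.∣ a j ∣ ℚ.≤ 1ℚ) {b : ℚ} (0≤b : 0ℚ ℚ.≤ b) where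

  T : ℕ → ℚ
  T j = powℚ b j ℚ.* 1/ j !

  0≤T : ∀ j → 0ℚ ℚ.≤ T j
  0≤T j = ℚₚ.nonNegative⁻¹ (T j)
    {{ℚₚ.nonNeg*nonNeg⇒nonNeg (powℚ b j) {{ℚ.nonNegative (0≤powℚ 0≤b j)}}
        (1/ j !) {{ℚ.nonNegative (0≤1/! j)}}}}

  K₀ : ℕ
  K₀ = 2 ℕ.* ℤ.∣ ℚ.↥ b ∣

  T-halves : ∀ {j} → K₀ ℕ.≤ j → T (suc j) ℚ.≤ ½ ℚ.* T j
  T-halves {j} K₀≤j = begin
    powℚ b j ℚ.* b ℚ.* (1/ j ! ℚ.* (+ 1 / suc j))
      ≡⟨ solve 4 (λ p b f i → p :* b :* (f :* i) := (b :* i) :* (p :* f)) refl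
           (powℚ b j) b (1/ j !) (+ 1 / suc j) ⟩
    b ℚ.* (+ 1 / suc j) ℚ.* T j
      ≤⟨ ℚₚ.*-monoʳ-≤-nonNeg (T j) {{ℚ.nonNegative (0≤T j)}}
           (ℚₚ.≤-trans
             (ℚₚ.*-monoʳ-≤-nonNeg (+ 1 / suc j) {{ℚₚ.normalize-nonNeg 1 (suc j)}} (≤fromℕ b))
             (quotient≤½ {ℤ.∣ ℚ.↥ b ∣} {j} (ℕₚ.m≤n⇒m≤1+n K₀≤j))) ⟩
    ½ ℚ.* T j ∎
    where
    open ℚₚ.≤-Reasoning
    open +-*-Solver

  T-decays : ∀ i → (+ suc i / 1) ℚ.* T (i ℕ.+ K₀) ℚ.≤ T K₀
  T-decays zero    = ℚₚ.≤-reflexive (ℚₚ.*-identityˡ (T K₀))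
  T-decays (suc i) = begin
    (+ suc (suc i) / 1) ℚ.* T (suc i ℕ.+ K₀)
      ≤⟨ ℚₚ.*-monoˡ-≤-nonNeg (+ suc (suc i) / 1) {{ℚₚ.normalize-nonNeg (suc (suc i)) 1}}
           (T-halves (ℕₚ.m≤n+m K₀ i)) ⟩
    (+ suc (suc i) / 1) ℚ.* (½ ℚ.* T (i ℕ.+ K₀))
      ≡⟨ ℚₚ.*-assoc (+ suc (suc i) / 1) ½ (T (i ℕ.+ K₀)) ⟨
    (+ suc (suc i) / 1) ℚ.* ½ ℚ.* T (i ℕ.+ K₀)
      ≤⟨ ℚₚ.*-monoʳ-≤-nonNeg (T (i ℕ.+ K₀)) {{ℚ.nonNegative (0≤T (i ℕ.+ K₀))}} (halve≤ i) ⟩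
    (+ suc i / 1) ℚ.* T (i ℕ.+ K₀)
      ≤⟨ T-decays i ⟩
    T K₀ ∎
    where open ℚₚ.≤-Reasoning

  T-small : ∀ ε → 0ℚ ℚ.< ε → ∃[ K ] K₀ ℕ.≤ K × T K ℚ.≤ ε
  T-small ε 0<ε = i ℕ.+ K₀ , ℕₚ.m≤n+m K₀ i , ℚₚ.*-cancelˡ-≤-pos (+ suc i / 1)
    {{ℚₚ.normalize-pos (suc i) 1}} (begin
      (+ suc i / 1) ℚ.* T (i ℕ.+ K₀)  ≤⟨ T-decays i ⟩
      T K₀                            ≡⟨ ℚₚ.*-identityʳ (T K₀) ⟨
      T K₀ ℚ.* 1ℚ                     ≡⟨ cong (T K₀ ℚ.*_) (ℚₚ.*-inverseˡ ε) ⟨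
      T K₀ ℚ.* (ℚ.1/ ε ℚ.* ε)         ≡⟨ ℚₚ.*-assoc (T K₀) (ℚ.1/ ε) ε ⟨
      q ℚ.* ε                         ≤⟨ ℚₚ.*-monoʳ-≤-nonNeg ε {{ℚₚ.pos⇒nonNeg ε}} (≤fromℕ q) ⟩
      (+ i / 1) ℚ.* ε                 ≤⟨ ℚₚ.*-monoʳ-≤-nonNeg ε {{ℚₚ.pos⇒nonNeg ε}} i≤1+i ⟩
      (+ suc i / 1) ℚ.* ε             ∎)
    where
    open ℚₚ.≤-Reasoning
    instance
      ε-pos : ℚ.Positive ε
      ε-pos = ℚ.positive 0<ε
      ε-nonZero : ℚ.NonZero ε
      ε-nonZero = ℚₚ.pos⇒nonZero ε
    q = T K₀ ℚ.* ℚ.1/ ε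
    i = ℤ.∣ ℚ.↥ q ∣
    i≤1+i : + i / 1 ℚ.≤ + suc i / 1
    i≤1+i = ℚₚ.toℚᵘ-cancel-≤ (ℚᵘₚ.≤-respʳ-≃
      (ℚᵘₚ.≃-sym (ℚₚ.toℚᵘ-fromℚᵘ (ℚᵘ.mkℚᵘ (+ suc i) 0)))
      (ℚᵘₚ.≤-respˡ-≃ (ℚᵘₚ.≃-sym (ℚₚ.toℚᵘ-fromℚᵘ (ℚᵘ.mkℚᵘ (+ i) 0)))
        (ℚᵘ.*≤* (ℤₚ.*-monoʳ-≤-nonNeg (+ 1) (ℤ.+≤+ (ℕₚ.n≤1+n i))))))

  tail : ∀ {x K} → ℚ.∣ x ∣ ℚ.≤ b → K₀ ℕ.≤ K → ∀ i →
    ℚ.∣ expPartial a x (i ℕ.+ K) ℚ.- expPartial a x K ∣ ℚ.+ (T (i ℕ.+ K) ℚ.+ T (i ℕ.+ K))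
      ℚ.≤ T K ℚ.+ T K
  tail {x} {K} ∣x∣≤b K₀≤K zero = ℚₚ.≤-reflexive (trans
    (cong (λ z → ℚ.∣ z ∣ ℚ.+ (T K ℚ.+ T K)) (ℚₚ.+-inverseʳ (expPartial a x K)))
    (ℚₚ.+-identityˡ (T K ℚ.+ T K)))
  tail {x} {K} ∣x∣≤b K₀≤K (suc i) = begin
    ℚ.∣ (S ℚ.+ t) ℚ.- S₀ ∣ ℚ.+ (T′ ℚ.+ T′)
      ≡⟨ cong (λ z → ℚ.∣ z ∣ ℚ.+ (T′ ℚ.+ T′))
           (solve 3 (λ S t S₀ → (S :+ t) :- S₀ := (S :- S₀) :+ t) refl S t S₀) ⟩
    ℚ.∣ (S ℚ.- S₀) ℚ.+ t ∣ ℚ.+ (T′ ℚ.+ T′)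
      ≤⟨ ℚₚ.+-mono-≤
           (ℚₚ.≤-trans (ℚₚ.∣p+q∣≤∣p∣+∣q∣ (S ℚ.- S₀) t)
             (ℚₚ.+-monoʳ-≤ ℚ.∣ S ℚ.- S₀ ∣ (∣expTerm∣≤ ∣a∣≤1 ∣x∣≤b 0≤b (i ℕ.+ K))))
           (ℚₚ.≤-trans (ℚₚ.+-mono-≤ T′≤ T′≤) (ℚₚ.≤-reflexive (half+half (T (i ℕ.+ K))))) ⟩
    (ℚ.∣ S ℚ.- S₀ ∣ ℚ.+ T (i ℕ.+ K)) ℚ.+ T (i ℕ.+ K)
      ≡⟨ ℚₚ.+-assoc ℚ.∣ S ℚ.- S₀ ∣ (T (i ℕ.+ K)) (T (i ℕ.+ K)) ⟩
    ℚ.∣ S ℚ.- S₀ ∣ ℚ.+ (T (i ℕ.+ K) ℚ.+ T (i ℕ.+ K))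
      ≤⟨ tail ∣x∣≤b K₀≤K i ⟩
    T K ℚ.+ T K ∎
    where
    open ℚₚ.≤-Reasoning
    open +-*-Solver
    S  = expPartial a x (i ℕ.+ K)
    S₀ = expPartial a x K
    t  = a (i ℕ.+ K) ℚ.* (powℚ x (i ℕ.+ K) ℚ.* 1/ (i ℕ.+ K) !)
    T′ = T (suc i ℕ.+ K)
    T′≤ : T′ ℚ.≤ ½ ℚ.* T (i ℕ.+ K)
    T′≤ = T-halves (ℕₚ.≤-trans K₀≤K (ℕₚ.m≤n+m K i))

  tail≤ : ∀ {x K n} → ℚ.∣ x ∣ ℚ.≤ b → K₀ ℕ.≤ K → K ℕ.≤ n →
    ℚ.∣ expPartial a x n ℚ.- expPartial a x K ∣ ℚ.≤ T K ℚ.+ T K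
  tail≤ {x} {K} {n} ∣x∣≤b K₀≤K K≤n =
    subst (λ n → ℚ.∣ expPartial a x n ℚ.- expPartial a x K ∣ ℚ.≤ T K ℚ.+ T K)
      (ℕₚ.m∸n+n≡m K≤n)
      (ℚₚ.≤-trans (x≤x+y (ℚₚ.+-mono-≤ (0≤T (n ℕ.∸ K ℕ.+ K)) (0≤T (n ℕ.∸ K ℕ.+ K))))
                  (tail ∣x∣≤b K₀≤K (n ℕ.∸ K)))

powℝ : ℝ → ℕ → ℝ
powℝ x j = mkℝ (λ n → powℚ (seq x n) j) (cauchy-pow j)
  where
  cauchy-pow : ∀ j → CauchySeq (λ n → powℚ (seq x n) j)
  cauchy-pow zero    = cauchy 1ℝ
  cauchy-pow (suc j) = cauchy (mkℝ (λ n → powℚ (seq x n) j) (cauchy-pow j) * x)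

cauchy-expPartial : ∀ (a : ℕ → ℚ) x K → CauchySeq (λ n → expPartial a (seq x n) K)
cauchy-expPartial a x zero    = cauchy 0ℝ
cauchy-expPartial a x (suc K) = cauchy
  (mkℝ (λ n → expPartial a (seq x n) K) (cauchy-expPartial a x K) + fromℚ (a K) * (powℝ x K * fromℚ (1/ K !)))

module _ {a : ℕ → ℚ} (∣a∣≤1 : ∀ j → ℚ.∣ a j ∣ ℚ.≤ 1ℚ) (x : ℝ)
         {b : ℚ} (0≤b : 0ℚ ℚ.≤ b) (bound : ∀ n → ℚ.∣ seq x n ∣ ℚ.≤ b) where

  open Tail ∣a∣≤1 0≤b

  expPartial-close : ∀ {η δ K m n} → K₀ ℕ.≤ K → T K ℚ.≤ η → K ℕ.≤ m → K ℕ.≤ n →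
    ℚ.∣ expPartial a (seq x m) K ℚ.- expPartial a (seq x n) K ∣ ℚ.≤ δ →
    ℚ.∣ expPartial a (seq x m) m ℚ.- expPartial a (seq x n) n ∣ ℚ.≤ (η ℚ.+ η) ℚ.+ (δ ℚ.+ (η ℚ.+ η))
  expPartial-close {η} {δ} {K} {m} {n} K₀≤K TK≤η K≤m K≤n close = begin
    ℚ.∣ s m m ℚ.- s n n ∣
      ≤⟨ triangle (s m m) (s m K) (s n n) ⟩
    ℚ.∣ s m m ℚ.- s m K ∣ ℚ.+ ℚ.∣ s m K ℚ.- s n n ∣
      ≤⟨ ℚₚ.+-mono-≤ (near m K≤m) (triangle (s m K) (s n K) (s n n)) ⟩
    (η ℚ.+ η) ℚ.+ (ℚ.∣ s m K ℚ.- s n K ∣ ℚ.+ ℚ.∣ s n K ℚ.- s n n ∣)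
      ≤⟨ ℚₚ.+-monoʳ-≤ (η ℚ.+ η) (ℚₚ.+-mono-≤ close
           (ℚₚ.≤-trans (ℚₚ.≤-reflexive (∣-∣-comm (s n K) (s n n))) (near n K≤n))) ⟩
    (η ℚ.+ η) ℚ.+ (δ ℚ.+ (η ℚ.+ η)) ∎
    where
    open ℚₚ.≤-Reasoning
    s : ℕ → ℕ → ℚ
    s i j = expPartial a (seq x i) j
    near : ∀ i → K ℕ.≤ i → ℚ.∣ s i i ℚ.- s i K ∣ ℚ.≤ η ℚ.+ η
    near i K≤i = ℚₚ.≤-trans (tail≤ (bound i) K₀≤K K≤i) (ℚₚ.+-mono-≤ TK≤η TK≤η)

  cauchy-series : CauchySeq (λ n → expPartial a (seq x n) n)
  cauchy-series ε 0<ε =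
    let η = ½ ℚ.* (½ ℚ.* (½ ℚ.* ε))
        K , K₀≤K , TK≤η = T-small η (half-pos (half-pos (half-pos 0<ε)))
        N , close       = cauchy-expPartial a x K (½ ℚ.* ε) (half-pos 0<ε)
    in K ℕ.⊔ N , λ ≤m ≤n → ℚₚ.≤-trans
      (expPartial-close K₀≤K TK≤η (ℕₚ.m⊔n≤o⇒m≤o K N ≤m) (ℕₚ.m⊔n≤o⇒m≤o K N ≤n)
        (close (ℕₚ.m⊔n≤o⇒n≤o K N ≤m) (ℕₚ.m⊔n≤o⇒n≤o K N ≤n)))
      (ℚₚ.≤-reflexive (quarters ε))
    where
    quarters : ∀ ε → let η = ½ ℚ.* (½ ℚ.* (½ ℚ.* ε)) in
      (η ℚ.+ η) ℚ.+ (½ ℚ.* ε ℚ.+ (η ℚ.+ η)) ≡ ε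
    quarters ε = trans (cong (λ z → z ℚ.+ (½ ℚ.* ε ℚ.+ z)) (half+half (½ ℚ.* (½ ℚ.* ε))))
      (trans (solve 2 (λ p q → p :+ (q :+ p) := (p :+ p) :+ q) refl (½ ℚ.* (½ ℚ.* ε)) (½ ℚ.* ε))
        (trans (cong (ℚ._+ ½ ℚ.* ε) (half+half (½ ℚ.* ε))) (half+half ε)))
      where open +-*-Solver

-- Σ aⱼ xʲ / j!, approximated by its n-th partial sum at the n-th approximation of x.
expSeries : (a : ℕ → ℚ) → (∀ j → ℚ.∣ a j ∣ ℚ.≤ 1ℚ) → ℝ → ℝ
expSeries a ∣a∣≤1 x = mkℝ (λ n → expPartial a (seq x n) n)
  (let b , 0<b , bound = bounded x in cauchy-series ∣a∣≤1 x (ℚₚ.<⇒≤ 0<b) bound)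

Re-i^ Im-i^ : ℕ → ℚ
Re-i^ 0                         = 1ℚ
Re-i^ 1                         = 0ℚ
Re-i^ 2                         = ℚ.- 1ℚ
Re-i^ 3                         = 0ℚ
Re-i^ (suc (suc (suc (suc j)))) = Re-i^ j
Im-i^ 0                         = 0ℚ
Im-i^ 1                         = 1ℚ
Im-i^ 2                         = 0ℚ
Im-i^ 3                         = ℚ.- 1ℚ
Im-i^ (suc (suc (suc (suc j)))) = Im-i^ j

∣Re-i^∣≤1 : ∀ j → ℚ.∣ Re-i^ j ∣ ℚ.≤ 1ℚ
∣Re-i^∣≤1 0                         = ℚₚ.≤-refl
∣Re-i^∣≤1 1                         = 0≤1
∣Re-i^∣≤1 2                         = ℚₚ.≤-refl
∣Re-i^∣≤1 3                         = 0≤1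
∣Re-i^∣≤1 (suc (suc (suc (suc j)))) = ∣Re-i^∣≤1 j

∣Im-i^∣≤1 : ∀ j → ℚ.∣ Im-i^ j ∣ ℚ.≤ 1ℚ
∣Im-i^∣≤1 0                         = 0≤1
∣Im-i^∣≤1 1                         = ℚₚ.≤-refl
∣Im-i^∣≤1 2                         = 0≤1
∣Im-i^∣≤1 3                         = ℚₚ.≤-refl
∣Im-i^∣≤1 (suc (suc (suc (suc j)))) = ∣Im-i^∣≤1 j

-- e^(ix) = Σ iʲ xʲ / j! = cos x + i sin x
cos sin : ℝ → ℝ
cos = expSeries Re-i^ ∣Re-i^∣≤1
sin = expSeries Im-i^ ∣Im-i^∣≤1

-- π / 2 is the smallest positive zero of the cosine.
record IsPi (π : ℝ) : Set where
  field
    positive  : 0ℝ < π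
    cos-zero  : cos (fromℚ ½ * π) ≃ 0ℝ
    first     : ∀ x → 0ℝ < x → x < fromℚ ½ * π → ¬ cos x ≃ 0ℝ

record ℂ : Set where
  constructor _+i_
  field
    Re Im : ℝ

open ℂ public

ℂ-rawSemiring : RawSemiring 0ℓ 0ℓ
ℂ-rawSemiring = record
  { Carrier = ℂ
  ; _≈_     = λ z w → Re z ≃ Re w × Im z ≃ Im w
  ; _+_     = λ z w → (Re z + Re w) +i (Im z + Im w)
  ; _*_     = λ z w → (Re z * Re w - Im z * Im w) +i (Re z * Im w + Im z * Re w)
  ; 0#      = 0ℝ +i 0ℝ
  ; 1#      = 1ℝ +i 0ℝ
  }

module ℂ-ops where
  open RawSemiring ℂ-rawSemiring public
    using ()
    renaming (_+_ to _+ᶜ_; _*_ to _*ᶜ_; 0# to 0ᶜ; 1# to 1ᶜ)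
  open RawSemiringDefinitions ℂ-rawSemiring public
    using ()
    renaming (_^_ to _^ᶜ_)

open ℂ-ops public

expi : ℝ → ℂ
expi θ = cos θ +i sin θ

record IsModulus (r : ℝ) (z : ℂ) : Set where
  field
    nonNegative : 0ℝ ≤ r
    square      : r * r ≃ Re z * Re z + Im z * Im z

𝔽 : ℕ → Set
𝔽 = Fin

module _ (p : ℕ) .{{_ : NonZero p}} where

  𝔽-rawSemiring : RawSemiring 0ℓ 0ℓ
  𝔽-rawSemiring = record
    { Carrier = 𝔽 p
    ; _≈_     = _≡_
    ; _+_     = λ a b → (toℕ a ℕ.+ toℕ b) mod p
    ; _*_     = λ a b → (toℕ a ℕ.* toℕ b) mod p
    ; 0#      = 0 mod p
    ; 1#      = 1 mod p
    }

module 𝔽-ops {p : ℕ} .{{_ : NonZero p}} where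
  open RawSemiring (𝔽-rawSemiring p) public
    using ()
    renaming (_+_ to _+ᶠ_; _*_ to _*ᶠ_; 0# to 0ᶠ; 1# to 1ᶠ)
  open RawSemiringDefinitions (𝔽-rawSemiring p) public
    using ()
    renaming (_^_ to _^ᶠ_; sum to ∑ᶠ; product to ∏ᶠ)

open 𝔽-ops public

points : ∀ p n → List (Vec (𝔽 p) n)
points p zero    = [] ∷ []
points p (suc n) = List.cartesianProductWith _∷_ (List.allFin p) (points p n)

-- A polynomial in n variables over 𝔽 p is presented as a list of coefficients
-- with exponent vectors; repeated exponents and zero coefficients are allowed.
Poly : ℕ → ℕ → Set
Poly p n = List (𝔽 p × Vec ℕ n)

module _ {p : ℕ} .{{_ : NonZero p}} where

  ⟦_⟧ : ∀ {n} → Poly p n → Vec (𝔽 p) n → 𝔽 p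
  ⟦ P ⟧ x = List.foldr (λ (c , e) s → c *ᶠ ∏ᶠ (λ i → lookup x i ^ᶠ lookup e i) +ᶠ s) 0ᶠ P

  -- The degree is that of the function, not of a given presentation: it is the
  -- least degree of a polynomial representing f.
  Degree≤ : ∀ {n} → ℕ → (Vec (𝔽 p) n → 𝔽 p) → Set
  Degree≤ {n} d f = Σ[ P ∈ Poly p n ]
    All (λ (_ , e) → Vec.sum e ℕ.≤ d) P × (∀ x → f x ≡ ⟦ P ⟧ x)

  Degree : ∀ {n} → ℕ → (Vec (𝔽 p) n → 𝔽 p) → Set
  Degree d f = Degree≤ d f × (∀ d′ → Degree≤ d′ f → d ℕ.≤ d′)

module _ (p : ℕ) .{{_ : NonZero p}} where

  -- e^(2πi/p). The choice of root matters: other primitive p-th roots of unity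
  -- can give a different bias.
  rootOfUnity : ℝ → ℂ
  rootOfUnity π = expi (fromℚ (+ 2 / p) * π)

  average : ∀ {n} → (Vec (𝔽 p) n → ℂ) → ℂ
  average {n} F = (fromℚ (1/pⁿ n) +i 0ℝ) *ᶜ List.foldr (λ a s → F a +ᶜ s) 0ᶜ (points p n)
    where
    1/pⁿ : ℕ → ℚ
    1/pⁿ = powℚ (+ 1 / p)

-- δ = |𝔼 ω^f(a)|, as a relation: IsPi and IsModulus determine π and δ up to _≃_.
IsBias : ∀ {p n} .{{_ : NonZero p}} → (Vec (𝔽 p) n → 𝔽 p) → ℝ → Set
IsBias {p} f δ = Σ[ π ∈ ℝ ] IsPi π ×
  IsModulus δ (average p (λ a → rootOfUnity p π ^ᶜ toℕ (f a)))

-- By repeated Cauchy-Schwarz a large bias of f makes the symmetric 4-linear form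
-- B y z w u of its fourth differences vanish for many (y , z , u) and all w, say a
-- fraction 1 / A with A = O(ρ⁸).  Hence, y and z being restricted to subspaces of
-- codimension poly(A), the bilinear form B y z has small rank, and a maximal family
-- of such forms that stay of large rank under all linear combinations gives
-- B y z w u = μ (b y z) (b w u) up to small rank, with b a tuple of bilinear forms
-- robustly of large rank.  Robustness makes μ symmetric, and once the two other
-- pairings are subtracted the small rank remainder is symmetric, so that it vanishes
-- on a further subspace: there B is exactly the sum of the three pairings
-- μ (b y z) (b w u) + μ (b y w) (b z u) + μ (b y u) (b z w).  In characteristic 2 a
-- second use of the bias shows that μ is alternating, so that in every characteristic
-- μ and b are symmetrisations of bilinear θ and β; the quartic θ (Q x) (Q x) with
-- Q x = β x x then has the same fourth differences as f, and their difference is a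
-- cubic.  Restoring the functionals that were killed costs one product of a linear
-- and a cubic polynomial each, by Newton's formula along their directions.
--
-- The bias enters through the real numbers cos (2πm/p) and sin (2πm/p) only, that is
-- through the addition theorem and the fact that e^(2πi/p) ≠ 1, which follows by
-- halving the angle from π / 2 being the first zero of the cosine.
module Submission where

open import Algebra.Bundles using (CommutativeRing; CommutativeMonoid)
open import Algebra.Structures using (IsCommutativeRing)
open import Data.Empty using (⊥; ⊥-elim)
open import Data.Fin.Base using (Fin; toℕ)
open import Data.Nat.Base as ℕ using (ℕ; zero; suc; NonZero)
open import Data.Nat.Primality using (Prime; prime⇒nonTrivial)
open import Data.Product.Base using (Σ-syntax; ∃-syntax; _,_; proj₁; proj₂)
open import Data.Sum.Base using (_⊎_; inj₁; inj₂)
open import Level using (0ℓ)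
open import Relation.Binary.PropositionalEquality using (_≡_)
open import Relation.Nullary.Decidable using (Dec; yes; no)
open import Relation.Nullary.Negation using (¬_; contradiction)
import Algebra.Definitions.RawMonoid as RawMonoidDefinitions
import Data.Fin.Properties as Finₚ
import Data.Integer.Properties as ℤₚ
import Data.List.Properties as Listₚ
import Data.List.Relation.Unary.All.Properties as Allₚ
import Data.Nat.Properties as ℕₚ
import Data.Rational.Properties as ℚₚ
import Data.Rational.Unnormalised.Base as ℚᵘ
import Data.Rational.Unnormalised.Properties as ℚᵘₚ
import Data.Vec.Properties as Vecₚ

-- The bounds stay polynomial because no step is iterated with growing demands: the number of robust
-- forms is bounded in terms of `A` alone, and only then is the robustness fixed, as a polynomial in
-- `A`. Dense sets of good vectors yield subspaces by a pigeonhole argument on iterated sumsets, so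
-- that ranks are multiplied only by a linear function of the inverse density. In characteristic 2
-- the fourth differences alone cannot suffice. Over the field of two elements the elementary
-- symmetric polynomial of degree 4 has, where the coordinates sum to 0, exactly the three pairings
-- as fourth differences, with `b y z` the dot product and `μ` the multiplication; `μ` is not
-- alternating, and the polynomial is almost unbiased in many variables. The difference shows in the
-- third differences, which is where the bias enters again. Subspaces never receive coordinates:
-- each is the image of a linear map of the whole space, so that all forms stay on `V n`. Every
-- choice, also of a maximal family, is an exhaustive search over finite sets, with a counter
-- limited by a rank.

module IntegerSolver {c ℓ} (R : CommutativeRing c ℓ) where

  open import Algebra.Bundles using (RawRing)
  open import Algebra.Solver.Ring.AlmostCommutativeRing
    using (fromCommutativeRing; _-Raw-AlmostCommutative⟶_)
  open import Data.Integer.Base as ℤ using (ℤ; +_; -[1+_])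
  open import Data.Maybe.Base using (just; nothing)
  open import Relation.Binary.Definitions using (WeaklyDecidable)
  import Relation.Binary.PropositionalEquality as ≡

  open CommutativeRing R
  open import Algebra.Properties.Ring ring
  open import Algebra.Properties.AbelianGroup +-abelianGroup using (⁻¹-∙-comm)
  open import Algebra.Properties.Semiring.Mult semiring
  open import Relation.Binary.Reasoning.Setoid setoid

  ofℤ : ℤ → Carrier
  ofℤ (+ n)    = n × 1#
  ofℤ -[1+ n ] = - (suc n × 1#)

  ⊖-homo : ∀ m n → ofℤ (m ℤ.⊖ n) ≈ m × 1# + - (n × 1#)
  ⊖-homo m       zero    = sym (trans (+-congˡ -0#≈0#) (+-identityʳ _))
  ⊖-homo zero    (suc n) = sym (+-identityˡ _)
  ⊖-homo (suc m) (suc n) = begin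
    ofℤ (suc m ℤ.⊖ suc n)                          ≡⟨ ≡.cong ofℤ (ℤₚ.[1+m]⊖[1+n]≡m⊖n m n) ⟩
    ofℤ (m ℤ.⊖ n)                                  ≈⟨ ⊖-homo m n ⟩
    m × 1# + - (n × 1#)                            ≈⟨ +-congˡ (+-identityˡ _) ⟨
    m × 1# + (0# + - (n × 1#))                     ≈⟨ +-congˡ (+-congʳ (-‿inverseʳ 1#)) ⟨
    m × 1# + (1# + - 1# + - (n × 1#))              ≈⟨ +-congˡ (+-assoc _ _ _) ⟩
    m × 1# + (1# + (- 1# + - (n × 1#)))            ≈⟨ +-assoc _ _ _ ⟨
    m × 1# + 1# + (- 1# + - (n × 1#))              ≈⟨ +-cong (+-comm _ _) (⁻¹-∙-comm _ _) ⟩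
    suc m × 1# + - (suc n × 1#)                    ∎

  +-homo : ∀ i j → ofℤ (i ℤ.+ j) ≈ ofℤ i + ofℤ j
  +-homo (+ m)    (+ n)    = ×-homo-+ 1# m n
  +-homo (+ m)    -[1+ n ] = ⊖-homo m (suc n)
  +-homo -[1+ m ] (+ n)    = trans (⊖-homo n (suc m)) (+-comm _ _)
  +-homo -[1+ m ] -[1+ n ] = begin
    - (suc (suc (m ℕ.+ n)) × 1#)        ≡⟨ ≡.cong (λ k → - (k × 1#)) (≡.cong suc (≡.sym (ℕ-+-suc m n))) ⟩
    - ((suc m ℕ.+ suc n) × 1#)          ≈⟨ -‿cong (×-homo-+ 1# (suc m) (suc n)) ⟩
    - (suc m × 1# + suc n × 1#)         ≈⟨ ⁻¹-∙-comm _ _ ⟨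
    - (suc m × 1#) + - (suc n × 1#)     ∎
    where
    open import Data.Nat.Properties using () renaming (+-suc to ℕ-+-suc)

  -homo : ∀ i → ofℤ (ℤ.- i) ≈ - ofℤ i
  -homo (+ zero)  = sym -0#≈0#
  -homo (+ suc n) = refl
  -homo -[1+ n ]  = sym (-‿involutive _)

  pos-neg : ∀ m n → ofℤ (+ m ℤ.* -[1+ n ]) ≈ - ((m × 1#) * (suc n × 1#))
  pos-neg m n = begin
    ofℤ (+ m ℤ.* -[1+ n ])          ≡⟨ ≡.cong ofℤ (≡.sym (ℤₚ.neg-distribʳ-* (+ m) (+ suc n))) ⟩
    ofℤ (ℤ.- (+ m ℤ.* + suc n))     ≈⟨ -homo (+ m ℤ.* + suc n) ⟩
    - ofℤ (+ m ℤ.* + suc n)         ≡⟨ ≡.cong (λ k → - ofℤ k) (≡.sym (ℤₚ.pos-* m (suc n))) ⟩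
    - ((m ℕ.* suc n) × 1#)          ≈⟨ -‿cong (×1-homo-* m (suc n)) ⟩
    - ((m × 1#) * (suc n × 1#))     ∎

  *-homo : ∀ i j → ofℤ (i ℤ.* j) ≈ ofℤ i * ofℤ j
  *-homo (+ m)    (+ n)    = trans (reflexive (≡.cong ofℤ (≡.sym (ℤₚ.pos-* m n)))) (×1-homo-* m n)
  *-homo (+ m)    -[1+ n ] = trans (pos-neg m n) (-‿distribʳ-* _ _)
  *-homo -[1+ m ] (+ n)    = trans (reflexive (≡.cong ofℤ (ℤₚ.*-comm -[1+ m ] (+ n))))
    (trans (pos-neg n m) (trans (-‿cong (*-comm _ _)) (-‿distribˡ-* _ _)))
  *-homo -[1+ m ] -[1+ n ] = begin
    (suc m ℕ.* suc n) × 1#                 ≈⟨ ×1-homo-* (suc m) (suc n) ⟩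
    (suc m × 1#) * (suc n × 1#)            ≈⟨ -‿involutive _ ⟨
    - - ((suc m × 1#) * (suc n × 1#))      ≈⟨ -‿cong (-‿distribʳ-* _ _) ⟩
    - ((suc m × 1#) * - (suc n × 1#))      ≈⟨ -‿distribˡ-* _ _ ⟩
    - (suc m × 1#) * - (suc n × 1#)        ∎

  ℤ-rawRing : RawRing 0ℓ 0ℓ
  ℤ-rawRing = record
    { Carrier = ℤ ; _≈_ = ≡._≡_ ; _+_ = ℤ._+_ ; _*_ = ℤ._*_ ; -_ = ℤ.-_ ; 0# = + 0 ; 1# = + 1 }

  ℤ⟶R : ℤ-rawRing -Raw-AlmostCommutative⟶ fromCommutativeRing R
  ℤ⟶R = record
    { ⟦_⟧ = ofℤ ; +-homo = +-homo ; *-homo = *-homo ; -‿homo = -homo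
    ; 0-homo = refl ; 1-homo = +-identityʳ 1# }

  -- Integer coefficients make normal forms comparable although equality in `R` need not be
  -- decidable. Distinct integers may agree in `R`, hence no negative answer is ever given.
  ofℤ≟ : WeaklyDecidable (λ i j → ofℤ i ≈ ofℤ j)
  ofℤ≟ i j with i ℤₚ.≟ j
  ... | yes i≡j = just (reflexive (≡.cong ofℤ i≡j))
  ... | no  _   = nothing

  open import Algebra.Solver.Ring ℤ-rawRing (fromCommutativeRing R) ℤ⟶R ofℤ≟ public
    using (solve; con; _:=_; _:+_; _:*_; _:-_; :-_)

-- Costs of the structure theorem

module Costs where

  open import Data.Nat.Base using (_+_; _*_)

  -- Numbers of linear functionals, and ranks, that the steps of the structure theorem
  -- cost; A is an inverse density, T the robustness wanted.
  3× : ℕ → ℕ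
  3× zero    = zero
  3× (suc k) = 3 + 3× k

  -- Two averagings: a fraction 1/(2A) of the `y` is rich, and for each of these a fraction 1/(4A)
  -- of the `z` gives a form of rank at most 4A. Passing from a dense set to a subspace multiplies
  -- by `3×` of the inverse density each time.
  sliceCost : ℕ → ℕ
  sliceCost A = 3× (2 * A) * (2 * (2 * A) + 3× (2 * (2 * A)) * (2 * (2 * A)))

  -- For at most `suc r` pairs: `r` functionals for the sum `s` and `r` for each first component.
  -- The error is `r` from the slice at `s` plus `suc r` differences of rank at most `suc r * r`.
  coverCost coverRank : ℕ → ℕ
  coverCost r = r + suc r * r
  coverRank r = r + suc r * (suc r * r)

  -- The sum `s` and the `r + r` vectors of a family of at most `r` pairs, with `r` functionals
  -- each.
  cubicCost : ℕ → ℕ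
  cubicCost r = suc (r + r) * r

  quarticCost : ℕ → ℕ
  quarticCost r = (2 + (r + r)) * ((2 + (r + r)) * r + cubicCost r)

  -- There are 4 (r + 1) pairs, where r = t + 2k bounds the rank of the remainder. The first summand
  -- makes the opposite slices exact for all combinations of their components, the second is the
  -- rank that robustness must exceed for one more orthogonal pair to exist.
  symmetryCost : ℕ → ℕ → ℕ
  symmetryCost t k = 4 * suc (t + (k + k)) * (4 * suc (t + (k + k)) * (t + (k + k))) + 4 * (4 * suc (t + (k + k)) * k)

  factorCost : ℕ → ℕ → ℕ → ℕ
  factorCost k t T = k * (t + (t + t)) + (k + k) * T

  remainderRank : ℕ → ℕ → ℕ
  remainderRank A k = 3× (2 * A) * (2 * A + k + k)

  -- Three times `r` makes the coefficients linear. The rest bounds the rank of the form that is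
  -- shown to be zero at the end: twice the codimension of a kernel and twice that of a cut, once
  -- for each argument.
  char2Cost : ℕ → ℕ → ℕ
  char2Cost A k = (r + (r + r)) + ((cubicCost r + cubicCost r) + (2 * A + k) + (2 * A + k))
    where
    r : ℕ
    r = remainderRank A k

  module Cost (A T : ℕ) where
    R t k r c₅ T′ total : ℕ
    R  = sliceCost A
    t  = coverRank R
    k  = R + R
    r  = t + (k + k)
    c₅ = quarticCost r
    -- The last cut, of codimension at most `c₅`, may lower the robustness by `c₅` for each of the
    -- two arguments.
    T′ = T + c₅ + c₅ + symmetryCost t k
    total = 2 * A + coverCost R + factorCost R t T′ + c₅

  -- No circle arises: the bound for the number of forms that enters here does not involve the
  -- robustness that is asked of them.
  robustness : ℕ → ℕ
  robustness A = char2Cost A (sliceCost A + sliceCost A)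

  cutCost pairCost : ℕ → ℕ
  cutCost A = Cost.total A (robustness A)
  pairCost A = sliceCost A + sliceCost A

-- Exhaustive search over finite types

module Search where

  open import Data.List.Base using (List; []; _∷_; length)
  open import Data.Nat.Base using (z≤n; s≤s)
  open import Data.Product.Base using (_×_)
  open import Data.Vec.Base using (Vec; []; _∷_)
  open import Relation.Nullary.Decidable using (¬?; decidable-stable)

  Searchable : Set → Set₁
  Searchable A = ∀ {P : A → Set} → (∀ x → Dec (P x)) → Dec (∃[ x ] P x)

  search-Fin : ∀ {n} → Searchable (Fin n)
  search-Fin = Finₚ.any?

  search-× : ∀ {A B} → Searchable A → Searchable B → Searchable (A × B)
  search-× sA sB P? with sA (λ a → sB (λ b → P? (a , b)))
  ... | yes (a , b , Pab) = yes ((a , b) , Pab)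
  ... | no  none          = no λ ((a , b) , Pab) → none (a , b , Pab)

  search-Vec : ∀ {A n} → Searchable A → Searchable (Vec A n)
  search-Vec {n = zero} sA P? with P? []
  ... | yes P[] = yes ([] , P[])
  ... | no ¬P[] = no λ { ([] , P[]) → ¬P[] P[] }
  search-Vec {n = suc n} sA P? with sA (λ a → search-Vec sA (λ as → P? (a ∷ as)))
  ... | yes (a , as , Pas) = yes (a ∷ as , Pas)
  ... | no  none           = no λ { (a ∷ as , Pas) → none (a , as , Pas) }

  -- Serves to make `Rank≤` decidable: a form of small rank is given by a short list of pairs of
  -- vectors.
  search-List≤ : ∀ {A} → Searchable A → ∀ n {P : List A → Set} → (∀ x → Dec (P x)) →
    Dec (∃[ L ] length L ℕ.≤ n × P L)
  search-List≤ sA n P? with P? []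
  ... | yes P[] = yes ([] , z≤n , P[])
  search-List≤ sA zero    P? | no ¬P[] = no λ { ([] , _ , P[]) → ¬P[] P[] }
  search-List≤ sA (suc n) P? | no ¬P[] with sA (λ a → search-List≤ sA n (λ L → P? (a ∷ L)))
  ... | yes (a , L , L≤n , PL) = yes (a ∷ L , s≤s L≤n , PL)
  ... | no  none = no λ { ([] , _ , P[]) → ¬P[] P[] ; (a ∷ L , s≤s L≤n , PL) → none (a , L , L≤n , PL) }

  counterexample? : ∀ {A} → Searchable A → {P : A → Set} → (∀ x → Dec (P x)) → (∃[ x ] ¬ P x) ⊎ (∀ x → P x)
  counterexample? sA P? with sA (λ x → ¬? (P? x))
  ... | yes found = inj₁ found
  ... | no  none  = inj₂ λ x → decidable-stable (P? x) (λ ¬Px → none (x , ¬Px))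

  search-∀ : ∀ {A} → Searchable A → {P : A → Set} → (∀ x → Dec (P x)) → Dec (∀ x → P x)
  search-∀ sA P? with counterexample? sA P?
  ... | inj₁ (x , ¬Px) = no λ all → ¬Px (all x)
  ... | inj₂ all       = yes all

-- Prime fields and their vector spaces

record PrimeField (p : ℕ) : Set₁ where
  infixl 6 _+_
  infixl 7 _*_
  infix  8 -_
  field
    _+_ _*_           : Fin p → Fin p → Fin p
    -_                : Fin p → Fin p
    0# 1#             : Fin p
    isCommutativeRing : IsCommutativeRing _≡_ _+_ _*_ -_ 0# 1#
    1≢0               : ¬ 1# ≡ 0#
    inverse           : ∀ a → ¬ a ≡ 0# → ∃[ b ] b * a ≡ 1#
    -- Induction along 0, 1, 1 + 1, ...: this is what distinguishes a prime field. It makes additive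
    -- maps linear and sets closed under addition subspaces.
    generated         : ∀ (P : Fin p → Set) → P 0# → (∀ a → P a → P (1# + a)) → ∀ a → P a

  commutativeRing : CommutativeRing 0ℓ 0ℓ
  commutativeRing = record { isCommutativeRing = isCommutativeRing }

module Space {p : ℕ} (K : PrimeField p) where

  open Costs public
  open import Data.Fin.Base using (zero; suc)
  open import Data.Vec.Base using (Vec; []; _∷_; zipWith; map; replicate)
  open import Relation.Binary.Definitions using (DecidableEquality)
  open import Relation.Binary.PropositionalEquality

  open PrimeField K public

  module F-ring = CommutativeRing commutativeRing
  module FS = IntegerSolver commutativeRing

  F : Set
  F = Fin p

  _≟_ : DecidableEquality F
  _≟_ = Finₚ._≟_

  V : ℕ → Set
  V n = Vec F n

  infixl 6 _⊕_ _⊖_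
  infixl 7 _⊛_ _⊙_
  infix  8 ⊝_

  _⊕_ _⊛_ _⊖_ : ∀ {n} → V n → V n → V n
  _⊕_ = zipWith _+_
  _⊛_ = zipWith _*_

  ⊝_ : ∀ {n} → V n → V n
  ⊝_ = map -_

  x ⊖ y = x ⊕ ⊝ y

  𝟎 𝟏 : ∀ {n} → V n
  𝟎 = replicate _ 0#
  𝟏 = replicate _ 1#

  _⊙_ : ∀ {n} → F → V n → V n
  c ⊙ x = map (c *_) x

  _≟ᵛ_ : ∀ {n} → DecidableEquality (V n)
  _≟ᵛ_ = Vecₚ.≡-dec _≟_

  V-isCommutativeRing : ∀ n → IsCommutativeRing {A = V n} _≡_ _⊕_ _⊛_ ⊝_ 𝟎 𝟏
  V-isCommutativeRing n = record
    { isRing = record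
      { +-isAbelianGroup = record
        { isGroup = record
          { isMonoid = record
            { isSemigroup = record
              { isMagma = record { isEquivalence = isEquivalence ; ∙-cong = cong₂ _⊕_ }
              ; assoc = Vecₚ.zipWith-assoc F-ring.+-assoc }
            ; identity = Vecₚ.zipWith-identityˡ F-ring.+-identityˡ , Vecₚ.zipWith-identityʳ F-ring.+-identityʳ }
          ; inverse = Vecₚ.zipWith-inverseˡ F-ring.-‿inverseˡ , Vecₚ.zipWith-inverseʳ F-ring.-‿inverseʳ
          ; ⁻¹-cong = cong ⊝_ }
        ; comm = Vecₚ.zipWith-comm F-ring.+-comm }
      ; *-cong = cong₂ _⊛_
      ; *-assoc = Vecₚ.zipWith-assoc F-ring.*-assoc
      ; *-identity = Vecₚ.zipWith-identityˡ F-ring.*-identityˡ , Vecₚ.zipWith-identityʳ F-ring.*-identityʳ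
      ; distrib = Vecₚ.zipWith-distribˡ F-ring.distribˡ , Vecₚ.zipWith-distribʳ F-ring.distribʳ }
    ; *-comm = Vecₚ.zipWith-comm F-ring.*-comm }

  -- The coordinatewise product serves only to let the ring solver decide the
  -- identities of the additive group.
  V-commutativeRing : ℕ → CommutativeRing 0ℓ 0ℓ
  V-commutativeRing n = record { isCommutativeRing = V-isCommutativeRing n }

  module V-ring {n} = CommutativeRing (V-commutativeRing n)
  module VS {n} = IntegerSolver (V-commutativeRing n)

  x-x≡0 : ∀ x → x + - x ≡ 0#
  x-x≡0 = F-ring.-‿inverseʳ

  x-y≡0⇒x≡y : ∀ {x y} → x + - y ≡ 0# → x ≡ y
  x-y≡0⇒x≡y {x} {y} x-y≡0 = trans (FS.solve 2 (λ x y → x FS.:= (x FS.:- y) FS.:+ y) refl x y)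
    (trans (cong (_+ y) x-y≡0) (F-ring.+-identityˡ y))

  x≡x+y⇒y≡0 : ∀ {x y} → x ≡ x + y → y ≡ 0#
  x≡x+y⇒y≡0 {x} {y} x≡x+y = trans (FS.solve 2 (λ x y → y FS.:= (x FS.:+ y) FS.:- x) refl x y)
    (trans (cong (_+ - x) (sym x≡x+y)) (x-x≡0 x))

  *-cancel : ∀ {c x} → ¬ c ≡ 0# → c * x ≡ 0# → x ≡ 0#
  *-cancel {c} {x} c≢0 cx≡0 with b , bc≡1 ← inverse c c≢0 =
    trans (sym (F-ring.*-identityˡ x)) (trans (cong (_* x) (sym bc≡1))
      (trans (F-ring.*-assoc b c x) (trans (cong (b *_) cx≡0) (F-ring.zeroʳ b))))

  0⊙ : ∀ {n} (x : V n) → 0# ⊙ x ≡ 𝟎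
  0⊙ []       = refl
  0⊙ (x ∷ xs) = cong₂ _∷_ (F-ring.zeroˡ x) (0⊙ xs)

  ⊙𝟎 : ∀ {n} c → c ⊙ 𝟎 {n} ≡ 𝟎
  ⊙𝟎 {zero}  c = refl
  ⊙𝟎 {suc n} c = cong₂ _∷_ (F-ring.zeroʳ c) (⊙𝟎 c)

  1⊙ : ∀ {n} (x : V n) → 1# ⊙ x ≡ x
  1⊙ []       = refl
  1⊙ (x ∷ xs) = cong₂ _∷_ (F-ring.*-identityˡ x) (1⊙ xs)

  +⊙ : ∀ {n} b c (x : V n) → (b + c) ⊙ x ≡ b ⊙ x ⊕ c ⊙ x
  +⊙ b c []       = refl
  +⊙ b c (x ∷ xs) = cong₂ _∷_ (F-ring.distribʳ x b c) (+⊙ b c xs)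

  -1⊙ : ∀ {n} (x : V n) → (- 1#) ⊙ x ≡ ⊝ x
  -1⊙ []       = refl
  -1⊙ (x ∷ xs) = cong₂ _∷_ (-1*x≈-x x) (-1⊙ xs)
    where open import Algebra.Properties.Ring F-ring.ring using (-1*x≈-x)

-- Sums over a vector space

module VSum {p : ℕ} (K : PrimeField p) {c ℓ} (M : CommutativeMonoid c ℓ) where

  open import Data.Fin.Permutation using (Permutation′; permutation)
  open import Data.Vec.Base using ([]; _∷_)
  import Relation.Binary.PropositionalEquality as ≡
  open ≡ using (_≡_)

  open Space K using (F; V; _⊕_; module FS)
  open CommutativeMonoid M
  open import Algebra.Properties.CommutativeMonoid.Sum M
  open PrimeField K using () renaming (_+_ to _+ᶠ_; -_ to -ᶠ_)
  open import Relation.Binary.Reasoning.Setoid setoid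

  -- The monoid is left open: natural numbers serve for counting, an ordered ring for exponential
  -- sums.
  ∑ᵛ : ∀ {n} → (V n → Carrier) → Carrier
  ∑ᵛ {zero}  g = g []
  ∑ᵛ {suc n} g = sum (λ t → ∑ᵛ (λ x → g (t ∷ x)))

  ∑ᵛ-cong : ∀ {n} {g h : V n → Carrier} → (∀ x → g x ≈ h x) → ∑ᵛ g ≈ ∑ᵛ h
  ∑ᵛ-cong {zero}  g≈h = g≈h []
  ∑ᵛ-cong {suc n} g≈h = sum-cong-≋ (λ t → ∑ᵛ-cong (λ x → g≈h (t ∷ x)))

  ∑ᵛ-∙ : ∀ {n} (g h : V n → Carrier) → ∑ᵛ (λ x → g x ∙ h x) ≈ ∑ᵛ g ∙ ∑ᵛ h
  ∑ᵛ-∙ {zero}  g h = refl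
  ∑ᵛ-∙ {suc n} g h = trans (sum-cong-≋ (λ t → ∑ᵛ-∙ (λ x → g (t ∷ x)) (λ x → h (t ∷ x)))) (∑-distrib-+ {p} (λ t → ∑ᵛ (λ x → g (t ∷ x))) (λ t → ∑ᵛ (λ x → h (t ∷ x))))

  ∑ᵛ-sum : ∀ {n m} (g : V n → Fin m → Carrier) → ∑ᵛ (λ x → sum (g x)) ≈ sum (λ t → ∑ᵛ (λ x → g x t))
  ∑ᵛ-sum {zero}  g = refl
  ∑ᵛ-sum {suc n} g = trans (sum-cong-≋ (λ t → ∑ᵛ-sum (λ x → g (t ∷ x)))) (∑-comm (λ t i → ∑ᵛ (λ x → g (t ∷ x) i)))

  ∑ᵛ-swap : ∀ {m n} (g : V m → V n → Carrier) → ∑ᵛ (λ x → ∑ᵛ (g x)) ≈ ∑ᵛ (λ y → ∑ᵛ (λ x → g x y))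
  ∑ᵛ-swap {m} {zero}  g = refl
  ∑ᵛ-swap {m} {suc n} g = trans (∑ᵛ-sum (λ x t → ∑ᵛ (λ y → g x (t ∷ y))))
    (sum-cong-≋ (λ t → ∑ᵛ-swap (λ x y → g x (t ∷ y))))

  shift : F → Permutation′ p
  shift a = permutation (_+ᶠ a) (_+ᶠ -ᶠ a)
    (λ t → ≡.trans (FS.solve 2 (λ t a → (t FS.:- a) FS.:+ a FS.:= t) ≡.refl t a) ≡.refl)
    (λ t → ≡.trans (FS.solve 2 (λ t a → (t FS.:+ a) FS.:- a FS.:= t) ≡.refl t a) ≡.refl)

  ∑ᵛ-translate : ∀ {n} (g : V n → Carrier) a → ∑ᵛ (λ x → g (x ⊕ a)) ≈ ∑ᵛ g
  ∑ᵛ-translate {zero}  g []      = refl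
  ∑ᵛ-translate {suc n} g (a ∷ as) = trans
    (sum-cong-≋ (λ t → ∑ᵛ-translate (λ x → g ((t +ᶠ a) ∷ x)) as))
    (sym (sum-permute (λ t → ∑ᵛ (λ x → g (t ∷ x))) (shift a)))

-- Linear algebra over a prime field

module Forms {p : ℕ} (K : PrimeField p) where

  open import Data.Nat.Base using (s≤s; z≤n)
  open import Data.Fin.Base as Fin using (suc; zero)
  open import Data.List.Base as List using (List; []; _++_; _∷_; concatMap; length)
  open import Data.List.Relation.Unary.All as All using (All; []; _∷_)
  open import Data.Product.Base using (_×_)
  open import Data.Vec.Base as Vec using (Vec; []; _∷_; head; insertAt; lookup; removeAt; tail; toList)
  open import Relation.Binary.PropositionalEquality
  open import Relation.Nullary.Decidable using (_×-dec_; decidable-stable; ¬?)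
  open import Data.List.Membership.Propositional using (_∈_)
  open import Data.List.Relation.Unary.Any as Any using (Any; here; there)
  open import Data.List.Membership.Propositional.Properties using (∈-++⁺ʳ; ∈-++⁺ˡ; ∈-map⁺)
  open import Data.Nat.Solver using (module +-*-Solver)
  open import Algebra.Bundles.Raw using (RawSemiring)
  open import Defs using (Poly)
  import Algebra.Definitions.RawSemiring as RawSemiringDefinitions

  open Space K public
  open Search public

  -- Additivity is enough, since over a prime field it implies homogeneity, see `lin-⊙`.
  Lin : ∀ {n} → (V n → F) → Set
  Lin φ = ∀ x y → φ (x ⊕ y) ≡ φ x + φ y

  Linᵛ : ∀ {m n} → (V m → V n) → Set
  Linᵛ f = ∀ x y → f (x ⊕ y) ≡ f x ⊕ f y

  module _ {n} {φ : V n → F} (lin : Lin φ) where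

    lin-𝟎 : φ 𝟎 ≡ 0#
    lin-𝟎 = x≡x+y⇒y≡0 (trans (cong φ (sym (V-ring.+-identityˡ 𝟎))) (lin 𝟎 𝟎))

    lin-⊝ : ∀ x → φ (⊝ x) ≡ - φ x
    lin-⊝ x = x-y≡0⇒x≡y (begin
      φ (⊝ x) + - - φ x  ≡⟨ FS.solve 2 (λ a b → a FS.:+ FS.:- (FS.:- b) FS.:= a FS.:+ b) refl (φ (⊝ x)) (φ x) ⟩
      φ (⊝ x) + φ x      ≡⟨ lin (⊝ x) x ⟨
      φ (⊝ x ⊕ x)        ≡⟨ cong φ (V-ring.-‿inverseˡ x) ⟩
      φ 𝟎                ≡⟨ lin-𝟎 ⟩
      0#                 ∎)
      where open ≡-Reasoning

    lin-⊖ : ∀ x y → φ (x ⊖ y) ≡ φ x + - φ y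
    lin-⊖ x y = trans (lin x (⊝ y)) (cong (φ x +_) (lin-⊝ y))

    lin-⊙ : ∀ c x → φ (c ⊙ x) ≡ c * φ x
    lin-⊙ c x = generated (λ c → φ (c ⊙ x) ≡ c * φ x)
      (trans (cong φ (0⊙ x)) (trans lin-𝟎 (sym (F-ring.zeroˡ (φ x)))))
      (λ a ih → begin
        φ ((1# + a) ⊙ x)      ≡⟨ cong φ (trans (+⊙ 1# a x) (cong (_⊕ a ⊙ x) (1⊙ x))) ⟩
        φ (x ⊕ a ⊙ x)         ≡⟨ lin x (a ⊙ x) ⟩
        φ x + φ (a ⊙ x)       ≡⟨ cong₂ _+_ (sym (F-ring.*-identityˡ (φ x))) ih ⟩
        1# * φ x + a * φ x    ≡⟨ F-ring.distribʳ (φ x) 1# a ⟨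
        (1# + a) * φ x        ∎) c
      where open ≡-Reasoning

  module _ {m n} {f : V m → V n} (lin : Linᵛ f) where

    linᵛ-𝟎 : f 𝟎 ≡ 𝟎
    linᵛ-𝟎 = begin
      f 𝟎                    ≡⟨ VS.solve 1 (λ a → a VS.:= (a VS.:+ a) VS.:- a) refl (f 𝟎) ⟩
      (f 𝟎 ⊕ f 𝟎) ⊖ f 𝟎      ≡⟨ cong (_⊖ f 𝟎) (lin 𝟎 𝟎) ⟨
      f (𝟎 ⊕ 𝟎) ⊖ f 𝟎        ≡⟨ cong (λ z → f z ⊖ f 𝟎) (V-ring.+-identityˡ 𝟎) ⟩
      f 𝟎 ⊖ f 𝟎              ≡⟨ V-ring.-‿inverseʳ (f 𝟎) ⟩
      𝟎                      ∎
      where open ≡-Reasoning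

    linᵛ-⊙ : ∀ c x → f (c ⊙ x) ≡ c ⊙ f x
    linᵛ-⊙ c x = generated (λ c → f (c ⊙ x) ≡ c ⊙ f x)
      (trans (cong f (0⊙ x)) (trans linᵛ-𝟎 (sym (0⊙ (f x)))))
      (λ a ih → begin
        f ((1# + a) ⊙ x)      ≡⟨ cong f (trans (+⊙ 1# a x) (cong (_⊕ a ⊙ x) (1⊙ x))) ⟩
        f (x ⊕ a ⊙ x)         ≡⟨ lin x (a ⊙ x) ⟩
        f x ⊕ f (a ⊙ x)       ≡⟨ cong₂ _⊕_ (sym (1⊙ (f x))) ih ⟩
        1# ⊙ f x ⊕ a ⊙ f x    ≡⟨ +⊙ 1# a (f x) ⟨
        (1# + a) ⊙ f x        ∎) c
      where open ≡-Reasoning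

  ⟨_,_⟩ : ∀ {n} → V n → V n → F
  ⟨ [] , [] ⟩         = 0#
  ⟨ a ∷ as , x ∷ xs ⟩ = a * x + ⟨ as , xs ⟩

  ⟨⟩-linʳ : ∀ {n} (a : V n) → Lin ⟨ a ,_⟩
  ⟨⟩-linʳ []       []       []       = sym (F-ring.+-identityˡ 0#)
  ⟨⟩-linʳ (a ∷ as) (x ∷ xs) (y ∷ ys) = trans (cong (a * (x + y) +_) (⟨⟩-linʳ as xs ys))
    (FS.solve 5 (λ a x y u v → a FS.:* (x FS.:+ y) FS.:+ (u FS.:+ v)
      FS.:= (a FS.:* x FS.:+ u) FS.:+ (a FS.:* y FS.:+ v)) refl a x y ⟨ as , xs ⟩ ⟨ as , ys ⟩)

  ⟨⟩-comm : ∀ {n} (a x : V n) → ⟨ a , x ⟩ ≡ ⟨ x , a ⟩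
  ⟨⟩-comm []       []       = refl
  ⟨⟩-comm (a ∷ as) (x ∷ xs) = cong₂ _+_ (F-ring.*-comm a x) (⟨⟩-comm as xs)

  ⟨⟩-linˡ : ∀ {n} (x : V n) → Lin ⟨_, x ⟩
  ⟨⟩-linˡ x a b = trans (⟨⟩-comm (a ⊕ b) x)
    (trans (⟨⟩-linʳ x a b) (cong₂ _+_ (⟨⟩-comm x a) (⟨⟩-comm x b)))

  ⟨𝟎,⟩ : ∀ {n} (x : V n) → ⟨ 𝟎 , x ⟩ ≡ 0#
  ⟨𝟎,⟩ x = lin-𝟎 (⟨⟩-linˡ x)

  -- The values on the standard basis. Functionals become vectors in this way, and so can be
  -- compared and searched for.
  rep : ∀ {n} → (V n → F) → V n
  rep {zero}  φ = []
  rep {suc n} φ = φ (1# ∷ 𝟎) ∷ rep (λ x → φ (0# ∷ x))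

  ∷-split : ∀ {n} x (xs : V n) → x ∷ xs ≡ x ⊙ (1# ∷ 𝟎) ⊕ (0# ∷ xs)
  ∷-split x xs = cong₂ _∷_
    (sym (trans (F-ring.+-identityʳ (x * 1#)) (F-ring.*-identityʳ x)))
    (sym (trans (cong (_⊕ xs) (⊙𝟎 x)) (V-ring.+-identityˡ xs)))

  0∷-lin : ∀ {n} → Linᵛ {n} (0# ∷_)
  0∷-lin x y = cong (_∷ x ⊕ y) (sym (F-ring.+-identityˡ 0#))

  rep-correct : ∀ {n} {φ : V n → F} → Lin φ → ∀ x → φ x ≡ ⟨ rep φ , x ⟩
  rep-correct lin []       = lin-𝟎 lin
  rep-correct {φ = φ} lin (x ∷ xs) = begin
    φ (x ∷ xs)                                   ≡⟨ cong φ (∷-split x xs) ⟩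
    φ (x ⊙ (1# ∷ 𝟎) ⊕ (0# ∷ xs))                 ≡⟨ lin (x ⊙ (1# ∷ 𝟎)) (0# ∷ xs) ⟩
    φ (x ⊙ (1# ∷ 𝟎)) + φ (0# ∷ xs)               ≡⟨ cong₂ _+_ (trans (lin-⊙ lin x (1# ∷ 𝟎)) (F-ring.*-comm x _))
                                                     (rep-correct (λ y z → trans (cong φ (0∷-lin y z)) (lin (0# ∷ y) (0# ∷ z))) xs) ⟩
    ⟨ rep φ , x ∷ xs ⟩                           ∎
    where open ≡-Reasoning

  -- A list of vectors stands for the subspace annihilated by all of them.
  infix 4 _⟂_ _⟂?_

  _⟂_ : ∀ {n} → List (V n) → V n → Set
  Λ ⟂ x = All (λ a → ⟨ a , x ⟩ ≡ 0#) Λ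

  _⟂?_ : ∀ {n} (Λ : List (V n)) x → Dec (Λ ⟂ x)
  Λ ⟂? x = All.all? (λ a → ⟨ a , x ⟩ ≟ 0#) Λ

  ++⟂ˡ : ∀ {n} (Λ Λ′ : List (V n)) {x} → Λ ++ Λ′ ⟂ x → Λ ⟂ x
  ++⟂ˡ Λ Λ′ = Allₚ.++⁻ˡ Λ

  ++⟂ʳ : ∀ {n} (Λ Λ′ : List (V n)) {x} → Λ ++ Λ′ ⟂ x → Λ′ ⟂ x
  ++⟂ʳ Λ Λ′ = Allₚ.++⁻ʳ Λ

  comb : ∀ {m n} → Vec (V n) m → V m → V n
  comb []       []       = 𝟎
  comb (y ∷ ys) (c ∷ cs) = c ⊙ y ⊕ comb ys cs

  comb-lin : ∀ {m n} (ys : Vec (V n) m) → Linᵛ (comb ys)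
  comb-lin []       []       []       = sym (V-ring.+-identityˡ 𝟎)
  comb-lin (y ∷ ys) (b ∷ bs) (c ∷ cs) = trans (cong₂ _⊕_ (+⊙ b c y) (comb-lin ys bs cs))
    (VS.solve 4 (λ a b c d → (a VS.:+ b) VS.:+ (c VS.:+ d) VS.:= (a VS.:+ c) VS.:+ (b VS.:+ d)) refl
      (b ⊙ y) (c ⊙ y) (comb ys bs) (comb ys cs))

  pivot : ∀ {n} (A : List (V (suc n))) → All (λ a → head a ≡ 0#) A ⊎
    (∃[ a ] ∃[ A′ ] ¬ head a ≡ 0# × length A ≡ suc (length A′) ×
      (∀ {c} → ⟨ a , c ⟩ ≡ 0# → A′ ⟂ c → A ⟂ c))
  pivot []      = inj₁ []
  pivot (a ∷ A) with head a ≟ 0#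
  ... | no  a≢0 = inj₂ (a , A , a≢0 , refl , _∷_)
  ... | yes a≡0 with pivot A
  ...   | inj₁ A≡0 = inj₁ (a≡0 ∷ A≡0)
  ...   | inj₂ (b , A′ , b≢0 , len , sound) =
    inj₂ (b , a ∷ A′ , b≢0 , cong suc len , λ { bc (ac ∷ A′c) → ac ∷ sound bc A′c })

  -- Gaussian elimination: an equation with invertible leading coefficient determines the first
  -- unknown and is subtracted from the others, which leaves fewer equations in one unknown less.
  underdetermined : ∀ {m} (A : List (V m)) → length A ℕ.< m → ∃[ c ] ¬ c ≡ 𝟎 × A ⟂ c
  underdetermined {suc m} A |A|<m with pivot A
  ... | inj₁ A≡0 = 1# ∷ 𝟎 , (λ eq → 1≢0 (cong head eq)) , All.map (λ {a} → kills a) A≡0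
    where
    kills : ∀ (a : V (suc m)) → head a ≡ 0# → ⟨ a , 1# ∷ 𝟎 ⟩ ≡ 0#
    kills (a ∷ as) refl = trans (cong₂ _+_ (F-ring.zeroˡ 1#) (lin-𝟎 (⟨⟩-linʳ as))) (F-ring.+-identityˡ 0#)
  ... | inj₂ (a ∷ as , A′ , a≢0 , len , sound) = solution
    where
    a⁻¹ = proj₁ (inverse a a≢0)
    reduce : V (suc m) → V m
    reduce (b ∷ bs) = bs ⊖ (b * a⁻¹) ⊙ as
    solution : ∃[ c ] ¬ c ≡ 𝟎 × A ⟂ c
    solution with underdetermined (List.map reduce A′)
      (subst (ℕ._< m) (sym (Listₚ.length-map reduce A′)) (ℕₚ.≤-pred (subst (ℕ._< suc m) len |A|<m)))
    ... | c , c≢0 , A″c = (- (a⁻¹ * ⟨ as , c ⟩)) ∷ c , (λ eq → c≢0 (cong tail eq)) ,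
      sound at-pivot (All.map (λ {b} → lift b) (Allₚ.map⁻ A″c))
      where
      open ≡-Reasoning
      s = ⟨ as , c ⟩
      at-pivot : a * - (a⁻¹ * s) + s ≡ 0#
      at-pivot = begin
        a * - (a⁻¹ * s) + s       ≡⟨ FS.solve 3 (λ a i s → a FS.:* FS.:- (i FS.:* s) FS.:+ s FS.:= s FS.:- (i FS.:* a) FS.:* s) refl a a⁻¹ s ⟩
        s + - (a⁻¹ * a * s)       ≡⟨ cong (λ z → s + - (z * s)) (proj₂ (inverse a a≢0)) ⟩
        s + - (1# * s)            ≡⟨ cong (λ z → s + - z) (F-ring.*-identityˡ s) ⟩
        s + - s                   ≡⟨ x-x≡0 s ⟩
        0#                        ∎
      lift : ∀ (b : V (suc m)) → ⟨ reduce b , c ⟩ ≡ 0# → ⟨ b , (- (a⁻¹ * s)) ∷ c ⟩ ≡ 0#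
      lift (b ∷ bs) eq = begin
        b * - (a⁻¹ * s) + ⟨ bs , c ⟩           ≡⟨ FS.solve 4 (λ b i s t → b FS.:* FS.:- (i FS.:* s) FS.:+ t FS.:= t FS.:- (b FS.:* i) FS.:* s) refl b a⁻¹ s ⟨ bs , c ⟩ ⟩
        ⟨ bs , c ⟩ + - (b * a⁻¹ * s)           ≡⟨ cong (λ z → ⟨ bs , c ⟩ + - z) (lin-⊙ (⟨⟩-linˡ c) (b * a⁻¹) as) ⟨
        ⟨ bs , c ⟩ + - ⟨ (b * a⁻¹) ⊙ as , c ⟩  ≡⟨ lin-⊖ (⟨⟩-linˡ c) bs ((b * a⁻¹) ⊙ as) ⟨
        ⟨ reduce (b ∷ bs) , c ⟩                ≡⟨ eq ⟩
        0#                                     ∎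

  -- Residual of a projection: the part of x removed when the functionals of L are
  -- killed along the accompanying directions.
  residual : ∀ {n} → List (V n × V n) → V n → V n
  residual []            x = 𝟎
  residual ((a , e) ∷ L) x = ⟨ a , x ⟩ ⊙ e ⊕ residual L x

  -- A subspace of codimension at most `c`, given as the image of a map, together with the
  -- functionals that were killed and the directions along which this was done. `restore` is what
  -- finally turns each of these into a product of a linear and a cubic polynomial.
  record Cut {n} (c : ℕ) : Set where
    field
      Π        : V n → V n
      Π-lin    : Linᵛ Π
      pairs    : List (V n × V n)
      pairs≤   : length pairs ℕ.≤ c
      restore  : ∀ x → x ≡ Π x ⊕ residual pairs x

  open Cut public

  cut-id : ∀ {n c} → Cut {n} c
  cut-id = record
    { Π = λ x → x ; Π-lin = λ _ _ → refl ; pairs = [] ; pairs≤ = ℕ.z≤n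
    ; restore = λ x → sym (V-ring.+-identityʳ x) }

  residual-++ : ∀ {n} (L L′ : List (V n × V n)) x → residual (L ++ L′) x ≡ residual L x ⊕ residual L′ x
  residual-++ []            L′ x = sym (V-ring.+-identityˡ (residual L′ x))
  residual-++ ((a , e) ∷ L) L′ x = trans (cong (⟨ a , x ⟩ ⊙ e ⊕_) (residual-++ L L′ x))
    (sym (V-ring.+-assoc (⟨ a , x ⟩ ⊙ e) (residual L x) (residual L′ x)))

  pullback : ∀ {m n} → V m → (V n → V m) → V n
  pullback a f = rep (λ x → ⟨ a , f x ⟩)

  pullback-correct : ∀ {m n} (a : V m) {f : V n → V m} → Linᵛ f → ∀ x → ⟨ a , f x ⟩ ≡ ⟨ pullback a f , x ⟩
  pullback-correct a {f} f-lin = rep-correct (λ x y → trans (cong ⟨ a ,_⟩ (f-lin x y)) (⟨⟩-linʳ a (f x) (f y)))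

  residual-∘ : ∀ {n} (L : List (V n × V n)) {f : V n → V n} → Linᵛ f → ∀ x →
    residual L (f x) ≡ residual (List.map (λ (a , e) → pullback a f , e) L) x
  residual-∘ []            f-lin x = refl
  residual-∘ ((a , e) ∷ L) f-lin x = cong₂ (λ c r → c ⊙ e ⊕ r) (pullback-correct a f-lin x) (residual-∘ L f-lin x)

  -- First P, then Q is applied inside: the composite projection is P ∘ Q.
  cut-∘ : ∀ {n c d} → Cut {n} c → Cut {n} d → Cut {n} (c ℕ.+ d)
  cut-∘ P Q = record
    { Π = λ x → Π P (Π Q x)
    ; Π-lin = λ x y → trans (cong (Π P) (Π-lin Q x y)) (Π-lin P (Π Q x) (Π Q y))
    ; pairs = P∘Q ++ pairs Q
    ; pairs≤ = subst (ℕ._≤ _) (sym (trans (Listₚ.length-++ P∘Q) (cong (ℕ._+ length (pairs Q)) (Listₚ.length-map _ (pairs P)))))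
        (ℕₚ.+-mono-≤ (pairs≤ P) (pairs≤ Q))
    ; restore = λ x → begin
        x                                                                      ≡⟨ restore Q x ⟩
        Π Q x ⊕ residual (pairs Q) x                                           ≡⟨ cong (_⊕ residual (pairs Q) x) (restore P (Π Q x)) ⟩
        (Π P (Π Q x) ⊕ residual (pairs P) (Π Q x)) ⊕ residual (pairs Q) x      ≡⟨ V-ring.+-assoc _ _ _ ⟩
        Π P (Π Q x) ⊕ (residual (pairs P) (Π Q x) ⊕ residual (pairs Q) x)      ≡⟨ cong (λ r → Π P (Π Q x) ⊕ (r ⊕ residual (pairs Q) x)) (residual-∘ (pairs P) (Π-lin Q) x) ⟩
        Π P (Π Q x) ⊕ (residual P∘Q x ⊕ residual (pairs Q) x)                  ≡⟨ cong (Π P (Π Q x) ⊕_) (residual-++ P∘Q (pairs Q) x) ⟨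
        Π P (Π Q x) ⊕ residual (P∘Q ++ pairs Q) x                              ∎ }
    where
    open ≡-Reasoning
    P∘Q = List.map (λ (a , e) → pullback a (Π Q) , e) (pairs P)

  cut-mono : ∀ {n c d} → c ℕ.≤ d → Cut {n} c → Cut {n} d
  cut-mono c≤d P = record
    { Π = Π P ; Π-lin = Π-lin P ; pairs = pairs P ; pairs≤ = ℕₚ.≤-trans (pairs≤ P) c≤d ; restore = restore P }

  nonzero? : ∀ {n} (a : V n) → (∀ x → ⟨ a , x ⟩ ≡ 0#) ⊎ ∃[ e ] ⟨ a , e ⟩ ≡ 1#
  nonzero? []       = inj₁ λ { [] → refl }
  nonzero? (a ∷ as) with a ≟ 0#
  ... | no a≢0 with b , ba≡1 ← inverse a a≢0 =
    inj₂ (b ∷ 𝟎 , trans (cong₂ _+_ (trans (F-ring.*-comm a b) ba≡1) (lin-𝟎 (⟨⟩-linʳ as))) (F-ring.+-identityʳ 1#))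
  ... | yes refl with nonzero? as
  ...   | inj₁ zero-as = inj₁ λ { (x ∷ xs) → trans (cong₂ _+_ (F-ring.zeroˡ x) (zero-as xs)) (F-ring.+-identityˡ 0#) }
  ...   | inj₂ (e , ae≡1) = inj₂ (0# ∷ e , trans (cong₂ _+_ (F-ring.zeroˡ 0#) ae≡1) (F-ring.+-identityˡ 1#))

  cut-one : ∀ {n} (a : V n) → Σ[ P ∈ Cut {n} 1 ] (∀ x → ⟨ a , Π P x ⟩ ≡ 0#)
  cut-one a with nonzero? a
  ... | inj₁ a≡0 = cut-id , a≡0
  ... | inj₂ (e , ae≡1) = record
    { Π = λ x → x ⊖ ⟨ a , x ⟩ ⊙ e
    ; Π-lin = λ x y → trans (cong (λ z → (x ⊕ y) ⊖ z) (trans (cong (_⊙ e) (⟨⟩-linʳ a x y)) (+⊙ ⟨ a , x ⟩ ⟨ a , y ⟩ e)))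
        (VS.solve 4 (λ x y u v → (x VS.:+ y) VS.:- (u VS.:+ v) VS.:= (x VS.:- u) VS.:+ (y VS.:- v)) refl
          x y (⟨ a , x ⟩ ⊙ e) (⟨ a , y ⟩ ⊙ e))
    ; pairs = (a , e) ∷ []
    ; pairs≤ = ℕₚ.≤-refl
    ; restore = λ x → trans (VS.solve 2 (λ x u → x VS.:= (x VS.:- u) VS.:+ u) refl x (⟨ a , x ⟩ ⊙ e))
        (cong ((x ⊖ ⟨ a , x ⟩ ⊙ e) ⊕_) (sym (V-ring.+-identityʳ (⟨ a , x ⟩ ⊙ e)))) } ,
    λ x → let ax = ⟨ a , x ⟩ in begin
      ⟨ a , x ⊖ ax ⊙ e ⟩             ≡⟨ lin-⊖ (⟨⟩-linʳ a) x (ax ⊙ e) ⟩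
      ax + - ⟨ a , ax ⊙ e ⟩          ≡⟨ cong (λ z → ax + - z) (trans (lin-⊙ (⟨⟩-linʳ a) ax e)
                                          (trans (cong (ax *_) ae≡1) (F-ring.*-identityʳ ax))) ⟩
      ax + - ax                      ≡⟨ x-x≡0 ax ⟩
      0#                             ∎
    where open ≡-Reasoning

  -- Each functional is pulled back along the cut already made. The new projection then acts inside,
  -- and the functionals killed before stay killed.
  cut-ker : ∀ {n} (Λ : List (V n)) → Σ[ P ∈ Cut {n} (length Λ) ] (∀ x → Λ ⟂ Π P x)
  cut-ker []      = cut-id , λ _ → []
  cut-ker (a ∷ Λ) with P , ΛP ← cut-ker Λ with Q , aQ ← cut-one (pullback a (Π P)) =
    cut-mono (ℕₚ.≤-reflexive (ℕₚ.+-comm (length Λ) 1)) (cut-∘ P Q) ,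
    λ x → trans (pullback-correct a (Π-lin P) (Π Q x)) (aQ x) ∷ ΛP (Π Q x)

  search-V : ∀ {n} → Searchable (V n)
  search-V = search-Vec search-Fin

  -- Forms of small rank

  record Bil {m n} (M : V m → V n → F) : Set where
    field
      linˡ : ∀ u → Lin (λ w → M w u)
      linʳ : ∀ w → Lin (M w)

  open Bil public

  Form : ℕ → Set
  Form n = V n → V n → F

  eval : ∀ {n} → List (V n × V n) → Form n
  eval []            w u = 0#
  eval ((a , b) ∷ L) w u = ⟨ a , w ⟩ * ⟨ b , u ⟩ + eval L w u

  Rank≤ : ∀ {n} → ℕ → Form n → Set
  Rank≤ t M = ∃[ L ] length L ℕ.≤ t × (∀ w u → M w u ≡ eval L w u)

  Rank≤? : ∀ {n} t (M : Form n) → Dec (Rank≤ t M)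
  Rank≤? t M = search-List≤ (search-× search-V search-V) t
    (λ L → search-∀ search-V (λ w → search-∀ search-V (λ u → M w u ≟ eval L w u)))

  eval-++ : ∀ {n} (L L′ : List (V n × V n)) w u → eval (L ++ L′) w u ≡ eval L w u + eval L′ w u
  eval-++ []            L′ w u = sym (F-ring.+-identityˡ _)
  eval-++ ((a , b) ∷ L) L′ w u = trans (cong (⟨ a , w ⟩ * ⟨ b , u ⟩ +_) (eval-++ L L′ w u))
    (sym (F-ring.+-assoc _ _ _))

  module _ {n : ℕ} where

    rank-cong : ∀ {t} {M N : Form n} → (∀ w u → M w u ≡ N w u) → Rank≤ t M → Rank≤ t N
    rank-cong M≡N (L , L≤t , M≡) = L , L≤t , λ w u → trans (sym (M≡N w u)) (M≡ w u)

    rank-mono : ∀ {s t} {M : Form n} → s ℕ.≤ t → Rank≤ s M → Rank≤ t M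
    rank-mono s≤t (L , L≤s , M≡) = L , ℕₚ.≤-trans L≤s s≤t , M≡

    rank-0 : ∀ {t} → Rank≤ {n} t (λ w u → 0#)
    rank-0 = [] , ℕ.z≤n , λ w u → refl

    rank-+ : ∀ {s t} {M N : Form n} → Rank≤ s M → Rank≤ t N → Rank≤ (s ℕ.+ t) (λ w u → M w u + N w u)
    rank-+ (L , L≤s , M≡) (L′ , L′≤t , N≡) = L ++ L′ ,
      subst (ℕ._≤ _) (sym (Listₚ.length-++ L)) (ℕₚ.+-mono-≤ L≤s L′≤t) ,
      λ w u → trans (cong₂ _+_ (M≡ w u) (N≡ w u)) (sym (eval-++ L L′ w u))

    rank-* : ∀ {t} {M : Form n} c → Rank≤ t M → Rank≤ t (λ w u → c * M w u)
    rank-* c (L , L≤t , M≡) = List.map (λ (a , b) → c ⊙ a , b) L ,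
      subst (ℕ._≤ _) (sym (Listₚ.length-map _ L)) L≤t ,
      λ w u → trans (cong (c *_) (M≡ w u)) (scale L w u)
      where
      scale : ∀ L w u → c * eval L w u ≡ eval (List.map (λ (a , b) → c ⊙ a , b) L) w u
      scale []            w u = F-ring.zeroʳ c
      scale ((a , b) ∷ L) w u = trans (F-ring.distribˡ c _ _) (cong₂ _+_
        (trans (sym (F-ring.*-assoc c ⟨ a , w ⟩ ⟨ b , u ⟩)) (cong (_* ⟨ b , u ⟩) (sym (lin-⊙ (⟨⟩-linˡ w) c a))))
        (scale L w u))

    rank-neg : ∀ {t} {M : Form n} → Rank≤ t M → Rank≤ t (λ w u → - M w u)
    rank-neg {M = M} r = rank-cong (λ w u → -1*x≈-x (M w u)) (rank-* (- 1#) r)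
      where open import Algebra.Properties.Ring F-ring.ring using (-1*x≈-x)

    rank-- : ∀ {s t} {M N : Form n} → Rank≤ s M → Rank≤ t N → Rank≤ (s ℕ.+ t) (λ w u → M w u + - N w u)
    rank-- rM rN = rank-+ rM (rank-neg rN)

    rank-flip : ∀ {t} {M : Form n} → Rank≤ t M → Rank≤ t (λ w u → M u w)
    rank-flip (L , L≤t , M≡) = List.map (λ (a , b) → b , a) L ,
      subst (ℕ._≤ _) (sym (Listₚ.length-map _ L)) L≤t , λ w u → trans (M≡ u w) (flip L u w)
      where
      flip : ∀ L w u → eval L w u ≡ eval (List.map (λ (a , b) → b , a) L) u w
      flip []            w u = refl
      flip ((a , b) ∷ L) w u = cong₂ _+_ (F-ring.*-comm _ _) (flip L w u)

    rank-∘ : ∀ {t m} {M : Form m} {f g : V n → V m} → Linᵛ f → Linᵛ g → Rank≤ t M → Rank≤ t (λ w u → M (f w) (g u))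
    rank-∘ {f = f} {g} f-lin g-lin (L , L≤t , M≡) = List.map (λ (a , b) → pullback a f , pullback b g) L ,
      subst (ℕ._≤ _) (sym (Listₚ.length-map _ L)) L≤t , λ w u → trans (M≡ (f w) (g u)) (pull L w u)
      where
      pull : ∀ L w u → eval L (f w) (g u) ≡ eval (List.map (λ (a , b) → pullback a f , pullback b g) L) w u
      pull []            w u = refl
      pull ((a , b) ∷ L) w u = cong₂ _+_ (cong₂ _*_ (pullback-correct a f-lin w) (pullback-correct b g-lin u)) (pull L w u)

    rank-product : ∀ {φ ψ : V n → F} → Lin φ → Lin ψ → Rank≤ 1 (λ w u → φ w * ψ u)
    rank-product φ-lin ψ-lin = (rep _ , rep _) ∷ [] , ℕₚ.≤-refl , λ w u →
      trans (cong₂ _*_ (rep-correct φ-lin w) (rep-correct ψ-lin u)) (sym (F-ring.+-identityʳ _))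

    rank-⟨⟩ : ∀ {k} {f g : V n → V k} → Linᵛ f → Linᵛ g → Rank≤ k (λ w u → ⟨ f w , g u ⟩)
    rank-⟨⟩ {zero} {f} {g} _ _ = rank-cong (λ w u → zero-dim (f w) (g u)) rank-0
      where
      zero-dim : ∀ (x y : V 0) → 0# ≡ ⟨ x , y ⟩
      zero-dim [] [] = refl
    rank-⟨⟩ {suc k} {f} {g} f-lin g-lin = rank-cong (λ w u → split (f w) (g u))
      (rank-+ (rank-product (λ x y → head-lin f-lin x y) (λ x y → head-lin g-lin x y))
              (rank-⟨⟩ (λ x y → tail-lin f-lin x y) (λ x y → tail-lin g-lin x y)))
      where
      open import Data.Vec.Base using (head; tail)
      head-⊕ : ∀ (x y : V (suc k)) → head (x ⊕ y) ≡ head x + head y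
      head-⊕ (x ∷ xs) (y ∷ ys) = refl
      tail-⊕ : ∀ (x y : V (suc k)) → tail (x ⊕ y) ≡ tail x ⊕ tail y
      tail-⊕ (x ∷ xs) (y ∷ ys) = refl
      head-lin : ∀ {h : V n → V (suc k)} → Linᵛ h → Lin (λ x → head (h x))
      head-lin {h} l x y = trans (cong head (l x y)) (head-⊕ (h x) (h y))
      tail-lin : ∀ {h : V n → V (suc k)} → Linᵛ h → Linᵛ (λ x → tail (h x))
      tail-lin {h} l x y = trans (cong tail (l x y)) (tail-⊕ (h x) (h y))
      split : ∀ (x y : V (suc k)) → head x * head y + ⟨ tail x , tail y ⟩ ≡ ⟨ x , y ⟩
      split (x ∷ xs) (y ∷ ys) = refl

    eval-ker : ∀ (L : List (V n × V n)) {w} → List.map proj₁ L ⟂ w → ∀ u → eval L w u ≡ 0#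
    eval-ker []            []         u = refl
    eval-ker ((a , b) ∷ L) (aw ∷ Lw)  u = trans (cong₂ _+_ (trans (cong (_* ⟨ b , u ⟩) aw) (F-ring.zeroˡ _)) (eval-ker L Lw u))
      (F-ring.+-identityˡ 0#)

    abstract
      rank→ker : ∀ {t} {M : Form n} → Rank≤ t M → ∃[ Λ ] length Λ ℕ.≤ t × (∀ {w} → Λ ⟂ w → ∀ u → M w u ≡ 0#)
      rank→ker (L , L≤t , M≡) = List.map proj₁ L , subst (ℕ._≤ _) (sym (Listₚ.length-map _ L)) L≤t ,
        λ {w} Λw u → trans (M≡ w u) (eval-ker L Λw u)

    rank-residual : ∀ {M : Form n} → Bil M → ∀ (L : List (V n × V n)) → Rank≤ (length L) (λ w u → M (residual L w) u)
    rank-residual         bil []            = rank-cong (λ w u → sym (lin-𝟎 (linˡ bil u))) rank-0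
    rank-residual {M = M} bil ((a , e) ∷ L) = rank-cong
      (λ w u → sym (trans (linˡ bil u (⟨ a , w ⟩ ⊙ e) (residual L w))
        (cong (_+ M (residual L w) u) (lin-⊙ (linˡ bil u) ⟨ a , w ⟩ e))))
      (rank-+ (rank-product (⟨⟩-linʳ a) (linʳ bil e)) (rank-residual bil L))

    rank-uncutˡ : ∀ {t c} {M : Form n} → Bil M → (P : Cut c) → Rank≤ t (λ w u → M (Π P w) u) → Rank≤ (t ℕ.+ c) M
    rank-uncutˡ {M = M} bil P r = rank-cong
      (λ w u → sym (trans (cong (λ z → M z u) (restore P w)) (linˡ bil u (Π P w) (residual (pairs P) w))))
      (rank-+ r (rank-mono (pairs≤ P) (rank-residual bil (pairs P))))

    -- What the cut removes from an argument lies in the span of at most `c` directions, and so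
    -- contributes rank at most `c`.
    rank-uncut : ∀ {t c} {M : Form n} → Bil M → (P : Cut c) → Rank≤ t (λ w u → M (Π P w) (Π P u)) → Rank≤ (t ℕ.+ c ℕ.+ c) M
    rank-uncut {M = M} bil P r = rank-uncutˡ bil P (rank-flip (rank-uncutˡ
      (record { linˡ = λ u → linʳ bil (Π P u)
              ; linʳ = λ w x y → trans (cong (λ z → M z w) (Π-lin P x y)) (linˡ bil w (Π P x) (Π P y)) })
      P (rank-flip r)))

    ker→rank : ∀ {M : Form n} → Bil M → (Λ : List (V n)) → (∀ {w} → Λ ⟂ w → ∀ u → M w u ≡ 0#) → Rank≤ (length Λ) M
    ker→rank bil Λ zero-on-ker with P , ΛP ← cut-ker Λ =
      rank-uncutˡ bil P (rank-cong (λ w u → sym (zero-on-ker (ΛP w) u)) rank-0)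

    ker²→rank : ∀ {M : Form n} → Bil M → (Λ : List (V n)) → (∀ {w u} → Λ ⟂ w → Λ ⟂ u → M w u ≡ 0#) →
      Rank≤ (length Λ ℕ.+ length Λ) M
    ker²→rank bil Λ zero-on-ker with P , ΛP ← cut-ker Λ =
      rank-uncut {t = 0} bil P (rank-cong (λ w u → sym (zero-on-ker (ΛP w) (ΛP u))) rank-0)

    dependent : ∀ {m} (Λ : List (V n)) (ys : Vec (V n) m) → length Λ ℕ.< m → ∃[ c ] ¬ c ≡ 𝟎 × Λ ⟂ comb ys c
    dependent Λ ys |Λ|<m with c , c≢0 , Ac ← underdetermined (List.map (λ a → pullback a (comb ys)) Λ)
                                (subst (ℕ._< _) (sym (Listₚ.length-map _ Λ)) |Λ|<m) =
      c , c≢0 , All.map (λ {a} ac → trans (pullback-correct a (comb-lin ys) c) ac) (Allₚ.map⁻ Ac)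

    -- A family of pairs on which the matrix of values is diagonal with nonzero entries: a lower
    -- bound for the rank that can be extended one pair at a time.
    data Diagonal (M : Form n) : List (V n × V n) → Set where
      []   : Diagonal M []
      cons : ∀ {w u ps} → ¬ M w u ≡ 0# → All (λ (w′ , u′) → M w u′ ≡ 0# × M w′ u ≡ 0#) ps →
             Diagonal M ps → Diagonal M ((w , u) ∷ ps)

    -- The membership conditions say that `w` occurs as a first and `u` as a second component,
    -- possibly of different pairs; no other values enter into `Diagonal`.
    diagonal-cong : ∀ {M N : Form n} {ps} →
      (∀ {w u w′ u′} → (w , u′) ∈ ps → (w′ , u) ∈ ps → M w u ≡ N w u) → Diagonal M ps → Diagonal N ps
    diagonal-cong M≡N []                = []
    diagonal-cong M≡N (cons Mwu≢0 cross D) = cons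
      (λ Nwu≡0 → Mwu≢0 (trans (M≡N (here refl) (here refl)) Nwu≡0))
      (All.tabulate λ {(w′ , u′)} ∈ps → let Mwu′ , Mw′u = All.lookup cross ∈ps in
        trans (sym (M≡N (here refl) (there ∈ps))) Mwu′ , trans (sym (M≡N (there ∈ps) (here refl))) Mw′u)
      (diagonal-cong (λ a b → M≡N (there a) (there b)) D)

    private
      ws : (ps : List (V n × V n)) → Vec (V n) (length ps)
      ws []             = []
      ws ((w , _) ∷ ps) = w ∷ ws ps

    module _ {M : Form n} (bil : Bil M) where

      comb-orthogonal : ∀ ps (c : V (length ps)) {u} → All (λ (w , _) → M w u ≡ 0#) ps → M (comb (ws ps) c) u ≡ 0#
      comb-orthogonal []             []       []           = lin-𝟎 (linˡ bil _)
      comb-orthogonal ((w , _) ∷ ps) (c ∷ cs) {u} (wu ∷ rest) = begin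
        M (c ⊙ w ⊕ comb (ws ps) cs) u          ≡⟨ linˡ bil u (c ⊙ w) (comb (ws ps) cs) ⟩
        M (c ⊙ w) u + M (comb (ws ps) cs) u    ≡⟨ cong₂ _+_ (trans (lin-⊙ (linˡ bil u) c w) (trans (cong (c *_) wu) (F-ring.zeroʳ c)))
                                                    (comb-orthogonal ps cs rest) ⟩
        0# + 0#                                ≡⟨ F-ring.+-identityˡ 0# ⟩
        0#                                     ∎
        where open ≡-Reasoning

      diagonal-independent : ∀ {ps} → Diagonal M ps → ∀ c → (∀ u → M (comb (ws ps) c) u ≡ 0#) → c ≡ 𝟎
      diagonal-independent []                                   []       _    = refl
      diagonal-independent {(w , u) ∷ ps} (cons Mwu≢0 cross D) (c ∷ cs) kills with c ≟ 0#
      ... | yes refl = cong (0# ∷_) (diagonal-independent D cs λ u′ →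
        trans (cong (λ z → M z u′) (sym (trans (cong (_⊕ comb (ws ps) cs) (0⊙ w)) (V-ring.+-identityˡ _)))) (kills u′))
      ... | no c≢0 = contradiction (*-cancel c≢0 (begin
        c * M w u                                    ≡⟨ lin-⊙ (linˡ bil u) c w ⟨
        M (c ⊙ w) u                                  ≡⟨ F-ring.+-identityʳ _ ⟨
        M (c ⊙ w) u + 0#                             ≡⟨ cong (M (c ⊙ w) u +_) (comb-orthogonal ps cs (All.map proj₂ cross)) ⟨
        M (c ⊙ w) u + M (comb (ws ps) cs) u          ≡⟨ linˡ bil u (c ⊙ w) (comb (ws ps) cs) ⟨
        M (comb (w ∷ ws ps) (c ∷ cs)) u              ≡⟨ kills u ⟩
        0#                                           ∎)) Mwu≢0
        where open ≡-Reasoning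

      -- More than `r` first components have a nontrivial combination in the kernel of the form,
      -- whereas those of a diagonal family are independent modulo it.
      diagonal-bound : ∀ {r ps} → Rank≤ r M → Diagonal M ps → length ps ℕ.≤ r
      diagonal-bound {r} {ps} rank D with rank→ker rank
      ... | Λ , Λ≤r , zero-on-ker = decidable-stable (length ps ℕₚ.≤? r) λ ps≰r →
        let c , c≢0 , Λc = dependent Λ (ws ps) (ℕₚ.≤-<-trans Λ≤r (ℕₚ.≰⇒> ps≰r))
        in c≢0 (diagonal-independent D c (zero-on-ker Λc))

    gather : ∀ {A : Set} → (A → List (V n)) → List A → List (V n)
    gather = concatMap

    gather-⟂ : ∀ {A : Set} {f : A → List (V n)} {xs x} {v : A} → v ∈ xs → gather f xs ⟂ x → f v ⟂ x
    gather-⟂ {f = f} {y ∷ xs} (here refl) h = ++⟂ˡ (f y) _ h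
    gather-⟂ {f = f} {y ∷ xs} (there ∈xs) h = gather-⟂ ∈xs (++⟂ʳ (f y) _ h)

    gather≤ : ∀ {A : Set} {f : A → List (V n)} {b} → (∀ v → length (f v) ℕ.≤ b) → ∀ xs → length (gather f xs) ℕ.≤ length xs ℕ.* b
    gather≤         f≤b []       = ℕ.z≤n
    gather≤ {f = f} f≤b (x ∷ xs) = subst (ℕ._≤ _) (sym (Listₚ.length-++ (f x))) (ℕₚ.+-mono-≤ (f≤b x) (gather≤ f≤b xs))

  -- Symmetric multilinear forms all of whose slices have small rank

  record Sym³ {n} (T : V n → V n → V n → F) : Set where
    field
      lin₁ : ∀ w u → Lin (λ y → T y w u)
      s₁₂  : ∀ y w u → T y w u ≡ T w y u
      s₂₃  : ∀ y w u → T y w u ≡ T y u w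

    lin₂ : ∀ y u → Lin (λ w → T y w u)
    lin₂ y u a b = trans (s₁₂ y (a ⊕ b) u) (trans (lin₁ y u a b) (cong₂ _+_ (s₁₂ a y u) (s₁₂ b y u)))

    lin₃ : ∀ y w → Lin (T y w)
    lin₃ y w a b = trans (s₂₃ y w (a ⊕ b)) (trans (lin₂ y w a b) (cong₂ _+_ (s₂₃ y a w) (s₂₃ y b w)))

    slice : ∀ y → Bil (T y)
    slice y = record { linˡ = lin₂ y ; linʳ = lin₃ y }

  support : ∀ {n} → List (V n × V n) → List (V n)
  support ps = List.map proj₁ ps ++ List.map proj₂ ps

  ∈-supportˡ : ∀ {n} {ps : List (V n × V n)} {w u} → (w , u) ∈ ps → w ∈ support ps
  ∈-supportˡ ∈ps = ∈-++⁺ˡ (∈-map⁺ proj₁ ∈ps)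

  ∈-supportʳ : ∀ {n} {ps : List (V n × V n)} {w u} → (w , u) ∈ ps → u ∈ support ps
  ∈-supportʳ {ps = ps} ∈ps = ∈-++⁺ʳ (List.map proj₁ ps) (∈-map⁺ proj₂ ∈ps)

  length-support : ∀ {n} (ps : List (V n × V n)) → length (support ps) ≡ length ps ℕ.+ length ps
  length-support ps = trans (Listₚ.length-++ (List.map proj₁ ps))
    (cong₂ ℕ._+_ (Listₚ.length-map proj₁ ps) (Listₚ.length-map proj₂ ps))

  sum₂ : ∀ {a b} → a ≡ 0# → b ≡ 0# → a + b ≡ 0#
  sum₂ refl refl = F-ring.+-identityˡ 0#

  0+ : ∀ {a b} → a ≡ 0# → a + b ≡ b
  0+ {b = b} refl = F-ring.+-identityˡ b

  +0 : ∀ {a b} → b ≡ 0# → a + b ≡ a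
  +0 {a} refl = F-ring.+-identityʳ a

  abstract
    -- `Λ` collects the kernels of the slices at `s` and at the vectors of the family, so that every
    -- value with one of these and a vector of the subspace vanishes. A nonzero value inside the
    -- subspace would therefore add a diagonal entry without disturbing the others.
    cubic-kernel : ∀ {n r} {T : V n → V n → V n → F} → Sym³ T → (∀ y → Rank≤ r (T y)) →
      ∃[ Λ ] length Λ ℕ.≤ cubicCost r × (∀ {y w u} → Λ ⟂ y → Λ ⟂ w → Λ ⟂ u → T y w u ≡ 0#)
    cubic-kernel {n} {r} {T} sym³ rank = go (suc r) [] 𝟎 [] refl
      where
      open Sym³ sym³
      ker : V n → List (V n)
      ker v = proj₁ (rank→ker (rank v))
      ker≤ : ∀ v → length (ker v) ℕ.≤ r
      ker≤ v = proj₁ (proj₂ (rank→ker (rank v)))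
      kills : ∀ {v x} → ker v ⟂ x → ∀ u → T v x u ≡ 0#
      kills {v} = proj₂ (proj₂ (rank→ker (rank v)))

      -- The sum s of the first components of a maximal family of triples with all
      -- mixed values zero makes T s diagonal, so the family has at most r members.
      go : ∀ m ps s → Diagonal (T s) ps → length ps ℕ.+ m ≡ suc r →
        ∃[ Λ ] length Λ ℕ.≤ cubicCost r × (∀ {y w u} → Λ ⟂ y → Λ ⟂ w → Λ ⟂ u → T y w u ≡ 0#)
      go zero ps s D |ps|≡1+r = contradiction (diagonal-bound (slice s) (rank s) D)
        (ℕₚ.<⇒≱ (ℕₚ.≤-reflexive (sym (trans (sym (ℕₚ.+-identityʳ _)) |ps|≡1+r))))
      go (suc m) ps s D |ps|+m with Λ ← gather ker (s ∷ support ps) in Λ≡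
        with search-× search-V (search-× search-V search-V)
               (λ (y , w , u) → (Λ ⟂? y) ×-dec (Λ ⟂? w) ×-dec (Λ ⟂? u) ×-dec ¬? (T y w u ≟ 0#))
      ... | no none = Λ , subst (λ Λ → length Λ ℕ.≤ cubicCost r) Λ≡ (ℕₚ.≤-trans (gather≤ {f = ker} ker≤ (s ∷ support ps))
              (ℕₚ.*-monoˡ-≤ r (ℕ.s≤s (subst (ℕ._≤ r ℕ.+ r) (sym (length-support ps)) (ℕₚ.+-mono-≤ |ps|≤r |ps|≤r))))) ,
            λ {y} {w} {u} Λy Λw Λu → decidable-stable (T y w u ≟ 0#) (λ T≢0 → none ((y , w , u) , Λy , Λw , Λu , T≢0))
        where
        |ps|≤r : length ps ℕ.≤ r
        |ps|≤r = ℕₚ.≤-pred (ℕₚ.≤-trans (ℕₚ.m≤m+n (suc (length ps)) m)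
          (ℕₚ.≤-reflexive (trans (sym (ℕₚ.+-suc (length ps) m)) |ps|+m)))
      ... | yes ((y , w , u) , Λy , Λw , Λu , T≢0) =
        go m ((w , u) ∷ ps) (s ⊕ y) (cons diag (All.tabulate off) (diagonal-cong old D))
          (trans (sym (ℕₚ.+-suc (length ps) m)) |ps|+m)
        where
        kill : ∀ {v x} → v ∈ s ∷ support ps → Λ ⟂ x → ∀ z → T v x z ≡ 0#
        kill v∈ Λx = kills (gather-⟂ v∈ (subst (_⟂ _) (sym Λ≡) Λx))
        diag : ¬ T (s ⊕ y) w u ≡ 0#
        diag eq = T≢0 (trans (sym (trans (lin₁ w u s y) (0+ (kill (here refl) Λw u)))) eq)
        off : ∀ {q} → q ∈ ps → T (s ⊕ y) w (proj₂ q) ≡ 0# × T (s ⊕ y) (proj₁ q) u ≡ 0#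
        off {w′ , u′} ∈ps =
          trans (lin₁ w u′ s y) (sum₂ (kill (here refl) Λw u′)
            (trans (s₂₃ y w u′) (trans (s₁₂ y u′ w) (kill (there (∈-supportʳ ∈ps)) Λy w)))) ,
          trans (lin₁ w′ u s y) (sum₂ (trans (s₂₃ s w′ u) (kill (here refl) Λu w′))
            (trans (s₁₂ y w′ u) (kill (there (∈-supportˡ ∈ps)) Λy u)))
        old : ∀ {w₁ u₁ w₂ u₂} → (w₁ , u₂) ∈ ps → (w₂ , u₁) ∈ ps → T s w₁ u₁ ≡ T (s ⊕ y) w₁ u₁
        old {w₁} {u₁} w₁∈ _ = sym (trans (lin₁ w₁ u₁ s y)
          (+0 (trans (s₁₂ y w₁ u₁) (kill (there (∈-supportˡ w₁∈)) Λy u₁))))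

  Form⁴ : ℕ → Set
  Form⁴ n = V n → V n → V n → V n → F

  record Sym⁴ {n} (B : Form⁴ n) : Set where
    field
      lin₁ : ∀ z w u → Lin (λ y → B y z w u)
      s₁₂  : ∀ y z w u → B y z w u ≡ B z y w u
      s₂₃  : ∀ y z w u → B y z w u ≡ B y w z u
      s₃₄  : ∀ y z w u → B y z w u ≡ B y z u w

    lin₂ : ∀ y w u → Lin (λ z → B y z w u)
    lin₂ y w u a b = trans (s₁₂ y (a ⊕ b) w u) (trans (lin₁ y w u a b) (cong₂ _+_ (s₁₂ a y w u) (s₁₂ b y w u)))

    cubic : ∀ y → Sym³ (B y)
    cubic y = record { lin₁ = lin₂ y ; s₁₂ = s₂₃ y ; s₂₃ = s₃₄ y }

    lin₃ : ∀ y z u → Lin (λ w → B y z w u)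
    lin₃ y = Sym³.lin₂ (cubic y)

    lin₄ : ∀ y z w → Lin (B y z w)
    lin₄ y = Sym³.lin₃ (cubic y)

    slice₂ : ∀ y z → Bil (B y z)
    slice₂ y z = Sym³.slice (cubic y) z

    s₁₃ : ∀ y z w u → B y z w u ≡ B w z y u
    s₁₃ y z w u = trans (s₂₃ y z w u) (trans (s₁₂ y w z u) (s₂₃ w y z u))

    s₂₄ : ∀ y z w u → B y z w u ≡ B y u w z
    s₂₄ y z w u = trans (s₃₄ y z w u) (trans (s₂₃ y z u w) (s₃₄ y u z w))

    swap-pairs : ∀ y z w u → B y z w u ≡ B w u y z
    swap-pairs y z w u = trans (s₁₃ y z w u) (s₂₄ w z y u)

    lin₁₂ : ∀ y y′ z z′ w u → B (y ⊕ y′) (z ⊕ z′) w u ≡ B y z w u + B y′ z w u + (B y z′ w u + B y′ z′ w u)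
    lin₁₂ y y′ z z′ w u = trans (lin₂ (y ⊕ y′) w u z z′) (cong₂ _+_ (lin₁ z w u y y′) (lin₁ z′ w u y y′))

  -- There are two sums now, `s` and `t`. A mixed value contains either two old vectors besides a
  -- new one, and is killed through the rank of `G v v′`, or one old vector and three new ones, and
  -- is killed by `cubic-kernel` for `G v`.
  quartic-kernel : ∀ {n r} {G : Form⁴ n} → Sym⁴ G → (∀ y z → Rank≤ r (G y z)) →
    ∃[ Λ ] length Λ ℕ.≤ quarticCost r × (∀ {y z w u} → Λ ⟂ y → Λ ⟂ z → Λ ⟂ w → Λ ⟂ u → G y z w u ≡ 0#)
  quartic-kernel {n} {r} {G} sym⁴ rank = go (suc r) [] 𝟎 𝟎 [] refl
    where
    open Sym⁴ sym⁴
    ker : V n → V n → List (V n)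
    ker v v′ = proj₁ (rank→ker (rank v v′))
    ker≤ : ∀ v v′ → length (ker v v′) ℕ.≤ r
    ker≤ v v′ = proj₁ (proj₂ (rank→ker (rank v v′)))
    ker³ : V n → List (V n)
    ker³ v = proj₁ (cubic-kernel (cubic v) (rank v))
    ker³≤ : ∀ v → length (ker³ v) ℕ.≤ cubicCost r
    ker³≤ v = proj₁ (proj₂ (cubic-kernel (cubic v) (rank v)))

    Result : Set
    Result = ∃[ Λ ] length Λ ℕ.≤ quarticCost r ×
      (∀ {y z w u} → Λ ⟂ y → Λ ⟂ z → Λ ⟂ w → Λ ⟂ u → G y z w u ≡ 0#)

    conditions : List (V n) → List (V n)
    conditions S = gather (λ v → gather (ker v) S ++ ker³ v) S

    conditions≤ : ∀ S → length S ℕ.≤ 2 ℕ.+ (r ℕ.+ r) → length (conditions S) ℕ.≤ quarticCost r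
    conditions≤ S |S|≤ = ℕₚ.≤-trans
      (gather≤ {f = λ v → gather (ker v) S ++ ker³ v} {b = (2 ℕ.+ (r ℕ.+ r)) ℕ.* r ℕ.+ cubicCost r}
        (λ v → subst (ℕ._≤ _) (sym (Listₚ.length-++ (gather (ker v) S)))
          (ℕₚ.+-mono-≤ (ℕₚ.≤-trans (gather≤ {f = ker v} (ker≤ v) S) (ℕₚ.*-monoˡ-≤ r |S|≤)) (ker³≤ v))) S)
      (ℕₚ.*-monoˡ-≤ _ |S|≤)

    kill₂ : ∀ {S v v′ x} → v ∈ S → v′ ∈ S → conditions S ⟂ x → ∀ u → G v v′ x u ≡ 0#
    kill₂ {S} {v} {v′} v∈ v′∈ Λx = proj₂ (proj₂ (rank→ker (rank v v′)))
      (gather-⟂ {f = ker v} v′∈ (++⟂ˡ (gather (ker v) S) (ker³ v) (gather-⟂ {f = λ v → gather (ker v) S ++ ker³ v} v∈ Λx)))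

    kill₁ : ∀ {S v x y z} → v ∈ S → conditions S ⟂ x → conditions S ⟂ y → conditions S ⟂ z → G v x y z ≡ 0#
    kill₁ {S} {v} v∈ Λx Λy Λz = proj₂ (proj₂ (cubic-kernel (cubic v) (rank v))) (at Λx) (at Λy) (at Λz)
      where
      at : ∀ {x} → conditions S ⟂ x → ker³ v ⟂ x
      at Λx = ++⟂ʳ (gather (ker v) S) (ker³ v) (gather-⟂ {f = λ v → gather (ker v) S ++ ker³ v} v∈ Λx)

    -- As for cubics: all the mixed values of a maximal family of quadruples vanish.
    go : ∀ m ps s t → Diagonal (G s t) ps → length ps ℕ.+ m ≡ suc r → Result
    go zero ps s t D |ps|≡1+r = contradiction (diagonal-bound (slice₂ s t) (rank s t) D)
      (ℕₚ.<⇒≱ (ℕₚ.≤-reflexive (sym (trans (sym (ℕₚ.+-identityʳ _)) |ps|≡1+r))))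
    go (suc m) ps s t D |ps|+m
      with search-× search-V (search-× search-V (search-× search-V search-V))
             (λ (y , z , w , u) → (Λ ⟂? y) ×-dec (Λ ⟂? z) ×-dec (Λ ⟂? w) ×-dec (Λ ⟂? u) ×-dec ¬? (G y z w u ≟ 0#))
      where Λ = conditions (s ∷ t ∷ support ps)
    ... | no none = conditions S , conditions≤ S
            (ℕ.s≤s (ℕ.s≤s (subst (ℕ._≤ r ℕ.+ r) (sym (length-support ps)) (ℕₚ.+-mono-≤ |ps|≤r |ps|≤r)))) ,
          λ {y} {z} {w} {u} Λy Λz Λw Λu → decidable-stable (G y z w u ≟ 0#)
            (λ G≢0 → none ((y , z , w , u) , Λy , Λz , Λw , Λu , G≢0))
      where
      S = s ∷ t ∷ support ps
      |ps|≤r : length ps ℕ.≤ r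
      |ps|≤r = ℕₚ.≤-pred (ℕₚ.≤-trans (ℕₚ.m≤m+n (suc (length ps)) m)
        (ℕₚ.≤-reflexive (trans (sym (ℕₚ.+-suc (length ps) m)) |ps|+m)))
    ... | yes ((y , z , w , u) , Λy , Λz , Λw , Λu , G≢0) =
      go m ((w , u) ∷ ps) (s ⊕ y) (t ⊕ z) (cons diag (All.tabulate off) (diagonal-cong old D))
        (trans (sym (ℕₚ.+-suc (length ps) m)) |ps|+m)
      where
      S = s ∷ t ∷ support ps
      s∈ : s ∈ S
      s∈ = here refl
      t∈ : t ∈ S
      t∈ = there (here refl)
      diag : ¬ G (s ⊕ y) (t ⊕ z) w u ≡ 0#
      diag eq = G≢0 (trans (sym (trans (lin₁₂ s y t z w u) (trans
        (0+ (sum₂ (kill₂ s∈ t∈ Λw u) (trans (s₁₂ y t w u) (kill₁ t∈ Λy Λw Λu))))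
        (0+ (kill₁ s∈ Λz Λw Λu))))) eq)
      newˡ : ∀ {v x} → v ∈ S → conditions S ⟂ x → G (s ⊕ y) (t ⊕ z) v x ≡ 0#
      newˡ {v} {x} v∈ Λx = trans (lin₁₂ s y t z v x) (sum₂
        (sum₂ (trans (s₃₄ s t v x) (kill₂ s∈ t∈ Λx v))
              (trans (s₁₂ y t v x) (trans (s₂₃ t y v x) (kill₂ t∈ v∈ Λy x))))
        (sum₂ (trans (s₂₃ s z v x) (kill₂ s∈ v∈ Λz x))
              (trans (s₁₃ y z v x) (kill₁ v∈ Λz Λy Λx))))
      off : ∀ {q} → q ∈ ps → G (s ⊕ y) (t ⊕ z) w (proj₂ q) ≡ 0# × G (s ⊕ y) (t ⊕ z) (proj₁ q) u ≡ 0#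
      off {w′ , u′} ∈ps =
        trans (s₃₄ _ _ w u′) (newˡ (there (there (∈-supportʳ ∈ps))) Λw) ,
        newˡ (there (there (∈-supportˡ ∈ps))) Λu
      old : ∀ {w₁ u₁ w₂ u₂} → (w₁ , u₂) ∈ ps → (w₂ , u₁) ∈ ps → G s t w₁ u₁ ≡ G (s ⊕ y) (t ⊕ z) w₁ u₁
      old {w₁} {u₁} w₁∈ps u₁∈ps = sym (trans (lin₁₂ s y t z w₁ u₁) (trans
        (+0 (sum₂ (trans (s₂₃ s z w₁ u₁) (kill₂ s∈ w₁∈ Λz u₁))
                  (trans (swap-pairs y z w₁ u₁) (kill₂ w₁∈ u₁∈ Λy z))))
        (+0 (trans (s₁₂ y t w₁ u₁) (trans (s₂₃ t y w₁ u₁) (kill₂ t∈ w₁∈ Λy u₁))))))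
        where
        w₁∈ = there (there (∈-supportˡ w₁∈ps))
        u₁∈ = there (there (∈-supportʳ u₁∈ps))

  -- Counting

  open VSum K ℕₚ.+-0-commutativeMonoid public
  open import Algebra.Properties.CommutativeMonoid.Sum ℕₚ.+-0-commutativeMonoid using (sum; sum-cong-≋)

  open import Data.Nat.Base public using () renaming (_≤_ to _≤ℕ_; _<_ to _<ℕ_; _*_ to _*ℕ_; _+_ to _+ℕ_; _^_ to _^ℕ_)

  p>1 : 1 <ℕ p
  p>1 = two-elements 1# 0# 1≢0
    where
    two-elements : ∀ {m} (a b : Fin m) → ¬ a ≡ b → 1 <ℕ m
    two-elements {suc zero}    zero zero a≢b = contradiction refl a≢b
    two-elements {suc (suc m)} a    b    a≢b = s≤s (s≤s z≤n)

  pⁿ>0 : ∀ n → 0 <ℕ p ^ℕ n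
  pⁿ>0 n = ℕₚ.m^n>0 p {{ℕ.>-nonZero (ℕₚ.<-trans (s≤s z≤n) p>1)}} n

  n<pⁿ : ∀ n → n <ℕ p ^ℕ n
  n<pⁿ zero    = s≤s z≤n
  n<pⁿ (suc n) = begin-strict
    suc n               ≤⟨ n<pⁿ n ⟩
    p ^ℕ n              <⟨ ℕₚ.m<m+n (p ^ℕ n) (pⁿ>0 n) ⟩
    p ^ℕ n +ℕ p ^ℕ n    ≡⟨ cong (p ^ℕ n +ℕ_) (ℕₚ.+-identityʳ _) ⟨
    2 *ℕ p ^ℕ n         ≤⟨ ℕₚ.*-monoˡ-≤ (p ^ℕ n) p>1 ⟩
    p *ℕ p ^ℕ n         ∎
    where open ℕₚ.≤-Reasoning

  sum-mono : ∀ {m} {g h : Fin m → ℕ} → (∀ t → g t ≤ℕ h t) → sum g ≤ℕ sum h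
  sum-mono {zero}  g≤h = z≤n
  sum-mono {suc m} g≤h = ℕₚ.+-mono-≤ (g≤h zero) (sum-mono (λ t → g≤h (suc t)))

  sum-const : ∀ m c → sum {m} (λ _ → c) ≡ m *ℕ c
  sum-const zero    c = refl
  sum-const (suc m) c = cong (c +ℕ_) (sum-const m c)

  sum-scale : ∀ {m} c (g : Fin m → ℕ) → sum (λ t → c *ℕ g t) ≡ c *ℕ sum g
  sum-scale {zero}  c g = sym (ℕₚ.*-zeroʳ c)
  sum-scale {suc m} c g = trans (cong (c *ℕ g zero +ℕ_) (sum-scale c (λ t → g (suc t)))) (sym (ℕₚ.*-distribˡ-+ c _ _))

  term≤sum : ∀ {m} (g : Fin m → ℕ) t → g t ≤ℕ sum g
  term≤sum g zero    = ℕₚ.m≤m+n _ _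
  term≤sum g (suc t) = ℕₚ.≤-trans (term≤sum (λ t → g (suc t)) t) (ℕₚ.m≤n+m _ _)

  ∑ᵛ-mono : ∀ {n} {g h : V n → ℕ} → (∀ x → g x ≤ℕ h x) → ∑ᵛ g ≤ℕ ∑ᵛ h
  ∑ᵛ-mono {zero}  g≤h = g≤h []
  ∑ᵛ-mono {suc n} g≤h = sum-mono (λ t → ∑ᵛ-mono (λ x → g≤h (t ∷ x)))

  ∑ᵛ-const : ∀ n c → ∑ᵛ {n} (λ _ → c) ≡ p ^ℕ n *ℕ c
  ∑ᵛ-const zero    c = sym (ℕₚ.+-identityʳ c)
  ∑ᵛ-const (suc n) c = trans (sum-cong-≋ {p} (λ t → ∑ᵛ-const n c)) (trans (sum-const p _) (sym (ℕₚ.*-assoc p (p ^ℕ n) c)))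

  ∑ᵛ-scale : ∀ {n} c (g : V n → ℕ) → ∑ᵛ (λ x → c *ℕ g x) ≡ c *ℕ ∑ᵛ g
  ∑ᵛ-scale {zero}  c g = refl
  ∑ᵛ-scale {suc n} c g = trans (sum-cong-≋ (λ t → ∑ᵛ-scale c (λ x → g (t ∷ x)))) (sum-scale {p} c (λ t → ∑ᵛ (λ x → g (t ∷ x))))

  term≤∑ᵛ : ∀ {n} (g : V n → ℕ) x → g x ≤ℕ ∑ᵛ g
  term≤∑ᵛ g []      = ℕₚ.≤-refl
  term≤∑ᵛ g (t ∷ x) = ℕₚ.≤-trans (term≤∑ᵛ (λ x → g (t ∷ x)) x) (term≤sum (λ t → ∑ᵛ (λ x → g (t ∷ x))) t)

  ind : ∀ {P : Set} → Dec P → ℕ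
  ind (yes _) = 1
  ind (no  _) = 0

  ind-yes : ∀ {P : Set} (P? : Dec P) → P → ind P? ≡ 1
  ind-yes (yes _)  _ = refl
  ind-yes (no ¬P)  P = contradiction P ¬P

  ind-no : ∀ {P : Set} (P? : Dec P) → ¬ P → ind P? ≡ 0
  ind-no (yes P) ¬P = contradiction P ¬P
  ind-no (no _)  _  = refl

  ind≤1 : ∀ {P : Set} (P? : Dec P) → ind P? ≤ℕ 1
  ind≤1 (yes _) = ℕₚ.≤-refl
  ind≤1 (no _)  = z≤n

  ind-mono : ∀ {P Q : Set} (P? : Dec P) (Q? : Dec Q) → (P → Q) → ind P? ≤ℕ ind Q?
  ind-mono (no _)  Q? _   = z≤n
  ind-mono (yes P) Q? P⇒Q = ℕₚ.≤-reflexive (sym (ind-yes Q? (P⇒Q P)))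

  ind-cong : ∀ {P Q : Set} (P? : Dec P) (Q? : Dec Q) → (P → Q) → (Q → P) → ind P? ≡ ind Q?
  ind-cong P? Q? P⇒Q Q⇒P = ℕₚ.≤-antisym (ind-mono P? Q? P⇒Q) (ind-mono Q? P? Q⇒P)

  # : ∀ {n} {P : V n → Set} → (∀ x → Dec (P x)) → ℕ
  # P? = ∑ᵛ (λ x → ind (P? x))

  #>0 : ∀ {n} {P : V n → Set} (P? : ∀ x → Dec (P x)) {x} → P x → 0 <ℕ # P?
  #>0 P? {x} Px = ℕₚ.≤-trans (ℕₚ.≤-reflexive (sym (ind-yes (P? x) Px))) (term≤∑ᵛ (λ x → ind (P? x)) x)

  #≤ : ∀ {n} {P : V n → Set} (P? : ∀ x → Dec (P x)) → # P? ≤ℕ p ^ℕ n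
  #≤ {n} P? = ℕₚ.≤-trans (∑ᵛ-mono (λ x → ind≤1 (P? x))) (ℕₚ.≤-reflexive (trans (∑ᵛ-const n 1) (ℕₚ.*-identityʳ _)))

  abstract
    -- Points with a small value contribute at most half of the total, so that the other half comes
    -- from large values, each at most `m`. Denominators are cleared throughout.
    markov : ∀ {n} (g : V n → ℕ) {m k} → 0 <ℕ m → (∀ x → g x ≤ℕ m) → p ^ℕ n *ℕ m ≤ℕ k *ℕ ∑ᵛ g →
      p ^ℕ n ≤ℕ 2 *ℕ k *ℕ # (λ x → m ℕₚ.≤? 2 *ℕ k *ℕ g x)
    markov {n} g {m} {k} m>0 g≤m large = ℕₚ.*-cancelʳ-≤ (p ^ℕ n) (2 *ℕ k *ℕ N) m {{ℕ.>-nonZero m>0}}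
      (ℕₚ.+-cancelʳ-≤ (p ^ℕ n *ℕ m) (p ^ℕ n *ℕ m) (2 *ℕ k *ℕ N *ℕ m) (begin
        p ^ℕ n *ℕ m +ℕ p ^ℕ n *ℕ m                                 ≡⟨ cong (p ^ℕ n *ℕ m +ℕ_) (ℕₚ.+-identityʳ _) ⟨
        2 *ℕ (p ^ℕ n *ℕ m)                                         ≤⟨ ℕₚ.*-monoʳ-≤ 2 large ⟩
        2 *ℕ (k *ℕ ∑ᵛ g)                                           ≡⟨ ℕₚ.*-assoc 2 k (∑ᵛ g) ⟨
        2 *ℕ k *ℕ ∑ᵛ g                                             ≡⟨ ∑ᵛ-scale (2 *ℕ k) g ⟨
        ∑ᵛ (λ x → 2 *ℕ k *ℕ g x)                                   ≤⟨ ∑ᵛ-mono pointwise ⟩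
        ∑ᵛ (λ x → 2 *ℕ k *ℕ m *ℕ ind (big? x) +ℕ m)                ≡⟨ ∑ᵛ-∙ {n} (λ x → 2 *ℕ k *ℕ m *ℕ ind (big? x)) (λ _ → m) ⟩
        ∑ᵛ (λ x → 2 *ℕ k *ℕ m *ℕ ind (big? x)) +ℕ ∑ᵛ {n} (λ _ → m) ≡⟨ cong₂ _+ℕ_ (∑ᵛ-scale {n} (2 *ℕ k *ℕ m) (λ x → ind (big? x))) (∑ᵛ-const n m) ⟩
        2 *ℕ k *ℕ m *ℕ N +ℕ p ^ℕ n *ℕ m                            ≡⟨ cong (_+ℕ p ^ℕ n *ℕ m) (solve 3 (λ k m N → k :* m :* N := k :* N :* m) refl (2 *ℕ k) m N) ⟩
        2 *ℕ k *ℕ N *ℕ m +ℕ p ^ℕ n *ℕ m                            ∎))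
      where
      open ℕₚ.≤-Reasoning
      open +-*-Solver
      big? : ∀ x → Dec (m ≤ℕ 2 *ℕ k *ℕ g x)
      big? x = m ℕₚ.≤? 2 *ℕ k *ℕ g x
      N : ℕ
      N = # big?
      pointwise : ∀ x → 2 *ℕ k *ℕ g x ≤ℕ 2 *ℕ k *ℕ m *ℕ ind (big? x) +ℕ m
      pointwise x with big? x
      ... | yes _     = ℕₚ.≤-trans (ℕₚ.*-monoʳ-≤ (2 *ℕ k) (g≤m x))
        (ℕₚ.≤-trans (ℕₚ.≤-reflexive (sym (ℕₚ.*-identityʳ _))) (ℕₚ.m≤m+n _ m))
      ... | no  small = ℕₚ.≤-trans (ℕₚ.<⇒≤ (ℕₚ.≰⇒> small)) (ℕₚ.m≤n+m m _)

    average : ∀ {n} (g : V n → ℕ) {m k} → p ^ℕ n *ℕ m ≤ℕ k *ℕ ∑ᵛ g → ∃[ x ] m ≤ℕ k *ℕ g x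
    average {n} g {m} {k} large with search-V (λ x → m ℕₚ.≤? k *ℕ g x)
    ... | yes found = found
    ... | no  none  = ⊥-elim (ℕₚ.<⇒≱ (begin-strict
      k *ℕ ∑ᵛ g                          ≡⟨ ∑ᵛ-scale k g ⟨
      ∑ᵛ (λ x → k *ℕ g x)                <⟨ ℕₚ.m<m+n _ (pⁿ>0 n) ⟩
      ∑ᵛ (λ x → k *ℕ g x) +ℕ p ^ℕ n      ≡⟨ cong (∑ᵛ (λ x → k *ℕ g x) +ℕ_) (trans (∑ᵛ-const n 1) (ℕₚ.*-identityʳ _)) ⟨
      ∑ᵛ (λ x → k *ℕ g x) +ℕ ∑ᵛ {n} (λ _ → 1)  ≡⟨ ∑ᵛ-∙ {n} (λ x → k *ℕ g x) (λ _ → 1) ⟨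
      ∑ᵛ (λ x → k *ℕ g x +ℕ 1)           ≤⟨ ∑ᵛ-mono (λ x → ℕₚ.≤-trans (ℕₚ.≤-reflexive (ℕₚ.+-comm _ 1)) (ℕₚ.≰⇒> (λ m≤ → none (x , m≤)))) ⟩
      ∑ᵛ {n} (λ _ → m)                   ≡⟨ ∑ᵛ-const n m ⟩
      p ^ℕ n *ℕ m                        ∎) large)
      where open ℕₚ.≤-Reasoning

  -- Dense sets and the subspaces that they span

  record Subspace {n} (H : V n → Set) : Set where
    field
      has-𝟎 : H 𝟎
      has-⊕ : ∀ {x y} → H x → H y → H (x ⊕ y)

    has-⊙ : ∀ c {x} → H x → H (c ⊙ x)
    has-⊙ c {x} Hx = generated (λ c → H (c ⊙ x)) (subst H (sym (0⊙ x)) has-𝟎)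
      (λ a Hax → subst H (sym (trans (+⊙ 1# a x) (cong (_⊕ a ⊙ x) (1⊙ x)))) (has-⊕ Hx Hax)) c

    has-⊝ : ∀ {x} → H x → H (⊝ x)
    has-⊝ {x} Hx = subst H (-1⊙ x) (has-⊙ (- 1#) Hx)

  abstract
    -- By induction on the dimension. If all elements of `H` begin with 0, the first coordinate
    -- joins the functionals. Otherwise some `1# ∷ h₁` lies in `H`, all fibres over the first
    -- coordinate have the same size, and the functionals for the fibre over 0 are extended so as to
    -- vanish at `1# ∷ h₁`.
    annihilator : ∀ {n} {H : V n → Set} (H? : ∀ x → Dec (H x)) → Subspace H →
      ∃[ Λ ] p ^ℕ length Λ *ℕ # H? ≤ℕ p ^ℕ n × (∀ {x} → Λ ⟂ x → H x)
    annihilator {zero}  {H} H? sub = [] , ℕₚ.≤-trans (ℕₚ.≤-reflexive (ℕₚ.+-identityʳ _)) (ind≤1 (H? [])) ,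
      λ { {[]} _ → Subspace.has-𝟎 sub }
    annihilator {suc n} {H} H? sub
      with annihilator {n} {λ x → H (0# ∷ x)} (λ x → H? (0# ∷ x))
             (record { has-𝟎 = has-𝟎 ; has-⊕ = λ {x} {y} Hx Hy → subst H (sym (0∷-lin x y)) (has-⊕ Hx Hy) })
         | search-× search-Fin search-V (λ (t , x) → ¬? (t ≟ 0#) ×-dec H? (t ∷ x))
      where open Subspace sub
    ... | Λ , small , sound | no none = (1# ∷ 𝟎) ∷ List.map (0# ∷_) Λ , bound , λ { {t ∷ x} (t≡0 ∷ Λx) →
            subst (λ t → H (t ∷ x)) (sym (trans (sym (head-⟨⟩ t x)) t≡0)) (sound (lower Λ Λx)) }
      where
      head-⟨⟩ : ∀ t (x : V n) → ⟨ 1# ∷ 𝟎 , t ∷ x ⟩ ≡ t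
      head-⟨⟩ t x = trans (cong₂ _+_ (F-ring.*-identityˡ t) (⟨𝟎,⟩ x)) (F-ring.+-identityʳ t)
      lower : ∀ (Λ : List (V n)) {t x} → List.map (0# ∷_) Λ ⟂ t ∷ x → Λ ⟂ x
      lower []      []        = []
      lower (a ∷ Λ) (eq ∷ Λx) = trans (sym (0+ (F-ring.zeroˡ _))) eq ∷ lower Λ Λx
      fibre : ∀ t → ∑ᵛ (λ x → ind (H? (t ∷ x))) ≤ℕ ind (t ≟ 0#) *ℕ # (λ x → H? (0# ∷ x))
      fibre t with t ≟ 0#
      ... | yes refl = ℕₚ.≤-reflexive (sym (ℕₚ.+-identityʳ _))
      ... | no  t≢0  = ℕₚ.≤-reflexive (trans (∑ᵛ-cong (λ x → ind-no (H? (t ∷ x)) (λ Htx → none ((t , x) , t≢0 , Htx))))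
                          (trans (∑ᵛ-const n 0) (ℕₚ.*-zeroʳ (p ^ℕ n))))
      sum-delta : ∀ {m} (a : Fin m) c → sum (λ t → ind (t Finₚ.≟ a) *ℕ c) ≤ℕ c
      sum-delta {suc m} zero    c = ℕₚ.≤-reflexive (trans (cong (c +ℕ 0 +ℕ_)
        (trans (sum-cong-≋ {m} (λ t → refl)) (trans (sum-const m 0) (ℕₚ.*-zeroʳ m)))) (trans (ℕₚ.+-identityʳ _) (ℕₚ.+-identityʳ c)))
      sum-delta {suc m} (suc a) c = ℕₚ.≤-trans (ℕₚ.≤-reflexive (sum-cong-≋ {m} (λ t →
        cong (_*ℕ c) (ind-cong (suc t Finₚ.≟ suc a) (t Finₚ.≟ a) Finₚ.suc-injective (cong suc))))) (sum-delta a c)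
      bound : p ^ℕ suc (length (List.map (0# ∷_) Λ)) *ℕ # H? ≤ℕ p *ℕ p ^ℕ n
      bound = begin
        p ^ℕ suc (length (List.map (0# ∷_) Λ)) *ℕ # H?  ≡⟨ cong (λ l → p ^ℕ suc l *ℕ # H?) (Listₚ.length-map _ Λ) ⟩
        p *ℕ p ^ℕ length Λ *ℕ # H?                       ≡⟨ ℕₚ.*-assoc p _ _ ⟩
        p *ℕ (p ^ℕ length Λ *ℕ # H?)                     ≤⟨ ℕₚ.*-monoʳ-≤ p (ℕₚ.*-monoʳ-≤ (p ^ℕ length Λ)
                                                              (ℕₚ.≤-trans (sum-mono fibre) (sum-delta 0# _))) ⟩
        p *ℕ (p ^ℕ length Λ *ℕ # (λ x → H? (0# ∷ x)))    ≤⟨ ℕₚ.*-monoʳ-≤ p small ⟩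
        p *ℕ p ^ℕ n                                      ∎
        where open ℕₚ.≤-Reasoning
    ... | Λ , small , sound | yes ((t , h) , t≢0 , Hth) = List.map lift Λ , bound , λ { {s ∷ x} Λx → recover s x (descend Λ Λx) }
      where
      open Subspace sub
      b : F
      b = proj₁ (inverse t t≢0)
      h₁ : V n
      h₁ = b ⊙ h
      Hh₁ : H (1# ∷ h₁)
      Hh₁ = subst (λ z → H (z ∷ h₁)) (proj₂ (inverse t t≢0)) (has-⊙ b Hth)
      lift : V n → V (suc n)
      lift a = (- ⟨ a , h₁ ⟩) ∷ a
      ⟨lift⟩ : ∀ a s (x : V n) → ⟨ lift a , s ∷ x ⟩ ≡ ⟨ a , x ⊖ s ⊙ h₁ ⟩
      ⟨lift⟩ a s x = trans (FS.solve 3 (λ h s x → FS.:- h FS.:* s FS.:+ x FS.:= x FS.:- s FS.:* h) refl ⟨ a , h₁ ⟩ s ⟨ a , x ⟩)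
        (sym (trans (lin-⊖ (⟨⟩-linʳ a) x (s ⊙ h₁)) (cong (λ z → ⟨ a , x ⟩ + - z) (lin-⊙ (⟨⟩-linʳ a) s h₁))))
      descend : ∀ (Λ : List (V n)) {s x} → List.map lift Λ ⟂ s ∷ x → Λ ⟂ x ⊖ s ⊙ h₁
      descend []      []        = []
      descend (a ∷ Λ) {s} {x} (eq ∷ Λx) = trans (sym (⟨lift⟩ a s x)) eq ∷ descend Λ Λx
      shifted : ∀ s x → (0# ∷ (x ⊖ s ⊙ h₁)) ⊕ s ⊙ (1# ∷ h₁) ≡ s ∷ x
      shifted s x = cong₂ _∷_ (trans (F-ring.+-identityˡ _) (F-ring.*-identityʳ s))
        (VS.solve 2 (λ x y → (x VS.:- y) VS.:+ y VS.:= x) refl x (s ⊙ h₁))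
      recover : ∀ s x → Λ ⟂ x ⊖ s ⊙ h₁ → H (s ∷ x)
      recover s x Λx = subst H (shifted s x) (has-⊕ (sound Λx) (has-⊙ s Hh₁))
      shift-back : ∀ s x → s ∷ (x ⊕ s ⊙ h₁) ≡ (0# ∷ x) ⊕ s ⊙ (1# ∷ h₁)
      shift-back s x = cong (_∷ (x ⊕ s ⊙ h₁)) (sym (trans (F-ring.+-identityˡ _) (F-ring.*-identityʳ s)))
      fibre : ∀ s → ∑ᵛ (λ x → ind (H? (s ∷ x))) ≡ # (λ x → H? (0# ∷ x))
      fibre s = trans (sym (∑ᵛ-translate (λ x → ind (H? (s ∷ x))) (s ⊙ h₁)))
        (∑ᵛ-cong (λ x → ind-cong (H? (s ∷ (x ⊕ s ⊙ h₁))) (H? (0# ∷ x))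
          (λ Hsx → subst H (VS.solve 2 (λ x y → (x VS.:+ y) VS.:- y VS.:= x) refl (0# ∷ x) (s ⊙ (1# ∷ h₁)))
                     (has-⊕ (subst H (shift-back s x) Hsx) (has-⊝ (has-⊙ s Hh₁))))
          (λ H0x → subst H (sym (shift-back s x)) (has-⊕ H0x (has-⊙ s Hh₁)))))
      bound : p ^ℕ length (List.map lift Λ) *ℕ # H? ≤ℕ p *ℕ p ^ℕ n
      bound = begin
        p ^ℕ length (List.map lift Λ) *ℕ # H?              ≡⟨ cong₂ (λ l h → p ^ℕ l *ℕ h) (Listₚ.length-map lift Λ)
                                                              (trans (sum-cong-≋ {p} fibre) (sum-const p _)) ⟩
        p ^ℕ length Λ *ℕ (p *ℕ # (λ x → H? (0# ∷ x)))      ≡⟨ solve 3 (λ a p h → a :* (p :* h) := p :* (a :* h)) refl (p ^ℕ length Λ) p _ ⟩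
        p *ℕ (p ^ℕ length Λ *ℕ # (λ x → H? (0# ∷ x)))      ≤⟨ ℕₚ.*-monoʳ-≤ p small ⟩
        p *ℕ p ^ℕ n                                        ∎
        where
        open ℕₚ.≤-Reasoning
        open +-*-Solver

    -- Counting bounds the codimension by the logarithm of `k`; by `n<pⁿ` this is weakened to `k`,
    -- which is enough for polynomial bounds.
    dense-annihilator : ∀ {n k} {H : V n → Set} (H? : ∀ x → Dec (H x)) → Subspace H → p ^ℕ n ≤ℕ k *ℕ # H? →
      ∃[ Λ ] length Λ ≤ℕ k × (∀ {x} → Λ ⟂ x → H x)
    dense-annihilator {n} {k} H? sub dense with Λ , small , sound ← annihilator H? sub =
      Λ , ℕₚ.<⇒≤ (ℕₚ.<-≤-trans (n<pⁿ (length Λ)) (ℕₚ.*-cancelʳ-≤ (p ^ℕ length Λ) k (# H?)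
        {{ℕ.>-nonZero (#>0 H? (Subspace.has-𝟎 sub))}} (ℕₚ.≤-trans small dense))) , sound

  SumOf : ∀ {n} → (V n → Set) → ℕ → V n → Set
  SumOf S zero    x = x ≡ 𝟎
  SumOf S (suc j) x = ∃[ s ] S s × SumOf S j (x ⊖ s)

  module _ {n} {S : V n → Set} (S? : ∀ x → Dec (S x)) (S𝟎 : S 𝟎) (S⊝ : ∀ {x} → S x → S (⊝ x)) where

    sumOf? : ∀ j x → Dec (SumOf S j x)
    sumOf? zero    x = x ≟ᵛ 𝟎
    sumOf? (suc j) x = search-V (λ s → S? s ×-dec sumOf? j (x ⊖ s))

    sumOf-suc : ∀ j {x} → SumOf S j x → SumOf S (suc j) x
    sumOf-suc j {x} Sx = 𝟎 , S𝟎 , subst (SumOf S j) (V-solve x) Sx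
      where
      V-solve : ∀ (x : V n) → x ≡ x ⊖ 𝟎
      V-solve x = trans (sym (V-ring.+-identityʳ x)) (cong (x ⊕_) (sym (linᵛ-𝟎 {f = λ x → ⊝ x} (λ x y → sym (⊝-⊕ x y)))))
        where
        ⊝-⊕ : ∀ (x y : V n) → ⊝ x ⊕ ⊝ y ≡ ⊝ (x ⊕ y)
        ⊝-⊕ = VS.solve 2 (λ x y → VS.:- x VS.:+ VS.:- y VS.:= VS.:- (x VS.:+ y)) refl

    sumOf-⊕ : ∀ i {j x y} → SumOf S i x → SumOf S j y → SumOf S (i +ℕ j) (x ⊕ y)
    sumOf-⊕ zero    {j} {y = y} refl Sy = subst (SumOf S j) (sym (V-ring.+-identityˡ y)) Sy
    sumOf-⊕ (suc i) {j} {x} {y} (s , Ss , Sx) Sy = s , Ss ,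
      subst (SumOf S (i +ℕ j)) (VS.solve 3 (λ x s y → (x VS.:- s) VS.:+ y VS.:= (x VS.:+ y) VS.:- s) refl x s y) (sumOf-⊕ i Sx Sy)

    Collision : List (V n) → Set
    Collision []      = ⊥
    Collision (x ∷ P) = Any (λ y → ∃[ s ] ∃[ t ] S s × S t × x ⊕ s ≡ y ⊕ t) P ⊎ Collision P

    -- The points left after removing 0, 3, 6, … summands.  When the translates of
    -- S by two of them meet, at least three summands can be replaced by two.
    shortcut : ∀ k {x} → SumOf S (suc (3× k)) x →
      ∃[ P ] length P ≡ suc k × All (SumOf S (suc (3× k))) P × (Collision P → SumOf S (3× k) x)
    shortcut zero    {x} Sx = x ∷ [] , refl , Sx ∷ [] , λ { (inj₁ ()) ; (inj₂ ()) }
    shortcut (suc k) {x} Sx@(a , Sa , b , Sb , c , Sc , Sy) with P , |P| , SP , shorten ← shortcut k Sy =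
      x ∷ P , cong suc |P| , Sx ∷ All.map (λ S-y → sumOf-suc _ (sumOf-suc _ (sumOf-suc _ S-y))) SP ,
      λ { (inj₁ meets) → via SP meets ; (inj₂ coll) → a , Sa , b , Sb , c , Sc , shorten coll }
      where
      via : ∀ {P} → All (SumOf S (suc (3× k))) P → Any (λ y → ∃[ s ] ∃[ t ] S s × S t × x ⊕ s ≡ y ⊕ t) P → SumOf S (3× (suc k)) x
      via (Sy ∷ _)  (here {y} (s , t , Ss , St , eq)) = ⊝ s , S⊝ Ss , t , St , subst (SumOf S (suc (3× k))) x-form Sy
        where
        x-form : y ≡ (x ⊖ ⊝ s) ⊖ t
        x-form = trans (VS.solve 2 (λ y t → y VS.:= (y VS.:+ t) VS.:- t) refl y t)
          (trans (cong (_⊖ t) (sym eq)) (VS.solve 3 (λ x s t → (x VS.:+ s) VS.:- t VS.:= (x VS.:- (VS.:- s)) VS.:- t) refl x s t))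
      via (_ ∷ SP) (there meets) = via SP meets

    hits : List (V n) → V n → ℕ
    hits []      x = 0
    hits (y ∷ P) x = ind (S? (x ⊖ y)) +ℕ hits P x

    ∑ᵛ-hits : ∀ P → ∑ᵛ (hits P) ≡ length P *ℕ # S?
    ∑ᵛ-hits []      = trans (∑ᵛ-const n 0) (ℕₚ.*-zeroʳ (p ^ℕ n))
    ∑ᵛ-hits (y ∷ P) = trans (∑ᵛ-∙ {n} (λ x → ind (S? (x ⊖ y))) (hits P))
      (cong₂ _+ℕ_ (∑ᵛ-translate {n} (λ x → ind (S? x)) (⊝ y)) (∑ᵛ-hits P))

    hit : ∀ P {x} → 0 <ℕ hits P x → Any (λ y → S (x ⊖ y)) P
    hit (y ∷ P) {x} pos with S? (x ⊖ y)
    ... | yes S-xy = here S-xy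
    ... | no  _    = there (hit P pos)

    collide : ∀ P {x} → 1 <ℕ hits P x → Collision P
    collide (y ∷ P) {x} two with S? (x ⊖ y)
    ... | yes S-xy = inj₁ (Any.map (λ {z} S-xz → x ⊖ y , x ⊖ z , S-xy , S-xz ,
            VS.solve 3 (λ x y z → y VS.:+ (x VS.:- y) VS.:= z VS.:+ (x VS.:- z)) refl x y z) (hit P (ℕₚ.≤-pred two)))
    ... | no  _    = inj₂ (collide P two)

    module _ {k} (dense : p ^ℕ n ≤ℕ k *ℕ # S?) where

      -- Pigeonhole: `suc k` translates of `S` have total size above `p ^ℕ n`, so that two of them
      -- meet.
      collision : ∀ P → length P ≡ suc k → Collision P
      collision P |P| with search-V (λ x → 2 ℕₚ.≤? hits P x)
      ... | yes (x , two) = collide P two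
      ... | no  none = ⊥-elim (ℕₚ.<-irrefl refl (begin-strict
        p ^ℕ n                   ≤⟨ dense ⟩
        k *ℕ # S?                <⟨ ℕₚ.m<n+m (k *ℕ # S?) (#>0 S? S𝟎) ⟩
        # S? +ℕ k *ℕ # S?        ≡⟨ cong (_*ℕ # S?) |P| ⟨
        length P *ℕ # S?         ≡⟨ ∑ᵛ-hits P ⟨
        ∑ᵛ (hits P)              ≤⟨ ∑ᵛ-mono (λ x → ℕₚ.≤-pred (ℕₚ.≰⇒> (λ two → none (x , two)))) ⟩
        ∑ᵛ {n} (λ _ → 1)         ≡⟨ trans (∑ᵛ-const n 1) (ℕₚ.*-identityʳ _) ⟩
        p ^ℕ n                   ∎))
        where open ℕₚ.≤-Reasoning

      shorten : ∀ {x} → SumOf S (suc (3× k)) x → SumOf S (3× k) x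
      shorten Sx with P , |P| , _ , shorten-if ← shortcut k Sx = shorten-if (collision P |P|)

      shorten* : ∀ j {x} → SumOf S (j +ℕ 3× k) x → SumOf S (3× k) x
      shorten* zero    Sx = Sx
      shorten* (suc j) (s , Ss , Sx) = shorten (s , Ss , shorten* j Sx)

      -- A sum with one summand too many can be shortened, hence so can any longer one, in
      -- particular the sum of two sums of full length.
      sums-subspace : Subspace (SumOf S (3× k))
      sums-subspace = record { has-𝟎 = sums-𝟎 (3× k) ; has-⊕ = λ Sx Sy → shorten* (3× k) (sumOf-⊕ (3× k) Sx Sy) }
        where
        sums-𝟎 : ∀ j → SumOf S j 𝟎
        sums-𝟎 zero    = refl
        sums-𝟎 (suc j) = sumOf-suc j (sums-𝟎 j)

      sumOf-1 : ∀ {x} → S x → SumOf S 1 x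
      sumOf-1 {x} Sx = x , Sx , V-ring.-‿inverseʳ x

      #-mono : ∀ {P Q : V n → Set} (P? : ∀ x → Dec (P x)) (Q? : ∀ x → Dec (Q x)) → (∀ {x} → P x → Q x) → # P? ≤ℕ # Q?
      #-mono P? Q? P⇒Q = ∑ᵛ-mono (λ x → ind-mono (P? x) (Q? x) P⇒Q)

      abstract
        -- This takes the place of Bogolyubov's lemma: the number of summands is linear in `k`
        -- instead of constant, but pigeonhole suffices for the proof.
        bounded-span : ∃[ Λ ] length Λ ≤ℕ k × (∀ {x} → Λ ⟂ x → SumOf S (3× k) x)
        bounded-span = dense-annihilator (sumOf? (3× k)) sums-subspace
          (ℕₚ.≤-trans dense (ℕₚ.*-monoʳ-≤ k (#-mono S? (sumOf? (3× k)) (S⊂sums k dense))))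
          where
          pad : ∀ j {x} → SumOf S 1 x → SumOf S (suc j) x
          pad zero    S₁x = S₁x
          pad (suc j) S₁x = sumOf-suc (suc j) (pad j S₁x)
          S⊂sums : ∀ k → p ^ℕ n ≤ℕ k *ℕ # S? → ∀ {x} → S x → SumOf S (3× k) x
          S⊂sums zero    empty = contradiction empty (ℕₚ.<⇒≱ (pⁿ>0 n))
          S⊂sums (suc k) _ Sx = pad (2 +ℕ 3× k) (sumOf-1 Sx)

  module _ {n} {S : V n → Set} (Good : ℕ → V n → Set) (good-𝟎 : Good 0 𝟎)
           (good-⊕ : ∀ {a b x y} → Good a x → Good b y → Good (a +ℕ b) (x ⊕ y)) where

    sumOf-good : ∀ {r} → (∀ {x} → S x → Good r x) → ∀ j {x} → SumOf S j x → Good (j *ℕ r) x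
    sumOf-good S⇒good zero    refl = good-𝟎
    sumOf-good {r} S⇒good (suc j) {x} (s , Ss , rest) =
      subst (Good _) (VS.solve 2 (λ s x → s VS.:+ (x VS.:- s) VS.:= x) refl s x)
        (good-⊕ {r} {j *ℕ r} (S⇒good Ss) (sumOf-good S⇒good j rest))

    -- The principle by which a subadditive property passes from a dense set to a subspace: its cost
    -- is multiplied by the number of summands.
    dense-good : (S? : ∀ x → Dec (S x)) → S 𝟎 → (∀ {x} → S x → S (⊝ x)) → ∀ {k r} → p ^ℕ n ≤ℕ k *ℕ # S? →
      (∀ {x} → S x → Good r x) → ∃[ Λ ] length Λ ≤ℕ k × (∀ {x} → Λ ⟂ x → Good (3× k *ℕ r) x)
    dense-good S? S𝟎 S⊝ {k} dense S⇒good with Λ , |Λ|≤k , span ← bounded-span S? S𝟎 S⊝ {k} dense =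
      Λ , |Λ|≤k , λ Λx → sumOf-good S⇒good (3× k) (span Λx)

  -- From many degenerate slices to slices of small rank

  vanishing : ∀ {n} → Form n → ℕ
  vanishing M = # (λ w → search-∀ search-V (λ u → M w u ≟ 0#))

  vanishing-cong : ∀ {n} {M N : Form n} → (∀ {w} → (∀ u → M w u ≡ 0#) → ∀ u → N w u ≡ 0#) →
    (∀ {w} → (∀ u → N w u ≡ 0#) → ∀ u → M w u ≡ 0#) → vanishing M ≡ vanishing N
  vanishing-cong {n} {M} {N} f g = ∑ᵛ-cong {n} (λ w → ind-cong (search-∀ search-V (λ u → M w u ≟ 0#)) (search-∀ search-V (λ u → N w u ≟ 0#)) f g)

  abstract
    -- The counted vectors form the radical, a subspace of density at least 1/k, hence of
    -- codimension at most `k`.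
    vanishing→rank : ∀ {n k} {M : Form n} → Bil M → p ^ℕ n ≤ℕ k *ℕ vanishing M → Rank≤ k M
    vanishing→rank {n} {k} {M} bil dense
      with Λ , |Λ|≤k , zero-on-ker ← dense-annihilator {n} {k} {λ w → ∀ u → M w u ≡ 0#}
             (λ w → search-∀ search-V (λ u → M w u ≟ 0#))
             (record { has-𝟎 = λ u → lin-𝟎 (linˡ bil u)
                     ; has-⊕ = λ {w} {w′} Mw Mw′ u → trans (linˡ bil u w w′) (sum₂ (Mw u) (Mw′ u)) }) dense =
      rank-mono |Λ|≤k (ker→rank bil Λ (λ Λw → zero-on-ker Λw))

  dense⇒k>0 : ∀ {n k m} → p ^ℕ n ≤ℕ k *ℕ m → 1 ≤ℕ k
  dense⇒k>0 {n} {zero}  h = contradiction h (ℕₚ.<⇒≱ (pⁿ>0 n))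
  dense⇒k>0 {n} {suc k} h = s≤s z≤n

  dense-total : ∀ {n k m} → p ^ℕ n ≤ℕ k *ℕ m → p ^ℕ n ≤ℕ k *ℕ p ^ℕ n
  dense-total {n} {k} h = ℕₚ.≤-trans (ℕₚ.≤-reflexive (sym (ℕₚ.*-identityˡ _))) (ℕₚ.*-monoˡ-≤ (p ^ℕ n) (dense⇒k>0 {n} {k} h))

  -- One number bounds both codimension and rank, which makes the property subadditive in the form
  -- required by `dense-good`.
  NearlyFlat : ∀ {n} → ℕ → (V n → Form n) → Set
  NearlyFlat r N = ∃[ Λ ] length Λ ≤ℕ r × (∀ {z} → Λ ⟂ z → Rank≤ r (N z))

  module _ {n} {B : Form⁴ n} (sym⁴ : Sym⁴ B) where

    open Sym⁴ sym⁴

    private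
      κ : V n → V n → ℕ
      κ y z = vanishing (B y z)

    κ≤ : ∀ y z → κ y z ≤ℕ p ^ℕ n
    κ≤ y z = #≤ (λ w → search-∀ search-V (λ u → B y z w u ≟ 0#))

    κ-𝟎 : ∀ y → κ y 𝟎 ≡ p ^ℕ n
    κ-𝟎 y = trans (∑ᵛ-cong {n} (λ w → ind-yes (search-∀ search-V (λ u → B y 𝟎 w u ≟ 0#)) (λ u → lin-𝟎 (lin₂ y w u))))
      (trans (∑ᵛ-const n 1) (ℕₚ.*-identityʳ _))

    κ-comm : ∀ y z → κ y z ≡ κ z y
    κ-comm y z = vanishing-cong (λ h u → trans (s₁₂ z y _ u) (h u)) (λ h u → trans (s₁₂ y z _ u) (h u))

    κ-⊝ : ∀ y z → κ y (⊝ z) ≡ κ y z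
    κ-⊝ y z = vanishing-cong
      (λ {w} h u → trans (FS.solve 1 (λ a → a FS.:= FS.:- (FS.:- a)) refl _)
                   (trans (cong -_ (trans (sym (lin-⊝ (lin₂ y w u) z)) (h u))) -0≡0))
      (λ {w} h u → trans (lin-⊝ (lin₂ y w u) z) (trans (cong -_ (h u)) -0≡0))
      where
      -0≡0 : - 0# ≡ 0#
      -0≡0 = -0#≈0#
        where open import Algebra.Properties.Ring F-ring.ring using (-0#≈0#)

    module _ (A : ℕ) where

      private
        k₂ k₄ r₁ : ℕ
        k₂ = 2 *ℕ A
        k₄ = 2 *ℕ k₂
        r₁ = k₄ +ℕ 3× k₄ *ℕ k₄

      row : V n → ℕ
      row y = ∑ᵛ (κ y)

      Rich : V n → Set
      Rich y = p ^ℕ n *ℕ p ^ℕ n ≤ℕ k₂ *ℕ row y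

      many-columns : ∀ {y} → Rich y → p ^ℕ n ≤ℕ k₄ *ℕ # (λ z → p ^ℕ n ℕₚ.≤? k₄ *ℕ κ y z)
      many-columns {y} = markov (κ y) {p ^ℕ n} {k₂} (pⁿ>0 n) (κ≤ y)

      rich-row : ∀ {y} → Rich y → NearlyFlat r₁ (B y)
      rich-row {y} rich
        with Λ , |Λ|≤ , flat ← dense-good (λ r z → Rank≤ r (B y z))
               (rank-cong (λ w u → sym (lin-𝟎 (lin₂ y w u))) (rank-0 {t = 0}))
               (λ {a} {b} {x} {z} Rx Rz → rank-cong (λ w u → sym (lin₂ y w u x z)) (rank-+ {s = a} {t = b} Rx Rz))
               (λ z → p ^ℕ n ℕₚ.≤? k₄ *ℕ κ y z)
               -- The zero vector belongs to the dense set: `B y 𝟎` vanishes identically, and `k₄`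
               -- is positive because the density is.
               (ℕₚ.≤-trans (dense-total {n} {k₄} (many-columns rich)) (ℕₚ.*-monoʳ-≤ k₄ (ℕₚ.≤-reflexive (sym (κ-𝟎 y)))))
               (λ {z} dense → subst (λ m → p ^ℕ n ≤ℕ k₄ *ℕ m) (sym (κ-⊝ y z)) dense)
               {k₄} {k₄} (many-columns rich)
               (vanishing→rank (slice₂ y _)) =
        Λ , ℕₚ.≤-trans |Λ|≤ (ℕₚ.m≤m+n k₄ _) , λ Λz → rank-mono (ℕₚ.m≤n+m _ k₄) (flat Λz)

      flat-𝟎 : NearlyFlat 0 (B 𝟎)
      flat-𝟎 = [] , z≤n , λ {z} _ → rank-cong (λ w u → sym (lin-𝟎 (lin₁ z w u))) rank-0

      flat-⊕ : ∀ {a b x y} → NearlyFlat a (B x) → NearlyFlat b (B y) → NearlyFlat (a +ℕ b) (B (x ⊕ y))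
      flat-⊕ {x = x} {y} (Λ , Λ≤a , fx) (Λ′ , Λ′≤b , fy) = Λ ++ Λ′ ,
        subst (_≤ℕ _) (sym (Listₚ.length-++ Λ)) (ℕₚ.+-mono-≤ Λ≤a Λ′≤b) ,
        λ {z} h → rank-cong (λ w u → sym (lin₁ z w u x y)) (rank-+ (fx (++⟂ˡ Λ Λ′ h)) (fy (++⟂ʳ Λ Λ′ h)))

      row≤ : ∀ y → row y ≤ℕ p ^ℕ n *ℕ p ^ℕ n
      row≤ y = ℕₚ.≤-trans (∑ᵛ-mono (κ≤ y)) (ℕₚ.≤-reflexive (∑ᵛ-const n (p ^ℕ n)))

      abstract
        -- `dense-good` is applied twice: in `z` for each rich `y`, the property being small rank of
        -- `B y z`, and then in `y`, the property being `NearlyFlat`.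
        biased⇒flat : p ^ℕ n *ℕ (p ^ℕ n *ℕ p ^ℕ n) ≤ℕ A *ℕ ∑ᵛ (λ y → ∑ᵛ (λ z → vanishing (B y z))) →
          ∃[ Λ ] length Λ ≤ℕ 2 *ℕ A × (∀ {y} → Λ ⟂ y → NearlyFlat (sliceCost A) (B y))
        biased⇒flat dense = dense-good (λ r y → NearlyFlat r (B y)) flat-𝟎 flat-⊕
          (λ y → p ^ℕ n *ℕ p ^ℕ n ℕₚ.≤? k₂ *ℕ row y)
          (subst (λ m → p ^ℕ n *ℕ p ^ℕ n ≤ℕ k₂ *ℕ m) (sym row-𝟎)
            (ℕₚ.≤-trans (ℕₚ.≤-reflexive (sym (ℕₚ.*-identityˡ _))) (ℕₚ.*-monoˡ-≤ _ (dense⇒k>0 {n} {k₂} many))))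
          (λ {y} rich → subst (λ m → p ^ℕ n *ℕ p ^ℕ n ≤ℕ k₂ *ℕ m) (sym (row-⊝ y)) rich)
          {k₂} {r₁} many rich-row
          where
          many : p ^ℕ n ≤ℕ k₂ *ℕ # (λ y → p ^ℕ n *ℕ p ^ℕ n ℕₚ.≤? k₂ *ℕ row y)
          many = markov row {p ^ℕ n *ℕ p ^ℕ n} {A} (ℕₚ.*-mono-< (pⁿ>0 n) (pⁿ>0 n)) row≤ dense
          row-𝟎 : row 𝟎 ≡ p ^ℕ n *ℕ p ^ℕ n
          row-𝟎 = trans (∑ᵛ-cong (λ z → trans (κ-comm 𝟎 z) (κ-𝟎 z))) (∑ᵛ-const n (p ^ℕ n))
          row-⊝ : ∀ y → row (⊝ y) ≡ row y
          row-⊝ y = ∑ᵛ-cong (λ z → trans (κ-comm (⊝ y) z) (trans (κ-⊝ z y) (κ-comm z y)))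

  -- Tuples of bilinear forms robustly of large rank

  Char2 : Set
  Char2 = 1# + 1# ≡ 0#

  -- In characteristic 2 a symmetric form is the sum of a bilinear form and its transpose only if it
  -- is alternating; `alt-f` preserves this possibility through all constructions.
  record SymForms {n k} (q : V n → V n → V k) : Set where
    field
      linˡ-f : ∀ u → Linᵛ (λ w → q w u)
      comm-f : ∀ w u → q w u ≡ q u w
      alt-f  : Char2 → ∀ w → q w w ≡ 𝟎

    linʳ-f : ∀ w → Linᵛ (q w)
    linʳ-f w x y = trans (comm-f w (x ⊕ y)) (trans (linˡ-f w x y) (cong₂ _⊕_ (comm-f x w) (comm-f y w)))

  open SymForms public

  _∙_ : ∀ {n k} → V k → (V n → V n → V k) → Form n
  (c ∙ q) w u = ⟨ c , q w u ⟩

  ∙-bil : ∀ {n k} {q : V n → V n → V k} → SymForms q → ∀ c → Bil (c ∙ q)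
  ∙-bil {q = q} sf c = record
    { linˡ = λ u x y → trans (cong ⟨ c ,_⟩ (linˡ-f sf u x y)) (⟨⟩-linʳ c (q x u) (q y u))
    ; linʳ = λ w x y → trans (cong ⟨ c ,_⟩ (linʳ-f sf w x y)) (⟨⟩-linʳ c (q w x) (q w y)) }

  Robust : ∀ {n k} → ℕ → (V n → V n → V k) → Set
  Robust t q = ∀ {c} → ¬ c ≡ 𝟎 → ¬ Rank≤ t (c ∙ q)

  module _ {n k : ℕ} where

    ∙-⊖ : ∀ (q : V n → V n → V k) b c w u → (b ∙ q) w u + - (c ∙ q) w u ≡ ((b ⊖ c) ∙ q) w u
    ∙-⊖ q b c w u = sym (lin-⊖ (⟨⟩-linˡ (q w u)) b c)

    ⊖≡𝟎 : ∀ {b c : V k} → b ⊖ c ≡ 𝟎 → b ≡ c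
    ⊖≡𝟎 {b} {c} eq = trans (VS.solve 2 (λ b c → b VS.:= (b VS.:- c) VS.:+ c) refl b c)
      (trans (cong (_⊕ c) eq) (V-ring.+-identityˡ c))

    robust-zero : ∀ {t} {q : V n → V n → V k} → Robust t q → ∀ {c} → Rank≤ t (c ∙ q) → c ≡ 𝟎
    robust-zero robust {c} r = decidable-stable (c ≟ᵛ 𝟎) (λ c≢0 → robust c≢0 r)

    -- The difference of the two combinations is itself a combination, of rank at most `s +ℕ t`.
    robust-unique : ∀ {s t T} {M : Form n} {q : V n → V n → V k} → s +ℕ t ≤ℕ T → Robust T q → ∀ {b c} →
      Rank≤ s (λ w u → M w u + - (b ∙ q) w u) → Rank≤ t (λ w u → M w u + - (c ∙ q) w u) → b ≡ c
    robust-unique {M = M} {q} s+t≤T robust {b} {c} rb rc = sym (⊖≡𝟎 (robust-zero robust (rank-mono s+t≤T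
      (rank-cong (λ w u → trans (FS.solve 3 (λ m x y → (m FS.:- x) FS.:- (m FS.:- y) FS.:= y FS.:- x) refl (M w u) _ _) (∙-⊖ q c b w u))
        (rank-- rb rc)))))

    robust-mono : ∀ {s t} {q : V n → V n → V k} → s ≤ℕ t → Robust t q → Robust s q
    robust-mono s≤t robust c≢0 r = robust c≢0 (rank-mono s≤t r)

    module _ {m t T} {N : V m → Form n} {q : V n → V n → V k} (3t≤T : t +ℕ (t +ℕ t) ≤ℕ T) (robust : Robust T q)
             (N-lin : ∀ w u → Lin (λ y → N y w u)) (α : V m → V k) (near : ∀ y → Rank≤ t (λ w u → N y w u + - (α y ∙ q) w u)) where

      -- Uniqueness of coefficients: `α (x ⊕ y)` approximates the form with error `t`, and
      -- `α x ⊕ α y` approximates the same form with error `t +ℕ t`.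
      coefficients-linear : Linᵛ α
      coefficients-linear x y = robust-unique {s = t} {t = t +ℕ t} 3t≤T robust (near (x ⊕ y))
        (rank-cong (λ w u → trans
          (FS.solve 4 (λ a b c d → (a FS.:- c) FS.:+ (b FS.:- d) FS.:= (a FS.:+ b) FS.:- (c FS.:+ d)) refl (N x w u) (N y w u) _ _)
          (cong₂ (λ a b → a + - b) (sym (N-lin w u x y)) (sym (⟨⟩-linˡ (q w u) (α x) (α y)))))
          (rank-+ (near x) (near y)))

  nonzero-entry : ∀ {k} (c : V k) → ¬ c ≡ 𝟎 → ∃[ i ] ¬ lookup c i ≡ 0#
  nonzero-entry []       c≢0 = contradiction refl c≢0
  nonzero-entry (x ∷ xs) c≢0 with x ≟ 0#
  ... | no  x≢0  = zero , x≢0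
  ... | yes refl with i , ≢0 ← nonzero-entry xs (λ eq → c≢0 (cong (0# ∷_) eq)) = suc i , ≢0

  removeAt-lin : ∀ {k} (i : Fin (suc k)) → Linᵛ (λ x → removeAt x i)
  removeAt-lin zero          (x ∷ xs)     (y ∷ ys)     = refl
  removeAt-lin {suc k} (suc i) (x ∷ xs@(_ ∷ _)) (y ∷ ys@(_ ∷ _)) = cong (x + y ∷_) (removeAt-lin i xs ys)

  insertAt-⊕ : ∀ {k} (i : Fin (suc k)) (x y : V k) a b → insertAt (x ⊕ y) i (a + b) ≡ insertAt x i a ⊕ insertAt y i b
  insertAt-⊕ zero    x        y        a b = refl
  insertAt-⊕ (suc i) (x ∷ xs) (y ∷ ys) a b = cong (x + y ∷_) (insertAt-⊕ i xs ys a b)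

  removeAt-𝟎 : ∀ {k} (i : Fin (suc k)) → removeAt 𝟎 i ≡ 𝟎
  removeAt-𝟎 i = linᵛ-𝟎 (removeAt-lin i)

  ⟨⟩-removeAt : ∀ {k} (i : Fin (suc k)) (c v : V (suc k)) →
    ⟨ c , v ⟩ ≡ lookup c i * lookup v i + ⟨ removeAt c i , removeAt v i ⟩
  ⟨⟩-removeAt zero            (c ∷ cs)     (v ∷ vs)     = refl
  ⟨⟩-removeAt {suc k} (suc i) (c ∷ cs@(_ ∷ _)) (v ∷ vs@(_ ∷ _)) = trans (cong (c * v +_) (⟨⟩-removeAt i cs vs))
    (FS.solve 3 (λ a b c → a FS.:+ (b FS.:+ c) FS.:= b FS.:+ (a FS.:+ c)) refl (c * v) (lookup cs i * lookup vs i) _)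

  pull-forms : ∀ {m n k} {q : V n → V n → V k} {f : V m → V n} → Linᵛ f → SymForms q → SymForms (λ w u → q (f w) (f u))
  pull-forms {q = q} {f} f-lin sf = record
    { linˡ-f = λ u x y → trans (cong (λ z → q z (f u)) (f-lin x y)) (linˡ-f sf (f u) (f x) (f y))
    ; comm-f = λ w u → comm-f sf (f w) (f u)
    ; alt-f  = λ ch2 w → alt-f sf ch2 (f w) }

  -- On the cut all forms of `q` are linear functions of the robust tuple `b`. The latter is pulled
  -- back to the whole space, so that its ranks are those of forms on `V n`.
  record Robustified {n k} (q : V n → V n → V k) (t : ℕ) : Set where
    field
      cut    : Cut {n} (k *ℕ t)
      dim    : ℕ
      dim≤   : dim ≤ℕ k
      b      : V n → V n → V dim
      b-sym  : SymForms b
      robust : Robust t b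
      expand : V dim → V k
      expand-lin : Linᵛ expand
      expands : ∀ x y → q (Π cut x) (Π cut y) ≡ expand (b x y)

  abstract
    -- As long as some nontrivial combination has rank at most `t`, the kernel of that form is
    -- passed to, and there one of the forms is determined by the others. A form is lost each time,
    -- so that there are at most `k` cuts; the threshold `t` stays the same.
    robustify : ∀ {n} k {q : V n → V n → V k} t → SymForms q → Robustified q t
    robustify zero {q} t sf = record
      { cut = cut-id ; dim = 0 ; dim≤ = z≤n ; b = q ; b-sym = sf ; robust = λ { {[]} c≢0 _ → c≢0 refl }
      ; expand = λ x → x ; expand-lin = λ _ _ → refl ; expands = λ _ _ → refl }
    robustify {n} (suc k) {q} t sf with search-V (λ c → ¬? (c ≟ᵛ 𝟎) ×-dec Rank≤? t (c ∙ q))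
    ... | no none = record
      { cut = cut-id ; dim = suc k ; dim≤ = ℕₚ.≤-refl ; b = q ; b-sym = sf ; robust = λ {c} c≢0 r → none (c , c≢0 , r)
      ; expand = λ x → x ; expand-lin = λ _ _ → refl ; expands = λ _ _ → refl }
    ... | yes (c , c≢0 , r) with i , cᵢ≢0 ← nonzero-entry c c≢0 with Λ , Λ≤t , zero-on-ker ← rank→ker r
        with P , ΛP ← cut-ker Λ = record
      { cut = cut-mono (ℕₚ.+-monoˡ-≤ (k *ℕ t) Λ≤t) (cut-∘ P R.cut) ; dim = R.dim ; dim≤ = ℕₚ.m≤n⇒m≤1+n R.dim≤
      ; b = R.b ; b-sym = R.b-sym ; robust = R.robust
      ; expand = λ x → refill (R.expand x)
      ; expand-lin = λ x y → trans (cong refill (R.expand-lin x y)) (refill-lin (R.expand x) (R.expand y))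
      ; expands = λ x y → trans (refilled (q″ x y) (zero-on-ker (ΛP (Π R.cut x)) (Π P (Π R.cut y)))) (cong refill (R.expands x y)) }
      where
      q′ : V n → V n → V k
      q′ w u = removeAt (q (Π P w) (Π P u)) i
      q′-sym : SymForms q′
      q′-sym = record
        { linˡ-f = λ u x y → trans (cong (λ z → removeAt z i) (linˡ-f qP u x y)) (removeAt-lin i (q (Π P x) (Π P u)) (q (Π P y) (Π P u)))
        ; comm-f = λ w u → cong (λ z → removeAt z i) (comm-f qP w u)
        ; alt-f  = λ ch2 w → trans (cong (λ z → removeAt z i) (alt-f qP ch2 w)) (removeAt-𝟎 i) }
        where
        qP : SymForms (λ w u → q (Π P w) (Π P u))
        qP = pull-forms (Π-lin P) sf
      module R = Robustified (robustify k {q′} t q′-sym)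
      q″ : V n → V n → V (suc k)
      q″ x y = q (Π P (Π R.cut x)) (Π P (Π R.cut y))
      d : F
      d = proj₁ (inverse (lookup c i) cᵢ≢0)
      -- The coordinate `i`, solved from the relation `⟨ c , v ⟩ ≡ 0#`.
      entry : V k → F
      entry x = - (d * ⟨ removeAt c i , x ⟩)
      refill : V k → V (suc k)
      refill x = insertAt x i (entry x)
      refill-lin : Linᵛ refill
      refill-lin x y = trans (cong (insertAt (x ⊕ y) i) (trans (cong (λ z → - (d * z)) (⟨⟩-linʳ (removeAt c i) x y))
        (FS.solve 3 (λ d a b → FS.:- (d FS.:* (a FS.:+ b)) FS.:= FS.:- (d FS.:* a) FS.:+ FS.:- (d FS.:* b)) refl d _ _)))
        (insertAt-⊕ i x y (entry x) (entry y))
      refilled : ∀ v → ⟨ c , v ⟩ ≡ 0# → v ≡ refill (removeAt v i)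
      refilled v cv≡0 = trans (sym (Vecₚ.insertAt-removeAt v i)) (cong (insertAt (removeAt v i) i) (begin
        lookup v i                                                              ≡⟨ F-ring.*-identityˡ _ ⟨
        1# * lookup v i                                                         ≡⟨ cong (_* lookup v i) (proj₂ (inverse (lookup c i) cᵢ≢0)) ⟨
        d * lookup c i * lookup v i                                             ≡⟨ FS.solve 4 (λ d c v r → d FS.:* c FS.:* v FS.:= d FS.:* (c FS.:* v FS.:+ r) FS.:- d FS.:* r) refl d (lookup c i) (lookup v i) _ ⟩
        d * (lookup c i * lookup v i + ⟨ removeAt c i , removeAt v i ⟩) + entry (removeAt v i)  ≡⟨ cong (λ z → d * z + entry (removeAt v i)) (trans (sym (⟨⟩-removeAt i c v)) cv≡0) ⟩
        d * 0# + entry (removeAt v i)                                           ≡⟨ 0+ (F-ring.zeroʳ d) ⟩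
        entry (removeAt v i)                                                    ∎))
        where open ≡-Reasoning

  open import Data.Vec.Relation.Unary.All as VAll using ([]; _∷_) renaming (All to VAll)

  Alt⁴ : ∀ {n} → Form⁴ n → Set
  Alt⁴ B = Char2 → ∀ y w u → B y y w u ≡ 0#

  pull⁴ : ∀ {m n} → (V m → V n) → Form⁴ n → Form⁴ m
  pull⁴ f B y z w u = B (f y) (f z) (f w) (f u)

  module _ {m n} {f : V m → V n} (f-lin : Linᵛ f) {B : Form⁴ n} where

    pull-sym⁴ : Sym⁴ B → Sym⁴ (pull⁴ f B)
    pull-sym⁴ sym⁴ = record
      { lin₁ = λ z w u x y → trans (cong (λ v → B v (f z) (f w) (f u)) (f-lin x y)) (lin₁ (f z) (f w) (f u) (f x) (f y))
      ; s₁₂ = λ y z w u → s₁₂ (f y) (f z) (f w) (f u)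
      ; s₂₃ = λ y z w u → s₂₃ (f y) (f z) (f w) (f u)
      ; s₃₄ = λ y z w u → s₃₄ (f y) (f z) (f w) (f u) }
      where open Sym⁴ sym⁴

    pull-alt⁴ : Alt⁴ B → Alt⁴ (pull⁴ f B)
    pull-alt⁴ alt ch2 y w u = alt ch2 (f y) (f w) (f u)

  pull-⟂ : ∀ {m n} {f : V m → V n} → Linᵛ f → ∀ Λ {x} → List.map (λ a → pullback a f) Λ ⟂ x → Λ ⟂ f x
  pull-⟂ f-lin Λ {x} h = All.map (λ {a} ax → trans (pullback-correct a f-lin x) ax) (Allₚ.map⁻ h)

  pull-flat : ∀ {m n r} {f : V m → V n} → Linᵛ f → {B : Form⁴ n} → ∀ {y} → NearlyFlat r (B (f y)) → NearlyFlat r (pull⁴ f B y)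
  pull-flat {f = f} f-lin (Λ , Λ≤r , flat) = List.map (λ a → pullback a f) Λ , subst (_≤ℕ _) (sym (Listₚ.length-map _ Λ)) Λ≤r ,
    λ h → rank-∘ f-lin f-lin (flat (pull-⟂ f-lin Λ h))

  -- Approximating all slices by few forms

  Near : ∀ {n k} → ℕ → Form n → (V n → V n → V k) → Set
  Near t M q = ∃[ c ] Rank≤ t (λ w u → M w u + - (c ∙ q) w u)

  near? : ∀ {n k} t (M : Form n) (q : V n → V n → V k) → Dec (Near t M q)
  near? t M q = search-V (λ c → Rank≤? t (λ w u → M w u + - (c ∙ q) w u))

  record Covering {n} (B : Form⁴ n) (r : ℕ) : Set where
    field
      Λ     : List (V n)
      Λ≤    : length Λ ≤ℕ coverCost r
      dim   : ℕ
      dim≤  : dim ≤ℕ r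
      q     : V n → V n → V dim
      q-sym : SymForms q
      near  : ∀ {y z} → Λ ⟂ y → Λ ⟂ z → Near (coverRank r) (B y z) q

  module _ {n r} {B : Form⁴ n} (sym⁴ : Sym⁴ B) (alt : Alt⁴ B) (flat : ∀ y → NearlyFlat r (B y)) where

    open Sym⁴ sym⁴

    private
      T : ℕ
      T = coverRank r

      flatΛ : V n → List (V n)
      flatΛ y = proj₁ (flat y)

      values : ∀ {j} → Vec (V n × V n) j → V n → V n → V j
      values ps w u = Vec.map (λ (y , z) → B y z w u) ps

      values-sym : ∀ {j} (ps : Vec (V n × V n) j) → SymForms (values ps)
      values-sym []             = record { linˡ-f = λ _ _ _ → refl ; comm-f = λ _ _ → refl ; alt-f = λ _ _ → refl }
      values-sym ((y , z) ∷ ps) = record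
        { linˡ-f = λ u a b → cong₂ _∷_ (lin₃ y z u a b) (linˡ-f (values-sym ps) u a b)
        ; comm-f = λ w u → cong₂ _∷_ (s₃₄ y z w u) (comm-f (values-sym ps) w u)
        ; alt-f  = λ ch2 w → cong₂ _∷_ (trans (swap-pairs y z w w) (alt ch2 w y z)) (alt-f (values-sym ps) ch2 w) }

      Close : ℕ → V n → V n × V n → Set
      Close t s (y , z) = Rank≤ t (λ w u → B y s w u + - B y z w u)

      firsts : ∀ {j} → Vec (V n × V n) j → Vec (V n) j
      firsts = Vec.map proj₁

      comb-close : ∀ {j t s} (ps : Vec (V n × V n) j) → VAll (Close t s) ps → ∀ c →
        Rank≤ (j *ℕ t) (λ w u → B (comb (firsts ps) c) s w u + - (c ∙ values ps) w u)
      comb-close {s = s} []             []             []       = rank-cong (λ w u → sym (trans (cong (_+ - 0#) (lin-𝟎 (lin₁ s w u))) (x-x≡0 0#))) rank-0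
      comb-close {s = s} ((y , z) ∷ ps) (close ∷ rest) (c ∷ cs) = rank-cong
        (λ w u → sym (trans
          (cong (λ a → a + - (c * B y z w u + (cs ∙ values ps) w u)) (trans (lin₁ s w u (c ⊙ y) _) (cong (_+ B (comb (firsts ps) cs) s w u) (lin-⊙ (lin₁ s w u) c y))))
          (FS.solve 5 (λ c a b d e → (c FS.:* a FS.:+ b) FS.:- (c FS.:* d FS.:+ e) FS.:= c FS.:* (a FS.:- d) FS.:+ (b FS.:- e)) refl
            c (B y s w u) (B (comb (firsts ps) cs) s w u) (B y z w u) ((cs ∙ values ps) w u))))
        (rank-+ (rank-* c close) (comb-close ps rest cs))

      -- A combination of small rank that involves the new form would, after division by its
      -- coefficient, express the new form through the old ones.
      extend-robust : ∀ {j} {ps : Vec (V n × V n) j} {y z} → Robust T (values ps) → ¬ Near T (B y z) (values ps) →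
        Robust T (values ((y , z) ∷ ps))
      extend-robust {ps = ps} {y} {z} robust far {c ∷ cs} c≢0 rank with c ≟ 0#
      ... | yes refl = robust (λ eq → c≢0 (cong (0# ∷_) eq))
        (rank-cong (λ w u → 0+ (F-ring.zeroˡ _)) rank)
      ... | no c≢0′ with d , dc≡1 ← inverse c c≢0′ = far ((- d) ⊙ cs , rank-cong
        (λ w u → trans (F-ring.distribˡ d _ _) (cong₂ _+_
          (trans (sym (F-ring.*-assoc d c _)) (trans (cong (_* B y z w u) dc≡1) (F-ring.*-identityˡ _)))
          (trans (FS.solve 2 (λ d v → d FS.:* v FS.:= FS.:- (FS.:- d FS.:* v)) refl d _)
                 (cong -_ (sym (lin-⊙ (⟨⟩-linˡ (values ps w u)) (- d) cs))))))
        (rank-* d rank))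

    abstract
      -- A family of pairs with robust forms `B y z` is extended as long as possible. If `s` is the
      -- sum of the second components, `B y s` stays close to `B y z` for each pair, since a new `y`
      -- is taken where `B s` is nearly flat and a new `z` where the older `B y` are. For `suc r`
      -- pairs some combination of the first components would lie where `B s` is nearly flat, and
      -- the same combination of the forms would have small rank.
      covering : Covering B r
      covering = go (suc r) [] 𝟎 [] (λ { {[]} c≢0 _ → c≢0 refl }) refl
        where
        go : ∀ m {j} (ps : Vec (V n × V n) j) s → VAll (Close (j *ℕ r) s) ps → Robust T (values ps) → j +ℕ m ≡ suc r → Covering B r
        go zero {j} ps s close robust j≡ with Λ , Λ≤r , flat-s ← flat s
           with c , c≢0 , Λc ← dependent Λ (firsts ps) (ℕₚ.≤-trans (s≤s Λ≤r) (ℕₚ.≤-reflexive (trans (sym j≡) (ℕₚ.+-identityʳ j)))) =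
          contradiction (rank-mono bound (rank-cong
            (λ w u → trans (cong (λ b → b + - (B (comb (firsts ps) c) s w u + - (c ∙ values ps) w u)) (s₁₂ s (comb (firsts ps) c) w u))
              (FS.solve 2 (λ a b → a FS.:- (a FS.:- b) FS.:= b) refl (B (comb (firsts ps) c) s w u) ((c ∙ values ps) w u)))
            (rank-- (flat-s Λc) (comb-close ps close c)))) (robust c≢0)
          where
          bound : r +ℕ j *ℕ (j *ℕ r) ≤ℕ T
          bound = ℕₚ.≤-reflexive (cong (λ j → r +ℕ j *ℕ (j *ℕ r)) (trans (sym (ℕₚ.+-identityʳ j)) j≡))
        go (suc m) {j} ps s close robust j+m with search-× search-V search-V
            (λ (y , z) → (Λ ⟂? y) ×-dec (Λ ⟂? z) ×-dec ¬? (near? T (B y z) (values ps)))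
          where
          Λ : List (V n)
          Λ = flatΛ s ++ gather flatΛ (toList (firsts ps))
        ... | no none = record
          { Λ = flatΛ s ++ gather flatΛ (toList (firsts ps))
          ; Λ≤ = subst (_≤ℕ _) (sym (Listₚ.length-++ (flatΛ s))) (ℕₚ.+-mono-≤ (proj₁ (proj₂ (flat s)))
              (ℕₚ.≤-trans (gather≤ {f = flatΛ} (λ v → proj₁ (proj₂ (flat v))) (toList (firsts ps)))
                (ℕₚ.*-monoˡ-≤ r (ℕₚ.≤-trans (ℕₚ.≤-reflexive (length-toList (firsts ps))) j≤1+r))))
          ; dim = j ; dim≤ = ℕₚ.≤-pred (ℕₚ.≤-trans (ℕₚ.m≤m+n (suc j) m) (ℕₚ.≤-reflexive (trans (sym (ℕₚ.+-suc j m)) j+m)))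
          ; q = values ps ; q-sym = values-sym ps
          ; near = λ {y} {z} Λy Λz → decidable-stable (near? T (B y z) (values ps)) (λ far → none ((y , z) , Λy , Λz , far)) }
          where
          j≤1+r : j ≤ℕ suc r
          j≤1+r = ℕₚ.≤-trans (ℕₚ.m≤m+n j (suc m)) (ℕₚ.≤-reflexive j+m)
          length-toList : ∀ {A : Set} {k} (xs : Vec A k) → length (toList xs) ≡ k
          length-toList []       = refl
          length-toList (x ∷ xs) = cong suc (length-toList xs)
        ... | yes ((y , z) , Λy , Λz , far) =
          go m ((y , z) ∷ ps) (s ⊕ z) (head-close ∷ tail-close ps (λ v∈ → v∈) close) (extend-robust {ps = ps} robust far)
            (trans (sym (ℕₚ.+-suc j m)) j+m)
          where
          head-close : Close (suc j *ℕ r) (s ⊕ z) (y , z)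
          head-close = rank-mono (ℕₚ.m≤m+n r (j *ℕ r)) (rank-cong
            (λ w u → sym (trans (cong (λ a → a + - B y z w u) (lin₂ y w u s z))
              (trans (FS.solve 2 (λ a b → (a FS.:+ b) FS.:- b FS.:= a) refl (B y s w u) (B y z w u)) (s₁₂ y s w u))))
            (proj₂ (proj₂ (flat s)) (++⟂ˡ (flatΛ s) _ Λy)))
          tail-close : ∀ {i} (ps′ : Vec (V n × V n) i) → (∀ {v} → v ∈ toList (firsts ps′) → v ∈ toList (firsts ps)) →
            VAll (Close (j *ℕ r) s) ps′ → VAll (Close (suc j *ℕ r) (s ⊕ z)) ps′
          tail-close []               sub []             = []
          tail-close ((y₁ , z₁) ∷ ps′) sub (close ∷ rest) = rank-cong
              (λ w u → trans (FS.solve 3 (λ a b c → a FS.:+ (b FS.:- c) FS.:= (b FS.:+ a) FS.:- c) refl (B y₁ z w u) (B y₁ s w u) (B y₁ z₁ w u))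
                (cong (λ a → a + - B y₁ z₁ w u) (sym (lin₂ y₁ w u s z))))
              (rank-+ (proj₂ (proj₂ (flat y₁)) (gather-⟂ {f = flatΛ} (sub (here refl)) (++⟂ʳ (flatΛ s) _ Λz))) close)
            ∷ tail-close ps′ (λ v∈ → sub (there v∈)) rest

  open import Data.Vec.Base as Vec using (Vec; []; _∷_; take; drop) renaming (_++_ to _++ᵛ_)

  -- Factoring the slices through one bilinear map

  record Factored {n} (B : Form⁴ n) (k t T : ℕ) : Set where
    field
      dim    : ℕ
      dim≤   : dim ≤ℕ k
      b      : V n → V n → V dim
      b-sym  : SymForms b
      robust : Robust T b
      μ      : V dim → V dim → F
      μ-bil  : Bil μ
      near   : ∀ y z → Rank≤ t (λ w u → B y z w u + - μ (b y z) (b w u))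

  ++-⊕ : ∀ {j k} (x x′ : V j) (y y′ : V k) → (x ⊕ x′) ++ᵛ (y ⊕ y′) ≡ (x ++ᵛ y) ⊕ (x′ ++ᵛ y′)
  ++-⊕ []       []         y y′ = refl
  ++-⊕ (a ∷ x)  (a′ ∷ x′)  y y′ = cong (a + a′ ∷_) (++-⊕ x x′ y y′)

  ++-𝟎 : ∀ j {k} → 𝟎 {j} ++ᵛ 𝟎 {k} ≡ 𝟎
  ++-𝟎 zero    = refl
  ++-𝟎 (suc j) = cong (0# ∷_) (++-𝟎 j)

  take-++ : ∀ {j k} (x : V j) (y : V k) → take j (x ++ᵛ y) ≡ x
  take-++ []      y = refl
  take-++ (a ∷ x) y = cong (a ∷_) (take-++ x y)

  drop-++ : ∀ {j k} (x : V j) (y : V k) → drop j (x ++ᵛ y) ≡ y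
  drop-++ []      y = refl
  drop-++ (a ∷ x) y = drop-++ x y

  take-lin : ∀ j {k} → Linᵛ (take j {k})
  take-lin j x y = Vecₚ.take-zipWith _+_ x y

  drop-lin : ∀ j {k} → Linᵛ (drop j {k})
  drop-lin j x y = Vecₚ.drop-zipWith _+_ x y

  module _ {n k t} {B : Form⁴ n} (sym⁴ : Sym⁴ B) (alt : Alt⁴ B) {q : V n → V n → V k} (q-sym : SymForms q)
           (near : ∀ y z → Near t (B y z) q) (T : ℕ) where

    private
      -- Three times `t` is what uniqueness, and with it bilinearity, of the coefficients `α`
      -- requires.
      module R₁ = Robustified (robustify k (t +ℕ (t +ℕ t)) q-sym)
      k₁ : ℕ
      k₁ = R₁.dim
      P₁ : Cut (k *ℕ (t +ℕ (t +ℕ t)))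
      P₁ = R₁.cut
      B₁ : Form⁴ n
      B₁ = pull⁴ (Π P₁) B
      open Sym⁴ (pull-sym⁴ (Π-lin P₁) sym⁴)

      near₁ : ∀ y z → Near t (B₁ y z) R₁.b
      near₁ y z with c , r ← near (Π P₁ y) (Π P₁ z) = pullback c R₁.expand ,
        rank-cong (λ w u → cong (λ v → B₁ y z w u + - v)
          (trans (cong ⟨ c ,_⟩ (R₁.expands w u)) (pullback-correct c R₁.expand-lin (R₁.b w u))))
          (rank-∘ (Π-lin P₁) (Π-lin P₁) r)

      α : V n → V n → V k₁
      α y z = proj₁ (near₁ y z)

      2t≤3t : t +ℕ t ≤ℕ t +ℕ (t +ℕ t)
      2t≤3t = ℕₚ.+-monoʳ-≤ t (ℕₚ.m≤m+n t t)

      α-sym : SymForms α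
      α-sym = record
        { linˡ-f = λ z → coefficients-linear {N = λ y → B₁ y z} {q = R₁.b} ℕₚ.≤-refl R₁.robust (λ w u → lin₁ z w u)
            (λ y → α y z) (λ y → proj₂ (near₁ y z))
        ; comm-f = λ y z → robust-unique {q = R₁.b} 2t≤3t R₁.robust (proj₂ (near₁ y z))
            (rank-cong (λ w u → cong (λ v → v + - ⟨ α z y , R₁.b w u ⟩) (s₁₂ z y w u)) (proj₂ (near₁ z y)))
        ; alt-f = λ ch2 y → robust-unique {q = R₁.b} 2t≤3t R₁.robust (proj₂ (near₁ y y))
            (rank-mono ℕ.z≤n (rank-cong (λ w u → sym (trans (cong₂ (λ a b → a + - b)
              (pull-alt⁴ (Π-lin P₁) {B} alt ch2 y w u) (⟨𝟎,⟩ (R₁.b w u))) (x-x≡0 0#))) (rank-0 {t = 0}))) }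

      -- Forms and their coefficients side by side. Made robust together, both are linear functions
      -- of one tuple, and the scalar product of coefficients and forms becomes `μ`.
      g : V n → V n → V (k₁ +ℕ k₁)
      g y z = R₁.b y z ++ᵛ α y z

      g-sym : SymForms g
      g-sym = record
        { linˡ-f = λ u x y → trans (cong₂ _++ᵛ_ (linˡ-f R₁.b-sym u x y) (linˡ-f α-sym u x y)) (++-⊕ (R₁.b x u) (R₁.b y u) (α x u) (α y u))
        ; comm-f = λ w u → cong₂ _++ᵛ_ (comm-f R₁.b-sym w u) (comm-f α-sym w u)
        ; alt-f  = λ ch2 w → trans (cong₂ _++ᵛ_ (alt-f R₁.b-sym ch2 w) (alt-f α-sym ch2 w)) (++-𝟎 k₁) }

      module R₂ = Robustified (robustify (k₁ +ℕ k₁) T g-sym)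
      P₂ : Cut ((k₁ +ℕ k₁) *ℕ T)
      P₂ = R₂.cut

      b-part α-part : V R₂.dim → V k₁
      b-part x = take k₁ (R₂.expand x)
      α-part x = drop k₁ (R₂.expand x)

      b-expands : ∀ y z → R₁.b (Π P₂ y) (Π P₂ z) ≡ b-part (R₂.b y z)
      b-expands y z = trans (sym (take-++ (R₁.b (Π P₂ y) (Π P₂ z)) (α (Π P₂ y) (Π P₂ z)))) (cong (take k₁) (R₂.expands y z))

      α-expands : ∀ y z → α (Π P₂ y) (Π P₂ z) ≡ α-part (R₂.b y z)
      α-expands y z = trans (sym (drop-++ (R₁.b (Π P₂ y) (Π P₂ z)) (α (Π P₂ y) (Π P₂ z)))) (cong (drop k₁) (R₂.expands y z))

    abstract
      factor : Σ[ P ∈ Cut (factorCost k t T) ] Factored (pull⁴ (Π P) B) (k +ℕ k) t T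
      factor = cut-mono (ℕₚ.+-monoʳ-≤ (k *ℕ (t +ℕ (t +ℕ t))) (ℕₚ.*-monoˡ-≤ T (ℕₚ.+-mono-≤ R₁.dim≤ R₁.dim≤))) (cut-∘ P₁ P₂) , record
        { dim = R₂.dim ; dim≤ = ℕₚ.≤-trans R₂.dim≤ (ℕₚ.+-mono-≤ R₁.dim≤ R₁.dim≤)
        ; b = R₂.b ; b-sym = R₂.b-sym ; robust = R₂.robust
        ; μ = λ x y → ⟨ α-part x , b-part y ⟩
        ; μ-bil = record
          { linˡ = λ y x x′ → trans (cong ⟨_, b-part y ⟩ (α-part-lin x x′)) (⟨⟩-linˡ (b-part y) (α-part x) (α-part x′))
          ; linʳ = λ x y y′ → trans (cong ⟨ α-part x ,_⟩ (b-part-lin y y′)) (⟨⟩-linʳ (α-part x) (b-part y) (b-part y′)) }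
        ; near = λ y z → rank-cong (λ w u → cong (λ v → B₁ (Π P₂ y) (Π P₂ z) (Π P₂ w) (Π P₂ u) + - v)
            (cong₂ ⟨_,_⟩ (α-expands y z) (b-expands w u)))
            (rank-∘ (Π-lin P₂) (Π-lin P₂) (proj₂ (near₁ (Π P₂ y) (Π P₂ z)))) }
        where
        b-part-lin : Linᵛ b-part
        b-part-lin x y = trans (cong (take k₁) (R₂.expand-lin x y)) (take-lin k₁ (R₂.expand x) (R₂.expand y))
        α-part-lin : Linᵛ α-part
        α-part-lin x y = trans (cong (drop k₁) (R₂.expand-lin x y)) (drop-lin k₁ (R₂.expand x) (R₂.expand y))

  rep-⊕ : ∀ {n} (φ ψ : V n → F) → rep (λ x → φ x + ψ x) ≡ rep φ ⊕ rep ψ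
  rep-⊕ {zero}  φ ψ = refl
  rep-⊕ {suc n} φ ψ = cong (φ (1# ∷ 𝟎) + ψ (1# ∷ 𝟎) ∷_) (rep-⊕ (λ x → φ (0# ∷ x)) (λ x → ψ (0# ∷ x)))

  rep-cong : ∀ {n} {φ ψ : V n → F} → (∀ x → φ x ≡ ψ x) → rep φ ≡ rep ψ
  rep-cong {zero}  φ≡ψ = refl
  rep-cong {suc n} φ≡ψ = cong₂ _∷_ (φ≡ψ _) (rep-cong (λ x → φ≡ψ (0# ∷ x)))

  module _ {j k} {M : V j → V k → F} (bil : Bil M) where

    bil-rep : ∀ x y → M x y ≡ ⟨ rep (M x) , y ⟩
    bil-rep x y = rep-correct (linʳ bil x) y

    rep-bil-lin : Linᵛ (λ x → rep (M x))
    rep-bil-lin x x′ = trans (rep-cong (λ y → linˡ bil y x x′)) (rep-⊕ (M x) (M x′))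

    rank-bil : ∀ {n} {f : V n → V j} {g : V n → V k} → Linᵛ f → Linᵛ g → Rank≤ k (λ w u → M (f w) (g u))
    rank-bil {f = f} {g} f-lin g-lin = rank-cong (λ w u → sym (bil-rep (f w) (g u)))
      (rank-⟨⟩ (λ x y → trans (cong (λ z → rep (M z)) (f-lin x y)) (rep-bil-lin (f x) (f y))) g-lin)

  coords : ∀ {n k} → (V n → V k) → List (V n)
  coords {k = zero}  f = []
  coords {k = suc k} f = rep (λ x → head (f x)) ∷ coords (λ x → tail (f x))

  length-coords : ∀ {n} k (f : V n → V k) → length (coords f) ≡ k
  length-coords zero    f = refl
  length-coords (suc k) f = cong suc (length-coords k (λ x → tail (f x)))

  coords-⟂ : ∀ {n k} {f : V n → V k} → Linᵛ f → ∀ {x} → coords f ⟂ x → f x ≡ 𝟎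
  coords-⟂ {k = zero} {f} f-lin {x} [] with f x
  ... | [] = refl
  coords-⟂ {k = suc k} {f} f-lin {x} (hx ∷ tx) = trans (η (f x))
    (cong₂ _∷_ (trans (rep-correct head-lin x) hx) (coords-⟂ tail-lin tx))
    where
    η : ∀ (y : V (suc k)) → y ≡ head y ∷ tail y
    η (y ∷ ys) = refl
    head-lin : Lin (λ x → head (f x))
    head-lin x y = trans (cong head (f-lin x y)) (h (f x) (f y))
      where
      h : ∀ (x y : V (suc k)) → head (x ⊕ y) ≡ head x + head y
      h (x ∷ xs) (y ∷ ys) = refl
    tail-lin : Linᵛ (λ x → tail (f x))
    tail-lin x y = trans (cong tail (f-lin x y)) (h (f x) (f y))
      where
      h : ∀ (x y : V (suc k)) → tail (x ⊕ y) ≡ tail x ⊕ tail y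
      h (x ∷ xs) (y ∷ ys) = refl

  -- Symmetry of the coefficient form

  nonzero-half : ∀ {n} {φ : V n → F} → Lin φ → ∀ {e} → ¬ φ e ≡ 0# → p ^ℕ n ≤ℕ 2 *ℕ # (λ x → ¬? (φ x ≟ 0#))
  nonzero-half {n} {φ} lin {e} φe≢0 = begin
    p ^ℕ n                                     ≡⟨ trans (∑ᵛ-const n 1) (ℕₚ.*-identityʳ _) ⟨
    ∑ᵛ {n} (λ _ → 1)                           ≤⟨ ∑ᵛ-mono one-of-two ⟩
    ∑ᵛ (λ x → ind (N? x) +ℕ ind (N? (x ⊕ e)))  ≡⟨ ∑ᵛ-∙ (λ x → ind (N? x)) (λ x → ind (N? (x ⊕ e))) ⟩
    # N? +ℕ ∑ᵛ (λ x → ind (N? (x ⊕ e)))        ≡⟨ cong (# N? +ℕ_) (trans (∑ᵛ-translate (λ x → ind (N? x)) e) (sym (ℕₚ.+-identityʳ _))) ⟩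
    2 *ℕ # N?                                  ∎
    where
    open ℕₚ.≤-Reasoning
    N? : ∀ x → Dec (¬ φ x ≡ 0#)
    N? x = ¬? (φ x ≟ 0#)
    one-of-two : ∀ x → 1 ≤ℕ ind (N? x) +ℕ ind (N? (x ⊕ e))
    one-of-two x with φ x ≟ 0#
    ... | no  _    = s≤s z≤n
    ... | yes φx≡0 = ℕₚ.≤-reflexive (sym (ind-yes (N? (x ⊕ e)) (λ φxe≡0 → φe≢0
            (trans (sym (0+ φx≡0)) (trans (sym (lin x e)) φxe≡0)))))

  -- At least half of the `y` have `M y z₀` nonzero, as of two vectors differing by `y₀` at most one
  -- lies in the kernel; for each such `y` the same holds for half of the `z`.
  nonzero-quarter : ∀ {n} {M : Form n} → Bil M → ∀ {y z} → ¬ M y z ≡ 0# →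
    p ^ℕ n *ℕ p ^ℕ n ≤ℕ 4 *ℕ ∑ᵛ (λ y → # (λ z → ¬? (M y z ≟ 0#)))
  nonzero-quarter {n} {M} bil {y₀} {z₀} M≢0 = begin
    p ^ℕ n *ℕ p ^ℕ n                                    ≤⟨ ℕₚ.*-monoˡ-≤ (p ^ℕ n) (nonzero-half (linˡ bil z₀) M≢0) ⟩
    2 *ℕ # (λ y → ¬? (M y z₀ ≟ 0#)) *ℕ p ^ℕ n           ≡⟨ ℕₚ.*-assoc 2 N (p ^ℕ n) ⟩
    2 *ℕ (N *ℕ p ^ℕ n)                                  ≡⟨ cong (2 *ℕ_) (trans (ℕₚ.*-comm N (p ^ℕ n)) (sym (∑ᵛ-scale (p ^ℕ n) (λ y → ind (¬? (M y z₀ ≟ 0#)))))) ⟩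
    2 *ℕ ∑ᵛ (λ y → p ^ℕ n *ℕ ind (¬? (M y z₀ ≟ 0#)))    ≤⟨ ℕₚ.*-monoʳ-≤ 2 (∑ᵛ-mono half) ⟩
    2 *ℕ ∑ᵛ (λ y → 2 *ℕ # (λ z → ¬? (M y z ≟ 0#)))      ≡⟨ cong (2 *ℕ_) (∑ᵛ-scale 2 (λ y → # (λ z → ¬? (M y z ≟ 0#)))) ⟩
    2 *ℕ (2 *ℕ S)                                       ≡⟨ ℕₚ.*-assoc 2 2 S ⟨
    4 *ℕ S                                              ∎
    where
    open ℕₚ.≤-Reasoning
    N = # (λ y → ¬? (M y z₀ ≟ 0#))
    S = ∑ᵛ (λ y → # (λ z → ¬? (M y z ≟ 0#)))
    half : ∀ y → p ^ℕ n *ℕ ind (¬? (M y z₀ ≟ 0#)) ≤ℕ 2 *ℕ # (λ z → ¬? (M y z ≟ 0#))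
    half y with M y z₀ ≟ 0#
    ... | yes _ = ℕₚ.≤-trans (ℕₚ.≤-reflexive (ℕₚ.*-zeroʳ (p ^ℕ n))) z≤n
    ... | no ≢0 = ℕₚ.≤-trans (ℕₚ.≤-reflexive (ℕₚ.*-identityʳ (p ^ℕ n))) (nonzero-half (linʳ bil y) ≢0)

  Pairings : ∀ {n k} → (V k → V k → F) → (V n → V n → V k) → Form⁴ n
  Pairings μ b y z w u = μ (b y z) (b w u) + μ (b y w) (b z u) + μ (b y u) (b z w)

  module _ {n k t T} {B : Form⁴ n} (sym⁴ : Sym⁴ B) {b : V n → V n → V k} (b-sym : SymForms b) (robust : Robust T b)
           {μ : V k → V k → F} (μ-bil : Bil μ) (near : ∀ y z → Rank≤ t (λ w u → B y z w u + - μ (b y z) (b w u))) where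

    open Sym⁴ sym⁴

    private
      r : ℕ
      r = t +ℕ (k +ℕ k)

      b-linˡ : ∀ u → Linᵛ (λ w → b w u)
      b-linˡ = linˡ-f b-sym
      b-linʳ : ∀ w → Linᵛ (b w)
      b-linʳ = linʳ-f b-sym

    remainder : Form⁴ n
    remainder y z w u = B y z w u + - Pairings μ b y z w u

    crossed : ∀ y z → Rank≤ (k +ℕ k) (λ w u → μ (b y w) (b z u) + μ (b y u) (b z w))
    crossed y z = rank-+ (rank-bil μ-bil (b-linʳ y) (b-linʳ z)) (rank-flip (rank-bil μ-bil (b-linʳ y) (b-linʳ z)))

    remainder-slice : ∀ y z → Rank≤ r (remainder y z)
    remainder-slice y z = rank-cong
      (λ w u → FS.solve 4 (λ B a b c → (B FS.:- a) FS.:- (b FS.:+ c) FS.:= B FS.:- ((a FS.:+ b) FS.:+ c)) refl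
        (B y z w u) (μ (b y z) (b w u)) _ _)
      (rank-- (near y z) (crossed y z))

    ν : V k → V k → F
    ν x x′ = μ x x′ + - μ x′ x

    ν-bil : Bil ν
    ν-bil = record
      { linˡ = λ u x y → trans (cong₂ (λ a b → a + - b) (linˡ μ-bil u x y) (linʳ μ-bil u x y)) (regroup _ _ _ _)
      ; linʳ = λ w x y → trans (cong₂ (λ a b → a + - b) (linʳ μ-bil w x y) (linˡ μ-bil w x y)) (regroup _ _ _ _) }
      where
      regroup : ∀ a b c d → (a + b) + - (c + d) ≡ (a + - c) + (b + - d)
      regroup = FS.solve 4 (λ a b c d → (a FS.:+ b) FS.:- (c FS.:+ d) FS.:= (a FS.:- c) FS.:+ (b FS.:- d)) refl

    -- By `swap-pairs` the form is also close to `μ (b w u) (b y z)`. Against `μ (b y z) (b w u)`,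
    -- which `remainder` subtracts, this leaves `ν`; the crossed pairings have small rank in `y` and
    -- `z`.
    opposite-slice : ∀ w u → Rank≤ r (λ y z → remainder y z w u + - ν (b w u) (b y z))
    opposite-slice w u = rank-cong
      (λ y z → trans (cong (λ B → (B + - μ (b w u) (b y z)) + - (μ (b y w) (b z u) + μ (b y u) (b z w))) (swap-pairs w u y z))
        (FS.solve 5 (λ B m c d m′ → (B FS.:- m) FS.:- (c FS.:+ d) FS.:= (B FS.:- ((m′ FS.:+ c) FS.:+ d)) FS.:- (m FS.:- m′)) refl
          (B y z w u) (μ (b w u) (b y z)) (μ (b y w) (b z u)) (μ (b y u) (b z w)) (μ (b y z) (b w u))))
      (rank-- (near w u) (rank-+ (rank-bil μ-bil (b-linˡ w) (b-linˡ u)) (rank-bil μ-bil (b-linˡ u) (b-linˡ w))))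

    remainder-bil : ∀ y z → Bil (remainder y z)
    remainder-bil y z = record
      { linˡ = λ u x x′ → trans (cong₂ (λ a b → a + - b) (lin₃ y z u x x′) (cong₂ _+_ (cong₂ _+_
          (trans (cong (μ (b y z)) (b-linˡ u x x′)) (linʳ μ-bil (b y z) (b x u) (b x′ u)))
          (trans (cong (λ c → μ c (b z u)) (b-linʳ y x x′)) (linˡ μ-bil (b z u) (b y x) (b y x′))))
          (trans (cong (μ (b y u)) (b-linʳ z x x′)) (linʳ μ-bil (b y u) (b z x) (b z x′)))))
          (regroup _ _ _ _ _ _ _ _)
      ; linʳ = λ w x x′ → trans (cong₂ (λ a b → a + - b) (lin₄ y z w x x′) (cong₂ _+_ (cong₂ _+_
          (trans (cong (μ (b y z)) (b-linʳ w x x′)) (linʳ μ-bil (b y z) (b w x) (b w x′)))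
          (trans (cong (μ (b y w)) (b-linʳ z x x′)) (linʳ μ-bil (b y w) (b z x) (b z x′))))
          (trans (cong (λ c → μ c (b z w)) (b-linʳ y x x′)) (linˡ μ-bil (b z w) (b y x) (b y x′)))))
          (regroup _ _ _ _ _ _ _ _) }
      where
      regroup : ∀ B B′ a a′ b b′ c c′ →
        (B + B′) + - ((a + a′) + (b + b′) + (c + c′)) ≡ (B + - (a + b + c)) + (B′ + - (a′ + b′ + c′))
      regroup = FS.solve 8 (λ B B′ a a′ b b′ c c′ → (B FS.:+ B′) FS.:- ((a FS.:+ a′) FS.:+ (b FS.:+ b′) FS.:+ (c FS.:+ c′))
        FS.:= (B FS.:- (a FS.:+ b FS.:+ c)) FS.:+ (B′ FS.:- (a′ FS.:+ b′ FS.:+ c′))) refl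

    -- Suppose ν x₀ x₁ ≢ 0.  Find many pairs (w , u), orthogonal for b, with
    -- ν (b w u) x₁ ≢ 0; then for suitable y and z the form remainder y z is
    -- diagonal on these pairs, with more nonzero entries than its rank allows.
    module _ (T-large : symmetryCost t k ≤ℕ T) {x₀ x₁ : V k} (ν≢0 : ¬ ν x₀ x₁ ≡ 0#) where

      private
        -- At least a quarter of all `y` and `z` hit a given pair, so that some choice hits `suc r`
        -- pairs, one more than the rank of `remainder y z` permits.
        Nₚ : ℕ
        Nₚ = 4 *ℕ suc r

        probe : V k
        probe = rep (λ x → ν x x₁)

        probe-correct : ∀ x → ν x x₁ ≡ ⟨ probe , x ⟩
        probe-correct = rep-correct (linˡ ν-bil x₁)

        probe≢𝟎 : ¬ probe ≡ 𝟎
        probe≢𝟎 eq = ν≢0 (trans (probe-correct x₀) (trans (cong ⟨_, x₀ ⟩ eq) (⟨𝟎,⟩ x₀)))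

      data Orthogonal : List (V n × V n) → Set where
        []   : Orthogonal []
        cons : ∀ {w u ps} → ¬ ν (b w u) x₁ ≡ 0# → All (λ (w′ , u′) → b w u′ ≡ 𝟎 × b w′ u ≡ 𝟎) ps →
               Orthogonal ps → Orthogonal ((w , u) ∷ ps)

      -- If there were no further pair, the form `ν (b w u) x₁`, which is the combination
      -- `probe ∙ b`, would vanish on the common kernel of the `b v` for the vectors `v` chosen so
      -- far, and its rank would contradict robustness.
      orthogonal : ∀ j → j ≤ℕ Nₚ → ∃[ ps ] length ps ≡ j × Orthogonal ps
      orthogonal zero    _   = [] , refl , []
      orthogonal (suc j) j<Nₚ with ps , |ps| , orth ← orthogonal j (ℕₚ.<⇒≤ j<Nₚ)
        with search-× search-V search-V (λ (w , u) → (gather (λ v → coords (b v)) (support ps) ⟂? w) ×-dec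
               (gather (λ v → coords (b v)) (support ps) ⟂? u) ×-dec ¬? (ν (b w u) x₁ ≟ 0#))
      ... | yes ((w , u) , Λw , Λu , ≢0) = (w , u) ∷ ps , cong suc |ps| ,
        cons ≢0 (All.tabulate λ {(w′ , u′)} ∈ps →
          trans (comm-f b-sym w u′) (coords-⟂ (b-linʳ u′) (gather-⟂ {f = λ v → coords (b v)} (∈-supportʳ ∈ps) Λw)) ,
          coords-⟂ (b-linʳ w′) (gather-⟂ {f = λ v → coords (b v)} (∈-supportˡ ∈ps) Λu)) orth
      ... | no none = contradiction (rank-mono small (ker²→rank (∙-bil b-sym probe) Λ
          (λ {w} {u} Λw Λu → trans (sym (probe-correct (b w u)))
            (decidable-stable (ν (b w u) x₁ ≟ 0#) (λ ≢0 → none ((w , u) , Λw , Λu , ≢0)))))) (robust probe≢𝟎)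
        where
        Λ : List (V n)
        Λ = gather (λ v → coords (b v)) (support ps)
        Λ≤ : length Λ ≤ℕ 2 *ℕ (Nₚ *ℕ k)
        Λ≤ = begin
          length Λ                              ≤⟨ gather≤ {f = λ v → coords (b v)} (λ v → ℕₚ.≤-reflexive (length-coords k (b v))) (support ps) ⟩
          length (support ps) *ℕ k              ≡⟨ cong (_*ℕ k) (length-support ps) ⟩
          (length ps +ℕ length ps) *ℕ k         ≤⟨ ℕₚ.*-monoˡ-≤ k (ℕₚ.+-mono-≤ ps≤Nₚ ps≤Nₚ) ⟩
          (Nₚ +ℕ Nₚ) *ℕ k                         ≡⟨ cong (_*ℕ k) (cong (Nₚ +ℕ_) (sym (ℕₚ.+-identityʳ Nₚ))) ⟩
          2 *ℕ Nₚ *ℕ k                           ≡⟨ ℕₚ.*-assoc 2 Nₚ k ⟩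
          2 *ℕ (Nₚ *ℕ k)                         ∎
          where
          open ℕₚ.≤-Reasoning
          ps≤Nₚ : length ps ≤ℕ Nₚ
          ps≤Nₚ = ℕₚ.≤-trans (ℕₚ.≤-reflexive |ps|) (ℕₚ.<⇒≤ j<Nₚ)
        small : length Λ +ℕ length Λ ≤ℕ T
        small = ℕₚ.≤-trans (ℕₚ.+-mono-≤ Λ≤ Λ≤) (ℕₚ.≤-trans (ℕₚ.≤-reflexive
          (trans (cong (2 *ℕ (Nₚ *ℕ k) +ℕ_) (sym (ℕₚ.+-identityʳ _))) (sym (ℕₚ.*-assoc 2 2 (Nₚ *ℕ k)))))
          (ℕₚ.≤-trans (ℕₚ.m≤n+m _ (Nₚ *ℕ (Nₚ *ℕ r))) T-large))

      hitsAt : List (V n × V n) → V n → V n → ℕ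
      hitsAt []             y z = 0
      hitsAt ((w , u) ∷ ps) y z = ind (¬? (ν (b w u) (b y z) ≟ 0#)) +ℕ hitsAt ps y z

      -- Only the pairs hit by `y` and `z` are kept. Where the remainder equals `ν (b w u) (b y z)`,
      -- orthogonality of the pairs makes all other entries zero.
      thin : ∀ {y z} ps → (∀ {w u w′ u′} → (w , u′) ∈ ps → (w′ , u) ∈ ps → remainder y z w u ≡ ν (b w u) (b y z)) → Orthogonal ps →
        ∃[ qs ] (∀ {q} → q ∈ qs → q ∈ ps) × length qs ≡ hitsAt ps y z × Diagonal (remainder y z) qs
      thin []                 exact []                  = [] , (λ q∈ → q∈) , refl , []
      thin {y} {z} ((w , u) ∷ ps) exact (cons ≢0 cross orth)
        with qs , sub , |qs| , D ← thin {y} {z} ps (λ a b → exact (there a) (there b)) orth | ν (b w u) (b y z) ≟ 0#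
      ... | yes _ = qs , (λ q∈ → there (sub q∈)) , |qs| , D
      ... | no ν≢ = (w , u) ∷ qs , (λ { (here eq) → here eq ; (there q∈) → there (sub q∈) }) , cong suc |qs| ,
        cons (λ eq → ν≢ (trans (sym (exact (here refl) (here refl))) eq))
          (All.tabulate λ {(w′ , u′)} ∈qs → let bwu′ , bw′u = All.lookup cross (sub ∈qs) in
            trans (exact (here refl) (there (sub ∈qs))) (vanish bwu′) ,
            trans (exact (there (sub ∈qs)) (here refl)) (vanish bw′u)) D
        where
        vanish : ∀ {x} → x ≡ 𝟎 → ν x (b y z) ≡ 0#
        vanish refl = lin-𝟎 (linˡ ν-bil (b y z))

      private
        low : V n → V n → List (V n)
        low w u = proj₁ (rank→ker (opposite-slice w u))

        lows : List (V n × V n) → List (V n)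
        lows ps = gather (λ w → gather (low w) (List.map proj₂ ps)) (List.map proj₁ ps)

        lows≤ : ∀ ps → length ps ≡ Nₚ → length (lows ps) ≤ℕ Nₚ *ℕ (Nₚ *ℕ r)
        lows≤ ps |ps| = subst (λ m → length (lows ps) ≤ℕ m *ℕ (Nₚ *ℕ r)) (trans (Listₚ.length-map proj₁ ps) |ps|)
          (gather≤ {f = λ w → gather (low w) (List.map proj₂ ps)} (λ w →
            subst (λ m → length (gather (low w) (List.map proj₂ ps)) ≤ℕ m *ℕ r) (trans (Listₚ.length-map proj₂ ps) |ps|)
              (gather≤ {f = low w} (λ u → proj₁ (proj₂ (rank→ker (opposite-slice w u)))) (List.map proj₂ ps)))
            (List.map proj₁ ps))

        lows-exact : ∀ {ps y z w u w′ u′} → lows ps ⟂ y → (w , u′) ∈ ps → (w′ , u) ∈ ps → remainder y z w u ≡ ν (b w u) (b y z)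
        lows-exact {ps} {y} {z} {w} {u} h w∈ u∈ = x-y≡0⇒x≡y (proj₂ (proj₂ (rank→ker (opposite-slice w u)))
          (gather-⟂ {f = low w} (∈-map⁺ proj₂ u∈) (gather-⟂ {f = λ w → gather (low w) (List.map proj₂ ps)} (∈-map⁺ proj₁ w∈) h)) z)

      module _ {c} (P : Cut {n} c) (c≤T : c ≤ℕ T) where

        M : V n → V n → Form n
        M w u y z = ν (b w u) (b (Π P y) z)

        M-bil : ∀ w u → Bil (M w u)
        M-bil w u = record
          { linˡ = λ z x y → trans (cong (λ v → ν (b w u) (b v z)) (Π-lin P x y))
              (trans (cong (ν (b w u)) (b-linˡ z _ _)) (linʳ ν-bil (b w u) _ _))
          ; linʳ = λ y x x′ → trans (cong (ν (b w u)) (b-linʳ (Π P y) x x′)) (linʳ ν-bil (b w u) _ _) }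

        -- Otherwise a nontrivial combination of `b` would vanish on the cut in its first argument,
        -- and so have rank at most `c`.
        M-nonzero : ∀ {w u} → ¬ ν (b w u) x₁ ≡ 0# → ∃[ y ] ∃[ z ] ¬ M w u y z ≡ 0#
        M-nonzero {w} {u} ≢0 with search-V (λ y → search-V (λ z → ¬? (M w u y z ≟ 0#)))
        ... | yes found = found
        ... | no  none  = contradiction (rank-mono c≤T (rank-uncutˡ {t = 0} (∙-bil b-sym d) P (rank-cong
            (λ y z → trans (sym (decidable-stable (M w u y z ≟ 0#) (λ M≢0 → none (y , z , M≢0)))) (bil-rep ν-bil (b w u) (b (Π P y) z))) rank-0)))
            (robust d≢𝟎)
          where
          d : V k
          d = rep (ν (b w u))
          d≢𝟎 : ¬ d ≡ 𝟎
          d≢𝟎 eq = ≢0 (trans (bil-rep ν-bil (b w u) x₁) (trans (cong ⟨_, x₁ ⟩ eq) (⟨𝟎,⟩ x₁)))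

        many-hits : ∀ {ps} → Orthogonal ps → length ps *ℕ (p ^ℕ n *ℕ p ^ℕ n) ≤ℕ 4 *ℕ ∑ᵛ (λ y → ∑ᵛ (λ z → hitsAt ps (Π P y) z))
        many-hits [] = z≤n
        many-hits {(w , u) ∷ ps} (cons ≢0 _ orth) with y₀ , z₀ , M≢0 ← M-nonzero ≢0 = begin
          p ^ℕ n *ℕ p ^ℕ n +ℕ length ps *ℕ (p ^ℕ n *ℕ p ^ℕ n)  ≤⟨ ℕₚ.+-mono-≤ (nonzero-quarter (M-bil w u) M≢0) (many-hits orth) ⟩
          4 *ℕ ∑ᵛ a +ℕ 4 *ℕ ∑ᵛ a′                               ≡⟨ ℕₚ.*-distribˡ-+ 4 (∑ᵛ a) (∑ᵛ a′) ⟨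
          4 *ℕ (∑ᵛ a +ℕ ∑ᵛ a′)                                  ≡⟨ cong (4 *ℕ_) (trans (sym (∑ᵛ-∙ a a′)) (∑ᵛ-cong (λ y →
                                                                     sym (∑ᵛ-∙ (λ z → ind (¬? (M w u y z ≟ 0#))) (hitsAt ps (Π P y)))))) ⟩
          4 *ℕ ∑ᵛ (λ y → ∑ᵛ (λ z → hitsAt ((w , u) ∷ ps) (Π P y) z))  ∎
          where
          open ℕₚ.≤-Reasoning
          a a′ : V n → ℕ
          a y = # (λ z → ¬? (M w u y z ≟ 0#))
          a′ y = ∑ᵛ (λ z → hitsAt ps (Π P y) z)

        dense-hits : ∀ {ps} → length ps ≡ Nₚ → Orthogonal ps →
          p ^ℕ n *ℕ (p ^ℕ n *ℕ suc r) ≤ℕ 1 *ℕ ∑ᵛ (λ y → ∑ᵛ (λ z → hitsAt ps (Π P y) z))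
        dense-hits {ps} |ps| orth = ℕₚ.≤-trans (ℕₚ.*-cancelˡ-≤ 4 (begin
          4 *ℕ (p ^ℕ n *ℕ (p ^ℕ n *ℕ suc r))              ≡⟨ solve 2 (λ q r → con 4 :* (q :* (q :* r)) := (con 4 :* r) :* (q :* q)) refl (p ^ℕ n) (suc r) ⟩
          Nₚ *ℕ (p ^ℕ n *ℕ p ^ℕ n)                        ≡⟨ cong (_*ℕ (p ^ℕ n *ℕ p ^ℕ n)) |ps| ⟨
          length ps *ℕ (p ^ℕ n *ℕ p ^ℕ n)                 ≤⟨ many-hits orth ⟩
          4 *ℕ ∑ᵛ (λ y → ∑ᵛ (λ z → hitsAt ps (Π P y) z))  ∎)) (ℕₚ.≤-reflexive (sym (ℕₚ.*-identityˡ _)))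
          where
          open ℕₚ.≤-Reasoning
          open +-*-Solver

      conclude : ∀ {ps} → Orthogonal ps → ∀ {y} → lows ps ⟂ y → ∀ z → suc r ≤ℕ hitsAt ps y z → ⊥
      conclude {ps} orth {y} killed z hits =
        let qs , _ , |qs| , D = thin {y} {z} ps (λ w∈ u∈ → lows-exact {ps} killed w∈ u∈) orth
        in ℕₚ.<⇒≱ (ℕₚ.≤-trans hits (ℕₚ.≤-reflexive (sym |qs|))) (diagonal-bound (remainder-bil y z) (remainder-slice y z) D)

      well-hit : ∀ {ps} → length ps ≡ Nₚ → Orthogonal ps → ∀ {c} (P : Cut {n} c) → c ≤ℕ T → ∃[ y ] ∃[ z ] suc r ≤ℕ hitsAt ps (Π P y) z
      well-hit {ps} |ps| orth P c≤T =
        let y , row = average (λ y → ∑ᵛ (λ z → hitsAt ps (Π P y) z)) {p ^ℕ n *ℕ suc r} {1} (dense-hits P c≤T |ps| orth)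
            z , hits = average (λ z → hitsAt ps (Π P y) z) {suc r} {1} row
        in y , z , subst (suc r ≤ℕ_) (ℕₚ.*-identityˡ (hitsAt ps (Π P y) z)) hits

      asymmetric-absurd : ⊥
      asymmetric-absurd = absurd (orthogonal Nₚ ℕₚ.≤-refl)
        where
        absurd : ∃[ ps ] length ps ≡ Nₚ × Orthogonal ps → ⊥
        absurd (ps , |ps| , orth) = absurd′ (cut-ker (lows ps))
          where
          absurd′ : Σ[ P ∈ Cut (length (lows ps)) ] (∀ x → lows ps ⟂ Π P x) → ⊥
          absurd′ (P , killed) =
            let y , z , hits = well-hit |ps| orth P (ℕₚ.≤-trans (lows≤ ps |ps|) lows≤T)
            in conclude orth (killed y) z hits
            where
            lows≤T : Nₚ *ℕ (Nₚ *ℕ r) ≤ℕ T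
            lows≤T = ℕₚ.≤-trans (ℕₚ.m≤m+n (Nₚ *ℕ (Nₚ *ℕ r)) (4 *ℕ (Nₚ *ℕ k))) T-large

    abstract
      μ-symmetric : symmetryCost t k ≤ℕ T → ∀ x x′ → μ x x′ ≡ μ x′ x
      μ-symmetric T-large x x′ = decidable-stable (μ x x′ ≟ μ x′ x)
        (λ μ≢ → asymmetric-absurd T-large {x} {x′} (λ ν≡0 → μ≢ (x-y≡0⇒x≡y ν≡0)))

  -- The fourth differences as an exact sum of three pairings

  record Paired {n} (B : Form⁴ n) (k T : ℕ) : Set where
    field
      dim    : ℕ
      dim≤   : dim ≤ℕ k
      b      : V n → V n → V dim
      b-sym  : SymForms b
      robust : Robust T b
      μ      : V dim → V dim → F
      μ-bil  : Bil μ
      μ-comm : ∀ x y → μ x y ≡ μ y x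
      exact  : ∀ y z w u → B y z w u ≡ Pairings μ b y z w u

  robust-cut : ∀ {n k t c} {b : V n → V n → V k} → SymForms b → (P : Cut {n} c) → Robust (t +ℕ c +ℕ c) b →
    Robust t (λ w u → b (Π P w) (Π P u))
  robust-cut b-sym P robust {e} e≢0 r = robust e≢0 (rank-uncut (∙-bil b-sym e) P r)

  module _ {n k} {b : V n → V n → V k} (b-sym : SymForms b) {μ : V k → V k → F} (μ-bil : Bil μ) (μ-comm : ∀ x y → μ x y ≡ μ y x) where

    -- Exchanging the first two vectors permutes the crossed pairings, but also exchanges the two
    -- arguments of `μ` in them; this is where symmetry of `μ` is needed.
    pairings-sym⁴ : Sym⁴ (Pairings μ b)
    pairings-sym⁴ = record
      { lin₁ = λ z w u x y → trans
          (cong₂ _+_ (cong₂ _+_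
            (trans (cong (λ c → μ c (b w u)) (linˡ-f b-sym z x y)) (linˡ μ-bil (b w u) (b x z) (b y z)))
            (trans (cong (λ c → μ c (b z u)) (linˡ-f b-sym w x y)) (linˡ μ-bil (b z u) (b x w) (b y w))))
            (trans (cong (λ c → μ c (b z w)) (linˡ-f b-sym u x y)) (linˡ μ-bil (b z w) (b x u) (b y u))))
          (FS.solve 6 (λ a a′ b b′ c c′ → (a FS.:+ a′) FS.:+ (b FS.:+ b′) FS.:+ (c FS.:+ c′)
            FS.:= (a FS.:+ b FS.:+ c) FS.:+ (a′ FS.:+ b′ FS.:+ c′)) refl _ _ _ _ _ _)
      ; s₁₂ = λ y z w u → trans
          (cong₂ _+_ (cong₂ _+_ (cong (λ c → μ c (b w u)) (comm-f b-sym y z)) (μ-comm (b y w) (b z u))) (μ-comm (b y u) (b z w)))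
          (FS.solve 3 (λ a b c → a FS.:+ b FS.:+ c FS.:= a FS.:+ c FS.:+ b) refl (μ (b z y) (b w u)) (μ (b z u) (b y w)) (μ (b z w) (b y u)))
      ; s₂₃ = λ y z w u → trans
          (cong (λ c → μ (b y z) (b w u) + μ (b y w) (b z u) + μ (b y u) c) (comm-f b-sym z w))
          (cong (_+ μ (b y u) (b w z)) (F-ring.+-comm (μ (b y z) (b w u)) (μ (b y w) (b z u))))
      ; s₃₄ = λ y z w u → trans
          (cong (λ c → μ (b y z) c + μ (b y w) (b z u) + μ (b y u) (b z w)) (comm-f b-sym w u))
          (FS.solve 3 (λ a b c → a FS.:+ b FS.:+ c FS.:= a FS.:+ c FS.:+ b) refl (μ (b y z) (b u w)) (μ (b y w) (b z u)) (μ (b y u) (b z w))) }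

  sub-sym⁴ : ∀ {n} {B C : Form⁴ n} → Sym⁴ B → Sym⁴ C → Sym⁴ (λ y z w u → B y z w u + - C y z w u)
  sub-sym⁴ SB SC = record
    { lin₁ = λ z w u x y → trans (cong₂ (λ a b → a + - b) (B.lin₁ z w u x y) (C.lin₁ z w u x y))
        (FS.solve 4 (λ a b c d → (a FS.:+ b) FS.:- (c FS.:+ d) FS.:= (a FS.:- c) FS.:+ (b FS.:- d)) refl _ _ _ _)
    ; s₁₂ = λ y z w u → cong₂ (λ a b → a + - b) (B.s₁₂ y z w u) (C.s₁₂ y z w u)
    ; s₂₃ = λ y z w u → cong₂ (λ a b → a + - b) (B.s₂₃ y z w u) (C.s₂₃ y z w u)
    ; s₃₄ = λ y z w u → cong₂ (λ a b → a + - b) (B.s₃₄ y z w u) (C.s₃₄ y z w u) }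
    where
    module B = Sym⁴ SB
    module C = Sym⁴ SC

  symmetryCost-mono : ∀ t {k k′} → k ≤ℕ k′ → symmetryCost t k ≤ℕ symmetryCost t k′
  symmetryCost-mono t {k} {k′} k≤k′ = ℕₚ.+-mono-≤ (ℕₚ.*-mono-≤ N≤ (ℕₚ.*-mono-≤ N≤ r≤)) (ℕₚ.*-monoʳ-≤ 4 (ℕₚ.*-mono-≤ N≤ k≤k′))
    where
    r≤ : t +ℕ (k +ℕ k) ≤ℕ t +ℕ (k′ +ℕ k′)
    r≤ = ℕₚ.+-monoʳ-≤ t (ℕₚ.+-mono-≤ k≤k′ k≤k′)
    N≤ : 4 *ℕ suc (t +ℕ (k +ℕ k)) ≤ℕ 4 *ℕ suc (t +ℕ (k′ +ℕ k′))
    N≤ = ℕₚ.*-monoʳ-≤ 4 (ℕ.s≤s r≤)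

  module _ {n} {B : Form⁴ n} (sym⁴ : Sym⁴ B) (alt : Alt⁴ B) (A T : ℕ)
           (dense : p ^ℕ n *ℕ (p ^ℕ n *ℕ p ^ℕ n) ≤ℕ A *ℕ ∑ᵛ (λ y → ∑ᵛ (λ z → vanishing (B y z)))) where

    private
      module C = Cost A T

      stage₁ : Σ[ P ∈ Cut (2 *ℕ A) ] (∀ y → NearlyFlat C.R (pull⁴ (Π P) B y))
      stage₁ = let Λ , Λ≤ , flat = biased⇒flat sym⁴ A dense
                   P , killed = cut-ker Λ
               in cut-mono Λ≤ P , λ y → pull-flat (Π-lin P) {B} {y} (flat (killed y))

      module _ (P₁ : Cut (2 *ℕ A)) (flat : ∀ y → NearlyFlat C.R (pull⁴ (Π P₁) B y)) where

        B₁ : Form⁴ n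
        B₁ = pull⁴ (Π P₁) B
        sym₁ : Sym⁴ B₁
        sym₁ = pull-sym⁴ (Π-lin P₁) sym⁴
        alt₁ : Alt⁴ B₁
        alt₁ = pull-alt⁴ (Π-lin P₁) {B} alt

        cov : Covering B₁ C.R
        cov = covering sym₁ alt₁ flat
        module Q = Covering cov

        module _ (P₂ : Cut (length Q.Λ)) (killed : ∀ x → Q.Λ ⟂ Π P₂ x) where

          B₂ : Form⁴ n
          B₂ = pull⁴ (Π P₂) B₁
          sym₂ : Sym⁴ B₂
          sym₂ = pull-sym⁴ (Π-lin P₂) sym₁

          stage₃ : Σ[ P ∈ Cut (factorCost Q.dim C.t C.T′) ] Factored (pull⁴ (Π P) B₂) (Q.dim +ℕ Q.dim) C.t C.T′
          stage₃ = factor sym₂ (pull-alt⁴ (Π-lin P₂) {B₁} alt₁) (pull-forms (Π-lin P₂) Q.q-sym)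
            (λ y z → let c , r = Q.near (killed y) (killed z) in c , rank-∘ (Π-lin P₂) (Π-lin P₂) r) C.T′

          module _ (P₃ : Cut (factorCost Q.dim C.t C.T′)) (factored : Factored (pull⁴ (Π P₃) B₂) (Q.dim +ℕ Q.dim) C.t C.T′) where

            module Φ = Factored factored
            B₃ : Form⁴ n
            B₃ = pull⁴ (Π P₃) B₂
            sym₃ : Sym⁴ B₃
            sym₃ = pull-sym⁴ (Π-lin P₃) sym₂

            dim≤k : Φ.dim ≤ℕ C.k
            dim≤k = ℕₚ.≤-trans Φ.dim≤ (ℕₚ.+-mono-≤ Q.dim≤ Q.dim≤)

            μ-comm : ∀ x y → Φ.μ x y ≡ Φ.μ y x
            μ-comm = μ-symmetric sym₃ Φ.b-sym Φ.robust Φ.μ-bil Φ.near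
              (ℕₚ.≤-trans (symmetryCost-mono C.t dim≤k) (ℕₚ.m≤n+m (symmetryCost C.t C.k) (T +ℕ C.c₅ +ℕ C.c₅)))

            G : Form⁴ n
            G y z w u = B₃ y z w u + - Pairings Φ.μ Φ.b y z w u

            G-slice : ∀ y z → Rank≤ C.r (G y z)
            G-slice y z = rank-mono (ℕₚ.+-monoʳ-≤ C.t (ℕₚ.+-mono-≤ dim≤k dim≤k)) (remainder-slice sym₃ Φ.b-sym Φ.robust Φ.μ-bil Φ.near y z)

            G-kernel : ∃[ Λ ] length Λ ≤ℕ C.c₅ × (∀ {y z w u} → Λ ⟂ y → Λ ⟂ z → Λ ⟂ w → Λ ⟂ u → G y z w u ≡ 0#)
            G-kernel = quartic-kernel {r = C.r} {G = G} (sub-sym⁴ sym₃ (pairings-sym⁴ Φ.b-sym Φ.μ-bil μ-comm)) G-slice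

            P₅ : Cut C.c₅
            P₅ = cut-mono (proj₁ (proj₂ G-kernel)) (proj₁ (cut-ker (proj₁ G-kernel)))

            dead : ∀ x → proj₁ G-kernel ⟂ Π P₅ x
            dead = proj₂ (cut-ker (proj₁ G-kernel))

            paired : Paired (pull⁴ (Π P₅) B₃) C.k T
            paired = record
                { dim = Φ.dim ; dim≤ = dim≤k ; b = λ w u → Φ.b (Π P₅ w) (Π P₅ u) ; b-sym = pull-forms (Π-lin P₅) Φ.b-sym
                ; robust = robust-cut {t = T} {c = C.c₅} Φ.b-sym P₅ (robust-mono (ℕₚ.m≤m+n (T +ℕ C.c₅ +ℕ C.c₅) (symmetryCost C.t C.k)) Φ.robust)
                ; μ = Φ.μ ; μ-bil = Φ.μ-bil ; μ-comm = μ-comm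
                ; exact = λ y z w u → x-y≡0⇒x≡y (proj₂ (proj₂ G-kernel) (dead y) (dead z) (dead w) (dead u)) }

            stage₅ : Σ[ P ∈ Cut C.c₅ ] Paired (pull⁴ (Π P) B₃) C.k T
            stage₅ = P₅ , paired

    abstract
      pairing-structure : Σ[ P ∈ Cut C.total ] Paired (pull⁴ (Π P) B) C.k T
      pairing-structure =
        let P₁ , flat = stage₁
            P₂ , killed = cut-ker (Covering.Λ (cov P₁ flat))
            P₃ , factored = stage₃ P₁ flat P₂ killed
            P₅ , paired = stage₅ P₁ flat P₂ killed P₃ factored
        in cut-mono (ℕₚ.+-monoˡ-≤ C.c₅ (ℕₚ.+-mono-≤ (ℕₚ.+-monoʳ-≤ (2 *ℕ A) (Covering.Λ≤ (cov P₁ flat))) (cost-mono (Covering.dim≤ (cov P₁ flat)))))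
             (cut-∘ (cut-∘ (cut-∘ P₁ P₂) P₃) P₅) , paired
        where
        cost-mono : ∀ {d} → d ≤ℕ C.R → factorCost d C.t C.T′ ≤ℕ factorCost C.R C.t C.T′
        cost-mono d≤R = ℕₚ.+-mono-≤ (ℕₚ.*-monoˡ-≤ _ d≤R) (ℕₚ.*-monoˡ-≤ C.T′ (ℕₚ.+-mono-≤ d≤R d≤R))

  -- Polynomial functions

  Fun : ℕ → Set
  Fun n = V n → F

  Δ : ∀ {n} → V n → Fun n → Fun n
  Δ y f x = f (x ⊕ y) + - f x

  -- Der d f says that f is a polynomial function of degree below d.
  Der : ∀ {n} → ℕ → Fun n → Set
  Der zero    f = ∀ x → f x ≡ 0#
  Der (suc d) f = ∀ y → Der d (Δ y f)

  ⊕-right : ∀ {n} (x y z : V n) → x ⊕ y ⊕ z ≡ x ⊕ z ⊕ y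
  ⊕-right = VS.solve 3 (λ x y z → (x VS.:+ y) VS.:+ z VS.:= (x VS.:+ z) VS.:+ y) refl

  +-+ : ∀ a b c d → (a + b) + - (c + d) ≡ (a + - c) + (b + - d)
  +-+ = FS.solve 4 (λ a b c d → (a FS.:+ b) FS.:- (c FS.:+ d) FS.:= (a FS.:- c) FS.:+ (b FS.:- d)) refl

  module _ {n : ℕ} where

    Δ-cong : ∀ {f g : Fun n} → (∀ x → f x ≡ g x) → ∀ y x → Δ y f x ≡ Δ y g x
    Δ-cong f≡g y x = cong₂ (λ a b → a + - b) (f≡g (x ⊕ y)) (f≡g x)

    Δ-swap : ∀ (f : Fun n) y z x → Δ y (Δ z f) x ≡ Δ z (Δ y f) x
    Δ-swap f y z x = trans (cong (λ v → (f v + - f (x ⊕ y)) + - (f (x ⊕ z) + - f x)) (⊕-right x y z))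
      (FS.solve 4 (λ a b c d → (a FS.:- b) FS.:- (c FS.:- d) FS.:= (a FS.:- c) FS.:- (b FS.:- d)) refl
        (f (x ⊕ z ⊕ y)) (f (x ⊕ y)) (f (x ⊕ z)) (f x))

    -- Differences are additive in the direction up to a difference of one order more, which is why
    -- those of top order are multilinear.
    Δ-⊕ : ∀ (f : Fun n) y z x → Δ (y ⊕ z) f x ≡ Δ y f x + Δ z f x + Δ y (Δ z f) x
    Δ-⊕ f y z x = trans (cong (λ v → f v + - f x) (sym (V-ring.+-assoc x y z)))
      (FS.solve 4 (λ a b c d → a FS.:- d FS.:= (b FS.:- d) FS.:+ (c FS.:- d) FS.:+ ((a FS.:- b) FS.:- (c FS.:- d))) refl
        (f (x ⊕ y ⊕ z)) (f (x ⊕ y)) (f (x ⊕ z)) (f x))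

    Δ-at : ∀ (f : Fun n) a → f a ≡ f 𝟎 + Δ a f 𝟎
    Δ-at f a = trans (cong f (sym (V-ring.+-identityˡ a))) (FS.solve 2 (λ a b → a FS.:= b FS.:+ (a FS.:- b)) refl (f (𝟎 ⊕ a)) (f 𝟎))

    Δ-+ : ∀ (f g : Fun n) y x → Δ y (λ x → f x + g x) x ≡ Δ y f x + Δ y g x
    Δ-+ f g y x = +-+ (f (x ⊕ y)) (g (x ⊕ y)) (f x) (g x)

    der-cong : ∀ d {f g : Fun n} → (∀ x → f x ≡ g x) → Der d f → Der d g
    der-cong zero    f≡g Df x = trans (sym (f≡g x)) (Df x)
    der-cong (suc d) f≡g Df y = der-cong d (Δ-cong f≡g y) (Df y)

    der-zero : ∀ d {f : Fun n} → (∀ x → f x ≡ 0#) → Der d f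
    der-zero zero    f≡0 = f≡0
    der-zero (suc d) f≡0 y = der-zero d (λ x → trans (cong₂ (λ a b → a + - b) (f≡0 (x ⊕ y)) (f≡0 x)) (x-x≡0 0#))

    der-suc : ∀ d {f : Fun n} → Der d f → Der (suc d) f
    der-suc zero    f≡0 = der-zero 1 f≡0
    der-suc (suc d) Df y = der-suc d (Df y)

    der-mono : ∀ {d e} {f : Fun n} → d ≤ℕ e → Der d f → Der e f
    der-mono {d} {e} d≤e Df = go (ℕₚ.≤⇒≤′ d≤e)
      where
      go : ∀ {e} → d ℕ.≤′ e → Der e _
      go ℕ.≤′-refl       = Df
      go (ℕ.≤′-step d≤e) = der-suc _ (go d≤e)

    der-+ : ∀ d {f g : Fun n} → Der d f → Der d g → Der d (λ x → f x + g x)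
    der-+ zero    Df Dg x = sum₂ (Df x) (Dg x)
    der-+ (suc d) {f} {g} Df Dg y = der-cong d (λ x → sym (Δ-+ f g y x)) (der-+ d (Df y) (Dg y))

    der-const : ∀ c → Der {n} 1 (λ _ → c)
    der-const c y x = x-x≡0 c

    der-lin : ∀ {φ : Fun n} → Lin φ → Der 2 φ
    der-lin {φ} lin y = der-cong 1 (λ x → trans
      (FS.solve 2 (λ a b → b FS.:= (a FS.:+ b) FS.:- a) refl (φ x) (φ y)) (cong (_+ - φ x) (sym (lin x y)))) (der-const (φ y))

    der-shift : ∀ d {f : Fun n} a → Der d f → Der d (λ x → f (x ⊕ a))
    der-shift zero    a Df x = Df (x ⊕ a)
    der-shift (suc d) {f} a Df y = der-cong d (λ x → cong (λ v → f v + - f (x ⊕ a)) (⊕-right x a y)) (der-shift d a (Df y))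

    -- The Leibniz rule for differences, in which one factor is shifted; a shift does not change the
    -- degree.
    der-* : ∀ a b {f g : Fun n} → Der (suc a) f → Der (suc b) g → Der (suc (a +ℕ b)) (λ x → f x * g x)
    der-* a b {f} {g} Df Dg y = der-cong (a +ℕ b) (λ x → leibniz (f (x ⊕ y)) (f x) (g (x ⊕ y)) (g x))
      (der-+ (a +ℕ b) (left a Df) (right b Dg))
      where
      leibniz : ∀ f′ f g′ g → (f′ + - f) * g + f′ * (g′ + - g) ≡ f′ * g′ + - (f * g)
      leibniz = FS.solve 4 (λ f′ f g′ g → (f′ FS.:- f) FS.:* g FS.:+ f′ FS.:* (g′ FS.:- g) FS.:= f′ FS.:* g′ FS.:- f FS.:* g) refl
      left : ∀ a → Der (suc a) f → Der (a +ℕ b) (λ x → Δ y f x * g x)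
      left zero    Df = der-zero b (λ x → trans (cong (_* g x) (Df y x)) (F-ring.zeroˡ (g x)))
      left (suc a) Df = der-* a b (Df y) Dg
      right : ∀ b → Der (suc b) g → Der (a +ℕ b) (λ x → f (x ⊕ y) * Δ y g x)
      right zero    Dg = der-zero (a +ℕ 0) (λ x → trans (cong (f (x ⊕ y) *_) (Dg y x)) (F-ring.zeroʳ (f (x ⊕ y))))
      right (suc b) Dg = subst (λ d → Der d (λ x → f (x ⊕ y) * Δ y g x)) (sym (ℕₚ.+-suc a b)) (der-* a b (der-shift (suc a) y Df) (Dg y))

    der-scale : ∀ d c {f : Fun n} → Der d f → Der d (λ x → c * f x)
    der-scale zero    c Df x = trans (cong (c *_) (Df x)) (F-ring.zeroʳ c)
    der-scale (suc d) c Df = der-* 0 d (der-const c) Df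

    Δ-diag : ∀ {M : Form n} → Bil M → ∀ z x → Δ z (λ x → M x x) x ≡ M x z + M z x + M z z
    Δ-diag {M} bil z x = trans
      (cong (_+ - M x x) (trans (linˡ bil (x ⊕ z) x z) (cong₂ _+_ (linʳ bil x x z) (linʳ bil z x z))))
      (FS.solve 4 (λ a b c d → ((a FS.:+ b) FS.:+ (c FS.:+ d)) FS.:- a FS.:= b FS.:+ c FS.:+ d) refl (M x x) (M x z) (M z x) (M z z))

    second-difference : ∀ {M : Form n} → Bil M → ∀ {φ : Fun n} → Lin φ → ∀ c {h : Fun n} → (∀ x → h x ≡ M x x + φ x + c) →
      ∀ y z x → Δ y (Δ z h) x ≡ M y z + M z y
    second-difference {M} bil {φ} φ-lin c {h} h≡ y z x = trans (Δ-cong first y x) (trans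
      (cong (_+ - (M x z + M z x + M z z + φ z)) (cong₂ (λ a b → a + b + M z z + φ z) (linˡ bil z x y) (linʳ bil z x y)))
      (FS.solve 6 (λ a b c d e f → ((a FS.:+ b) FS.:+ (c FS.:+ d) FS.:+ e FS.:+ f) FS.:- (a FS.:+ c FS.:+ e FS.:+ f) FS.:= b FS.:+ d) refl
        (M x z) (M y z) (M z x) (M z y) (M z z) (φ z)))
      where
      first : ∀ x → Δ z h x ≡ M x z + M z x + M z z + φ z
      first x = trans (cong₂ (λ a b → a + - b) (h≡ (x ⊕ z)) (h≡ x)) (trans
        (cong (λ a → (M (x ⊕ z) (x ⊕ z) + a + c) + - (M x x + φ x + c)) (φ-lin x z))
        (trans (FS.solve 5 (λ a b d e c → (a FS.:+ (b FS.:+ d) FS.:+ c) FS.:- (e FS.:+ b FS.:+ c) FS.:= (a FS.:- e) FS.:+ d) refl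
          (M (x ⊕ z) (x ⊕ z)) (φ x) (φ z) (M x x) c)
          (cong (_+ φ z) (Δ-diag bil z x))))

    der-quadratic : ∀ {M : Form n} → Bil M → ∀ {φ : Fun n} → Lin φ → ∀ c {h : Fun n} → (∀ x → h x ≡ M x x + φ x + c) → Der 3 h
    der-quadratic {M} bil φ-lin c h≡ z y w x = trans
      (cong₂ (λ a b → a + - b) (second-difference bil φ-lin c h≡ y z (x ⊕ w)) (second-difference bil φ-lin c h≡ y z x))
      (x-x≡0 (M y z + M z y))

  module _ {m n} {g : V m → V n} (g-lin : Linᵛ g) where

    der-∘ : ∀ d {f : Fun n} → Der d f → Der d (λ x → f (g x))
    der-∘ zero    Df x = Df (g x)
    der-∘ (suc d) {f} Df y = der-cong d (λ x → cong (λ v → f v + - f (g x)) (sym (g-lin x y))) (der-∘ d (Df (g y)))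

  der₁-const : ∀ {n} {f : Fun n} → Der 1 f → ∀ x → f x ≡ f 𝟎
  der₁-const {f = f} Df x = trans (Δ-at f x) (+0 (Df x 𝟎))

  char2-⊕ : Char2 → ∀ {n} (x : V n) → x ⊕ x ≡ 𝟎
  char2-⊕ ch2 []       = refl
  char2-⊕ ch2 (x ∷ xs) = cong₂ _∷_ (trans (cong₂ _+_ (sym (F-ring.*-identityˡ x)) (sym (F-ring.*-identityˡ x)))
    (trans (sym (F-ring.distribʳ x 1# 1#)) (trans (cong (_* x) ch2) (F-ring.zeroˡ x)))) (char2-⊕ ch2 xs)

  char2-+ : Char2 → ∀ x → x + x ≡ 0#
  char2-+ ch2 x with char2-⊕ ch2 (x ∷ [])
  ... | eq = cong head eq

  Δ-char2 : Char2 → ∀ {n} (f : Fun n) y x → Δ y (Δ y f) x ≡ 0#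
  Δ-char2 ch2 f y x = trans (cong (λ v → (f v + - f (x ⊕ y)) + - (f (x ⊕ y) + - f x)) (trans (V-ring.+-assoc x y y)
      (trans (cong (x ⊕_) (char2-⊕ ch2 y)) (V-ring.+-identityʳ x))))
    (trans (FS.solve 2 (λ a b → (a FS.:- b) FS.:- (b FS.:- a) FS.:= (a FS.:- b) FS.:+ (a FS.:- b)) refl (f x) (f (x ⊕ y)))
      (char2-+ ch2 (f x + - f (x ⊕ y))))

  quartic-form : ∀ {n} → Fun n → Form⁴ n
  quartic-form f y z w u = Δ y (Δ z (Δ w (Δ u f))) 𝟎

  module _ {n} {f : Fun n} (Df : Der 5 f) where

    quartic-const : ∀ y z w u x → Δ y (Δ z (Δ w (Δ u f))) x ≡ quartic-form f y z w u
    quartic-const y z w u x = der₁-const (Df u w z y) x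

    quartic-sym⁴ : Sym⁴ (quartic-form f)
    quartic-sym⁴ = record
      { lin₁ = λ z w u x y → trans (Δ-⊕ (Δ z (Δ w (Δ u f))) x y 𝟎) (+0 (Df u w z y x 𝟎))
      ; s₁₂ = λ y z w u → Δ-swap (Δ w (Δ u f)) y z 𝟎
      ; s₂₃ = λ y z w u → Δ-cong (Δ-swap (Δ u f) z w) y 𝟎
      ; s₃₄ = λ y z w u → Δ-cong (Δ-cong (Δ-swap f w u) z) y 𝟎 }

    quartic-alt⁴ : Alt⁴ (quartic-form f)
    quartic-alt⁴ ch2 y w u = Δ-char2 ch2 (Δ w (Δ u f)) y 𝟎

  half? : Char2 ⊎ ∃[ h ] h + h ≡ 1#
  half? with (1# + 1#) ≟ 0#
  ... | yes ch2 = inj₁ ch2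
  ... | no  2≢0 with h , h2≡1 ← inverse (1# + 1#) 2≢0 = inj₂ (h ,
    trans (sym (cong₂ _+_ (F-ring.*-identityʳ h) (F-ring.*-identityʳ h))) (trans (sym (F-ring.distribˡ h 1# 1#)) h2≡1))

  -- Upper triangular part in characteristic two, half of μ otherwise.
  halve : ∀ {n} {μ : Form n} → Bil μ → (∀ x y → μ x y ≡ μ y x) → (Char2 → ∀ x → μ x x ≡ 0#) →
    ∃[ θ ] Bil θ × (∀ x y → μ x y ≡ θ x y + θ y x)
  halve {μ = μ} bil comm alt with half?
  ... | inj₂ (h , h+h≡1) = (λ x y → h * μ x y) ,
    record { linˡ = λ u x y → trans (cong (h *_) (linˡ bil u x y)) (F-ring.distribˡ h _ _)
           ; linʳ = λ w x y → trans (cong (h *_) (linʳ bil w x y)) (F-ring.distribˡ h _ _) } ,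
    λ x y → sym (trans (cong (λ m → h * μ x y + h * m) (comm y x)) (trans (sym (F-ring.distribʳ (μ x y) h h))
      (trans (cong (_* μ x y) h+h≡1) (F-ring.*-identityˡ (μ x y)))))
  ... | inj₁ ch2 = triangular bil comm (alt ch2)
    where
    triangular : ∀ {n} {μ : Form n} → Bil μ → (∀ x y → μ x y ≡ μ y x) → (∀ x → μ x x ≡ 0#) →
      ∃[ θ ] Bil θ × (∀ x y → μ x y ≡ θ x y + θ y x)
    triangular {zero}  bil comm alt = (λ _ _ → 0#) ,
      record { linˡ = λ _ _ _ → sym (F-ring.+-identityˡ 0#) ; linʳ = λ _ _ _ → sym (F-ring.+-identityˡ 0#) } ,
      λ { [] [] → trans (lin-𝟎 (linˡ bil [])) (sym (F-ring.+-identityˡ 0#)) }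
    triangular {suc n} {μ} bil comm alt with triangular {n} {λ x y → μ (0# ∷ x) (0# ∷ y)}
        (record { linˡ = λ u x y → trans (cong (λ v → μ v (0# ∷ u)) (0∷-lin x y)) (linˡ bil _ _ _)
                ; linʳ = λ w x y → trans (cong (μ (0# ∷ w)) (0∷-lin x y)) (linʳ bil _ _ _) })
        (λ x y → comm _ _) (λ x → alt _)
    ... | θ , θ-bil , θ-half = θ⁺ , record { linˡ = θ⁺-linˡ ; linʳ = θ⁺-linʳ } , θ⁺-half
      where
      e : V (suc n)
      e = 1# ∷ 𝟎
      top : V n → F
      top y = μ e (0# ∷ y)
      top-lin : Lin top
      top-lin x y = trans (cong (μ e) (0∷-lin x y)) (linʳ bil e _ _)
      θ⁺ : Form (suc n)
      θ⁺ (x ∷ xs) (y ∷ ys) = x * top ys + θ xs ys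
      θ⁺-linˡ : ∀ u → Lin (λ w → θ⁺ w u)
      θ⁺-linˡ (u ∷ us) (x ∷ xs) (y ∷ ys) = trans (cong₂ _+_ (F-ring.distribʳ (top us) x y) (linˡ θ-bil us xs ys))
        (FS.solve 4 (λ a b c d → (a FS.:+ b) FS.:+ (c FS.:+ d) FS.:= (a FS.:+ c) FS.:+ (b FS.:+ d)) refl (x * top us) (y * top us) (θ xs us) (θ ys us))
      θ⁺-linʳ : ∀ w → Lin (θ⁺ w)
      θ⁺-linʳ (w ∷ ws) (x ∷ xs) (y ∷ ys) = trans (cong₂ (λ a b → w * a + b) (top-lin xs ys) (linʳ θ-bil ws xs ys))
        (FS.solve 5 (λ w a b c d → w FS.:* (a FS.:+ b) FS.:+ (c FS.:+ d) FS.:= (w FS.:* a FS.:+ c) FS.:+ (w FS.:* b FS.:+ d)) refl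
          w (top xs) (top ys) (θ ws xs) (θ ws ys))
      θ⁺-half : ∀ x y → μ x y ≡ θ⁺ x y + θ⁺ y x
      θ⁺-half (x ∷ xs) (y ∷ ys) = begin
        μ (x ∷ xs) (y ∷ ys)                                        ≡⟨ cong₂ μ (∷-split x xs) (∷-split y ys) ⟩
        μ (x ⊙ e ⊕ X) (y ⊙ e ⊕ Y)                                  ≡⟨ trans (linˡ bil _ _ _) (cong₂ _+_ (linʳ bil _ _ _) (linʳ bil _ _ _)) ⟩
        (μ (x ⊙ e) (y ⊙ e) + μ (x ⊙ e) Y) + (μ X (y ⊙ e) + μ X Y)  ≡⟨ cong₂ _+_ (cong₂ _+_
            (trans (lin-⊙ (linˡ bil _) x e) (trans (cong (x *_) (trans (lin-⊙ (linʳ bil e) y e) (trans (cong (y *_) (alt e)) (F-ring.zeroʳ y)))) (F-ring.zeroʳ x)))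
            (lin-⊙ (linˡ bil Y) x e)) (cong₂ _+_ (trans (lin-⊙ (linʳ bil X) y e) (cong (y *_) (comm X e))) (θ-half xs ys)) ⟩
        (0# + x * top ys) + (y * top xs + (θ xs ys + θ ys xs))     ≡⟨ cong (_+ (y * top xs + (θ xs ys + θ ys xs))) (F-ring.+-identityˡ _) ⟩
        x * top ys + (y * top xs + (θ xs ys + θ ys xs))            ≡⟨ FS.solve 4 (λ a b c d → a FS.:+ (b FS.:+ (c FS.:+ d)) FS.:= (a FS.:+ c) FS.:+ (b FS.:+ d)) refl _ _ _ _ ⟩
        θ⁺ (x ∷ xs) (y ∷ ys) + θ⁺ (y ∷ ys) (x ∷ xs)                ∎
        where
        open ≡-Reasoning
        X Y : V (suc n)
        X = 0# ∷ xs
        Y = 0# ∷ ys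

  record VBil {n k} (β : V n → V n → V k) : Set where
    field
      linˡ-v : ∀ u → Linᵛ (λ w → β w u)
      linʳ-v : ∀ w → Linᵛ (β w)

  open VBil public

  head-⊕ : ∀ {k} (x y : V (suc k)) → head (x ⊕ y) ≡ head x + head y
  head-⊕ (x ∷ xs) (y ∷ ys) = refl

  tail-⊕ : ∀ {k} (x y : V (suc k)) → tail (x ⊕ y) ≡ tail x ⊕ tail y
  tail-⊕ (x ∷ xs) (y ∷ ys) = refl

  halveᵛ : ∀ {n} k {b : V n → V n → V k} → SymForms b → ∃[ β ] VBil β × (∀ x y → b x y ≡ β x y ⊕ β y x)
  halveᵛ zero {b} _ = (λ _ _ → []) , record { linˡ-v = λ _ _ _ → refl ; linʳ-v = λ _ _ _ → refl } , λ x y → unique (b x y)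
    where
    unique : ∀ (v : V 0) → v ≡ []
    unique [] = refl
  halveᵛ (suc k) {b} sf
    with θ , θ-bil , θ-half ← halve {μ = λ x y → head (b x y)}
           (record { linˡ = λ u x y → trans (cong head (linˡ-f sf u x y)) (head-⊕ (b x u) (b y u))
                   ; linʳ = λ w x y → trans (cong head (linʳ-f sf w x y)) (head-⊕ (b w x) (b w y)) })
           (λ x y → cong head (comm-f sf x y)) (λ ch2 x → cong head (alt-f sf ch2 x))
       | β , β-bil , β-half ← halveᵛ k {λ x y → tail (b x y)} record
           { linˡ-f = λ u x y → trans (cong tail (linˡ-f sf u x y)) (tail-⊕ (b x u) (b y u))
           ; comm-f = λ x y → cong tail (comm-f sf x y) ; alt-f = λ ch2 x → cong tail (alt-f sf ch2 x) } =
    (λ x y → θ x y ∷ β x y) ,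
    record { linˡ-v = λ u x y → cong₂ _∷_ (linˡ θ-bil u x y) (linˡ-v β-bil u x y)
           ; linʳ-v = λ w x y → cong₂ _∷_ (linʳ θ-bil w x y) (linʳ-v β-bil w x y) } ,
    λ x y → trans (η (b x y)) (cong₂ _∷_ (θ-half x y) (β-half x y))
    where
    η : ∀ (v : V (suc k)) → v ≡ head v ∷ tail v
    η (x ∷ xs) = refl

  -- The quartic x ↦ θ (Q x) (Q x), where Q x = β x x, has polarization Pairings μ b.
  module Square {n k} {b : V n → V n → V k} {β : V n → V n → V k} (β-bil : VBil β) (b≡ : ∀ x y → b x y ≡ β x y ⊕ β y x)
                {μ θ : V k → V k → F} (θ-bil : Bil θ) (μ≡ : ∀ x y → μ x y ≡ θ x y + θ y x) where

    Q : V n → V k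
    Q x = β x x

    b-comm : ∀ x y → b x y ≡ b y x
    b-comm x y = trans (b≡ x y) (trans (V-ring.+-comm (β x y) (β y x)) (sym (b≡ y x)))

    b-linˡ : ∀ u → Linᵛ (λ w → b w u)
    b-linˡ u x y = trans (b≡ (x ⊕ y) u) (trans (cong₂ _⊕_ (linˡ-v β-bil u x y) (linʳ-v β-bil u x y))
      (trans (VS.solve 4 (λ a b c d → (a VS.:+ b) VS.:+ (c VS.:+ d) VS.:= (a VS.:+ c) VS.:+ (b VS.:+ d)) refl _ _ _ _)
        (sym (cong₂ _⊕_ (b≡ x u) (b≡ y u)))))

    b-linʳ : ∀ w → Linᵛ (b w)
    b-linʳ w x y = trans (b-comm w (x ⊕ y)) (trans (b-linˡ w x y) (cong₂ _⊕_ (b-comm x w) (b-comm y w)))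

    Q-⊕ : ∀ x y → Q (x ⊕ y) ≡ Q x ⊕ Q y ⊕ b x y
    Q-⊕ x y = trans (linˡ-v β-bil (x ⊕ y) x y) (trans (cong₂ _⊕_ (linʳ-v β-bil x x y) (linʳ-v β-bil y x y))
      (trans (VS.solve 4 (λ a b c d → (a VS.:+ b) VS.:+ (c VS.:+ d) VS.:= (a VS.:+ d) VS.:+ (b VS.:+ c)) refl (β x x) (β x y) (β y x) (β y y))
        (cong (β x x ⊕ β y y ⊕_) (sym (b≡ x y)))))

    μ-comm′ : ∀ x y → μ x y ≡ μ y x
    μ-comm′ x y = trans (μ≡ x y) (trans (F-ring.+-comm (θ x y) (θ y x)) (sym (μ≡ y x)))

    μ-bil′ : Bil μ
    μ-bil′ = record
      { linˡ = μ-linˡ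
      ; linʳ = λ w x y → trans (μ-comm′ w (x ⊕ y)) (trans (μ-linˡ w x y) (cong₂ _+_ (μ-comm′ x w) (μ-comm′ y w))) }
      where
      μ-linˡ : ∀ u → Lin (λ w → μ w u)
      μ-linˡ u x y = trans (μ≡ (x ⊕ y) u) (trans (cong₂ _+_ (linˡ θ-bil u x y) (linʳ θ-bil u x y))
        (trans (FS.solve 4 (λ a b c d → (a FS.:+ b) FS.:+ (c FS.:+ d) FS.:= (a FS.:+ c) FS.:+ (b FS.:+ d)) refl _ _ _ _)
          (sym (cong₂ _+_ (μ≡ x u) (μ≡ y u)))))

    square : Fun n
    square x = θ (Q x) (Q x)

    private
      T R : V n → Fun n
      T u x = μ (Q x) (b x u)
      R u x = μ (Q x) (Q u) + θ (Q u ⊕ b x u) (Q u ⊕ b x u)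

    -- Δ u square is a cubic T plus a quadratic R.
    Δ-square : ∀ u x → Δ u square x ≡ T u x + R u x
    Δ-square u x = trans (cong₂ (λ a b → θ a b + - θ (Q x) (Q x)) split split) (trans
      (cong (_+ - θ (Q x) (Q x)) (trans (linˡ θ-bil (Q x ⊕ E) (Q x) E) (cong₂ _+_ (linʳ θ-bil (Q x) (Q x) E) (linʳ θ-bil E (Q x) E))))
      (trans (FS.solve 4 (λ a b c d → ((a FS.:+ b) FS.:+ (c FS.:+ d)) FS.:- a FS.:= (b FS.:+ c) FS.:+ d) refl (θ (Q x) (Q x)) (θ (Q x) E) (θ E (Q x)) (θ E E))
        (trans (cong (_+ θ E E) (trans (sym (μ≡ (Q x) E)) (linʳ μ-bil′ (Q x) (Q u) (b x u))))
          (FS.solve 3 (λ a b c → (a FS.:+ b) FS.:+ c FS.:= b FS.:+ (a FS.:+ c)) refl (μ (Q x) (Q u)) (μ (Q x) (b x u)) (θ E E)))))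
      where
      E : V k
      E = Q u ⊕ b x u
      split : Q (x ⊕ u) ≡ Q x ⊕ E
      split = trans (Q-⊕ x u) (V-ring.+-assoc (Q x) (Q u) (b x u))

    μQ-bil : ∀ c → Bil (λ x y → μ (β x y) c)
    μQ-bil c = record
      { linˡ = λ u x y → trans (cong (λ v → μ v c) (linˡ-v β-bil u x y)) (linˡ μ-bil′ c _ _)
      ; linʳ = λ w x y → trans (cong (λ v → μ v c) (linʳ-v β-bil w x y)) (linˡ μ-bil′ c _ _) }

    R-der : ∀ u → Der 3 (R u)
    R-der u = der-quadratic {M = λ x y → μ (β x y) (Q u) + θ (b x u) (b y u)}
      (record { linˡ = λ v x y → trans (cong₂ _+_ (linˡ (μQ-bil (Q u)) v x y)
                   (trans (cong (λ c → θ c (b v u)) (b-linˡ u x y)) (linˡ θ-bil (b v u) (b x u) (b y u)))) (swap₄ _ _ _ _)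
              ; linʳ = λ w x y → trans (cong₂ _+_ (linʳ (μQ-bil (Q u)) w x y)
                   (trans (cong (θ (b w u)) (b-linˡ u x y)) (linʳ θ-bil (b w u) (b x u) (b y u)))) (swap₄ _ _ _ _) })
      {φ = λ x → μ (Q u) (b x u)} (λ x y → trans (cong (μ (Q u)) (b-linˡ u x y)) (linʳ μ-bil′ (Q u) (b x u) (b y u))) (θ (Q u) (Q u))
      (λ x → trans (cong (μ (Q x) (Q u) +_) (trans (linˡ θ-bil (Q u ⊕ b x u) (Q u) (b x u))
          (cong₂ _+_ (linʳ θ-bil (Q u) (Q u) (b x u)) (linʳ θ-bil (b x u) (Q u) (b x u)))))
        (trans (FS.solve 5 (λ a b c d e → a FS.:+ ((b FS.:+ c) FS.:+ (d FS.:+ e)) FS.:= (a FS.:+ e) FS.:+ (c FS.:+ d) FS.:+ b) refl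
            (μ (Q x) (Q u)) (θ (Q u) (Q u)) (θ (Q u) (b x u)) (θ (b x u) (Q u)) (θ (b x u) (b x u)))
          (cong (λ m → (μ (Q x) (Q u) + θ (b x u) (b x u)) + m + θ (Q u) (Q u)) (sym (μ≡ (Q u) (b x u))))))
      where
      swap₄ : ∀ a b c d → (a + b) + (c + d) ≡ (a + c) + (b + d)
      swap₄ = FS.solve 4 (λ a b c d → (a FS.:+ b) FS.:+ (c FS.:+ d) FS.:= (a FS.:+ c) FS.:+ (b FS.:+ d)) refl

    Δ-T : ∀ w u x → Δ w (T u) x ≡ (μ (β x x) (b w u) + μ (b x w) (b x u)) + (μ (Q w) (b x u) + μ (b x w) (b w u)) + μ (Q w) (b w u)
    Δ-T w u x = trans (cong (_+ - T u x) (trans (cong₂ μ (trans (Q-⊕ x w) (V-ring.+-assoc (Q x) (Q w) (b x w))) (b-linˡ u x w))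
        (trans (linˡ μ-bil′ (b x u ⊕ b w u) (Q x) (Q w ⊕ b x w)) (cong₂ _+_ (linʳ μ-bil′ (Q x) (b x u) (b w u))
          (trans (linˡ μ-bil′ (b x u ⊕ b w u) (Q w) (b x w)) (cong₂ _+_ (linʳ μ-bil′ (Q w) (b x u) (b w u)) (linʳ μ-bil′ (b x w) (b x u) (b w u))))))))
      (FS.solve 6 (λ a b c d e f → ((a FS.:+ b) FS.:+ ((c FS.:+ d) FS.:+ (e FS.:+ f))) FS.:- a FS.:= (b FS.:+ e) FS.:+ (c FS.:+ f) FS.:+ d) refl
        (μ (Q x) (b x u)) (μ (Q x) (b w u)) (μ (Q w) (b x u)) (μ (Q w) (b w u)) (μ (b x w) (b x u)) (μ (b x w) (b w u)))

    Δ²-T : ∀ y z w u x → Δ y (Δ z (Δ w (T u))) x ≡ Pairings μ b y z w u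
    Δ²-T y z w u x = trans (second-difference {M = λ x y → μ (β x y) (b w u) + μ (b x w) (b y u)}
        (record { linˡ = λ v x y → trans (cong₂ _+_ (linˡ (μQ-bil (b w u)) v x y)
                     (trans (cong (λ c → μ c (b v u)) (b-linˡ w x y)) (linˡ μ-bil′ (b v u) (b x w) (b y w)))) (swap₄ _ _ _ _)
                ; linʳ = λ v x y → trans (cong₂ _+_ (linʳ (μQ-bil (b w u)) v x y)
                     (trans (cong (μ (b v w)) (b-linˡ u x y)) (linʳ μ-bil′ (b v w) (b x u) (b y u)))) (swap₄ _ _ _ _) })
        {φ = λ x → μ (Q w) (b x u) + μ (b x w) (b w u)}
        (λ x y → trans (cong₂ _+_ (trans (cong (μ (Q w)) (b-linˡ u x y)) (linʳ μ-bil′ (Q w) (b x u) (b y u)))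
                                  (trans (cong (λ c → μ c (b w u)) (b-linˡ w x y)) (linˡ μ-bil′ (b w u) (b x w) (b y w)))) (swap₄ _ _ _ _))
        (μ (Q w) (b w u)) (Δ-T w u) y z x)
      (trans (FS.solve 4 (λ a b c d → (a FS.:+ b) FS.:+ (c FS.:+ d) FS.:= (a FS.:+ c) FS.:+ b FS.:+ d) refl
          (μ (β y z) (b w u)) (μ (b y w) (b z u)) (μ (β z y) (b w u)) (μ (b z w) (b y u)))
        (cong₂ (λ a c → a + μ (b y w) (b z u) + c)
          (trans (sym (linˡ μ-bil′ (b w u) (β y z) (β z y))) (cong (λ v → μ v (b w u)) (sym (b≡ y z)))) (μ-comm′ (b z w) (b y u))))
      where
      swap₄ : ∀ a b c d → (a + b) + (c + d) ≡ (a + c) + (b + d)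
      swap₄ = FS.solve 4 (λ a b c d → (a FS.:+ b) FS.:+ (c FS.:+ d) FS.:= (a FS.:+ c) FS.:+ (b FS.:+ d)) refl

    abstract
      -- The three remaining differences annihilate the quadratic `R u` and turn the cubic `T u`
      -- into the pairings.
      square-polarization : ∀ y z w u x → Δ y (Δ z (Δ w (Δ u square))) x ≡ Pairings μ b y z w u
      square-polarization y z w u x = trans (Δ-cong (Δ-cong (λ x → trans (Δ-cong (Δ-square u) w x) (Δ-+ (T u) (R u) w x)) z) y x)
        (trans (Δ-cong (Δ-+ (Δ w (T u)) (Δ w (R u)) z) y x) (trans (Δ-+ (Δ z (Δ w (T u))) (Δ z (Δ w (R u))) y x)
          (trans (+0 (R-der u w z y x)) (Δ²-T y z w u x))))

  -- In characteristic 2 the coefficient form is alternating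

  module _ {n k} {b : V n → V n → V k} (b-sym : SymForms b) {μ : V k → V k → F} (μ-bil : Bil μ) (μ-comm : ∀ x y → μ x y ≡ μ y x)
           {g : Fun n} (Dg : Der 5 g) (exact : ∀ y z w u → quartic-form g y z w u ≡ Pairings μ b y z w u) where

    private
      β : V n → V n → V k
      β = proj₁ (halveᵛ k b-sym)
      β-bil : VBil β
      β-bil = proj₁ (proj₂ (halveᵛ k b-sym))
      b≡ : ∀ x y → b x y ≡ β x y ⊕ β y x
      b≡ = proj₂ (proj₂ (halveᵛ k b-sym))
      b-linˡ : ∀ u → Linᵛ (λ w → b w u)
      b-linˡ = linˡ-f b-sym
      b-linʳ : ∀ w → Linᵛ (b w)
      b-linʳ = linʳ-f b-sym
      b-comm : ∀ w u → b w u ≡ b u w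
      b-comm = comm-f b-sym

      Q : V n → V k
      Q x = β x x

      Q-⊕ : ∀ x y → Q (x ⊕ y) ≡ Q x ⊕ Q y ⊕ b x y
      Q-⊕ x y = trans (linˡ-v β-bil (x ⊕ y) x y) (trans (cong₂ _⊕_ (linʳ-v β-bil x x y) (linʳ-v β-bil y x y))
        (trans (VS.solve 4 (λ a b c d → (a VS.:+ b) VS.:+ (c VS.:+ d) VS.:= (a VS.:+ d) VS.:+ (b VS.:+ c)) refl (β x x) (β x y) (β y x) (β y y))
          (cong (β x x ⊕ β y y ⊕_) (sym (b≡ x y)))))

      C : V n → V n → V n → F
      C y z w = Δ y (Δ z (Δ w g)) 𝟎

    -- The third difference of g, corrected so as to be trilinear.
    N : V n → V n → V n → F
    N y z w = C y z w + - ((μ (Q y) (b z w) + μ (Q z) (b y w) + μ (Q w) (b y z))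
                           + (μ (b y z) (b y w) + μ (b z y) (b z w) + μ (b w y) (b w z)))

    -- Additivity of `C` fails by the fourth difference, hence by the three pairings. The terms with
    -- `Q` account for the first of them, since `Q` polarises to `b`, and the products of two values
    -- of `b` for the two others.
    N-lin : ∀ z w → Lin (λ y → N y z w)
    N-lin z w x y = begin
      N (x ⊕ y) z w
        ≡⟨ cong₂ (λ c d → c + - d) C-split (cong₂ _+_
             (cong₂ _+_ (cong₂ _+_ q₁ (trans (cong (μ (Q z)) (b-linˡ w x y)) (linʳ μ-bil (Q z) (b x w) (b y w))))
                                      (trans (cong (μ (Q w)) (b-linˡ z x y)) (linʳ μ-bil (Q w) (b x z) (b y z))))
             (cong₂ _+_ (cong₂ _+_ q₂ (trans (cong (λ v → μ v (b z w)) (b-linʳ z x y)) (linˡ μ-bil (b z w) (b z x) (b z y))))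
                                      (trans (cong (λ v → μ v (b w z)) (b-linʳ w x y)) (linˡ μ-bil (b w z) (b w x) (b w y))))) ⟩
      _ ≡⟨ FS.solve 17 (λ Cx Cy p₁ p₂ p₃ a₁ a₂ b₁ b₂ c₁ c₂ d₁ d₂ e₁ e₂ f₁ f₂ →
             (Cx FS.:+ Cy FS.:+ (p₁ FS.:+ p₂ FS.:+ p₃)) FS.:-
               (((a₁ FS.:+ a₂ FS.:+ p₁) FS.:+ (b₁ FS.:+ b₂) FS.:+ (c₁ FS.:+ c₂))
                 FS.:+ (((d₁ FS.:+ p₂) FS.:+ (p₃ FS.:+ d₂)) FS.:+ (e₁ FS.:+ e₂) FS.:+ (f₁ FS.:+ f₂)))
             FS.:= (Cx FS.:- ((a₁ FS.:+ b₁ FS.:+ c₁) FS.:+ (d₁ FS.:+ e₁ FS.:+ f₁)))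
                   FS.:+ (Cy FS.:- ((a₂ FS.:+ b₂ FS.:+ c₂) FS.:+ (d₂ FS.:+ e₂ FS.:+ f₂)))) refl
           (C x z w) (C y z w) (μ (b x y) (b z w)) (μ (b x z) (b y w)) (μ (b x w) (b y z))
           (μ (Q x) (b z w)) (μ (Q y) (b z w)) (μ (Q z) (b x w)) (μ (Q z) (b y w)) (μ (Q w) (b x z)) (μ (Q w) (b y z))
           (μ (b x z) (b x w)) (μ (b y z) (b y w)) (μ (b z x) (b z w)) (μ (b z y) (b z w)) (μ (b w x) (b w z)) (μ (b w y) (b w z)) ⟩
      N x z w + N y z w ∎
      where
      open ≡-Reasoning
      C-split : C (x ⊕ y) z w ≡ C x z w + C y z w + (μ (b x y) (b z w) + μ (b x z) (b y w) + μ (b x w) (b y z))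
      C-split = trans (Δ-⊕ (Δ z (Δ w g)) x y 𝟎) (cong (C x z w + C y z w +_) (exact x y z w))
      q₁ : μ (Q (x ⊕ y)) (b z w) ≡ μ (Q x) (b z w) + μ (Q y) (b z w) + μ (b x y) (b z w)
      q₁ = trans (cong (λ v → μ v (b z w)) (Q-⊕ x y)) (trans (linˡ μ-bil (b z w) (Q x ⊕ Q y) (b x y))
        (cong (_+ μ (b x y) (b z w)) (linˡ μ-bil (b z w) (Q x) (Q y))))
      q₂ : μ (b (x ⊕ y) z) (b (x ⊕ y) w) ≡ (μ (b x z) (b x w) + μ (b x z) (b y w)) + (μ (b x w) (b y z) + μ (b y z) (b y w))
      q₂ = trans (cong₂ μ (b-linˡ z x y) (b-linˡ w x y)) (trans (linˡ μ-bil (b x w ⊕ b y w) (b x z) (b y z))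
        (cong₂ _+_ (linʳ μ-bil (b x z) (b x w) (b y w)) (trans (linʳ μ-bil (b y z) (b x w) (b y w))
          (cong (_+ μ (b y z) (b y w)) (μ-comm (b y z) (b x w))))))

    N-sym³ : Sym³ N
    N-sym³ = record
      { lin₁ = N-lin
      ; s₁₂ = λ y z w → cong₂ (λ c d → c + - d) (Δ-swap (Δ w g) y z 𝟎) (cong₂ _+_
          (trans (cong (λ v → μ (Q y) (b z w) + μ (Q z) (b y w) + μ (Q w) v) (b-comm y z))
            (cong (_+ μ (Q w) (b z y)) (F-ring.+-comm _ _)))
          (trans (cong (μ (b y z) (b y w) + μ (b z y) (b z w) +_) (μ-comm (b w y) (b w z)))
            (cong (_+ μ (b w z) (b w y)) (F-ring.+-comm _ _))))
      ; s₂₃ = λ y z w → cong₂ (λ c d → c + - d) (Δ-cong (Δ-swap g z w) y 𝟎) (cong₂ _+_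
          (trans (cong (λ v → μ (Q y) v + μ (Q z) (b y w) + μ (Q w) (b y z)) (b-comm z w))
            (rotate (μ (Q y) (b w z)) (μ (Q z) (b y w)) (μ (Q w) (b y z))))
          (trans (cong (λ v → v + μ (b z y) (b z w) + μ (b w y) (b w z)) (μ-comm (b y z) (b y w)))
            (rotate (μ (b y w) (b y z)) (μ (b z y) (b z w)) (μ (b w y) (b w z))))) }
      where
      rotate : ∀ a b c → a + b + c ≡ a + c + b
      rotate = FS.solve 3 (λ a b c → a FS.:+ b FS.:+ c FS.:= a FS.:+ c FS.:+ b) refl

    open Sym³ N-sym³

    -- A difference taken twice in one direction vanishes in characteristic 2, and of the
    -- corrections a single one survives. Thus information on `N` becomes information on the
    -- diagonal of `μ`.
    N-diagonal : Char2 → ∀ y z → N y z z ≡ - μ (b y z) (b y z)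
    N-diagonal ch2 y z = trans (cong₂ (λ c d → c + - d) (Δ-char2-inner) (cong₂ _+_
        (sum₂ₐ (trans (cong (μ (Q y)) zz) (lin-𝟎 (linʳ μ-bil (Q y)))) (μ (Q z) (b y z)))
        (trans (cong₂ (λ u v → μ (b y z) (b y z) + u + v) (zero-r (b z y)) (zero-r (b z y)))
          (FS.solve 2 (λ a o → a FS.:+ o FS.:+ o FS.:= a FS.:+ (o FS.:+ o)) refl (μ (b y z) (b y z)) 0#))))
      (trans (cong (λ v → 0# + - (v + (μ (b y z) (b y z) + (0# + 0#)))) (char2-+ ch2 (μ (Q z) (b y z))))
        (trans (cong (λ v → 0# + - (0# + (μ (b y z) (b y z) + v))) (F-ring.+-identityˡ 0#))
          (trans (F-ring.+-identityˡ _) (cong -_ (trans (F-ring.+-identityˡ _) (F-ring.+-identityʳ _))))))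
      where
      zz : b z z ≡ 𝟎
      zz = alt-f b-sym ch2 z
      zero-r : ∀ v → μ v (b z z) ≡ 0#
      zero-r v = trans (cong (μ v) zz) (lin-𝟎 (linʳ μ-bil v))
      Δ-char2-inner : C y z z ≡ 0#
      Δ-char2-inner = trans (cong₂ (λ a b → a + - b) (Δ-char2 ch2 g z (𝟎 ⊕ y)) (Δ-char2 ch2 g z 𝟎)) (x-x≡0 0#)
      sum₂ₐ : ∀ {a} → a ≡ 0# → ∀ v → a + v + v ≡ v + v
      sum₂ₐ refl v = cong (_+ v) (F-ring.+-identityˡ v)

    kerCut : ∀ y → Cut {n} k
    kerCut y = cut-mono (ℕₚ.≤-reflexive (length-coords k (b y))) (proj₁ (cut-ker (coords (b y))))

    kerCut-kills : ∀ y x → b y (Π (kerCut y) x) ≡ 𝟎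
    kerCut-kills y x = coords-⟂ (b-linʳ y) (proj₂ (cut-ker (coords (b y))) x)

    -- The polarization of the quadratic function Δ y g on a coset of ker (b y).
    coset-form : V n → V n → Form n
    coset-form y a z w = Δ y (Δ (Π (kerCut y) z) (Δ (Π (kerCut y) w) g)) a

    private
      shiftVec : V n → V n → V k
      shiftVec y a = rep (λ v → μ (Q y) v + μ (b y a) v)

      shift-correct : ∀ y a v → μ (Q y) v + μ (b y a) v ≡ ⟨ shiftVec y a , v ⟩
      shift-correct y a = rep-correct (λ u v → trans (cong₂ _+_ (linʳ μ-bil (Q y) u v) (linʳ μ-bil (b y a) u v))
        (FS.solve 4 (λ a b c d → (a FS.:+ b) FS.:+ (c FS.:+ d) FS.:= (a FS.:+ c) FS.:+ (b FS.:+ d)) refl _ _ _ _))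

      adjusted : V n → V k → Form n
      adjusted y c z w = N y z w + (c ∙ b) z w

      adjusted-bil : ∀ y c → Bil (adjusted y c)
      adjusted-bil y c = record
        { linˡ = λ u x x′ → trans (cong₂ _+_ (lin₂ y u x x′) (linˡ (∙-bil b-sym c) u x x′)) (swap₄ (N y x u) _ _ _)
        ; linʳ = λ w x x′ → trans (cong₂ _+_ (lin₃ y w x x′) (linʳ (∙-bil b-sym c) w x x′)) (swap₄ (N y w x) _ _ _) }
        where
        swap₄ : ∀ a b c d → (a + b) + (c + d) ≡ (a + c) + (b + d)
        swap₄ = FS.solve 4 (λ a b c d → (a FS.:+ b) FS.:+ (c FS.:+ d) FS.:= (a FS.:+ c) FS.:+ (b FS.:+ d)) refl

      -- On the kernel of `b y` every correction term with `b y Z` or `b y W` vanishes. What is left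
      -- besides `N` is linear in `b Z W`, with coefficients that depend on the base point `a`.
      coset-form≡ : ∀ y a z w → coset-form y a z w ≡ adjusted y (shiftVec y a) (Π (kerCut y) z) (Π (kerCut y) w)
      coset-form≡ y a z w = trans (Δ-at (Δ y (Δ Z (Δ W g))) a) (trans
        (cong (C y Z W +_) (trans (exact a y Z W) (cong₂ _+_ (cong₂ _+_ (cong (λ v → μ v (b Z W)) (b-comm a y)) (zeroʳ (b a Z) yW)) (zeroʳ (b a W) yZ))))
        (trans (simplify (C y Z W) (μ (Q y) (b Z W)) (μ (b y a) (b Z W)) 0#)
          (cong₂ _+_ (cong (λ d → C y Z W + - d) (sym (cong₂ _+_
              (cong₂ _+_ (cong (μ (Q y) (b Z W) +_) (zeroʳ (Q Z) yW)) (zeroʳ (Q W) yZ))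
              (cong₂ _+_ (cong₂ _+_ (zeroˡ (b y W) yZ) (zeroˡ (b Z W) Zy)) (zeroˡ (b W Z) Wy)))))
            (shift-correct y a (b Z W)))))
        where
        Z W : V n
        Z = Π (kerCut y) z
        W = Π (kerCut y) w
        yZ : b y Z ≡ 𝟎
        yZ = kerCut-kills y z
        yW : b y W ≡ 𝟎
        yW = kerCut-kills y w
        Zy : b Z y ≡ 𝟎
        Zy = trans (b-comm Z y) yZ
        Wy : b W y ≡ 𝟎
        Wy = trans (b-comm W y) yW
        zeroʳ : ∀ v {x} → x ≡ 𝟎 → μ v x ≡ 0#
        zeroʳ v refl = lin-𝟎 (linʳ μ-bil v)
        zeroˡ : ∀ v {x} → x ≡ 𝟎 → μ x v ≡ 0#
        zeroˡ v refl = lin-𝟎 (linˡ μ-bil v)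
        simplify : ∀ c q m o → c + (m + 0# + 0#) ≡ (c + - ((q + 0# + 0#) + (0# + 0# + 0#))) + (q + m)
        simplify c q m o = trans (cong (c +_) (trans (F-ring.+-identityʳ _) (F-ring.+-identityʳ m)))
          (trans (FS.solve 3 (λ c q m → c FS.:+ m FS.:= (c FS.:- q) FS.:+ (q FS.:+ m)) refl c q m)
            (cong (λ d → (c + - d) + (q + m)) (sym (trans (cong₂ _+_ (trans (F-ring.+-identityʳ _) (F-ring.+-identityʳ q))
              (trans (F-ring.+-identityʳ _) (F-ring.+-identityʳ 0#))) (F-ring.+-identityʳ q)))))

      coset-form-bil : ∀ y a → Bil (coset-form y a)
      coset-form-bil y a = record
        { linˡ = λ u x x′ → trans (coset-form≡ y a (x ⊕ x′) u) (trans (cong (λ v → adjusted y c v (P u)) (P-lin x x′))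
            (trans (linˡ (adjusted-bil y c) (P u) (P x) (P x′)) (sym (cong₂ _+_ (coset-form≡ y a x u) (coset-form≡ y a x′ u)))))
        ; linʳ = λ w x x′ → trans (coset-form≡ y a w (x ⊕ x′)) (trans (cong (adjusted y c (P w)) (P-lin x x′))
            (trans (linʳ (adjusted-bil y c) (P w) (P x) (P x′)) (sym (cong₂ _+_ (coset-form≡ y a w x) (coset-form≡ y a w x′))))) }
        where
        c : V k
        c = shiftVec y a
        P : V n → V n
        P = Π (kerCut y)
        P-lin : Linᵛ P
        P-lin = Π-lin (kerCut y)

    module _ (ch2 : Char2) {A k′ : ℕ} (k≤k′ : k ≤ℕ k′) (robust : Robust (char2Cost A k′) b)
             (dense : p ^ℕ n *ℕ (p ^ℕ n *ℕ p ^ℕ n) ≤ℕ A *ℕ ∑ᵛ (λ y → ∑ᵛ (λ a → vanishing (coset-form y a)))) where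

      private
        k₂ : ℕ
        k₂ = 2 *ℕ A

        cosets : V n → ℕ
        cosets y = ∑ᵛ (λ a → vanishing (coset-form y a))

        vanishing≤ : ∀ {M : Form n} → vanishing M ≤ℕ p ^ℕ n
        vanishing≤ {M} = #≤ (λ w → search-∀ search-V (λ u → M w u ≟ 0#))

        cosets≤ : ∀ y → cosets y ≤ℕ p ^ℕ n *ℕ p ^ℕ n
        cosets≤ y = ℕₚ.≤-trans (∑ᵛ-mono (λ a → vanishing≤ {coset-form y a})) (ℕₚ.≤-reflexive (∑ᵛ-const n (p ^ℕ n)))

        many : p ^ℕ n ≤ℕ k₂ *ℕ # (λ y → p ^ℕ n *ℕ p ^ℕ n ℕₚ.≤? k₂ *ℕ cosets y)
        many = markov cosets {p ^ℕ n *ℕ p ^ℕ n} {A} (ℕₚ.*-mono-< (pⁿ>0 n) (pⁿ>0 n)) cosets≤ dense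

        -- The combination of `b` depends on the coset and is not controlled, so that small rank can
        -- be claimed only modulo such combinations.
        Good : ℕ → V n → Set
        Good r y = ∃[ c ] Rank≤ r (adjusted y c)

        good-𝟎 : Good 0 𝟎
        good-𝟎 = 𝟎 , rank-cong (λ z w → sym (sum₂ (lin-𝟎 (lin₁ z w)) (⟨𝟎,⟩ (b z w)))) rank-0

        good-⊕ : ∀ {r s x y} → Good r x → Good s y → Good (r +ℕ s) (x ⊕ y)
        good-⊕ {x = x} {y} (c , rc) (d , rd) = c ⊕ d , rank-cong (λ z w → trans
          (FS.solve 4 (λ a b c d → (a FS.:+ b) FS.:+ (c FS.:+ d) FS.:= (a FS.:+ c) FS.:+ (b FS.:+ d)) refl (N x z w) _ (N y z w) _)
          (sym (cong₂ _+_ (lin₁ z w x y) (⟨⟩-linˡ (b z w) c d)))) (rank-+ rc rd)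

        -- Some coset has a large radical, which gives rank `k₂` on the kernel of `b y`; leaving
        -- that kernel costs `k` for each argument.
        good-row : ∀ {y} → p ^ℕ n *ℕ p ^ℕ n ≤ℕ k₂ *ℕ cosets y → Good (k₂ +ℕ k +ℕ k) y
        good-row {y} rich = good (average (λ a → vanishing (coset-form y a)) {p ^ℕ n} {k₂} rich)
          where
          good : ∃[ a ] p ^ℕ n ≤ℕ k₂ *ℕ vanishing (coset-form y a) → Good (k₂ +ℕ k +ℕ k) y
          good (a , many) = shiftVec y a , rank-uncut (adjusted-bil y (shiftVec y a)) (kerCut y)
            (rank-cong (coset-form≡ y a) (vanishing→rank (coset-form-bil y a) many))

        cosets-𝟎 : cosets 𝟎 ≡ p ^ℕ n *ℕ p ^ℕ n
        cosets-𝟎 = trans (∑ᵛ-cong (λ a → trans (∑ᵛ-cong {n} (λ z → ind-yes (search-∀ search-V (λ w → coset-form 𝟎 a z w ≟ 0#))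
            (λ w → trans (cong (λ v → h z w v + - h z w a) (V-ring.+-identityʳ a)) (x-x≡0 (h z w a)))))
            (trans (∑ᵛ-const n 1) (ℕₚ.*-identityʳ _)))) (∑ᵛ-const n (p ^ℕ n))
          where
          h : V n → V n → Fun n
          h z w = Δ (Π (kerCut 𝟎) z) (Δ (Π (kerCut 𝟎) w) g)

        ⊝-char2 : ∀ (x : V n) → ⊝ x ≡ x
        ⊝-char2 x = trans (VS.solve 1 (λ x → VS.:- x VS.:= x VS.:- (x VS.:+ x)) refl x)
          (trans (cong (x ⊖_) (char2-⊕ ch2 x)) (trans (cong (x ⊕_) (linᵛ-𝟎 {f = ⊝_} (λ x y → sym (⊝-⊕ x y)))) (V-ring.+-identityʳ x)))
          where
          ⊝-⊕ : ∀ (x y : V n) → ⊝ x ⊕ ⊝ y ≡ ⊝ (x ⊕ y)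
          ⊝-⊕ = VS.solve 2 (λ x y → VS.:- x VS.:+ VS.:- y VS.:= VS.:- (x VS.:+ y)) refl

        r : ℕ
        r = remainderRank A k′

        good-subspace : ∃[ Λ ] length Λ ≤ℕ k₂ × (∀ {y} → Λ ⟂ y → Good r y)
        good-subspace =
          let Λ , Λ≤ , good = dense-good Good good-𝟎 (λ {a} {b} → good-⊕ {a} {b}) (λ y → p ^ℕ n *ℕ p ^ℕ n ℕₚ.≤? k₂ *ℕ cosets y)
                (subst (λ m → p ^ℕ n *ℕ p ^ℕ n ≤ℕ k₂ *ℕ m) (sym cosets-𝟎)
                  (ℕₚ.≤-trans (ℕₚ.≤-reflexive (sym (ℕₚ.*-identityˡ _))) (ℕₚ.*-monoˡ-≤ _ (dense⇒k>0 {n} {k₂} many))))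
                (λ {y} rich → subst (λ v → p ^ℕ n *ℕ p ^ℕ n ≤ℕ k₂ *ℕ cosets v) (sym (⊝-char2 y)) rich)
                {k₂} {k₂ +ℕ k +ℕ k} many good-row
          in Λ , Λ≤ , λ Λy → let c , rc = good Λy in c , rank-mono (ℕₚ.*-monoʳ-≤ (3× k₂) (ℕₚ.+-mono-≤ (ℕₚ.+-monoʳ-≤ k₂ k≤k′) k≤k′)) rc

        module _ (P₁ : Cut {n} k₂) (near : ∀ y → Good r (Π P₁ y)) where

          coeff : V n → V k
          coeff y = ⊝ proj₁ (near y)

          coeff-near : ∀ y → Rank≤ r (λ z w → N (Π P₁ y) z w + - (coeff y ∙ b) z w)
          coeff-near y = rank-cong (λ z w → cong (N (Π P₁ y) z w +_)
            (trans (FS.solve 1 (λ a → a FS.:= FS.:- (FS.:- a)) refl _) (cong -_ (sym (lin-⊝ (⟨⟩-linˡ (b z w)) (proj₁ (near y)))))))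
            (proj₂ (near y))

          -- Linear coefficients vanish on a subspace of codimension at most `k`, and there `N y`
          -- has small rank without any combination of `b`.
          coeff-lin : Linᵛ coeff
          coeff-lin = coefficients-linear {N = λ y → N (Π P₁ y)} {q = b} (ℕₚ.m≤m+n (r +ℕ (r +ℕ r)) _) robust
            (λ z w x y → trans (cong (λ v → N v z w) (Π-lin P₁ x y)) (lin₁ z w (Π P₁ x) (Π P₁ y))) coeff coeff-near

          P₂ : Cut {n} k
          P₂ = cut-mono (ℕₚ.≤-reflexive (length-coords k coeff)) (proj₁ (cut-ker (coords coeff)))

          P : Cut {n} (k₂ +ℕ k)
          P = cut-∘ P₁ P₂

          P-flat : ∀ y → Rank≤ r (N (Π P y))
          P-flat y = rank-cong (λ z w → trans (cong (λ c → N (Π P y) z w + - ⟨ c , b z w ⟩) (coords-⟂ coeff-lin (proj₂ (cut-ker (coords coeff)) y)))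
            (trans (cong (λ v → N (Π P y) z w + - v) (⟨𝟎,⟩ (b z w))) (+0 -0#≈0#))) (coeff-near (Π P₂ y))
            where open import Algebra.Properties.Ring F-ring.ring using (-0#≈0#)

          Nᴾ : V n → V n → V n → F
          Nᴾ y z w = N (Π P y) (Π P z) (Π P w)

          Nᴾ-sym³ : Sym³ Nᴾ
          Nᴾ-sym³ = record
            { lin₁ = λ w u x y → trans (cong (λ v → N v (Π P w) (Π P u)) (Π-lin P x y)) (lin₁ (Π P w) (Π P u) (Π P x) (Π P y))
            ; s₁₂ = λ y w u → s₁₂ (Π P y) (Π P w) (Π P u)
            ; s₂₃ = λ y w u → s₂₃ (Π P y) (Π P w) (Π P u) }

          Nᴾ-kernel : ∃[ Λ ] length Λ ≤ℕ cubicCost r × (∀ {y w u} → Λ ⟂ y → Λ ⟂ w → Λ ⟂ u → Nᴾ y w u ≡ 0#)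
          Nᴾ-kernel = cubic-kernel {r = r} {T = Nᴾ} Nᴾ-sym³ (λ y → rank-∘ (Π-lin P) (Π-lin P) (P-flat y))

          d : V k
          d = rep (λ x → μ x x)

          -- In characteristic 2 the cross terms cancel by symmetry. The diagonal of `μ` is thus a
          -- functional, given by `d`; since `N` vanishes on a subspace, `d ∙ b` does too, and
          -- robustness makes `d` zero.
          square-lin : Lin (λ x → μ x x)
          square-lin x y = trans (linˡ μ-bil (x ⊕ y) x y) (trans (cong₂ _+_ (linʳ μ-bil x x y) (linʳ μ-bil y x y))
            (trans (cong (λ m → (μ x x + μ x y) + (m + μ y y)) (μ-comm y x))
              (trans (FS.solve 3 (λ a b c → (a FS.:+ b) FS.:+ (b FS.:+ c) FS.:= (a FS.:+ c) FS.:+ (b FS.:+ b)) refl (μ x x) (μ x y) (μ y y))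
                (+0 (char2-+ ch2 (μ x y))))))

          d-rank : Rank≤ (char2Cost A k′) (d ∙ b)
          d-rank = rank-mono (ℕₚ.≤-trans (ℕₚ.+-mono-≤ (ℕₚ.+-mono-≤ (ℕₚ.+-mono-≤ Λ≤ Λ≤) k+) k+) (ℕₚ.m≤n+m _ (r +ℕ (r +ℕ r))))
            (rank-uncut (∙-bil b-sym d) P (ker²→rank (record
              { linˡ = λ u x y → trans (cong (λ v → (d ∙ b) v (Π P u)) (Π-lin P x y)) (linˡ (∙-bil b-sym d) (Π P u) (Π P x) (Π P y))
              ; linʳ = λ w x y → trans (cong ((d ∙ b) (Π P w)) (Π-lin P x y)) (linʳ (∙-bil b-sym d) (Π P w) (Π P x) (Π P y)) })
              (proj₁ Nᴾ-kernel) (λ {y} {z} Λy Λz → trans (sym (rep-correct square-lin (b (Π P y) (Π P z))))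
                (trans (FS.solve 1 (λ a → a FS.:= FS.:- (FS.:- a)) refl (μ (b (Π P y) (Π P z)) (b (Π P y) (Π P z))))
                  (trans (cong -_ (trans (sym (N-diagonal ch2 (Π P y) (Π P z))) (proj₂ (proj₂ Nᴾ-kernel) Λy Λz Λz))) -0#≈0#)))))
            where
            open import Algebra.Properties.Ring F-ring.ring using (-0#≈0#)
            Λ≤ : length (proj₁ Nᴾ-kernel) ≤ℕ cubicCost r
            Λ≤ = proj₁ (proj₂ Nᴾ-kernel)
            k+ : k₂ +ℕ k ≤ℕ k₂ +ℕ k′
            k+ = ℕₚ.+-monoʳ-≤ k₂ k≤k′

          square-zero : ∀ x → μ x x ≡ 0#
          square-zero x = trans (rep-correct square-lin x) (trans (cong ⟨_, x ⟩ (robust-zero {q = b} robust {d} d-rank)) (⟨𝟎,⟩ x))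

      abstract
        μ-alternating : ∀ x → μ x x ≡ 0#
        μ-alternating = square-zero (cut-mono (proj₁ (proj₂ good-subspace)) (proj₁ (cut-ker (proj₁ good-subspace))))
          (λ y → proj₂ (proj₂ good-subspace) (proj₂ (cut-ker (proj₁ good-subspace)) y))

  -- Newton's formula

  ι : ℕ → F
  ι zero    = 0#
  ι (suc m) = 1# + ι m

  -- The value 0 at 0 allows the binomial polynomials to be written down in every characteristic;
  -- invertibility is asked for only where they are used.
  recip : F → F
  recip a with a ≟ 0#
  ... | yes _   = 0#
  ... | no  a≢0 = proj₁ (inverse a a≢0)

  recip-inverse : ∀ {a} → ¬ a ≡ 0# → recip a * a ≡ 1#
  recip-inverse {a} a≢0 with a ≟ 0#
  ... | yes a≡0  = contradiction a≡0 a≢0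
  ... | no  a≢0′ = proj₂ (inverse a a≢0′)

  *-cancelˡ : ∀ {c x y} → ¬ c ≡ 0# → c * x ≡ c * y → x ≡ y
  *-cancelˡ {c} {x} {y} c≢0 cx≡cy = x-y≡0⇒x≡y (*-cancel c≢0 (trans
    (FS.solve 3 (λ c x y → c FS.:* (x FS.:- y) FS.:= c FS.:* x FS.:- c FS.:* y) refl c x y)
    (trans (cong (_+ - (c * y)) cx≡cy) (x-x≡0 (c * y)))))

  -- binom k t is the binomial coefficient "t choose k", as long as 1, …, k are
  -- invertible; binom′ k t is binom (suc k) t / t.
  binom′ binom : ℕ → F → F
  binom′ zero    t = recip (ι 1)
  binom′ (suc k) t = recip (ι (2 +ℕ k)) * ((t + - ι (suc k)) * binom′ k t)
  binom zero    t = 1#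
  binom (suc k) t = t * binom′ k t

  Invertible< : ℕ → Set
  Invertible< m = ∀ {k} → k ℕ.< m → ¬ ι (suc k) ≡ 0#

  binom-suc : ∀ k t → ¬ ι (suc k) ≡ 0# → ι (suc k) * binom (suc k) t ≡ (t + - ι k) * binom k t
  binom-suc zero    t ι≢0 = trans (FS.solve 3 (λ a t r → a FS.:* (t FS.:* r) FS.:= t FS.:* (r FS.:* a)) refl (ι 1) t (recip (ι 1)))
    (trans (cong (t *_) (recip-inverse ι≢0)) (cong (_* 1#) (sym (trans (cong (t +_) -0#≈0#) (F-ring.+-identityʳ t)))))
    where open import Algebra.Properties.Ring F-ring.ring using (-0#≈0#)
  binom-suc (suc k) t ι≢0 = trans
    (FS.solve 5 (λ a t r s b → a FS.:* (t FS.:* (r FS.:* (s FS.:* b))) FS.:= (r FS.:* a) FS.:* (s FS.:* (t FS.:* b))) refl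
      (ι (2 +ℕ k)) t (recip (ι (2 +ℕ k))) (t + - ι (suc k)) (binom′ k t))
    (trans (cong (_* ((t + - ι (suc k)) * (t * binom′ k t))) (recip-inverse ι≢0)) (F-ring.*-identityˡ _))

  -- Verified after multiplication by `ι (suc k)`, where `binom-suc` applies; cancelling that factor
  -- is the reason for the hypothesis.
  pascal : ∀ {m} → Invertible< m → ∀ k → k ℕ.< m → ∀ t → binom (suc k) (1# + t) ≡ binom (suc k) t + binom k t
  pascal inv zero k<m t = trans (F-ring.distribʳ r 1# t) (trans (F-ring.+-comm (1# * r) (t * r))
    (cong (t * r +_) (trans (F-ring.*-identityˡ r) (trans (sym (F-ring.*-identityʳ r))
      (trans (cong (r *_) (sym (F-ring.+-identityʳ 1#))) (recip-inverse (inv k<m)))))))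
    where
    r : F
    r = recip (ι 1)
  pascal inv (suc k) k<m t = *-cancelˡ (inv k<m) (begin
    ι (2 +ℕ k) * binom (2 +ℕ k) (1# + t)                                 ≡⟨ binom-suc (suc k) (1# + t) (inv k<m) ⟩
    ((1# + t) + - (1# + ι k)) * binom (suc k) (1# + t)                   ≡⟨ cong (((1# + t) + - (1# + ι k)) *_) (pascal inv k (ℕₚ.<-trans (ℕₚ.n<1+n k) k<m) t) ⟩
    ((1# + t) + - (1# + ι k)) * (B + binom k t)                          ≡⟨ FS.solve 5 (λ u t n B b → ((u FS.:+ t) FS.:- (u FS.:+ n)) FS.:* (B FS.:+ b) FS.:= (t FS.:- n) FS.:* B FS.:+ (t FS.:- n) FS.:* b) refl 1# t (ι k) B (binom k t) ⟩
    (t + - ι k) * B + (t + - ι k) * binom k t                            ≡⟨ cong ((t + - ι k) * B +_) (binom-suc k t (inv (ℕₚ.<-trans (ℕₚ.n<1+n k) k<m))) ⟨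
    (t + - ι k) * B + ι (suc k) * B                                      ≡⟨ FS.solve 4 (λ u t n B → (t FS.:- n) FS.:* B FS.:+ (u FS.:+ n) FS.:* B FS.:= (t FS.:- (u FS.:+ n)) FS.:* B FS.:+ (u FS.:+ (u FS.:+ n)) FS.:* B) refl 1# t (ι k) B ⟩
    (t + - ι (suc k)) * B + ι (2 +ℕ k) * B                               ≡⟨ cong (_+ ι (2 +ℕ k) * B) (binom-suc (suc k) t (inv k<m)) ⟨
    ι (2 +ℕ k) * binom (2 +ℕ k) t + ι (2 +ℕ k) * B                       ≡⟨ F-ring.distribˡ (ι (2 +ℕ k)) _ _ ⟨
    ι (2 +ℕ k) * (binom (2 +ℕ k) t + B)                                  ∎)
    where
    open ≡-Reasoning
    B : F
    B = binom (suc k) t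

  sumTo : ℕ → (ℕ → F) → F
  sumTo zero    g = 0#
  sumTo (suc m) g = sumTo m g + g m

  D : ∀ {n} → V n → ℕ → Fun n → Fun n
  D e zero    f = f
  D e (suc k) f = Δ e (D e k f)

  der-D : ∀ {n} e k {d} {f : Fun n} → Der (k +ℕ d) f → Der d (D e k f)
  der-D e zero    Df = Df
  der-D e (suc k) {d} {f} Df = der-D e k {suc d} (subst (λ m → Der m f) (sym (ℕₚ.+-suc k d)) Df) e

  D-step : ∀ {n} (e : V n) k f x → D e k f (x ⊕ e) ≡ D e k f x + D e (suc k) f x
  D-step e k f x = FS.solve 2 (λ a b → a FS.:= b FS.:+ (a FS.:- b)) refl (D e k f (x ⊕ e)) (D e k f x)

  module _ {m} (inv : Invertible< m) where

    -- Summation by parts with Pascal's rule. It converts a shift of the argument by `e` into the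
    -- step from `t` to `1# + t`, at the price of a boundary term that contains the difference of
    -- order one higher.
    abel : ∀ t (a : ℕ → F) j → j ≤ℕ m →
      sumTo (suc j) (λ k → binom k t * (a k + a (suc k))) ≡ sumTo (suc j) (λ k → binom k (1# + t) * a k) + binom j t * a (suc j)
    abel t a zero    _   = FS.solve 4 (λ o u b c → o FS.:+ u FS.:* (b FS.:+ c) FS.:= (o FS.:+ u FS.:* b) FS.:+ u FS.:* c) refl 0# 1# (a 0) (a 1)
    abel t a (suc j) j<m = trans (cong (_+ binom (suc j) t * (a (suc j) + a (2 +ℕ j))) (abel t a j (ℕₚ.<⇒≤ j<m)))
      (trans (FS.solve 5 (λ S b a₁ b₁ a₂ → S FS.:+ b FS.:* a₁ FS.:+ b₁ FS.:* (a₁ FS.:+ a₂) FS.:= S FS.:+ (b₁ FS.:+ b) FS.:* a₁ FS.:+ b₁ FS.:* a₂) refl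
          (sumTo (suc j) (λ k → binom k (1# + t) * a k)) (binom j t) (a (suc j)) (binom (suc j) t) (a (2 +ℕ j)))
        (cong (λ b → sumTo (suc j) (λ k → binom k (1# + t) * a k) + b * a (suc j) + binom (suc j) t * a (2 +ℕ j)) (sym (pascal inv j j<m t))))

    newton : ∀ {n} (e : V n) f → (∀ x → D e (suc m) f x ≡ 0#) → ∀ t x →
      f (x ⊕ t ⊙ e) ≡ sumTo (suc m) (λ k → binom k t * D e k f x)
    newton e f vanish = generated (λ t → ∀ x → f (x ⊕ t ⊙ e) ≡ sumTo (suc m) (λ k → binom k t * D e k f x))
      (λ x → trans (cong f (trans (cong (x ⊕_) (0⊙ e)) (V-ring.+-identityʳ x))) (sym (at-0 x m)))
      (λ t ih x → trans (cong f (trans (cong (x ⊕_) (trans (+⊙ 1# t e) (cong (_⊕ t ⊙ e) (1⊙ e)))) (sym (V-ring.+-assoc x e (t ⊙ e)))))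
        (trans (ih (x ⊕ e)) (trans (sumTo-cong (suc m) (λ k → cong (binom k t *_) (D-step e k f x)))
          (trans (abel t (λ k → D e k f x) m ℕₚ.≤-refl) (+0 (trans (cong (binom m t *_) (vanish x)) (F-ring.zeroʳ _)))))))
      where
      sumTo-cong : ∀ j {g h : ℕ → F} → (∀ k → g k ≡ h k) → sumTo j g ≡ sumTo j h
      sumTo-cong zero    g≡h = refl
      sumTo-cong (suc j) g≡h = cong₂ _+_ (sumTo-cong j g≡h) (g≡h j)
      at-0 : ∀ x j → sumTo (suc j) (λ k → binom k 0# * D e k f x) ≡ f x
      at-0 x zero    = trans (F-ring.+-identityˡ _) (F-ring.*-identityˡ _)
      at-0 x (suc j) = trans (+0 (trans (cong (_* D e (suc j) f x) (F-ring.zeroˡ _)) (F-ring.zeroˡ _))) (at-0 x j)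

    -- All terms but the first contain the factor `t`, which is going to be a linear functional.
    newton-divided : ∀ {n} (e : V n) f → (∀ x → D e (suc m) f x ≡ 0#) → ∀ t x →
      f (x ⊕ t ⊙ e) ≡ f x + t * sumTo m (λ k → binom′ k t * D e (suc k) f x)
    newton-divided e f vanish t x = trans (newton e f vanish t x) (divide m)
      where
      divide : ∀ j → sumTo (suc j) (λ k → binom k t * D e k f x) ≡ f x + t * sumTo j (λ k → binom′ k t * D e (suc k) f x)
      divide zero    = trans (F-ring.+-identityˡ _) (trans (F-ring.*-identityˡ _) (sym (+0 (F-ring.zeroʳ t))))
      divide (suc j) = trans (cong (_+ t * binom′ j t * D e (suc j) f x) (divide j))
        (FS.solve 5 (λ a t s b d → a FS.:+ t FS.:* s FS.:+ t FS.:* b FS.:* d FS.:= a FS.:+ t FS.:* (s FS.:+ b FS.:* d)) refl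
          (f x) t (sumTo j (λ k → binom′ k t * D e (suc k) f x)) (binom′ j t) (D e (suc j) f x))

  ι3⇒D³ : ∀ {n} → ι 3 ≡ 0# → ∀ (e : V n) f x → D e 3 f x ≡ 0#
  ι3⇒D³ 3≡0 e f x = trans (cong (λ v → ((f v + - a₂) + - (a₂ + - a₁)) + - ((a₂ + - a₁) + - (a₁ + - f x))) three)
    (trans (FS.solve 3 (λ a b c → ((a FS.:- c) FS.:- (c FS.:- b)) FS.:- ((c FS.:- b) FS.:- (b FS.:- a)) FS.:= (b FS.:- c) FS.:+ (b FS.:- c) FS.:+ (b FS.:- c)) refl (f x) a₁ a₂)
      (triple (a₁ + - a₂)))
    where
    a₁ a₂ : F
    a₁ = f (x ⊕ e)
    a₂ = f (x ⊕ e ⊕ e)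
    triple : ∀ a → a + a + a ≡ 0#
    triple a = trans (cong (λ b → b + b + b) (sym (F-ring.*-identityˡ a))) (trans
      (FS.solve 2 (λ u a → u FS.:* a FS.:+ u FS.:* a FS.:+ u FS.:* a FS.:= (u FS.:+ (u FS.:+ u)) FS.:* a) refl 1# a)
      (trans (cong (λ z → (1# + (1# + z)) * a) (sym (F-ring.+-identityʳ 1#))) (trans (cong (_* a) 3≡0) (F-ring.zeroˡ a))))
    tripleᵛ : ∀ {n} (e : V n) → e ⊕ e ⊕ e ≡ 𝟎
    tripleᵛ e = trans (cong (λ b → b ⊕ b ⊕ b) (sym (1⊙ e))) (trans (cong (_⊕ 1# ⊙ e) (sym (+⊙ 1# 1# e))) (trans (sym (+⊙ (1# + 1#) 1# e))
      (trans (cong (_⊙ e) (trans (F-ring.+-assoc 1# 1# 1#) (trans (cong (λ z → 1# + (1# + z)) (sym (F-ring.+-identityʳ 1#))) 3≡0))) (0⊙ e))))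
    three : x ⊕ e ⊕ e ⊕ e ≡ x
    three = trans (VS.solve 2 (λ x e → ((x VS.:+ e) VS.:+ e) VS.:+ e VS.:= x VS.:+ ((e VS.:+ e) VS.:+ e)) refl x e)
      (trans (cong (x ⊕_) (tripleᵛ e)) (V-ring.+-identityʳ x))

  -- In characteristic 2 or 3 the second or third difference along e vanishes, so
  -- that Newton's formula never needs to divide by zero.
  newton-length : ∀ {n d} → d ≤ℕ 4 → ∀ {f : Fun n} → Der (suc d) f → ∀ e →
    ∃[ m ] m ≤ℕ d × Invertible< m × (∀ x → D e (suc m) f x ≡ 0#)
  newton-length {d = zero}  d≤4 Df e = 0 , z≤n , (λ ()) , Df e
  newton-length {d = suc d} d≤4 {f} Df e with ι 2 ≟ 0#
  ... | yes 2≡0 = 1 , s≤s z≤n , (λ { {zero} _ eq → 1≢0 (trans (sym (F-ring.+-identityʳ 1#)) eq) ; {suc _} (s≤s ()) }) ,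
        Δ-char2 (trans (cong (1# +_) (sym (F-ring.+-identityʳ 1#))) 2≡0) f e
  newton-length {d = suc zero} d≤4 {f} Df e | no 2≢0 = 1 , ℕₚ.≤-refl ,
    (λ { {zero} _ eq → 1≢0 (trans (sym (F-ring.+-identityʳ 1#)) eq) ; {suc _} (s≤s ()) }) , Df e e
  newton-length {d = suc (suc d)} d≤4 {f} Df e | no 2≢0 with ι 3 ≟ 0#
  ... | yes 3≡0 = 2 , s≤s (s≤s z≤n) ,
    (λ { {zero} _ eq → 1≢0 (trans (sym (F-ring.+-identityʳ 1#)) eq) ; {suc zero} _ → 2≢0 ; {suc (suc _)} (s≤s (s≤s ())) }) , ι3⇒D³ 3≡0 e f
  ... | no 3≢0 = suc (suc d) , ℕₚ.≤-refl , (λ k<d → invertible (ℕₚ.<-≤-trans k<d d≤4)) ,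
    der-D e (3 +ℕ d) {0} (subst (λ m → Der m f) (sym (ℕₚ.+-identityʳ (3 +ℕ d))) Df)
    where
    invertible : Invertible< 4
    invertible {0} _ eq = 1≢0 (trans (sym (F-ring.+-identityʳ 1#)) eq)
    invertible {1} _ = 2≢0
    invertible {2} _ = 3≢0
    invertible {3} _ eq = 2≢0 (*-cancel 2≢0 (trans four eq))
      where
      four : ι 2 * ι 2 ≡ ι 4
      four = trans (cong₂ _*_ (cong (1# +_) (F-ring.+-identityʳ 1#)) (cong (1# +_) (F-ring.+-identityʳ 1#)))
        (trans (F-ring.distribʳ (1# + 1#) 1# 1#) (trans (cong₂ _+_ (F-ring.*-identityˡ _) (F-ring.*-identityˡ _))
          (trans (F-ring.+-assoc 1# 1# (1# + 1#)) (cong (λ z → 1# + (1# + (1# + z))) (sym (F-ring.+-identityʳ 1#))))))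
    invertible {suc (suc (suc (suc _)))} (s≤s (s≤s (s≤s (s≤s ()))))

  der-binom′ : ∀ {n} (a : V n) k → Der (suc k) (λ x → binom′ k ⟨ a , x ⟩)
  der-binom′ a zero    = der-const (recip (ι 1))
  der-binom′ a (suc k) = der-scale (2 +ℕ k) (recip (ι (2 +ℕ k)))
    (der-* 1 k (der-+ 2 (der-lin (⟨⟩-linʳ a)) (der-suc 1 (der-const (- ι (suc k))))) (der-binom′ a k))

  der-sumTo : ∀ {n d} m {g : ℕ → Fun n} → (∀ {k} → k ℕ.< m → Der d (g k)) → Der d (λ x → sumTo m (λ k → g k x))
  der-sumTo {d = d} zero    Dg = der-zero d (λ _ → refl)
  der-sumTo {d = d} (suc m) Dg = der-+ d (der-sumTo m (λ k<m → Dg (ℕₚ.m<n⇒m<1+n k<m))) (Dg (ℕₚ.n<1+n m))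

  terms : ∀ {n} → List (V n × Fun n) → Fun n
  terms []             x = 0#
  terms ((a , g) ∷ gs) x = ⟨ a , x ⟩ * g x + terms gs x

  module _ {n d} (d≤4 : d ≤ℕ 4) {f : Fun n} (Df : Der (suc d) f) where

    -- The `k`-th term is a product of degrees at most `k` and `d - suc k`: splitting off the linear
    -- factor lowers the degree by one.
    divide : ∀ {Q : V n → V n} → Linᵛ Q → ∀ a e → ∃[ g ] Der d g × (∀ x → f (Q x ⊕ ⟨ a , x ⟩ ⊙ e) ≡ f (Q x) + ⟨ a , x ⟩ * g x)
    divide {Q} Q-lin a e with m , m≤d , inv , vanish ← newton-length d≤4 Df e =
      (λ x → sumTo m (λ k → binom′ k ⟨ a , x ⟩ * D e (suc k) f (Q x))) ,
      der-sumTo m (λ k<m → term (ℕₚ.<-≤-trans k<m m≤d)) ,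
      λ x → newton-divided inv e f vanish ⟨ a , x ⟩ (Q x)
      where
      term : ∀ {k} → k ℕ.< d → Der d (λ x → binom′ k ⟨ a , x ⟩ * D e (suc k) f (Q x))
      term {k} k<d = subst (λ d → Der d _) (trans (sym (ℕₚ.+-suc k _)) (trans (ℕₚ.+-comm k _) (rest k<d)))
        (der-* k (d ℕ.∸ suc k) (der-binom′ a k) (der-∘ Q-lin (suc (d ℕ.∸ suc k))
          (der-D e (suc k) (subst (λ d → Der d f) (cong suc (sym (trans (ℕₚ.+-comm k _) (rest k<d)))) Df))))
        where
        rest : ∀ {k d} → k ℕ.< d → suc (d ℕ.∸ suc k) +ℕ k ≡ d
        rest {k} {d} k<d = trans (sym (ℕₚ.+-suc _ k)) (ℕₚ.m∸n+n≡m k<d)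

    residual-lin : ∀ L → Linᵛ (residual {n} L)
    residual-lin []            x y = sym (V-ring.+-identityˡ 𝟎)
    residual-lin ((a , e) ∷ L) x y = trans
      (cong₂ _⊕_ (trans (cong (_⊙ e) (⟨⟩-linʳ a x y)) (+⊙ ⟨ a , x ⟩ ⟨ a , y ⟩ e)) (residual-lin L x y))
      (VS.solve 4 (λ a b c d → (a VS.:+ b) VS.:+ (c VS.:+ d) VS.:= (a VS.:+ c) VS.:+ (b VS.:+ d)) refl _ _ _ _)

    Expansion : (V n → V n) → List (V n × V n) → Set
    Expansion Q L = ∃[ gs ] length gs ≡ length L × All (λ (_ , g) → Der d g) gs × (∀ x → f (Q x ⊕ residual L x) ≡ f (Q x) + terms gs x)

    expand-residual : ∀ {Q : V n → V n} → Linᵛ Q → ∀ L → Expansion Q L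
    expand-residual {Q} Q-lin [] = [] , refl , [] , λ x → trans (cong f (V-ring.+-identityʳ (Q x))) (sym (F-ring.+-identityʳ _))
    expand-residual {Q} Q-lin ((a , e) ∷ L) = prepend (divide Q′-lin a e) (expand-residual Q-lin L)
      where
      Q′ : V n → V n
      Q′ x = Q x ⊕ residual L x
      Q′-lin : Linᵛ Q′
      Q′-lin x y = trans (cong₂ _⊕_ (Q-lin x y) (residual-lin L x y))
        (VS.solve 4 (λ a b c d → (a VS.:+ b) VS.:+ (c VS.:+ d) VS.:= (a VS.:+ c) VS.:+ (b VS.:+ d)) refl (Q x) (Q y) (residual L x) (residual L y))
      prepend : ∃[ g ] Der d g × (∀ x → f (Q′ x ⊕ ⟨ a , x ⟩ ⊙ e) ≡ f (Q′ x) + ⟨ a , x ⟩ * g x) → Expansion Q L → Expansion Q ((a , e) ∷ L)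
      prepend (g , Dg , g≡) (gs , |gs| , Dgs , gs≡) = (a , g) ∷ gs , cong suc |gs| , Dg ∷ Dgs , λ x → trans
        (cong f (VS.solve 3 (λ q t r → q VS.:+ (t VS.:+ r) VS.:= (q VS.:+ r) VS.:+ t) refl (Q x) (⟨ a , x ⟩ ⊙ e) (residual L x)))
        (trans (g≡ x) (trans (cong (_+ ⟨ a , x ⟩ * g x) (gs≡ x))
          (FS.solve 3 (λ q t s → (q FS.:+ s) FS.:+ t FS.:= q FS.:+ (t FS.:+ s)) refl (f (Q x)) (⟨ a , x ⟩ * g x) (terms gs x))))

    -- The directions removed by the cut are put back one at a time, each contributing one product.
    along-cut : ∀ {c} (P : Cut {n} c) →
      ∃[ gs ] length gs ≤ℕ c × All (λ (_ , g) → Der d g) gs × (∀ x → f x ≡ f (Π P x) + terms gs x)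
    along-cut P with gs , |gs| , Dgs , gs≡ ← expand-residual (Π-lin P) (pairs P) =
      gs , ℕₚ.≤-trans (ℕₚ.≤-reflexive |gs|) (pairs≤ P) , Dgs , λ x → trans (cong f (restore P x)) (gs≡ x)

  -- The structure of a dense quartic

  onCoset : ∀ {n} → (V n → V n) → V n → Fun n → Fun n
  onCoset P a f x = f (P x ⊕ a)

  -- At least a fraction 1/A of the triples `y`, `z`, `w` annihilates the form in its last argument:
  -- all that the first use of the bias has to deliver.
  Dense₁ : ∀ {n} → Fun n → ℕ → Set
  Dense₁ {n} f A = p ^ℕ n *ℕ (p ^ℕ n *ℕ p ^ℕ n) ≤ℕ A *ℕ ∑ᵛ (λ y → ∑ᵛ (λ z → vanishing (quartic-form f y z)))

  -- The second use of the bias. It is quantified over `P` and `R` because these come out of the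
  -- structure obtained from `Dense₁`: the cut, and for each `y` a map into the kernel of `b y`. The
  -- hypothesis makes `Δ y` of the function quadratic on the cosets of the image of `R y`, and
  -- degenerate quadratics are counted.
  Dense₂ : ∀ {n} → Fun n → ℕ → Set
  Dense₂ {n} f A = ∀ {P : V n → V n} → Linᵛ P → (R : V n → V n → V n) → (∀ y → Linᵛ (R y)) →
    (∀ a y z w u x → Δ y (Δ (R y z) (Δ (R y w) (Δ (R y u) (onCoset P a f)))) x ≡ 0#) →
    p ^ℕ n *ℕ (p ^ℕ n *ℕ (p ^ℕ n *ℕ p ^ℕ n)) ≤ℕ
      A *ℕ ∑ᵛ (λ a → ∑ᵛ (λ y → ∑ᵛ (λ v → vanishing (λ z w → Δ y (Δ (R y z) (Δ (R y w) (onCoset P a f))) v))))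

  module _ {n} {P : V n → V n} (P-lin : Linᵛ P) (a : V n) where

    Δ-onCoset : ∀ (f : Fun n) y x → Δ y (onCoset P a f) x ≡ onCoset P a (Δ (P y) f) x
    Δ-onCoset f y x = cong (λ v → f v + - f (P x ⊕ a)) (trans (cong (_⊕ a) (P-lin x y)) (⊕-right (P x) (P y) a))

    der-onCoset : ∀ d {f : Fun n} → Der d f → Der d (onCoset P a f)
    der-onCoset d Df = der-∘ P-lin d (der-shift d a Df)

    Δ⁴-onCoset : ∀ (f : Fun n) y z w u x → Δ y (Δ z (Δ w (Δ u (onCoset P a f)))) x ≡ onCoset P a (Δ (P y) (Δ (P z) (Δ (P w) (Δ (P u) f)))) x
    Δ⁴-onCoset f y z w u x =
      trans (Δ-cong (Δ-cong (Δ-cong (Δ-onCoset f u) w) z) y x)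
      (trans (Δ-cong (Δ-cong (Δ-onCoset (Δ (P u) f) w) z) y x)
      (trans (Δ-cong (Δ-onCoset (Δ (P w) (Δ (P u) f)) z) y x)
             (Δ-onCoset (Δ (P z) (Δ (P w) (Δ (P u) f))) y x)))

  record Decomposition {n} (f : Fun n) (A : ℕ) : Set where
    field
      linear-terms  : List (V n × Fun n)
      linear-terms≤ : length linear-terms ≤ℕ cutCost A
      cofactors     : All (λ (_ , g) → Der 4 g) linear-terms
      dim           : ℕ
      dim≤          : dim ≤ℕ pairCost A
      q q′          : V n → V dim
      q-der         : ∀ i → Der 3 (λ x → lookup (q x) i)
      q′-der        : ∀ i → Der 3 (λ x → lookup (q′ x) i)
      cubic         : Fun n
      cubic-der     : Der 4 cubic
      decompose     : ∀ x → f x ≡ (terms linear-terms x + ⟨ q x , q′ x ⟩) + cubic x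

  lookup-quadratic : ∀ {n k} {M : V n → V n → V k} → VBil M → ∀ i → Der 3 (λ x → lookup (M x x) i)
  lookup-quadratic {M = M} M-bil i = der-quadratic {M = λ x y → lookup (M x y) i}
    (record { linˡ = λ u x y → trans (cong (λ v → lookup v i) (linˡ-v M-bil u x y)) (Vecₚ.lookup-zipWith _+_ i (M x u) (M y u))
            ; linʳ = λ w x y → trans (cong (λ v → lookup v i) (linʳ-v M-bil w x y)) (Vecₚ.lookup-zipWith _+_ i (M w x) (M w y)) })
    {φ = λ _ → 0#} (λ _ _ → sym (F-ring.+-identityˡ 0#)) 0#
    (λ x → sym (trans (F-ring.+-identityʳ _) (F-ring.+-identityʳ _)))

  module _ {n} {f : Fun n} (Df : Der 5 f) {A : ℕ} (dense₁ : Dense₁ f A) (dense₂ : Char2 → Dense₂ f A) where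

    private
      B : Form⁴ n
      B = quartic-form f

      structure : Σ[ P ∈ Cut (cutCost A) ] Paired (pull⁴ (Π P) B) (pairCost A) (robustness A)
      structure = pairing-structure (quartic-sym⁴ Df) (quartic-alt⁴ Df) A (robustness A) dense₁

    module _ (P : Cut {n} (cutCost A)) (paired : Paired (pull⁴ (Π P) B) (pairCost A) (robustness A)) where

      open Paired paired

      g : V n → Fun n
      g a = onCoset (Π P) a f

      g-Δ⁴ : ∀ a y z w u x → Δ y (Δ z (Δ w (Δ u (g a)))) x ≡ Pairings μ b y z w u
      g-Δ⁴ a y z w u x = trans (Δ⁴-onCoset (Π-lin P) a f y z w u x)
        (trans (quartic-const Df (Π P y) (Π P z) (Π P w) (Π P u) (Π P x ⊕ a)) (exact y z w u))

      -- All the functions `g a` have the same fourth differences, hence the same `b` and `μ`. It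
      -- suffices that one coset `a` is dense, and averaging provides it.
      alternating : Char2 → ∀ x → μ x x ≡ 0#
      alternating ch2 = from-coset (average rows {p ^ℕ n *ℕ (p ^ℕ n *ℕ p ^ℕ n)} {A} (dense₂ ch2 (Π-lin P) R (λ y → Π-lin (ker-b y)) R-kills))
        where
        ker-b : ∀ y → Cut {n} dim
        ker-b = kerCut b-sym μ-bil μ-comm (der-onCoset (Π-lin P) 𝟎 5 Df) (λ y z w u → g-Δ⁴ 𝟎 y z w u 𝟎)
        R : V n → V n → V n
        R y = Π (ker-b y)
        R-zero : ∀ y x → b y (R y x) ≡ 𝟎
        R-zero = kerCut-kills b-sym μ-bil μ-comm (der-onCoset (Π-lin P) 𝟎 5 Df) (λ y z w u → g-Δ⁴ 𝟎 y z w u 𝟎)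
        R-kills : ∀ a y z w u x → Δ y (Δ (R y z) (Δ (R y w) (Δ (R y u) (g a)))) x ≡ 0#
        R-kills a y z w u x = trans (g-Δ⁴ a y (R y z) (R y w) (R y u) x)
          (sum₂ (sum₂ (zeroˡ z _) (zeroˡ w _)) (zeroˡ u _))
          where
          zeroˡ : ∀ x v → μ (b y (R y x)) v ≡ 0#
          zeroˡ x v = trans (cong (λ z → μ z v) (R-zero y x)) (lin-𝟎 (linˡ μ-bil v))
        rows : V n → ℕ
        rows a = ∑ᵛ (λ y → ∑ᵛ (λ v → vanishing (λ z w → Δ y (Δ (R y z) (Δ (R y w) (g a))) v)))
        from-coset : ∃[ a ] p ^ℕ n *ℕ (p ^ℕ n *ℕ p ^ℕ n) ≤ℕ A *ℕ rows a → ∀ x → μ x x ≡ 0#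
        from-coset (a , dense) = μ-alternating b-sym μ-bil μ-comm (der-onCoset (Π-lin P) a 5 Df) (λ y z w u → g-Δ⁴ a y z w u 𝟎)
          ch2 {A} {pairCost A} dim≤ robust dense

      θ-half : ∃[ θ ] Bil θ × (∀ x y → μ x y ≡ θ x y + θ y x)
      θ-half = halve μ-bil μ-comm alternating

      β-half : ∃[ β ] VBil β × (∀ x y → b x y ≡ β x y ⊕ β y x)
      β-half = halveᵛ dim b-sym

      θ : V dim → V dim → F
      θ = proj₁ θ-half
      θ-bil : Bil θ
      θ-bil = proj₁ (proj₂ θ-half)
      β : V n → V n → V dim
      β = proj₁ β-half
      β-bil : VBil β
      β-bil = proj₁ (proj₂ β-half)

      module Sq = Square β-bil (proj₂ (proj₂ β-half)) θ-bil (proj₂ (proj₂ θ-half))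

      h : Fun n
      h x = g 𝟎 x + - Sq.square x

      h-der : Der 4 h
      h-der u w z y x = trans (Δ-cong (Δ-cong (Δ-cong (Δ-- (g 𝟎) Sq.square u) w) z) y x)
        (trans (Δ-cong (Δ-cong (Δ-- (Δ u (g 𝟎)) (Δ u S) w) z) y x) (trans (Δ-cong (Δ-- (Δ w (Δ u (g 𝟎))) (Δ w (Δ u S)) z) y x)
        (trans (Δ-- (Δ z (Δ w (Δ u (g 𝟎)))) (Δ z (Δ w (Δ u S))) y x)
          (trans (cong₂ (λ a b → a + - b) (g-Δ⁴ 𝟎 y z w u x) (Sq.square-polarization y z w u x)) (x-x≡0 _)))))
        where
        S : Fun n
        S = Sq.square
        Δ-- : ∀ (f g : Fun n) y x → Δ y (λ x → f x + - g x) x ≡ Δ y f x + - Δ y g x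
        Δ-- f g y x = FS.solve 4 (λ a b c d → (a FS.:- b) FS.:- (c FS.:- d) FS.:= (a FS.:- c) FS.:- (b FS.:- d)) refl
          (f (x ⊕ y)) (g (x ⊕ y)) (f x) (g x)

      θβ-bil : VBil (λ x y → rep (θ (β x y)))
      θβ-bil = record
        { linˡ-v = λ u x y → trans (cong (λ v → rep (θ v)) (linˡ-v β-bil u x y)) (rep-bil-lin θ-bil (β x u) (β y u))
        ; linʳ-v = λ w x y → trans (cong (λ v → rep (θ v)) (linʳ-v β-bil w x y)) (rep-bil-lin θ-bil (β w x) (β w y)) }

      decomposition′ : Decomposition f A
      decomposition′ = record
        { linear-terms = gs ; linear-terms≤ = proj₁ (proj₂ cut-terms) ; cofactors = proj₁ (proj₂ (proj₂ cut-terms)) ; dim = dim ; dim≤ = dim≤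
        ; q = λ x → rep (θ (β x x)) ; q′ = λ x → β x x
        ; q-der = lookup-quadratic θβ-bil ; q′-der = lookup-quadratic β-bil
        ; cubic = h ; cubic-der = h-der
        ; decompose = λ x → trans (proj₂ (proj₂ (proj₂ cut-terms)) x) (trans (cong (_+ terms gs x) (split x))
            (FS.solve 3 (λ s h t → (s FS.:+ h) FS.:+ t FS.:= (t FS.:+ s) FS.:+ h) refl ⟨ rep (θ (β x x)) , β x x ⟩ (h x) (terms gs x))) }
        where
        split : ∀ x → f (Π P x) ≡ ⟨ rep (θ (β x x)) , β x x ⟩ + h x
        split x = trans (cong f (sym (V-ring.+-identityʳ (Π P x)))) (trans
          (FS.solve 2 (λ g s → g FS.:= s FS.:+ (g FS.:- s)) refl (g 𝟎 x) (Sq.square x))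
          (cong (_+ h x) (bil-rep θ-bil (β x x) (β x x))))
        cut-terms : ∃[ gs ] length gs ≤ℕ cutCost A × All (λ (_ , g) → Der 4 g) gs × (∀ x → f x ≡ f (Π P x) + terms gs x)
        cut-terms = along-cut ℕₚ.≤-refl Df P
        gs : List (V n × Fun n)
        gs = proj₁ cut-terms

    abstract
      decomposition : Decomposition f A
      decomposition = decomposition′ (proj₁ structure) (proj₂ structure)

  -- Polynomials and polynomial functions

  K-rawSemiring : RawSemiring 0ℓ 0ℓ
  K-rawSemiring = record { Carrier = F ; _≈_ = _≡_ ; _+_ = _+_ ; _*_ = _*_ ; 0# = 0# ; 1# = 1# }

  open RawSemiringDefinitions K-rawSemiring using () renaming (_^_ to _^ᶠ_; product to ∏ᶠ)

  ⟦_⟧ : ∀ {n} → Poly p n → Fun n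
  ⟦ P ⟧ x = List.foldr (λ (c , e) s → c * ∏ᶠ (λ i → lookup x i ^ᶠ lookup e i) + s) 0# P

  Degree≤ : ∀ {n} → ℕ → Fun n → Set
  Degree≤ {n} d f = Σ[ P ∈ Poly p n ] All (λ (_ , e) → Vec.sum e ≤ℕ d) P × (∀ x → f x ≡ ⟦ P ⟧ x)

  monomial : ∀ {n} → Vec ℕ n → V n → F
  monomial e x = ∏ᶠ (λ i → lookup x i ^ᶠ lookup e i)

  der-power : ∀ {n} (i : Fin n) a → Der (suc a) (λ x → lookup x i ^ᶠ a)
  der-power i zero    = der-const 1#
  der-power i (suc a) = der-* 1 a (der-lin (λ x y → Vecₚ.lookup-zipWith _+_ i x y)) (der-power i a)

  der-monomial : ∀ {m n} (e : Vec ℕ m) (σ : Fin m → Fin n) → Der (suc (Vec.sum e)) (λ x → ∏ᶠ (λ i → lookup x (σ i) ^ᶠ lookup e i))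
  der-monomial []      σ = der-const 1#
  der-monomial (a ∷ e) σ = der-* a (Vec.sum e) (der-power (σ zero) a) (der-monomial e (λ i → σ (suc i)))

  degree⇒der : ∀ {n d} {f : Fun n} → Degree≤ d f → Der (suc d) f
  degree⇒der {n} {d} (P , P≤d , f≡P) = der-cong (suc d) (λ x → sym (f≡P x)) (der-poly P P≤d)
    where
    der-poly : ∀ (P : Poly p n) → All (λ (_ , e) → Vec.sum e ≤ℕ d) P → Der (suc d) ⟦ P ⟧
    der-poly []            []           = der-zero (suc d) (λ _ → refl)
    der-poly ((c , e) ∷ P) (e≤d ∷ P≤d) = der-+ (suc d)
      (der-mono (ℕ.s≤s e≤d) (der-scale (suc (Vec.sum e)) c (der-monomial e (λ i → i)))) (der-poly P P≤d)

  module _ {n : ℕ} where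

    degree-cong : ∀ {d} {f g : Fun n} → (∀ x → f x ≡ g x) → Degree≤ d f → Degree≤ d g
    degree-cong f≡g (P , P≤d , f≡P) = P , P≤d , λ x → trans (sym (f≡g x)) (f≡P x)

    degree-mono : ∀ {d e} {f : Fun n} → d ≤ℕ e → Degree≤ d f → Degree≤ e f
    degree-mono d≤e (P , P≤d , f≡P) = P , All.map (λ e≤d → ℕₚ.≤-trans e≤d d≤e) P≤d , f≡P

    degree-zero : ∀ {d} → Degree≤ {n = n} d (λ _ → 0#)
    degree-zero = [] , [] , λ _ → refl

    degree-+ : ∀ {d} {f g : Fun n} → Degree≤ d f → Degree≤ d g → Degree≤ d (λ x → f x + g x)
    degree-+ (P , P≤d , f≡P) (Q , Q≤d , g≡Q) = P ++ Q , Allₚ.++⁺ P≤d Q≤d , λ x → trans (cong₂ _+_ (f≡P x) (g≡Q x)) (⟦⟧-++ P x)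
      where
      ⟦⟧-++ : ∀ P x → ⟦ P ⟧ x + ⟦ Q ⟧ x ≡ ⟦ P ++ Q ⟧ x
      ⟦⟧-++ []            x = F-ring.+-identityˡ _
      ⟦⟧-++ ((c , e) ∷ P) x = trans (F-ring.+-assoc (c * monomial e x) (⟦ P ⟧ x) (⟦ Q ⟧ x)) (cong (c * monomial e x +_) (⟦⟧-++ P x))

    degree-scale : ∀ {d} c {f : Fun n} → Degree≤ d f → Degree≤ d (λ x → c * f x)
    degree-scale {d} c (P , P≤d , f≡P) = List.map (λ (b , e) → c * b , e) P , Allₚ.map⁺ P≤d , λ x → trans (cong (c *_) (f≡P x)) (⟦⟧-scale P x)
      where
      ⟦⟧-scale : ∀ P x → c * ⟦ P ⟧ x ≡ ⟦ List.map (λ (b , e) → c * b , e) P ⟧ x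
      ⟦⟧-scale []            x = F-ring.zeroʳ c
      ⟦⟧-scale ((b , e) ∷ P) x = trans (F-ring.distribˡ c _ _)
        (cong₂ _+_ (sym (F-ring.*-assoc c b (monomial e x))) (⟦⟧-scale P x))

    degree-tail : ∀ {d} {f : Fun n} → Degree≤ d f → Degree≤ d (λ x → f (tail x))
    degree-tail (P , P≤d , f≡P) = List.map (λ (c , e) → c , 0 ∷ e) P , Allₚ.map⁺ P≤d , λ { (t ∷ x) → trans (f≡P x) (⟦⟧-tail t x P) }
      where
      ⟦⟧-tail : ∀ t x P → ⟦ P ⟧ x ≡ ⟦ List.map (λ (c , e) → c , 0 ∷ e) P ⟧ (t ∷ x)
      ⟦⟧-tail t x []            = refl
      ⟦⟧-tail t x ((c , e) ∷ P) = cong₂ _+_ (cong (c *_) (sym (F-ring.*-identityˡ (monomial e x)))) (⟦⟧-tail t x P)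

    bump : Vec ℕ (suc n) → Vec ℕ (suc n)
    bump (a ∷ e) = suc a ∷ e

    degree-head : ∀ {d} {f : Fun (suc n)} → Degree≤ d f → Degree≤ (suc d) (λ x → head x * f x)
    degree-head (P , P≤d , f≡P) = List.map (λ (c , e) → c , bump e) P , Allₚ.map⁺ (All.map (λ {ce} → bump≤ (proj₂ ce)) P≤d) ,
      λ x → trans (cong (head x *_) (f≡P x)) (⟦⟧-bump P x)
      where
      bump≤ : ∀ (e : Vec ℕ (suc n)) {d} → Vec.sum e ≤ℕ d → Vec.sum (bump e) ≤ℕ suc d
      bump≤ (a ∷ e) h = ℕ.s≤s h
      monomial-bump : ∀ e (x : V (suc n)) → monomial (bump e) x ≡ head x * monomial e x
      monomial-bump (a ∷ e) (t ∷ x) = F-ring.*-assoc t (t ^ᶠ a) (monomial e x)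
      ⟦⟧-bump : ∀ P x → head x * ⟦ P ⟧ x ≡ ⟦ List.map (λ (c , e) → c , bump e) P ⟧ x
      ⟦⟧-bump []            x = F-ring.zeroʳ (head x)
      ⟦⟧-bump ((c , e) ∷ P) x = trans (F-ring.distribˡ (head x) _ _) (cong₂ _+_
        (trans (FS.solve 3 (λ h c m → h FS.:* (c FS.:* m) FS.:= c FS.:* (h FS.:* m)) refl (head x) c (monomial e x))
          (cong (c *_) (sym (monomial-bump e x)))) (⟦⟧-bump P x))

  module _ {n : ℕ} where

    degree-binom′ : ∀ {d} {g : Fun n} → Degree≤ d g → ∀ k → Degree≤ (k +ℕ d) (λ x → binom′ k (head x) * g (tail x))
    degree-binom′ Dg zero    = degree-scale (recip (ι 1)) (degree-tail Dg)
    degree-binom′ {d} {g} Dg (suc k) = degree-cong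
      (λ x → FS.solve 5 (λ r t o b g → r FS.:* (t FS.:* (b FS.:* g) FS.:+ o FS.:* (b FS.:* g)) FS.:= r FS.:* ((t FS.:+ o) FS.:* b) FS.:* g) refl
        (recip (ι (2 +ℕ k))) (head x) (- ι (suc k)) (binom′ k (head x)) (g (tail x)))
      (degree-scale (recip (ι (2 +ℕ k))) (degree-+ (degree-head (degree-binom′ Dg k))
        (degree-mono (ℕₚ.n≤1+n _) (degree-scale (- ι (suc k)) (degree-binom′ Dg k)))))

    degree-binom : ∀ {d} {g : Fun n} → Degree≤ d g → ∀ k → Degree≤ (k +ℕ d) (λ x → binom k (head x) * g (tail x))
    degree-binom {g = g} Dg zero = degree-cong (λ x → sym (F-ring.*-identityˡ (g (tail x)))) (degree-tail Dg)
    degree-binom {g = g} Dg (suc k) = degree-cong (λ x → sym (F-ring.*-assoc (head x) (binom′ k (head x)) (g (tail x))))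
      (degree-head (degree-binom′ Dg k))

    degree-sumTo : ∀ {d} m {g : ℕ → Fun n} → (∀ {k} → k ℕ.< m → Degree≤ d (g k)) → Degree≤ d (λ x → sumTo m (λ k → g k x))
    degree-sumTo zero    Dg = degree-zero
    degree-sumTo (suc m) Dg = degree-+ (degree-sumTo m (λ k<m → Dg (ℕₚ.m<n⇒m<1+n k<m))) (Dg (ℕₚ.n<1+n m))

  -- By induction on the number of variables: in Newton's formula along the first basis vector the
  -- coefficients are differences of order `k` at points beginning with 0, of degree at most `d - k`
  -- in the other variables.
  der⇒degree : ∀ {n d} → d ≤ℕ 4 → {f : Fun n} → Der (suc d) f → Degree≤ d f
  der⇒degree {zero}  d≤4 {f} Df = (f [] , []) ∷ [] , ℕ.z≤n ∷ [] , λ { [] → sym (trans (F-ring.+-identityʳ _) (F-ring.*-identityʳ (f []))) }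
  der⇒degree {suc n} {d} d≤4 {f} Df with m , m≤d , inv , vanish ← newton-length d≤4 Df (1# ∷ 𝟎) =
    degree-cong (λ { (t ∷ x) → sym (trans (cong f (trans (∷-split t x) (V-ring.+-comm (t ⊙ (1# ∷ 𝟎)) (0# ∷ x)))) (newton inv (1# ∷ 𝟎) f vanish t (0# ∷ x))) })
      (degree-sumTo (suc m) (λ {k} k≤m → term k (ℕₚ.≤-trans (ℕₚ.≤-pred k≤m) m≤d)))
    where
    term : ∀ k → k ≤ℕ d → Degree≤ d (λ x → binom k (head x) * D (1# ∷ 𝟎) k f (0# ∷ tail x))
    term k k≤d = degree-mono (ℕₚ.≤-reflexive (ℕₚ.m+[n∸m]≡n k≤d)) (degree-binom
      (der⇒degree {n} {d ℕ.∸ k} (ℕₚ.≤-trans (ℕₚ.m∸n≤m d k) d≤4) (der-∘ 0∷-lin (suc (d ℕ.∸ k))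
        (der-D (1# ∷ 𝟎) k (subst (λ m → Der m f) (sym (trans (ℕₚ.+-suc k (d ℕ.∸ k)) (cong suc (ℕₚ.m+[n∸m]≡n k≤d)))) Df)))) k)

  open RawSemiringDefinitions K-rawSemiring using () renaming (sum to ∑ᶠ)

  module _ {n : ℕ} where

    products : List (Fun n × Fun n) → Fun n
    products L x = List.foldr (λ (g , h) s → g x * h x + s) 0# L

    pad : ∀ c → List (Fun n × Fun n) → Fin c → Fun n × Fun n
    pad c       []       _       = (λ _ → 0#) , (λ _ → 0#)
    pad (suc c) (gh ∷ L) zero    = gh
    pad (suc c) (gh ∷ L) (suc j) = pad c L j

    pad-sum : ∀ {c} L → length L ≤ℕ c → ∀ x → ∑ᶠ (λ j → proj₁ (pad c L j) x * proj₂ (pad c L j) x) ≡ products L x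
    pad-sum {c}     []       _         x = zeros c
      where
      zeros : ∀ c → ∑ᶠ {c} (λ _ → 0# * 0#) ≡ 0#
      zeros zero    = refl
      zeros (suc c) = trans (cong₂ _+_ (F-ring.zeroˡ 0#) (zeros c)) (F-ring.+-identityˡ 0#)
    pad-sum {suc c} (gh ∷ L) (ℕ.s≤s h) x = cong (proj₁ gh x * proj₂ gh x +_) (pad-sum L h x)

    pad-degree : ∀ {d e} c {L} → All (λ (g , h) → Degree≤ d g × Degree≤ e h) L → ∀ j → Degree≤ d (proj₁ (pad c L j)) × Degree≤ e (proj₂ (pad c L j))
    pad-degree c       []        _       = degree-zero , degree-zero
    pad-degree (suc c) (gh ∷ ghs) zero    = gh
    pad-degree (suc c) (gh ∷ ghs) (suc j) = pad-degree c ghs j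

    module _ {f : Fun n} {A : ℕ} (D : Decomposition f A) where

      open Decomposition D

      cubics quadratics : List (Fun n × Fun n)
      -- The cubic remainder is a product with the constant 1; this is the origin of the `suc` in
      -- the number of terms.
      cubics     = ((λ _ → 1#) , cubic) ∷ List.map (λ (a , g) → ⟨ a ,_⟩ , g) linear-terms
      quadratics = List.tabulate (λ i → (λ x → lookup (q x) i) , (λ x → lookup (q′ x) i))

      cubics≤ : length cubics ≤ℕ suc (cutCost A)
      cubics≤ = ℕ.s≤s (ℕₚ.≤-trans (ℕₚ.≤-reflexive (Listₚ.length-map _ linear-terms)) linear-terms≤)

      quadratics≤ : length quadratics ≤ℕ pairCost A
      quadratics≤ = ℕₚ.≤-trans (ℕₚ.≤-reflexive (Listₚ.length-tabulate {n = dim} _)) dim≤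

      cubics-degree : All (λ (ℓ , g) → Degree≤ 1 ℓ × Degree≤ 3 g) cubics
      cubics-degree = (der⇒degree (ℕ.s≤s ℕ.z≤n) {f = λ _ → 1#} (der-suc 1 (der-const 1#)) , der⇒degree (ℕ.s≤s (ℕ.s≤s (ℕ.s≤s ℕ.z≤n))) {f = cubic} cubic-der) ∷ Allₚ.map⁺ (All.map
        (λ {ag} Dg → der⇒degree (ℕ.s≤s ℕ.z≤n) {f = ⟨ proj₁ ag ,_⟩} (der-lin (⟨⟩-linʳ (proj₁ ag))) , der⇒degree (ℕ.s≤s (ℕ.s≤s (ℕ.s≤s ℕ.z≤n))) {f = proj₂ ag} Dg) cofactors)

      quadratics-degree : All (λ (q , q′) → Degree≤ 2 q × Degree≤ 2 q′) quadratics
      quadratics-degree = Allₚ.tabulate⁺ (λ i → der⇒degree (ℕ.s≤s (ℕ.s≤s ℕ.z≤n)) {f = λ x → lookup (q x) i} (q-der i) , der⇒degree (ℕ.s≤s (ℕ.s≤s ℕ.z≤n)) {f = λ x → lookup (q′ x) i} (q′-der i))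

      products-cubics : ∀ x → products cubics x ≡ cubic x + terms linear-terms x
      products-cubics x = cong₂ _+_ (F-ring.*-identityˡ (cubic x)) (along linear-terms)
        where
        along : ∀ gs → products (List.map (λ (a , g) → ⟨ a ,_⟩ , g) gs) x ≡ terms gs x
        along []             = refl
        along ((a , g) ∷ gs) = cong (⟨ a , x ⟩ * g x +_) (along gs)

      products-quadratics : ∀ x → products quadratics x ≡ ⟨ q x , q′ x ⟩
      products-quadratics x = coordinates {φ = λ i x → lookup (q x) i} {λ i x → lookup (q′ x) i} (q x) (q′ x) (λ _ → refl) (λ _ → refl)
        where
        coordinates : ∀ {k} {φ ψ : Fin k → Fun n} (u v : V k) → (∀ i → φ i x ≡ lookup u i) → (∀ i → ψ i x ≡ lookup v i) →
          products (List.tabulate (λ i → φ i , ψ i)) x ≡ ⟨ u , v ⟩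
        coordinates []      []      φ≡ ψ≡ = refl
        coordinates (a ∷ u) (b ∷ v) φ≡ ψ≡ = cong₂ _+_ (cong₂ _*_ (φ≡ zero) (ψ≡ zero)) (coordinates u v (λ i → φ≡ (suc i)) (λ i → ψ≡ (suc i)))

      expressed : ∀ {c} → suc (cutCost A) ≤ℕ c → pairCost A ≤ℕ c → ∀ x → f x ≡ ∑ᶠ (λ j → proj₁ (pad c cubics j) x * proj₂ (pad c cubics j) x)
                            + ∑ᶠ (λ j → proj₁ (pad c quadratics j) x * proj₂ (pad c quadratics j) x)
      expressed cut≤c pair≤c x = trans (decompose x) (trans
        (FS.solve 3 (λ t s h → (t FS.:+ s) FS.:+ h FS.:= (h FS.:+ t) FS.:+ s) refl (terms linear-terms x) ⟨ q x , q′ x ⟩ (cubic x))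
        (sym (cong₂ _+_ (trans (pad-sum cubics (ℕₚ.≤-trans cubics≤ cut≤c) x) (products-cubics x)) (trans (pad-sum quadratics (ℕₚ.≤-trans quadratics≤ pair≤c) x) (products-quadratics x)))))

-- Ordered rings

record OrderedRing : Set₁ where
  field
    commutativeRing : CommutativeRing 0ℓ 0ℓ
  open CommutativeRing commutativeRing public
  open RawMonoidDefinitions +-rawMonoid public using (_×_)
  infix 4 _≤_
  field
    _≤_         : Carrier → Carrier → Set
    ≤-reflexive : ∀ {x y} → x ≈ y → x ≤ y
    ≤-trans     : ∀ {x y z} → x ≤ y → y ≤ z → x ≤ z
    +-mono-≤    : ∀ {x y u v} → x ≤ y → u ≤ v → x + u ≤ y + v
    *-monoˡ-≤   : ∀ {c x y} → 0# ≤ c → x ≤ y → c * x ≤ c * y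
    0≤x²        : ∀ x → 0# ≤ x * x
    -- Takes the place of division by positive integers.
    ×-cancel-≤  : ∀ m {x y} → suc m × x ≤ suc m × y → x ≤ y

module OrderedProperties (O : OrderedRing) where

  open import Data.Fin.Base using (zero; suc)
  open import Data.List.Base using (List; []; _∷_)

  open OrderedRing O hiding (zero)
  open import Algebra.Properties.Semiring.Mult semiring using (×1-homo-*)
  open import Algebra.Properties.Semiring.Sum semiring using (sum)
  open IntegerSolver commutativeRing using (solve; _:=_; _:+_; _:*_; _:-_; :-_)
  open import Relation.Binary.Reasoning.Setoid setoid

  ≤-refl : ∀ {x} → x ≤ x
  ≤-refl = ≤-reflexive refl

  ≤-respˡ : ∀ {x y z} → x ≈ y → x ≤ z → y ≤ z
  ≤-respˡ x≈y = ≤-trans (≤-reflexive (sym x≈y))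

  ≤-respʳ : ∀ {x y z} → y ≈ z → x ≤ y → x ≤ z
  ≤-respʳ y≈z x≤y = ≤-trans x≤y (≤-reflexive y≈z)

  0≤x⇒y≤y+x : ∀ {x y} → 0# ≤ x → y ≤ y + x
  0≤x⇒y≤y+x {x} {y} 0≤x = ≤-respˡ (+-identityʳ y) (+-mono-≤ ≤-refl 0≤x)

  0≤-+ : ∀ {x y} → 0# ≤ x → 0# ≤ y → 0# ≤ x + y
  0≤-+ 0≤x 0≤y = ≤-respˡ (+-identityˡ 0#) (+-mono-≤ 0≤x 0≤y)

  0≤y-x⇒x≤y : ∀ {x y} → 0# ≤ y - x → x ≤ y
  0≤y-x⇒x≤y {x} {y} 0≤y-x = ≤-respʳ (solve 2 (λ x y → x :+ (y :- x) := y) refl x y) (0≤x⇒y≤y+x 0≤y-x)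

  x+x≤y+y⇒x≤y : ∀ {x y} → x + x ≤ y + y → x ≤ y
  x+x≤y+y⇒x≤y {x} {y} h = ×-cancel-≤ 1 (≤-respˡ (+-congˡ (sym (+-identityʳ x))) (≤-respʳ (+-congˡ (sym (+-identityʳ y))) h))

  0≤1 : 0# ≤ 1#
  0≤1 = ≤-respʳ (*-identityˡ 1#) (0≤x² 1#)

  0≤-* : ∀ {x y} → 0# ≤ x → 0# ≤ y → 0# ≤ x * y
  0≤-* {x} 0≤x 0≤y = ≤-respˡ (zeroʳ x) (*-monoˡ-≤ 0≤x 0≤y)

  square-mono : ∀ {x y} → 0# ≤ x → x ≤ y → x * x ≤ y * y
  square-mono {x} {y} 0≤x x≤y = ≤-trans (*-monoˡ-≤ 0≤x x≤y)
    (≤-respˡ (*-comm y x) (*-monoˡ-≤ (≤-trans 0≤x x≤y) x≤y))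

  ofℕ : ℕ → Carrier
  ofℕ m = m × 1#

  0≤ofℕ : ∀ m → 0# ≤ ofℕ m
  0≤ofℕ zero    = ≤-refl
  0≤ofℕ (suc m) = 0≤-+ 0≤1 (0≤ofℕ m)

  ×≈* : ∀ m x → m × x ≈ ofℕ m * x
  ×≈* zero    x = sym (zeroˡ x)
  ×≈* (suc m) x = trans (+-cong (sym (*-identityˡ x)) (×≈* m x)) (sym (distribʳ x 1# (ofℕ m)))

  ofℕ-cancel : ∀ {m} → 0 ℕ.< m → ∀ {x y} → ofℕ m * x ≤ ofℕ m * y → x ≤ y
  ofℕ-cancel {suc m} _ {x} {y} h = ×-cancel-≤ m (≤-respˡ (sym (×≈* (suc m) x)) (≤-respʳ (sym (×≈* (suc m) y)) h))

  sum-mono : ∀ {m} {g h : Fin m → Carrier} → (∀ t → g t ≤ h t) → sum g ≤ sum h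
  sum-mono {zero}  g≤h = ≤-refl
  sum-mono {suc m} g≤h = +-mono-≤ (g≤h zero) (sum-mono (λ t → g≤h (suc t)))

  sum-const : ∀ m x → sum {m} (λ _ → x) ≈ ofℕ m * x
  sum-const zero    x = sym (zeroˡ x)
  sum-const (suc m) x = trans (+-cong (sym (*-identityˡ x)) (sum-const m x)) (sym (distribʳ x 1# (ofℕ m)))

  ofℕ-* : ∀ a b → ofℕ (a ℕ.* b) ≈ ofℕ a * ofℕ b
  ofℕ-* = ×1-homo-*

  1≤ofℕ : ∀ {m} → 0 ℕ.< m → 1# ≤ ofℕ m
  1≤ofℕ {suc m} _ = 0≤x⇒y≤y+x (0≤ofℕ m)

  *-mono-1≤ : ∀ {x y} → 0# ≤ x → 1# ≤ y → x ≤ x * y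
  *-mono-1≤ {x} 0≤x 1≤y = ≤-respˡ (*-identityʳ x) (*-monoˡ-≤ 0≤x 1≤y)

  ofℕ-mono : ∀ {a b} → a ℕ.≤ b → ofℕ a ≤ ofℕ b
  ofℕ-mono {b = b} ℕ.z≤n   = 0≤ofℕ b
  ofℕ-mono         (ℕ.s≤s h) = +-mono-≤ ≤-refl (ofℕ-mono h)

  -- δ is the modulus of i (x + y √-1).
  ScaledModulus : Carrier → Carrier → Carrier → Carrier → Set
  ScaledModulus δ i x y = δ * δ ≈ (i * x - 0# * y) * (i * x - 0# * y) + (i * y + 0# * x) * (i * y + 0# * x)

  module _ (eval : List Carrier → Carrier → Carrier) (eval-[] : ∀ x → eval [] x ≈ 0#) (eval-∷ : ∀ a as x → eval (a ∷ as) x ≈ a + x * eval as x) where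

    -- c (3 x⁸)ᵉ
    monomial : ℕ → Carrier → List Carrier
    monomial zero    c = c ∷ []
    monomial (suc e) c = 0# ∷ 0# ∷ 0# ∷ 0# ∷ 0# ∷ 0# ∷ 0# ∷ 0# ∷ monomial e (ofℕ 3 * c)

    power≤monomial : ∀ {A x} → let r = x * x in 0# ≤ (r * r) * (r * r) → ofℕ A ≤ ofℕ 3 * ((r * r) * (r * r)) →
      ∀ e {c} → 0# ≤ c → c * ofℕ (A ℕ.^ e) ≤ eval (monomial e c) x
    power≤monomial {A} {x} 0≤x⁸ A≤3x⁸ zero {c} 0≤c = ≤-reflexive (begin
      c * ofℕ 1                    ≈⟨ trans (*-congˡ (+-identityʳ 1#)) (*-identityʳ c) ⟩
      c                            ≈⟨ trans (+-congˡ (trans (*-congˡ (eval-[] x)) (zeroʳ x))) (+-identityʳ c) ⟨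
      c + x * eval [] x            ≈⟨ eval-∷ c [] x ⟨
      eval (c ∷ []) x              ∎)
    power≤monomial {A} {x} 0≤x⁸ A≤3x⁸ (suc e) {c} 0≤c = ≤-respˡ (begin
        (c * ofℕ (A ℕ.^ e)) * ofℕ A                ≈⟨ solve 3 (λ c E A → (c :* E) :* A := c :* (A :* E)) refl c (ofℕ (A ℕ.^ e)) (ofℕ A) ⟩
        c * (ofℕ A * ofℕ (A ℕ.^ e))                ≈⟨ *-congˡ (ofℕ-* A (A ℕ.^ e)) ⟨
        c * ofℕ (A ℕ.^ suc e)                      ∎)
      (≤-trans (*-monoˡ-≤ (0≤-* 0≤c (0≤ofℕ (A ℕ.^ e))) A≤3x⁸)
        (≤-respˡ (solve 4 (λ c E t x → ((x :* x) :* (x :* x)) :* ((x :* x) :* (x :* x)) :* ((t :* c) :* E)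
                     := (c :* E) :* (t :* (((x :* x) :* (x :* x)) :* ((x :* x) :* (x :* x))))) refl c (ofℕ (A ℕ.^ e)) (ofℕ 3) x)
          (≤-trans (*-monoˡ-≤ 0≤x⁸ (power≤monomial 0≤x⁸ A≤3x⁸ e (0≤-* (0≤ofℕ 3) 0≤c)))
            (≤-reflexive (sym (trans (shift _) (trans (*-congˡ (shift _)) (trans (*-congˡ (*-congˡ (shift _))) (trans (*-congˡ (*-congˡ (*-congˡ (shift _))))
              (trans (*-congˡ (*-congˡ (*-congˡ (*-congˡ (shift _))))) (trans (*-congˡ (*-congˡ (*-congˡ (*-congˡ (*-congˡ (shift _))))))
              (trans (*-congˡ (*-congˡ (*-congˡ (*-congˡ (*-congˡ (*-congˡ (shift _))))))) (trans (*-congˡ (*-congˡ (*-congˡ (*-congˡ (*-congˡ (*-congˡ (*-congˡ (shift _))))))))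
              (solve 2 (λ x E → x :* (x :* (x :* (x :* (x :* (x :* (x :* (x :* E))))))) := ((x :* x) :* (x :* x)) :* ((x :* x) :* (x :* x)) :* E) refl x _))))))))))))))
      where
      shift : ∀ as → eval (0# ∷ as) x ≈ x * eval as x
      shift as = trans (eval-∷ 0# as x) (+-identityˡ _)

-- Exponential sums and Cauchy-Schwarz

module CharSum {p : ℕ} (K : PrimeField p) (O : OrderedRing) where

  open import Data.Fin.Base using (zero; suc)
  open import Data.Vec.Base using ([]; _∷_)
  import Relation.Binary.PropositionalEquality as ≡
  open ≡ using (_≡_)
  open import Relation.Nullary.Decidable using (decidable-stable; ¬?)

  open Forms K
    using (F; V; _⊕_; _⊙_; 𝟎; Lin; Linᵛ; lin-⊙; Fun; Δ; Der; Δ-cong; Δ-swap; Δ-⊕; der₁-const; quartic-form; quartic-sym⁴; Sym⁴; module Sym⁴; vanishing; ind; ind-cong; search-V; search-∀; _≟_; onCoset; Δ-onCoset; linᵛ-𝟎; vanishing-cong; module V-ring; module FS; pⁿ>0)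
    renaming (0# to 0ᶠ; 1# to 1ᶠ; _+_ to _+ᶠ_; -_ to -ᶠ_; _*_ to _*ᶠ_; inverse to inverseᶠ; ∑ᵛ to ∑ℕ; ∑ᵛ-cong to ∑ᵛℕ-cong)
  open OrderedRing O hiding (zero)
  open import Algebra.Properties.Semiring.Mult semiring using (×-homo-+; ×1-homo-*)
  open import Algebra.Properties.Semiring.Sum semiring using (sum; sum-cong-≋; *-distribˡ-sum)
  open IntegerSolver commutativeRing using (solve; _:=_; _:+_; _:*_; _:-_; :-_)
  open OrderedProperties O public
  open VSum K +-commutativeMonoid
  open import Relation.Binary.Reasoning.Setoid setoid

  ∑-mono : ∀ {n} {g h : V n → Carrier} → (∀ x → g x ≤ h x) → ∑ᵛ g ≤ ∑ᵛ h
  ∑-mono {zero}  g≤h = g≤h []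
  ∑-mono {suc n} g≤h = sum-mono (λ t → ∑-mono (λ x → g≤h (t ∷ x)))

  ∑-scale : ∀ {n} a (g : V n → Carrier) → ∑ᵛ (λ x → a * g x) ≈ a * ∑ᵛ g
  ∑-scale {zero}  a g = refl
  ∑-scale {suc n} a g = trans (sum-cong-≋ {p} (λ t → ∑-scale a (λ x → g (t ∷ x)))) (sym (*-distribˡ-sum a (λ t → ∑ᵛ (λ x → g (t ∷ x)))))

  ∑-const : ∀ n x → ∑ᵛ {n} (λ _ → x) ≈ ofℕ (p ℕ.^ n) * x
  ∑-const zero    x = trans (sym (*-identityˡ x)) (*-congʳ (sym (+-identityʳ 1#)))
  ∑-const (suc n) x = trans (sum-cong-≋ {p} (λ t → ∑-const n x)) (trans (sum-const p _)
    (trans (sym (*-assoc _ _ _)) (*-congʳ (sym (×1-homo-* p (p ℕ.^ n))))))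

  ∑-ofℕ : ∀ {n} (g : V n → ℕ) → ofℕ (∑ℕ g) ≈ ∑ᵛ (λ x → ofℕ (g x))
  ∑-ofℕ {zero}  g = refl
  ∑-ofℕ {suc n} g = trans (sum-ofℕ (λ t → ∑ℕ (λ x → g (t ∷ x)))) (sum-cong-≋ {p} (λ t → ∑-ofℕ (λ x → g (t ∷ x))))
    where
    open import Algebra.Properties.CommutativeMonoid.Sum ℕₚ.+-0-commutativeMonoid using () renaming (sum to sumℕ)
    sum-ofℕ : ∀ {m} (g : Fin m → ℕ) → ofℕ (sumℕ g) ≈ sum (λ t → ofℕ (g t))
    sum-ofℕ {zero}  g = refl
    sum-ofℕ {suc m} g = trans (×-homo-+ 1# (g zero) (sumℕ (λ t → g (suc t)))) (+-congˡ (sum-ofℕ (λ t → g (suc t))))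

  ∑-* : ∀ {m n} (g : V m → Carrier) (h : V n → Carrier) → ∑ᵛ g * ∑ᵛ h ≈ ∑ᵛ (λ x → ∑ᵛ (λ y → g x * h y))
  ∑-* g h = trans (*-comm _ _) (trans (sym (∑-scale (∑ᵛ h) g))
    (∑ᵛ-cong (λ x → trans (*-comm _ _) (sym (∑-scale (g x) h)))))

  -- The sum over all `x` and `y` of the squares of `g x - g y` is nonnegative; expanded, it is
  -- twice the difference of the two sides.
  cauchy-schwarz : ∀ {n} (g : V n → Carrier) → ∑ᵛ g * ∑ᵛ g ≤ ofℕ (p ℕ.^ n) * ∑ᵛ (λ x → g x * g x)
  cauchy-schwarz {n} g = x+x≤y+y⇒x≤y (0≤y-x⇒x≤y (≤-respʳ expand
    (≤-respˡ (trans (∑-const n _) (trans (*-congˡ (trans (∑-const n 0#) (zeroʳ _))) (zeroʳ _)))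
      (∑-mono {n} (λ x → ∑-mono {n} (λ y → 0≤x² (g x - g y)))))))
    where
    N G Q : Carrier
    N = ofℕ (p ℕ.^ n)
    G = ∑ᵛ g
    Q = ∑ᵛ (λ x → g x * g x)
    inner : ∀ x → ∑ᵛ (λ y → (g x - g y) * (g x - g y)) ≈ (N * (g x * g x) + Q) - (g x * G + g x * G)
    inner x = begin
      ∑ᵛ (λ y → (g x - g y) * (g x - g y))
        ≈⟨ ∑ᵛ-cong (λ y → solve 2 (λ a b → (a :- b) :* (a :- b) := (a :* a :+ b :* b) :+ ((:- a) :* b :+ (:- a) :* b)) refl (g x) (g y)) ⟩
      ∑ᵛ (λ y → (g x * g x + g y * g y) + (- g x * g y + - g x * g y))
        ≈⟨ trans (∑ᵛ-∙ {n} _ _) (+-cong (∑ᵛ-∙ {n} _ _) (∑ᵛ-∙ {n} _ _)) ⟩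
      (∑ᵛ {n} (λ y → g x * g x) + Q) + (∑ᵛ (λ y → - g x * g y) + ∑ᵛ (λ y → - g x * g y))
        ≈⟨ +-cong (+-congʳ (∑-const n _)) (+-cong (∑-scale {n} (- g x) g) (∑-scale {n} (- g x) g)) ⟩
      (N * (g x * g x) + Q) + (- g x * G + - g x * G)
        ≈⟨ solve 4 (λ a q x G → (a :+ q) :+ ((:- x) :* G :+ (:- x) :* G) := (a :+ q) :- (x :* G :+ x :* G)) refl (N * (g x * g x)) Q (g x) G ⟩
      (N * (g x * g x) + Q) - (g x * G + g x * G) ∎
    expand : ∑ᵛ (λ x → ∑ᵛ (λ y → (g x - g y) * (g x - g y))) ≈ (N * Q + N * Q) - (G * G + G * G)
    expand = begin
      ∑ᵛ (λ x → ∑ᵛ (λ y → (g x - g y) * (g x - g y)))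
        ≈⟨ ∑ᵛ-cong (λ x → trans (inner x) (solve 4 (λ a q x G → (a :+ q) :- (x :* G :+ x :* G) := (a :+ q) :+ ((:- G) :* x :+ (:- G) :* x)) refl (N * (g x * g x)) Q (g x) G)) ⟩
      ∑ᵛ (λ x → (N * (g x * g x) + Q) + (- G * g x + - G * g x))
        ≈⟨ trans (∑ᵛ-∙ {n} _ _) (+-cong (∑ᵛ-∙ {n} _ _) (∑ᵛ-∙ {n} _ _)) ⟩
      (∑ᵛ (λ x → N * (g x * g x)) + ∑ᵛ {n} (λ _ → Q)) + (∑ᵛ (λ x → - G * g x) + ∑ᵛ (λ x → - G * g x))
        ≈⟨ +-cong (+-cong (∑-scale {n} N (λ x → g x * g x)) (∑-const n Q)) (+-cong (∑-scale {n} (- G) g) (∑-scale {n} (- G) g)) ⟩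
      (N * Q + N * Q) + (- G * G + - G * G)
        ≈⟨ solve 2 (λ a G → a :+ ((:- G) :* G :+ (:- G) :* G) := a :- (G :* G :+ G :* G)) refl (N * Q + N * Q) G ⟩
      (N * Q + N * Q) - (G * G + G * G) ∎

  record Character : Set where
    field
      c s        : F → Carrier
      c-+        : ∀ a b → c (a +ᶠ b) ≈ c a * c b - s a * s b
      s-+        : ∀ a b → s (a +ᶠ b) ≈ s a * c b + c a * s b
      norm       : ∀ a → c a * c a + s a * s a ≈ 1#
      -- In complex terms: multiplication by the value at 1 fixes no `x + i y` with nonzero `x`.
      -- Stated in this way it needs no inverse of that value minus 1.
      nontrivial : ∀ {x y} → c 1ᶠ * x - s 1ᶠ * y ≈ x → s 1ᶠ * x + c 1ᶠ * y ≈ y → x ≈ 0#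

  module Sums (χ : Character) where

    open Character χ

    c-cong : ∀ {a b} → a ≡ b → c a ≈ c b
    c-cong ≡.refl = refl

    s-cong : ∀ {a b} → a ≡ b → s a ≈ s b
    s-cong ≡.refl = refl

    c-difference : ∀ a b → c (a +ᶠ -ᶠ b) ≈ c a * c b + s a * s b
    c-difference a b = begin
      c d                                              ≈⟨ *-identityʳ _ ⟨
      c d * 1#                                         ≈⟨ *-congˡ (norm b) ⟨
      c d * (c b * c b + s b * s b)                    ≈⟨ solve 4 (λ cd sd cb sb → cd :* (cb :* cb :+ sb :* sb) := (cd :* cb :- sd :* sb) :* cb :+ (sd :* cb :+ cd :* sb) :* sb) refl (c d) (s d) (c b) (s b) ⟩
      (c d * c b - s d * s b) * c b + (s d * c b + c d * s b) * s b
                                                       ≈⟨ +-cong (*-congʳ (trans (sym (c-+ d b)) (c-cong d+b))) (*-congʳ (trans (sym (s-+ d b)) (s-cong d+b))) ⟩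
      c a * c b + s a * s b                            ∎
      where
      d : F
      d = a +ᶠ -ᶠ b
      d+b : d +ᶠ b ≡ a
      d+b = FS.solve 2 (λ a b → (a FS.:- b) FS.:+ b FS.:= a) ≡.refl a b

    c≤1 : ∀ a → c a ≤ 1#
    c≤1 a = x+x≤y+y⇒x≤y (0≤y-x⇒x≤y (≤-respʳ (begin
      (1# - c a) * (1# - c a) + s a * s a    ≈⟨ solve 3 (λ u c s → (u :- c) :* (u :- c) :+ s :* s := (c :* c :+ s :* s) :+ (u :* u :- (u :* c :+ u :* c))) refl 1# (c a) (s a) ⟩
      (c a * c a + s a * s a) + (1# * 1# - (1# * c a + 1# * c a))
                                             ≈⟨ +-cong (norm a) (+-cong (*-identityˡ 1#) (-‿cong (+-cong (*-identityˡ (c a)) (*-identityˡ (c a))))) ⟩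
      1# + (1# - (c a + c a))                ≈⟨ +-assoc 1# 1# _ ⟨
      (1# + 1#) - (c a + c a)                ∎) (0≤-+ (0≤x² (1# - c a)) (0≤x² (s a)))))

    -- Real part, imaginary part and squared modulus of the exponential sum of `h`.
    C S q : ∀ {n} → Fun n → Carrier
    C h = ∑ᵛ (λ x → c (h x))
    S h = ∑ᵛ (λ x → s (h x))
    q h = C h * C h + S h * S h

    0≤q : ∀ {n} (h : Fun n) → 0# ≤ q h
    0≤q h = 0≤-+ (0≤x² (C h)) (0≤x² (S h))

    -- The squared modulus is a double sum over pairs of points; it is rearranged by their
    -- difference. This is the basic differencing step, and only cosines occur since the value is
    -- real.
    q-differences : ∀ {n} (h : Fun n) → q h ≈ ∑ᵛ (λ y → C (Δ y h))
    q-differences {n} h = begin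
      C h * C h + S h * S h
        ≈⟨ +-cong (∑-* {n} {n} _ _) (∑-* {n} {n} _ _) ⟩
      ∑ᵛ (λ x → ∑ᵛ (λ y → c (h x) * c (h y))) + ∑ᵛ (λ x → ∑ᵛ (λ y → s (h x) * s (h y)))
        ≈⟨ trans (sym (∑ᵛ-∙ {n} _ _)) (∑ᵛ-cong {n} (λ x → sym (∑ᵛ-∙ {n} _ _))) ⟩
      ∑ᵛ (λ x → ∑ᵛ (λ y → c (h x) * c (h y) + s (h x) * s (h y)))
        ≈⟨ ∑ᵛ-cong (λ x → ∑ᵛ-cong (λ y → trans (+-cong (*-comm _ _) (*-comm _ _)) (sym (c-difference (h y) (h x))))) ⟩
      ∑ᵛ (λ x → ∑ᵛ (λ y → c (h y +ᶠ -ᶠ h x)))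
        ≈⟨ ∑ᵛ-cong (λ x → trans (sym (∑ᵛ-translate (λ y → c (h y +ᶠ -ᶠ h x)) x))
             (∑ᵛ-cong (λ y → c-cong (≡.cong (λ v → h v +ᶠ -ᶠ h x) (V-ring.+-comm y x))))) ⟩
      ∑ᵛ (λ x → ∑ᵛ (λ y → c (Δ y h x)))
        ≈⟨ ∑ᵛ-swap (λ x y → c (Δ y h x)) ⟩
      ∑ᵛ (λ y → C (Δ y h)) ∎

    C²≤q : ∀ {n} (h : Fun n) → C h * C h ≤ q h
    C²≤q h = 0≤x⇒y≤y+x (0≤x² (S h))

    size : ℕ → Carrier
    size n = ofℕ (p ℕ.^ n)

    0≤size : ∀ n → 0# ≤ size n
    0≤size n = 0≤ofℕ (p ℕ.^ n)

    q²≤ : ∀ {n} (h : Fun n) → q h * q h ≤ size n * ∑ᵛ (λ y → q (Δ y h))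
    q²≤ {n} h = ≤-respˡ (sym (*-cong (q-differences h) (q-differences h)))
      (≤-trans (cauchy-schwarz (λ y → C (Δ y h))) (*-monoˡ-≤ (0≤size n) (∑-mono (λ y → C²≤q (Δ y h)))))

    flat? : ∀ {n} (h : Fun n) → Dec (∀ e → Δ e h 𝟎 ≡ 0ᶠ)
    flat? h = search-∀ search-V (λ e → Δ e h 𝟎 ≟ 0ᶠ)

    C≤size : ∀ {n} (h : Fun n) → C h ≤ size n
    C≤size {n} h = ≤-trans (∑-mono (λ x → c≤1 (h x))) (≤-reflexive (trans (∑-const n 1#) (*-identityʳ _)))

    module _ {n} {h : Fun n} (Dh : Der 2 h) where

      slope-lin : Lin (λ e → Δ e h 𝟎)
      slope-lin x y = ≡.trans (Δ-⊕ h x y 𝟎) (≡.trans (≡.cong (Δ x h 𝟎 +ᶠ Δ y h 𝟎 +ᶠ_) (Dh y x 𝟎))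
        (PF.+-identityʳ _))
        where module PF = CommutativeRing (PrimeField.commutativeRing K)

      -- Translation along a direction in which `h` grows by 1 leaves the sum unchanged, yet
      -- multiplies it by the character at 1.
      C-affine-zero : ∀ {e} → ¬ Δ e h 𝟎 ≡ 0ᶠ → C h ≈ 0#
      C-affine-zero {e} slope≢0 = nontrivial
        (begin
          c 1ᶠ * C h - s 1ᶠ * S h
            ≈⟨ +-cong (sym (∑-scale {n} (c 1ᶠ) _)) (trans (solve 2 (λ s S → :- (s :* S) := (:- s) :* S) refl (s 1ᶠ) (S h)) (sym (∑-scale {n} (- s 1ᶠ) _))) ⟩
          ∑ᵛ (λ x → c 1ᶠ * c (h x)) + ∑ᵛ (λ x → - s 1ᶠ * s (h x))
            ≈⟨ sym (∑ᵛ-∙ {n} _ _) ⟩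
          ∑ᵛ (λ x → c 1ᶠ * c (h x) + - s 1ᶠ * s (h x))
            ≈⟨ ∑ᵛ-cong (λ x → trans (solve 4 (λ c s u v → c :* u :+ (:- s) :* v := u :* c :- v :* s) refl (c 1ᶠ) (s 1ᶠ) (c (h x)) (s (h x)))
                 (trans (sym (c-+ (h x) 1ᶠ)) (c-cong (≡.sym (step x))))) ⟩
          ∑ᵛ (λ x → c (h (x ⊕ e₁)))
            ≈⟨ ∑ᵛ-translate (λ x → c (h x)) e₁ ⟩
          C h ∎)
        (begin
          s 1ᶠ * C h + c 1ᶠ * S h
            ≈⟨ +-cong (sym (∑-scale {n} (s 1ᶠ) _)) (sym (∑-scale {n} (c 1ᶠ) _)) ⟩
          ∑ᵛ (λ x → s 1ᶠ * c (h x)) + ∑ᵛ (λ x → c 1ᶠ * s (h x))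
            ≈⟨ sym (∑ᵛ-∙ {n} _ _) ⟩
          ∑ᵛ (λ x → s 1ᶠ * c (h x) + c 1ᶠ * s (h x))
            ≈⟨ ∑ᵛ-cong (λ x → trans (solve 4 (λ c s u v → s :* u :+ c :* v := v :* c :+ u :* s) refl (c 1ᶠ) (s 1ᶠ) (c (h x)) (s (h x)))
                 (trans (sym (s-+ (h x) 1ᶠ)) (s-cong (≡.sym (step x))))) ⟩
          ∑ᵛ (λ x → s (h (x ⊕ e₁)))
            ≈⟨ ∑ᵛ-translate (λ x → s (h x)) e₁ ⟩
          S h ∎)
        where
        inv : ∃[ b ] b *ᶠ Δ e h 𝟎 ≡ 1ᶠ
        inv = inverseᶠ (Δ e h 𝟎) slope≢0
        e₁ : V n
        e₁ = proj₁ inv ⊙ e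
        step : ∀ x → h (x ⊕ e₁) ≡ h x +ᶠ 1ᶠ
        step x = ≡.trans (FS.solve 2 (λ a b → a FS.:= b FS.:+ (a FS.:- b)) ≡.refl (h (x ⊕ e₁)) (h x))
          (≡.cong (h x +ᶠ_) (≡.trans (der₁-const (Dh e₁) x) (≡.trans (lin-⊙ slope-lin (proj₁ inv) e) (proj₂ inv))))

      C-affine : C h ≤ size n * ofℕ (ind (flat? h))
      C-affine with flat? h
      ... | yes _ = ≤-respʳ (sym (trans (*-congˡ (+-identityʳ 1#)) (*-identityʳ _))) (C≤size h)
      ... | no ¬flat with search-V (λ e → ¬? (Δ e h 𝟎 ≟ 0ᶠ))
      ...   | yes (e , slope≢0) = ≤-reflexive (trans (C-affine-zero slope≢0) (sym (zeroʳ _)))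
      ...   | no none = contradiction (λ e → decidable-stable (Δ e h 𝟎 ≟ 0ᶠ) (λ ≢0 → none (e , ≢0))) ¬flat

    module _ {n} {f : Fun n} (Df : Der 5 f) where

      private
        N : Carrier
        N = size n
        0≤N : 0# ≤ N
        0≤N = 0≤size n
        open Sym⁴ (quartic-sym⁴ Df)

      -- A further difference is affine, so its sum is at most `N` if its slope vanishes and 0
      -- otherwise; the vanishing slopes are what `vanishing` counts.
      third-differences : ∀ y z → q (Δ z (Δ y f)) ≤ N * ofℕ (vanishing (quartic-form f y z))
      third-differences y z = ≤-respˡ (sym (q-differences (Δ z (Δ y f)))) (≤-trans
        (∑-mono (λ u → C-affine {h = Δ u (Δ z (Δ y f))} (Df y z u)))
        (≤-reflexive (trans (∑-scale {n} N _) (*-congˡ (trans (sym (∑-ofℕ {n} (λ u → ind (flat? (Δ u (Δ z (Δ y f))))))) (reflexive (≡.cong ofℕ count)))))))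
        where
        open import Relation.Binary.PropositionalEquality using (cong)
        reorder : ∀ u e → Δ e (Δ u (Δ z (Δ y f))) 𝟎 ≡ quartic-form f y z u e
        reorder u e = ≡.trans (s₁₂ e u z y) (≡.trans (s₁₃ u e z y) (≡.trans (s₁₄ z e u y) (s₂₄ y e u z)))
          where
          s₁₄ : ∀ a b c d → quartic-form f a b c d ≡ quartic-form f d b c a
          s₁₄ a b c d = ≡.trans (s₁₂ a b c d) (≡.trans (s₂₄ b a c d) (s₁₂ b d c a))
        count : ∑ℕ (λ u → ind (flat? (Δ u (Δ z (Δ y f))))) ≡ vanishing (quartic-form f y z)
        count = ∑ᵛℕ-cong (λ u → ind-cong (flat? (Δ u (Δ z (Δ y f)))) (search-∀ search-V (λ e → quartic-form f y z u e ≟ 0ᶠ))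
          (λ h e → ≡.trans (≡.sym (reorder u e)) (h e)) (λ h e → ≡.trans (reorder u e) (h e)))

      -- Two differencing steps, then `third-differences`. As `q f` is `N²δ²`, the count is at least
      -- `N³δ⁸`: the exponent 8 arises here.
      bias₁ : (q f * q f) * (q f * q f) ≤ N * (N * (N * (N * N))) * ofℕ (∑ℕ (λ y → ∑ℕ (λ z → vanishing (quartic-form f y z))))
      bias₁ = ≤-trans (square-mono (0≤x² (q f)) (q²≤ f)) (≤-trans
        (≤-respʳ (solve 2 (λ N X → (N :* N) :* (N :* X) := N :* (N :* (N :* X))) refl N _)
          (≤-respˡ (solve 2 (λ N X → (N :* N) :* (X :* X) := (N :* X) :* (N :* X)) refl N _)
            (*-monoˡ-≤ (0≤-* 0≤N 0≤N) (cauchy-schwarz (λ y → q (Δ y f))))))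
        (≤-trans (*-monoˡ-≤ 0≤N (*-monoˡ-≤ 0≤N (*-monoˡ-≤ 0≤N (∑-mono (λ y → ≤-trans (q²≤ (Δ y f))
            (*-monoˡ-≤ 0≤N (∑-mono (third-differences y))))))))
          (≤-reflexive (begin
            N * (N * (N * ∑ᵛ (λ y → N * ∑ᵛ (λ z → N * ofℕ (vanishing (quartic-form f y z))))))
              ≈⟨ *-congˡ (*-congˡ (*-congˡ (trans (∑-scale {n} N _) (*-congˡ (trans (∑ᵛ-cong (λ y → trans (∑-scale {n} N _) (*-congˡ (sym (∑-ofℕ {n} (λ z → vanishing (quartic-form f y z)))))))
                   (trans (∑-scale {n} N _) (*-congˡ (sym (∑-ofℕ {n} (λ y → ∑ℕ (λ z → vanishing (quartic-form f y z)))))))))))) ⟩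
            N * (N * (N * (N * (N * ofℕ (∑ℕ (λ y → ∑ℕ (λ z → vanishing (quartic-form f y z))))))))
              ≈⟨ solve 2 (λ N X → N :* (N :* (N :* (N :* (N :* X)))) := N :* (N :* (N :* (N :* N))) :* X) refl N _ ⟩
            N * (N * (N * (N * N))) * ofℕ (∑ℕ (λ y → ∑ℕ (λ z → vanishing (quartic-form f y z)))) ∎))))

    module _ {n : ℕ} where

      private
        N : Carrier
        N = size n
        0≤N : 0# ≤ N
        0≤N = 0≤size n
        cancel-N : ∀ {x y} → N * x ≤ N * y → x ≤ y
        cancel-N = ofℕ-cancel (pⁿ>0 n)

      module _ {P : V n → V n} (P-lin : Linᵛ P) (h : Fun n) where

        average-cosets : ∀ (χ : F → Carrier) → N * ∑ᵛ (λ x → χ (h x)) ≈ ∑ᵛ (λ a → ∑ᵛ (λ x → χ (onCoset P a h x)))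
        average-cosets χ = sym (begin
          ∑ᵛ (λ a → ∑ᵛ (λ x → χ (h (P x ⊕ a))))    ≈⟨ ∑ᵛ-swap {n} {n} (λ a x → χ (h (P x ⊕ a))) ⟩
          ∑ᵛ (λ x → ∑ᵛ (λ a → χ (h (P x ⊕ a))))    ≈⟨ ∑ᵛ-cong {n} (λ x → trans (∑ᵛ-cong {n} (λ a → reflexive (≡.cong (λ v → χ (h v)) (V-ring.+-comm (P x) a))))
                                                        (∑ᵛ-translate {n} (λ a → χ (h a)) (P x))) ⟩
          ∑ᵛ {n} (λ x → ∑ᵛ (λ a → χ (h a)))        ≈⟨ ∑-const n _ ⟩
          N * ∑ᵛ (λ x → χ (h x))                   ∎)

        -- The sum of `h` is the mean of its sums over the translates by `a`, and by Cauchy-Schwarz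
        -- the squared modulus of a mean is at most the mean of the squared moduli.
        cosets≥ : N * q h ≤ ∑ᵛ (λ a → q (onCoset P a h))
        cosets≥ = cancel-N (≤-respˡ (begin
            ∑ᵛ Cₐ * ∑ᵛ Cₐ + ∑ᵛ Sₐ * ∑ᵛ Sₐ               ≈⟨ +-cong (*-cong (sym (average-cosets c)) (sym (average-cosets c))) (*-cong (sym (average-cosets s)) (sym (average-cosets s))) ⟩
            (N * C h) * (N * C h) + (N * S h) * (N * S h) ≈⟨ solve 3 (λ N C S → (N :* C) :* (N :* C) :+ (N :* S) :* (N :* S) := N :* (N :* (C :* C :+ S :* S))) refl N (C h) (S h) ⟩
            N * (N * q h)                                 ∎)
          (≤-respʳ (begin
            N * ∑ᵛ (λ a → Cₐ a * Cₐ a) + N * ∑ᵛ (λ a → Sₐ a * Sₐ a)   ≈⟨ distribˡ N _ _ ⟨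
            N * (∑ᵛ (λ a → Cₐ a * Cₐ a) + ∑ᵛ (λ a → Sₐ a * Sₐ a))     ≈⟨ *-congˡ (sym (∑ᵛ-∙ {n} _ _)) ⟩
            N * ∑ᵛ (λ a → q (onCoset P a h))                          ∎)
          (+-mono-≤ (cauchy-schwarz Cₐ) (cauchy-schwarz Sₐ))))
          where
          Cₐ Sₐ : V n → Carrier
          Cₐ a = C (onCoset P a h)
          Sₐ a = S (onCoset P a h)

      module _ {R : V n → V n} (R-lin : Linᵛ R) {h : Fun n} (quadratic : ∀ z w u x → Δ (R z) (Δ (R w) (Δ (R u) h)) x ≡ 0ᶠ) where

        private
          Δ²-onCoset : ∀ a z w x → Δ z (Δ w (onCoset R a h)) x ≡ onCoset R a (Δ (R z) (Δ (R w) h)) x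
          Δ²-onCoset a z w x = ≡.trans (Δ-cong (Δ-onCoset R-lin a h w) z x) (Δ-onCoset R-lin a (Δ (R w) h) z x)

          der₃ : ∀ a → Der 3 (onCoset R a h)
          der₃ a z w u x = ≡.trans (Δ-cong (Δ²-onCoset a w z) u x) (≡.trans (Δ-onCoset R-lin a (Δ (R w) (Δ (R z) h)) u x)
            (quadratic u w z (R x ⊕ a)))

        q-coset : ∀ a → q (onCoset R a h) ≤ N * ofℕ (vanishing (λ z w → Δ (R z) (Δ (R w) h) a))
        q-coset a = ≤-respˡ (sym (q-differences (onCoset R a h))) (≤-trans
          (∑-mono (λ z → C-affine {h = Δ z (onCoset R a h)} (der₃ a z)))
          (≤-reflexive (trans (∑-scale {n} N _) (*-congˡ (trans (sym (∑-ofℕ {n} (λ z → ind (flat? (Δ z (onCoset R a h)))))) (reflexive (≡.cong ofℕ count)))))))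
          where
          at-𝟎 : ∀ z w → Δ w (Δ z (onCoset R a h)) 𝟎 ≡ Δ (R z) (Δ (R w) h) a
          at-𝟎 z w = ≡.trans (Δ-swap (onCoset R a h) w z 𝟎) (≡.trans (Δ²-onCoset a z w 𝟎)
            (≡.cong (Δ (R z) (Δ (R w) h)) (≡.trans (≡.cong (_⊕ a) (linᵛ-𝟎′)) (V-ring.+-identityˡ a))))
            where
            linᵛ-𝟎′ : R 𝟎 ≡ 𝟎
            linᵛ-𝟎′ = linᵛ-𝟎 R-lin
          count : ∑ℕ (λ z → ind (flat? (Δ z (onCoset R a h)))) ≡ vanishing (λ z w → Δ (R z) (Δ (R w) h) a)
          count = ∑ᵛℕ-cong (λ z → ind-cong (flat? (Δ z (onCoset R a h))) (search-∀ search-V (λ w → Δ (R z) (Δ (R w) h) a ≟ 0ᶠ))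
            (λ hyp w → ≡.trans (≡.sym (at-𝟎 z w)) (hyp w)) (λ hyp w → ≡.trans (at-𝟎 z w) (hyp w)))

        -- On each coset of the image of `R` the function is quadratic, and one differencing step
        -- reduces its sum to the radical of its polarisation there.
        q-quadratic : q h ≤ ofℕ (∑ℕ (λ a → vanishing (λ z w → Δ (R z) (Δ (R w) h) a)))
        q-quadratic = cancel-N (≤-trans (cosets≥ R-lin h) (≤-trans (∑-mono q-coset)
          (≤-reflexive (trans (∑-scale {n} N _) (*-congˡ (sym (∑-ofℕ {n} (λ a → vanishing (λ z w → Δ (R z) (Δ (R w) h) a)))))))))

      module _ {f : Fun n} {P : V n → V n} (P-lin : Linᵛ P) (R : V n → V n → V n) (R-lin : ∀ y → Linᵛ (R y))
               (kills : ∀ a y z w u x → Δ y (Δ (R y z) (Δ (R y w) (Δ (R y u) (onCoset P a f)))) x ≡ 0ᶠ) where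

        private
          count : V n → V n → ℕ
          count a y = ∑ℕ (λ v → vanishing (λ z w → Δ y (Δ (R y z) (Δ (R y w) (onCoset P a f))) v))

          derivative : ∀ a y → q (Δ y (onCoset P a f)) ≤ ofℕ (count a y)
          derivative a y = ≤-respʳ (reflexive (≡.cong ofℕ (∑ᵛℕ-cong (λ v → vanishing-cong
              (λ hyp w → ≡.trans (move v _ w) (hyp w)) (λ hyp w → ≡.trans (≡.sym (move v _ w)) (hyp w))))))
            (q-quadratic (R-lin y) {h = Δ y (onCoset P a f)} (λ z w u x → ≡.trans
              (Δ-cong (λ x → ≡.trans (Δ-cong (Δ-swap (onCoset P a f) (R y u) y) (R y w) x) (Δ-swap (Δ (R y u) (onCoset P a f)) (R y w) y x)) (R y z) x)
              (≡.trans (Δ-swap (Δ (R y w) (Δ (R y u) (onCoset P a f))) (R y z) y x) (kills a y z w u x))))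
            where
            move : ∀ v z w → Δ y (Δ (R y z) (Δ (R y w) (onCoset P a f))) v ≡ Δ (R y z) (Δ (R y w) (Δ y (onCoset P a f))) v
            move v z w = ≡.trans (Δ-swap (Δ (R y w) (onCoset P a f)) y (R y z) v) (Δ-cong (Δ-swap (onCoset P a f) y (R y w)) (R y z) v)

        -- Restriction to the cosets of `P`, one differencing step, then `q-quadratic`. Only the
        -- square of `q f` enters, so that the count is at least `N⁴δ⁴`.
        bias₂ : q f * q f ≤ ofℕ (∑ℕ (λ a → ∑ℕ (count a)))
        bias₂ = cancel-N (cancel-N (≤-respˡ (solve 2 (λ N X → (N :* X) :* (N :* X) := N :* (N :* (X :* X))) refl N (q f))
          (≤-trans (square-mono (0≤-* 0≤N (0≤q f)) (cosets≥ P-lin f)) (≤-trans (cauchy-schwarz (λ a → q (onCoset P a f)))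
            (*-monoˡ-≤ 0≤N (≤-trans (∑-mono (λ a → ≤-trans (q²≤ (onCoset P a f)) (*-monoˡ-≤ 0≤N (≤-trans (∑-mono (derivative a))
              (≤-reflexive (sym (∑-ofℕ {n} (count a))))))))
              (≤-reflexive (trans (∑-scale {n} N _) (*-congˡ (sym (∑-ofℕ {n} (λ a → ∑ℕ (count a)))))))))))))

-- From bias to density

module Link {p : ℕ} (K : PrimeField p) (O : OrderedRing) where

  open import Data.Product.Base using () renaming (_×_ to _∧_)

  open CharSum K O
  open Forms K using (Fun; Δ; Der; Dense₁; Dense₂; pⁿ>0; vanishing; quartic-form) renaming (∑ᵛ to ∑ℕ)
  open OrderedRing O hiding (zero)
  open import Algebra.Properties.Semiring.Mult semiring using (×-homo-+)
  open import Algebra.Properties.Ring ring using (-0#≈0#)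
  open IntegerSolver commutativeRing using (solve; _:=_; _:+_; _:*_)
  open import Relation.Binary.Reasoning.Setoid setoid

  module _ (χ : Character) (archimedean : ∀ x → 0# ≤ x → ∃[ m ] x ≤ ofℕ m ∧ ofℕ m ≤ x + ofℕ 2)
           (ofℕ-reflects-≤ : ∀ {a b} → ofℕ a ≤ ofℕ b → a ℕ.≤ b) where

    open Sums χ

    -- The square of the modulus of (i + 0 √-1) (X + Y √-1).
    average² : ∀ {n} (f : Fun n) {i X Y d} → X ≈ C f → Y ≈ S f →
      d ≈ (i * X - 0# * Y) * (i * X - 0# * Y) + (i * Y + 0# * X) * (i * Y + 0# * X) → d ≈ (i * i) * q f
    average² f {i} {X} {Y} {d} X≈ Y≈ d≈ = trans d≈ (trans (+-cong (*-cong real real) (*-cong imaginary imaginary))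
      (solve 3 (λ i C S → (i :* C) :* (i :* C) :+ (i :* S) :* (i :* S) := (i :* i) :* (C :* C :+ S :* S)) refl i (C f) (S f)))
      where
      real : i * X - 0# * Y ≈ i * C f
      real = trans (+-cong (*-congˡ X≈) (trans (-‿cong (zeroˡ Y)) -0#≈0#)) (+-identityʳ _)
      imaginary : i * Y + 0# * X ≈ i * S f
      imaginary = trans (+-cong (*-congˡ Y≈) (zeroˡ X)) (+-identityʳ _)

    module _ {n} {f : Fun n} (Df : Der 5 f) {δ ρ i : Carrier} (i*N≈1 : i * size n ≈ 1#)
             (modulus : δ * δ ≈ (i * i) * q f) (ρδ≈p : ρ * δ ≈ ofℕ p) where

      private
        N r D : Carrier
        N = size n
        r = ρ * ρ
        D = δ * δ
        0≤N : 0# ≤ N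
        0≤N = 0≤size n
        0≤r : 0# ≤ r
        0≤r = 0≤x² ρ
        cancel-N : ∀ {x y} → N * x ≤ N * y → x ≤ y
        cancel-N = ofℕ-cancel (pⁿ>0 n)

      q≈N²D : q f ≈ N * (N * D)
      q≈N²D = sym (begin
        N * (N * D)                        ≈⟨ *-congˡ (*-congˡ modulus) ⟩
        N * (N * ((i * i) * q f))          ≈⟨ solve 3 (λ N i q → N :* (N :* ((i :* i) :* q)) := ((i :* N) :* (i :* N)) :* q) refl N i (q f) ⟩
        ((i * N) * (i * N)) * q f          ≈⟨ *-congʳ (trans (*-cong i*N≈1 i*N≈1) (*-identityˡ 1#)) ⟩
        1# * q f                           ≈⟨ *-identityˡ (q f) ⟩
        q f                                ∎)

      rD≈p² : r * D ≈ ofℕ p * ofℕ p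
      rD≈p² = trans (solve 2 (λ ρ δ → (ρ :* ρ) :* (δ :* δ) := (ρ :* δ) :* (ρ :* δ)) refl ρ δ) (*-cong ρδ≈p ρδ≈p)

      1≤rD : 1# ≤ r * D
      1≤rD = ≤-respʳ (sym rD≈p²) (≤-respˡ (*-identityˡ 1#) (square-mono 0≤1 (1≤ofℕ 0<p)))
        where
        0<p : 0 ℕ.< p
        0<p = ℕₚ.≤-trans (pⁿ>0 1) (ℕₚ.≤-reflexive (ℕₚ.*-identityʳ p))

      -- The trivial bound for the sum. It implies `1# ≤ r`, so that one `A` above `ρ⁸` serves also
      -- for the second count, where `ρ⁴` would do.
      D≤1 : D ≤ 1#
      D≤1 = cancel-N (cancel-N (≤-respˡ q≈N²D (≤-respˡ (sym (q-differences f)) (≤-trans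
        (∑-mono {n} (λ y → C≤size (Δ y f))) (≤-reflexive (trans (∑-const n N) (*-congˡ (sym (*-identityʳ N)))))))))

      1≤r : 1# ≤ r
      1≤r = ≤-trans 1≤rD (≤-respʳ (*-identityʳ r) (*-monoˡ-≤ 0≤r D≤1))

      1≤r² : 1# ≤ r * r
      1≤r² = ≤-respˡ (*-identityˡ 1#) (square-mono 0≤1 1≤r)

      ρ⁸ : Carrier
      ρ⁸ = (r * r) * (r * r)

      1≤ρ⁸ : 1# ≤ ρ⁸
      1≤ρ⁸ = ≤-respˡ (*-identityˡ 1#) (square-mono 0≤1 1≤r²)

      N²≤rq : N * N ≤ r * q f
      N²≤rq = ≤-respʳ (sym (trans (*-congˡ q≈N²D) (solve 3 (λ r N D → r :* (N :* (N :* D)) := (N :* N) :* (r :* D)) refl r N D)))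
        (*-mono-1≤ (0≤-* 0≤N 0≤N) 1≤rD)

      N⁴≤ : (N * N) * (N * N) ≤ (r * r) * (q f * q f)
      N⁴≤ = ≤-respʳ (solve 2 (λ r q → (r :* q) :* (r :* q) := (r :* r) :* (q :* q)) refl r (q f)) (square-mono (0≤-* 0≤N 0≤N) N²≤rq)

      N⁸≤ : ((N * N) * (N * N)) * ((N * N) * (N * N)) ≤ ρ⁸ * ((q f * q f) * (q f * q f))
      N⁸≤ = ≤-respʳ (solve 2 (λ r q → (r :* q) :* (r :* q) := (r :* r) :* (q :* q)) refl (r * r) (q f * q f))
        (square-mono (0≤-* (0≤-* 0≤N 0≤N) (0≤-* 0≤N 0≤N)) N⁴≤)

      module _ (A : ℕ) (ρ⁸≤A : ρ⁸ ≤ ofℕ A) where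

        scale-A : ∀ m → ρ⁸ * ofℕ m ≤ ofℕ (A ℕ.* m)
        scale-A m = ≤-respʳ (sym (ofℕ-* A m)) (≤-respˡ (*-comm (ofℕ m) ρ⁸) (≤-respʳ (*-comm (ofℕ m) (ofℕ A)) (*-monoˡ-≤ (0≤ofℕ m) ρ⁸≤A)))

        dense₁ : Dense₁ f A
        dense₁ = ofℕ-reflects-≤ (≤-respˡ (sym (trans (ofℕ-* (p ℕ.^ n) (p ℕ.^ n ℕ.* p ℕ.^ n)) (*-congˡ (ofℕ-* (p ℕ.^ n) (p ℕ.^ n)))))
          (≤-trans N³≤ (scale-A count)))
          where
          count : ℕ
          count = ∑ℕ (λ y → ∑ℕ (λ z → vanishing (quartic-form f y z)))
          N³≤ : N * (N * N) ≤ ρ⁸ * ofℕ count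
          N³≤ = cancel-N (cancel-N (cancel-N (cancel-N (cancel-N
            (≤-respˡ (solve 1 (λ N → ((N :* N) :* (N :* N)) :* ((N :* N) :* (N :* N)) := N :* (N :* (N :* (N :* (N :* (N :* (N :* N))))))) refl N)
            (≤-respʳ (solve 3 (λ N r c → r :* (N :* (N :* (N :* (N :* N))) :* c) := N :* (N :* (N :* (N :* (N :* (r :* c)))))) refl N ρ⁸ (ofℕ count))
              (≤-trans N⁸≤ (*-monoˡ-≤ (≤-trans 0≤1 1≤ρ⁸) (bias₁ Df)))))))))

        N⁴-bound : ∀ count → q f * q f ≤ ofℕ count → p ℕ.^ n ℕ.* (p ℕ.^ n ℕ.* (p ℕ.^ n ℕ.* p ℕ.^ n)) ℕ.≤ A ℕ.* count
        N⁴-bound count q²≤count = ofℕ-reflects-≤ (≤-respˡ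
          (sym (trans (ofℕ-* (p ℕ.^ n) (p ℕ.^ n ℕ.* (p ℕ.^ n ℕ.* p ℕ.^ n))) (*-congˡ (trans (ofℕ-* (p ℕ.^ n) (p ℕ.^ n ℕ.* p ℕ.^ n)) (*-congˡ (ofℕ-* (p ℕ.^ n) (p ℕ.^ n)))))))
          (≤-respˡ (solve 1 (λ N → (N :* N) :* (N :* N) := N :* (N :* (N :* N))) refl N)
            (≤-trans N⁴≤ (≤-trans (*-monoˡ-≤ (≤-trans 0≤1 1≤r²) q²≤count)
              (≤-trans (≤-respˡ (*-comm (ofℕ count) (r * r)) (≤-respʳ (*-comm (ofℕ count) ρ⁸) (*-monoˡ-≤ (0≤ofℕ count) (*-mono-1≤ (≤-trans 0≤1 1≤r²) 1≤r²)))) (scale-A count))))))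

        dense₂ : Dense₂ f A
        dense₂ P-lin R R-lin kills = N⁴-bound _ (bias₂ P-lin R R-lin kills)

      -- The factor 3 arises because `A` is chosen at most `ρ⁸` plus 2, while `ρ⁸` is at least 1.
      dense : ∃[ A ] 1 ℕ.≤ A ∧ ofℕ A ≤ ofℕ 3 * ρ⁸ ∧ Dense₁ f A ∧ Dense₂ f A
      dense = proj₁ A-bounds , ofℕ-reflects-≤ (≤-trans (≤-reflexive (+-identityʳ 1#)) (≤-trans 1≤ρ⁸ ρ⁸≤A)) ,
        ≤-trans (proj₂ (proj₂ A-bounds)) (≤-respʳ (sym (trans (*-congʳ (×-homo-+ 1# 1 2)) (trans (distribʳ ρ⁸ (ofℕ 1) (ofℕ 2)) (+-congʳ (trans (*-congʳ (+-identityʳ 1#)) (*-identityˡ ρ⁸))))))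
          (+-mono-≤ ≤-refl (*-mono-1≤ (0≤ofℕ 2) 1≤ρ⁸))) ,
        dense₁ (proj₁ A-bounds) ρ⁸≤A , dense₂ (proj₁ A-bounds) ρ⁸≤A
        where
        A-bounds : ∃[ m ] ρ⁸ ≤ ofℕ m ∧ ofℕ m ≤ ρ⁸ + ofℕ 2
        A-bounds = archimedean ρ⁸ (≤-trans 0≤1 1≤ρ⁸)
        ρ⁸≤A : ρ⁸ ≤ ofℕ (proj₁ A-bounds)
        ρ⁸≤A = proj₁ (proj₂ A-bounds)

-- Sums over the list of points

module Accumulate where

  open import Data.List.Base as List using (List; []; _∷_)
  open import Relation.Binary.PropositionalEquality

  -- foldr (λ a s → w a ∙ s) e, with a result type that is literally B.
  accumulate : ∀ {A B : Set} → (B → B → B) → B → (A → B) → List A → B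
  accumulate _∙_ e w []      = e
  accumulate _∙_ e w (a ∷ L) = w a ∙ accumulate _∙_ e w L

  foldr-accumulate : ∀ {A B : Set} (_∙_ : B → B → B) e (w : A → B) L → List.foldr (λ a s → w a ∙ s) e L ≡ accumulate _∙_ e w L
  foldr-accumulate _∙_ e w []      = refl
  foldr-accumulate _∙_ e w (a ∷ L) = cong (w a ∙_) (foldr-accumulate _∙_ e w L)

module Points {p : ℕ} (K : PrimeField p) {c ℓ} (M : CommutativeMonoid c ℓ) where

  open import Data.Fin.Base using (zero; suc)
  open import Data.List.Base as List using (List; []; _∷_)
  open import Data.Vec.Base using ([]; _∷_)
  open import Defs using (points)

  open Space K using (V)
  open VSum K M using (∑ᵛ)
  open CommutativeMonoid M
  open import Algebra.Properties.CommutativeMonoid.Sum M using (sum; sum-cong-≋)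

  total : ∀ {A : Set} → (A → Carrier) → List A → Carrier
  total g = List.foldr (λ a s → g a ∙ s) ε

  total-++ : ∀ {A : Set} (g : A → Carrier) xs ys → total g (xs List.++ ys) ≈ total g xs ∙ total g ys
  total-++ g []       ys = sym (identityˡ _)
  total-++ g (x ∷ xs) ys = trans (∙-congˡ (total-++ g xs ys)) (sym (assoc _ _ _))

  total-product : ∀ {A B C : Set} (g : C → Carrier) (h : A → B → C) xs ys →
    total g (List.cartesianProductWith h xs ys) ≈ total (λ x → total (λ y → g (h x y)) ys) xs
  total-product g h []       ys = refl
  total-product g h (x ∷ xs) ys = trans (total-++ g (List.map (h x) ys) _)
    (∙-cong (reflexive (Listₚ.foldr-map (λ a s → g a ∙ s) (h x) ε ys)) (total-product g h xs ys))

  total-tabulate : ∀ {A : Set} (g : A → Carrier) {m} (h : Fin m → A) → total g (List.tabulate h) ≈ sum (λ t → g (h t))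
  total-tabulate g {zero}  h = refl
  total-tabulate g {suc m} h = ∙-congˡ (total-tabulate g (λ t → h (suc t)))

  total-points : ∀ {n} (g : V n → Carrier) → total g (points p n) ≈ ∑ᵛ g
  total-points {zero}  g = identityʳ (g [])
  total-points {suc n} g = trans (total-product g _∷_ (List.allFin p) (points p n))
    (trans (total-tabulate (λ t → total (λ x → g (t ∷ x)) (points p n)) (λ t → t)) (sum-cong-≋ (λ t → total-points (λ x → g (t ∷ x)))))

module Bias {p : ℕ} (K : PrimeField p) (O : OrderedRing) where

  open import Data.List.Base using ([]; _∷_)
  open import Data.Product.Base using () renaming (_×_ to _∧_)

  open Accumulate
  open import Defs using (points)
  open Forms K using (Fun; Der; Dense₁; Dense₂)
  open OrderedRing O hiding (zero)
  open OrderedProperties O using (ofℕ; ScaledModulus)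
  open Points K +-commutativeMonoid
  open VSum K +-commutativeMonoid using (∑ᵛ-cong)
  open CharSum K O using (Character; module Sums)
  open Link K O

  module _ (χ : Character) (archimedean : ∀ x → 0# ≤ x → ∃[ m ] x ≤ ofℕ m ∧ ofℕ m ≤ x + ofℕ 2)
           (ofℕ-reflects-≤ : ∀ {a b} → ofℕ a ≤ ofℕ b → a ℕ.≤ b)
           -- `W` stands for the complex numbers, seen only through additive real and imaginary
           -- parts.
           {W : Set} (_⊞_ : W → W → W) (0ʷ : W) (re im : W → Carrier)
           (re-+ : ∀ u v → re (u ⊞ v) ≈ re u + re v) (re-0 : re 0ʷ ≈ 0#) (im-+ : ∀ u v → im (u ⊞ v) ≈ im u + im v) (im-0 : im 0ʷ ≈ 0#)
           (ω : ℕ → W) (re-ω : ∀ a → re (ω (toℕ a)) ≈ Character.c χ a) (im-ω : ∀ a → im (ω (toℕ a)) ≈ Character.s χ a) where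

    open Sums χ using (C; S)

    fold-total : ∀ {A : Set} (φ : W → Carrier) → (∀ u v → φ (u ⊞ v) ≈ φ u + φ v) → φ 0ʷ ≈ 0# → (w : A → W) → ∀ L →
      φ (accumulate _⊞_ 0ʷ w L) ≈ total (λ a → φ (w a)) L
    fold-total φ φ-+ φ-0 w []      = φ-0
    fold-total φ φ-+ φ-0 w (a ∷ L) = trans (φ-+ (w a) _) (+-congˡ (fold-total φ φ-+ φ-0 w L))

    module _ {n} (f : Fun n) where

      re-sum : re (accumulate _⊞_ 0ʷ (λ a → ω (toℕ (f a))) (points p n)) ≈ C f
      re-sum = trans (fold-total re re-+ re-0 (λ a → ω (toℕ (f a))) (points p n))
        (trans (total-points (λ a → re (ω (toℕ (f a))))) (∑ᵛ-cong (λ a → re-ω (f a))))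

      im-sum : im (accumulate _⊞_ 0ʷ (λ a → ω (toℕ (f a))) (points p n)) ≈ S f
      im-sum = trans (fold-total im im-+ im-0 (λ a → ω (toℕ (f a))) (points p n))
        (trans (total-points (λ a → im (ω (toℕ (f a))))) (∑ᵛ-cong (λ a → im-ω (f a))))

      SumModulus : Carrier → Carrier → Set
      SumModulus δ i = ScaledModulus δ i (re (accumulate _⊞_ 0ʷ (λ a → ω (toℕ (f a))) (points p n))) (im (accumulate _⊞_ 0ʷ (λ a → ω (toℕ (f a))) (points p n)))

      module _ {i δ ρ : Carrier} (i*N≈1 : i * ofℕ (p ℕ.^ n) ≈ 1#)
               (modulus : SumModulus δ i)
               (ρδ≈p : ρ * δ ≈ ofℕ p) (Df : Der 5 f) where

        biased⇒dense : ∃[ A ] 1 ℕ.≤ A ∧ ofℕ A ≤ ofℕ 3 * (((ρ * ρ) * (ρ * ρ)) * ((ρ * ρ) * (ρ * ρ))) ∧ Dense₁ f A ∧ Dense₂ f A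
        biased⇒dense = dense χ archimedean ofℕ-reflects-≤ Df {δ} {ρ} {i} i*N≈1
          (average² χ archimedean ofℕ-reflects-≤ f re-sum im-sum modulus) ρδ≈p

-- The field of residues modulo a prime

module Concrete where

  open import Data.Nat.Base using (_%_)
  open import Data.Nat.Coprimality using (prime⇒coprime; coprime-Bézout)
  open import Data.Nat.DivMod
  open import Data.Nat.GCD using (module Bézout)
  open import Relation.Binary.PropositionalEquality hiding ([_])

  open import Defs using (𝔽; _+ᶠ_; _*ᶠ_; 0ᶠ; 1ᶠ)

  module _ {p : ℕ} .{{nz : NonZero p}} where

    [_] : ℕ → 𝔽 p
    [ m ] = m mod p

    toℕ-[] : ∀ m → toℕ [ m ] ≡ m % p
    toℕ-[] m = Finₚ.toℕ-fromℕ< (m%n<n m p)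

    []-toℕ : ∀ (a : 𝔽 p) → [ toℕ a ] ≡ a
    []-toℕ a = Finₚ.toℕ-injective (trans (toℕ-[] (toℕ a)) (m<n⇒m%n≡m (Finₚ.toℕ<n a)))

    []-% : ∀ m n → m % p ≡ n % p → [ m ] ≡ [ n ]
    []-% m n eq = Finₚ.toℕ-injective (trans (toℕ-[] m) (trans eq (sym (toℕ-[] n))))

    []-+ : ∀ m n → [ m ] +ᶠ [ n ] ≡ [ m ℕ.+ n ]
    []-+ m n = []-% _ _ (trans (cong₂ (λ a b → (a ℕ.+ b) % p) (toℕ-[] m) (toℕ-[] n)) (sym (%-distribˡ-+ m n p)))

    []-* : ∀ m n → [ m ] *ᶠ [ n ] ≡ [ m ℕ.* n ]
    []-* m n = []-% _ _ (trans (cong₂ (λ a b → (a ℕ.* b) % p) (toℕ-[] m) (toℕ-[] n)) (sym (%-distribˡ-* m n p)))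

    -- Every residue is the class of a natural number, so that the ring laws are inherited from
    -- those of natural numbers.
    []-induction : ∀ (P : 𝔽 p → Set) → (∀ m → P [ m ]) → ∀ a → P a
    []-induction P P[] a = subst P ([]-toℕ a) (P[] (toℕ a))

    infix 8 -ᶠ_
    -ᶠ_ : 𝔽 p → 𝔽 p
    -ᶠ a = [ p ℕ.∸ toℕ a ]

    +ᶠ-comm : ∀ (a b : 𝔽 p) → a +ᶠ b ≡ b +ᶠ a
    +ᶠ-comm a b = cong [_] (ℕₚ.+-comm (toℕ a) (toℕ b))

    *ᶠ-comm : ∀ (a b : 𝔽 p) → a *ᶠ b ≡ b *ᶠ a
    *ᶠ-comm a b = cong [_] (ℕₚ.*-comm (toℕ a) (toℕ b))

    +ᶠ-assoc : ∀ (a b c : 𝔽 p) → (a +ᶠ b) +ᶠ c ≡ a +ᶠ (b +ᶠ c)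
    +ᶠ-assoc = []-induction _ λ a → []-induction _ λ b → []-induction _ λ c → begin
      ([ a ] +ᶠ [ b ]) +ᶠ [ c ]    ≡⟨ cong (_+ᶠ [ c ]) ([]-+ a b) ⟩
      [ a ℕ.+ b ] +ᶠ [ c ]         ≡⟨ []-+ (a ℕ.+ b) c ⟩
      [ (a ℕ.+ b) ℕ.+ c ]          ≡⟨ cong [_] (ℕₚ.+-assoc a b c) ⟩
      [ a ℕ.+ (b ℕ.+ c) ]          ≡⟨ []-+ a (b ℕ.+ c) ⟨
      [ a ] +ᶠ [ b ℕ.+ c ]         ≡⟨ cong ([ a ] +ᶠ_) ([]-+ b c) ⟨
      [ a ] +ᶠ ([ b ] +ᶠ [ c ])    ∎
      where open ≡-Reasoning

    *ᶠ-assoc : ∀ (a b c : 𝔽 p) → (a *ᶠ b) *ᶠ c ≡ a *ᶠ (b *ᶠ c)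
    *ᶠ-assoc = []-induction _ λ a → []-induction _ λ b → []-induction _ λ c → begin
      ([ a ] *ᶠ [ b ]) *ᶠ [ c ]    ≡⟨ cong (_*ᶠ [ c ]) ([]-* a b) ⟩
      [ a ℕ.* b ] *ᶠ [ c ]         ≡⟨ []-* (a ℕ.* b) c ⟩
      [ (a ℕ.* b) ℕ.* c ]          ≡⟨ cong [_] (ℕₚ.*-assoc a b c) ⟩
      [ a ℕ.* (b ℕ.* c) ]          ≡⟨ []-* a (b ℕ.* c) ⟨
      [ a ] *ᶠ [ b ℕ.* c ]         ≡⟨ cong ([ a ] *ᶠ_) ([]-* b c) ⟨
      [ a ] *ᶠ ([ b ] *ᶠ [ c ])    ∎
      where open ≡-Reasoning

    *ᶠ-distribˡ : ∀ (a b c : 𝔽 p) → a *ᶠ (b +ᶠ c) ≡ (a *ᶠ b) +ᶠ (a *ᶠ c)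
    *ᶠ-distribˡ = []-induction _ λ a → []-induction _ λ b → []-induction _ λ c → begin
      [ a ] *ᶠ ([ b ] +ᶠ [ c ])             ≡⟨ cong ([ a ] *ᶠ_) ([]-+ b c) ⟩
      [ a ] *ᶠ [ b ℕ.+ c ]                  ≡⟨ []-* a (b ℕ.+ c) ⟩
      [ a ℕ.* (b ℕ.+ c) ]                   ≡⟨ cong [_] (ℕₚ.*-distribˡ-+ a b c) ⟩
      [ a ℕ.* b ℕ.+ a ℕ.* c ]               ≡⟨ []-+ (a ℕ.* b) (a ℕ.* c) ⟨
      [ a ℕ.* b ] +ᶠ [ a ℕ.* c ]            ≡⟨ cong₂ _+ᶠ_ ([]-* a b) ([]-* a c) ⟨
      ([ a ] *ᶠ [ b ]) +ᶠ ([ a ] *ᶠ [ c ])  ∎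
      where open ≡-Reasoning

    +ᶠ-identityˡ : ∀ (a : 𝔽 p) → 0ᶠ +ᶠ a ≡ a
    +ᶠ-identityˡ = []-induction _ ([]-+ 0)

    *ᶠ-identityˡ : ∀ (a : 𝔽 p) → 1ᶠ *ᶠ a ≡ a
    *ᶠ-identityˡ = []-induction _ λ a → trans ([]-* 1 a) (cong [_] (ℕₚ.*-identityˡ a))

    +ᶠ-inverseʳ : ∀ (a : 𝔽 p) → a +ᶠ -ᶠ a ≡ 0ᶠ
    +ᶠ-inverseʳ a = trans (cong (_+ᶠ -ᶠ a) (sym ([]-toℕ a))) (trans ([]-+ (toℕ a) (p ℕ.∸ toℕ a))
      ([]-% _ 0 (trans (cong (_% p) (ℕₚ.m+[n∸m]≡n (ℕₚ.<⇒≤ (Finₚ.toℕ<n a)))) (trans (n%n≡0 p) (sym (m*n%n≡0 0 p))))))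

    module _ (prime : Prime p) where

      1ᶠ≢0ᶠ : ¬ 1ᶠ {p} ≡ 0ᶠ
      1ᶠ≢0ᶠ eq = ℕₚ.1+n≢0 (trans (sym (m<n⇒m%n≡m (ℕ.nonTrivial⇒n>1 p {{prime⇒nonTrivial prime}})))
        (trans (sym (toℕ-[] 1)) (trans (cong toℕ eq) (trans (toℕ-[] 0) (m*n%n≡0 0 p)))))

      inverseᶠ : ∀ (a : 𝔽 p) → ¬ a ≡ 0ᶠ → ∃[ b ] b *ᶠ a ≡ 1ᶠ
      inverseᶠ a a≢0 with coprime-Bézout (prime⇒coprime prime {{ℕ.≢-nonZero toℕ≢0}} (Finₚ.toℕ<n a))
        where
        toℕ≢0 : ¬ toℕ a ≡ 0
        toℕ≢0 eq = a≢0 (trans (sym ([]-toℕ a)) (cong [_] eq))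
      ... | Bézout.-+ x y eq = [ y ] , trans (cong ([ y ] *ᶠ_) (sym ([]-toℕ a))) (trans ([]-* y (toℕ a)) (trans (cong [_] (sym eq))
        ([]-% (1 ℕ.+ x ℕ.* p) 1 ([m+kn]%n≡m%n 1 x p))))
      -- In this case `1 + y a` is a multiple of `p`, and the inverse is the negative of `y`.
      ... | Bézout.+- x y eq = -ᶠ [ y ] , (begin
          -ᶠ [ y ] *ᶠ a                                  ≡⟨ +ᶠ-identityʳ _ ⟨
          -ᶠ [ y ] *ᶠ a +ᶠ 0ᶠ                            ≡⟨ cong (-ᶠ [ y ] *ᶠ a +ᶠ_) y*a+1≡0 ⟨
          -ᶠ [ y ] *ᶠ a +ᶠ ([ y ] *ᶠ a +ᶠ 1ᶠ)            ≡⟨ +ᶠ-assoc _ _ _ ⟨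
          (-ᶠ [ y ] *ᶠ a +ᶠ [ y ] *ᶠ a) +ᶠ 1ᶠ            ≡⟨ cong (_+ᶠ 1ᶠ) (trans (cong₂ _+ᶠ_ (*ᶠ-comm _ a) (*ᶠ-comm _ a)) (sym (*ᶠ-distribˡ a (-ᶠ [ y ]) [ y ]))) ⟩
          a *ᶠ (-ᶠ [ y ] +ᶠ [ y ]) +ᶠ 1ᶠ                 ≡⟨ cong (λ z → a *ᶠ z +ᶠ 1ᶠ) (trans (+ᶠ-comm (-ᶠ [ y ]) [ y ]) (+ᶠ-inverseʳ [ y ])) ⟩
          a *ᶠ 0ᶠ +ᶠ 1ᶠ                                  ≡⟨ cong (_+ᶠ 1ᶠ) (trans (cong (_*ᶠ 0ᶠ) (sym ([]-toℕ a))) (trans ([]-* (toℕ a) 0) (cong [_] (ℕₚ.*-zeroʳ (toℕ a))))) ⟩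
          0ᶠ +ᶠ 1ᶠ                                       ≡⟨ +ᶠ-identityˡ 1ᶠ ⟩
          1ᶠ                                             ∎)
        where
        open ≡-Reasoning
        +ᶠ-identityʳ : ∀ (a : 𝔽 p) → a +ᶠ 0ᶠ ≡ a
        +ᶠ-identityʳ a = trans (+ᶠ-comm a 0ᶠ) (+ᶠ-identityˡ a)
        y*a+1≡0 : [ y ] *ᶠ a +ᶠ 1ᶠ ≡ 0ᶠ
        y*a+1≡0 = trans (cong (λ z → [ y ] *ᶠ z +ᶠ 1ᶠ) (sym ([]-toℕ a))) (trans (cong (_+ᶠ 1ᶠ) ([]-* y (toℕ a)))
          (trans ([]-+ (y ℕ.* toℕ a) 1) (trans (cong [_] (trans (ℕₚ.+-comm _ 1) eq))
            ([]-% (x ℕ.* p) 0 (trans (m*n%n≡0 x p) (sym (m*n%n≡0 0 p)))))))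

      𝔽-primeField : PrimeField p
      𝔽-primeField = record
        { _+_ = _+ᶠ_ ; _*_ = _*ᶠ_ ; -_ = -ᶠ_ ; 0# = 0ᶠ ; 1# = 1ᶠ
        ; isCommutativeRing = record
          { isRing = record
            { +-isAbelianGroup = record
              { isGroup = record
                { isMonoid = record
                  { isSemigroup = record
                    { isMagma = record { isEquivalence = isEquivalence ; ∙-cong = cong₂ _+ᶠ_ }
                    ; assoc = +ᶠ-assoc }
                  ; identity = +ᶠ-identityˡ , λ a → trans (+ᶠ-comm a 0ᶠ) (+ᶠ-identityˡ a) }
                ; inverse = (λ a → trans (+ᶠ-comm (-ᶠ a) a) (+ᶠ-inverseʳ a)) , +ᶠ-inverseʳ
                ; ⁻¹-cong = cong -ᶠ_ }
              ; comm = +ᶠ-comm }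
            ; *-cong = cong₂ _*ᶠ_
            ; *-assoc = *ᶠ-assoc
            ; *-identity = *ᶠ-identityˡ , λ a → trans (*ᶠ-comm a 1ᶠ) (*ᶠ-identityˡ a)
            ; distrib = *ᶠ-distribˡ , λ a b c → trans (*ᶠ-comm (b +ᶠ c) a) (trans (*ᶠ-distribˡ a b c) (cong₂ _+ᶠ_ (*ᶠ-comm a b) (*ᶠ-comm a c))) }
          ; *-comm = *ᶠ-comm }
        ; 1≢0 = 1ᶠ≢0ᶠ
        ; inverse = inverseᶠ
        ; generated = λ P P0 step → []-induction P (λ m → induct P P0 step m) }
        where
        induct : ∀ (P : 𝔽 p → Set) → P 0ᶠ → (∀ a → P a → P (1ᶠ +ᶠ a)) → ∀ m → P [ m ]
        induct P P0 step zero    = P0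
        induct P P0 step (suc m) = subst P ([]-+ 1 m) (step [ m ] (induct P P0 step m))

-- The costs grow polynomially

module PolyBound where

  open import Data.Nat.Base using (_+_; _*_; _^_; _≤_)
  open import Relation.Binary.PropositionalEquality

  open Costs

  -- For `A` at least 1 a single monomial dominates any polynomial; monomials are closed under
  -- products and, by adding exponents, bound sums as well.
  PolynomiallyBounded : (ℕ → ℕ) → Set
  PolynomiallyBounded g = ∃[ c ] ∃[ e ] ∀ A → 1 ≤ A → g A ≤ c * A ^ e

  const : ∀ m → PolynomiallyBounded (λ _ → m)
  const m = m , 0 , λ A _ → ℕₚ.≤-reflexive (sym (ℕₚ.*-identityʳ m))

  var : PolynomiallyBounded (λ A → A)
  var = 1 , 1 , λ A _ → ℕₚ.≤-reflexive (sym (trans (ℕₚ.*-identityˡ (A ^ 1)) (ℕₚ.*-identityʳ A)))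

  infixl 6 _⊞_
  infixl 7 _⊠_

  _⊠_ : ∀ {g h} → PolynomiallyBounded g → PolynomiallyBounded h → PolynomiallyBounded (λ A → g A * h A)
  (c , d , g≤) ⊠ (c′ , d′ , h≤) = c * c′ , d + d′ , λ A 1≤A → ℕₚ.≤-trans (ℕₚ.*-mono-≤ (g≤ A 1≤A) (h≤ A 1≤A))
    (ℕₚ.≤-reflexive (trans (interchange c (A ^ d) c′ (A ^ d′)) (cong (c * c′ *_) (sym (ℕₚ.^-distribˡ-+-* A d d′)))))
    where
    open import Algebra.Properties.CommutativeSemigroup ℕₚ.*-commutativeSemigroup using (interchange)

  _⊞_ : ∀ {g h} → PolynomiallyBounded g → PolynomiallyBounded h → PolynomiallyBounded (λ A → g A + h A)
  (c , d , g≤) ⊞ (c′ , d′ , h≤) = c + c′ , d + d′ , λ A 1≤A → ℕₚ.≤-trans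
    (ℕₚ.+-mono-≤ (ℕₚ.≤-trans (g≤ A 1≤A) (ℕₚ.*-monoʳ-≤ c (power-mono A 1≤A (ℕₚ.m≤m+n d d′))))
                 (ℕₚ.≤-trans (h≤ A 1≤A) (ℕₚ.*-monoʳ-≤ c′ (power-mono A 1≤A (ℕₚ.m≤n+m d′ d)))))
    (ℕₚ.≤-reflexive (sym (ℕₚ.*-distribʳ-+ (A ^ (d + d′)) c c′)))
    where
    power-mono : ∀ A → 1 ≤ A → ∀ {d e} → d ≤ e → A ^ d ≤ A ^ e
    power-mono (suc A) _ = ℕₚ.^-monoʳ-≤ (suc A)

  triple : ∀ {g} → PolynomiallyBounded g → PolynomiallyBounded (λ A → 3× (g A))
  triple {g} G = let c , e , 3g≤ = const 3 ⊠ G in c , e , λ A 1≤A → ℕₚ.≤-trans (ℕₚ.≤-reflexive (3×≡3* (g A))) (3g≤ A 1≤A)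
    where
    3×≡3* : ∀ k → 3× k ≡ 3 * k
    3×≡3* zero    = refl
    3×≡3* (suc k) = trans (cong (3 +_) (3×≡3* k)) (sym (ℕₚ.*-suc 3 k))

  slice : PolynomiallyBounded sliceCost
  slice = triple (const 2 ⊠ var) ⊠ (const 2 ⊠ (const 2 ⊠ var) ⊞ triple (const 2 ⊠ (const 2 ⊠ var)) ⊠ (const 2 ⊠ (const 2 ⊠ var)))

  cubic : ∀ {r} → PolynomiallyBounded r → PolynomiallyBounded (λ A → cubicCost (r A))
  cubic R = (const 1 ⊞ (R ⊞ R)) ⊠ R

  quartic : ∀ {r} → PolynomiallyBounded r → PolynomiallyBounded (λ A → quarticCost (r A))
  quartic R = (const 2 ⊞ (R ⊞ R)) ⊠ ((const 2 ⊞ (R ⊞ R)) ⊠ R ⊞ cubic R)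

  cover : ∀ {r} → PolynomiallyBounded r → PolynomiallyBounded (λ A → coverCost (r A))
  cover R = R ⊞ (const 1 ⊞ R) ⊠ R

  cover-rank : ∀ {r} → PolynomiallyBounded r → PolynomiallyBounded (λ A → coverRank (r A))
  cover-rank R = R ⊞ (const 1 ⊞ R) ⊠ ((const 1 ⊞ R) ⊠ R)

  symmetry : ∀ {t k} → PolynomiallyBounded t → PolynomiallyBounded k → PolynomiallyBounded (λ A → symmetryCost (t A) (k A))
  symmetry T K = const 4 ⊠ (const 1 ⊞ R) ⊠ (const 4 ⊠ (const 1 ⊞ R) ⊠ R) ⊞ const 4 ⊠ (const 4 ⊠ (const 1 ⊞ R) ⊠ K)
    where R = T ⊞ (K ⊞ K)

  factor : ∀ {k t T} → PolynomiallyBounded k → PolynomiallyBounded t → PolynomiallyBounded T → PolynomiallyBounded (λ A → factorCost (k A) (t A) (T A))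
  factor K t T = K ⊠ (t ⊞ (t ⊞ t)) ⊞ (K ⊞ K) ⊠ T

  remainder-rank : ∀ {k} → PolynomiallyBounded k → PolynomiallyBounded (λ A → remainderRank A (k A))
  remainder-rank K = triple (const 2 ⊠ var) ⊠ (const 2 ⊠ var ⊞ K ⊞ K)

  char2 : ∀ {k} → PolynomiallyBounded k → PolynomiallyBounded (λ A → char2Cost A (k A))
  char2 K = (R ⊞ (R ⊞ R)) ⊞ ((cubic R ⊞ cubic R) ⊞ (const 2 ⊠ var ⊞ K) ⊞ (const 2 ⊠ var ⊞ K))
    where R = remainder-rank K

  cut : PolynomiallyBounded cutCost
  cut = const 2 ⊠ var ⊞ cover slice ⊞ factor slice t T ⊞ c₅
    where
    t  = cover-rank slice
    k  = slice ⊞ slice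
    c₅ = quartic (t ⊞ (k ⊞ k))
    T  = char2 (slice ⊞ slice) ⊞ c₅ ⊞ c₅ ⊞ symmetry t k

  abstract
    total-bounded : PolynomiallyBounded (λ A → 4 * (suc (cutCost A) + pairCost A))
    total-bounded = const 4 ⊠ (const 1 ⊞ cut ⊞ (slice ⊞ slice))

-- Cauchy reals as an ordered ring

module Reals where

  open import Data.Product.Base using () renaming (_×_ to _∧_)
  open import Data.Rational.Base as ℚ using (ℚ; 0ℚ; 1ℚ; ½)
  open import Data.Rational.Solver using (module +-*-Solver)
  open import Relation.Binary.PropositionalEquality

  open import Defs

  open +-*-Solver

  pointwise : ∀ {x y} → (∀ n → seq x n ≡ seq y n) → x ≃ y
  pointwise {x} {y} x≡y ε 0<ε = 0 , λ n _ → subst (λ z → ℚ.∣ z ∣ ℚ.≤ ε)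
    (sym (trans (cong (ℚ._- seq y n) (x≡y n)) (ℚₚ.+-inverseʳ (seq y n)))) (ℚₚ.<⇒≤ 0<ε)

  ≃-refl : ∀ {x} → x ≃ x
  ≃-refl {x} = pointwise {x} {x} (λ _ → refl)

  ≃-sym : ∀ {x y} → x ≃ y → y ≃ x
  ≃-sym {x} {y} x≃y ε 0<ε = let N , close = x≃y ε 0<ε in
    N , λ n N≤n → subst (ℚ._≤ ε) (∣-∣-comm (seq x n) (seq y n)) (close n N≤n)

  halves : ∀ {a b ε} → a ℚ.≤ ½ ℚ.* ε → b ℚ.≤ ½ ℚ.* ε → a ℚ.+ b ℚ.≤ ε
  halves {ε = ε} a≤ b≤ = ℚₚ.≤-trans (ℚₚ.+-mono-≤ a≤ b≤) (ℚₚ.≤-reflexive (half+half ε))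

  ≃-trans : ∀ {x y z} → x ≃ y → y ≃ z → x ≃ z
  ≃-trans {x} {y} {z} x≃y y≃z ε 0<ε =
    let M , closeˣ = x≃y (½ ℚ.* ε) (half-pos 0<ε)
        N , closeʸ = y≃z (½ ℚ.* ε) (half-pos 0<ε)
    in M ℕ.⊔ N , λ n ≤n → ℚₚ.≤-trans (triangle (seq x n) (seq y n) (seq z n))
         (halves (closeˣ n (ℕₚ.m⊔n≤o⇒m≤o M N ≤n)) (closeʸ n (ℕₚ.m⊔n≤o⇒n≤o M N ≤n)))

  +-cong : ∀ {x x′ y y′} → x ≃ x′ → y ≃ y′ → x + y ≃ x′ + y′
  +-cong {x} {x′} {y} {y′} x≃ y≃ ε 0<ε =
    let M , closeˣ = x≃ (½ ℚ.* ε) (half-pos 0<ε)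
        N , closeʸ = y≃ (½ ℚ.* ε) (half-pos 0<ε)
    in M ℕ.⊔ N , λ n ≤n → ℚₚ.≤-trans (ℚₚ.≤-reflexive (cong ℚ.∣_∣
           (solve 4 (λ a b c d → (a :+ b) :- (c :+ d) := (a :- c) :+ (b :- d)) refl (seq x n) (seq y n) (seq x′ n) (seq y′ n))))
         (ℚₚ.≤-trans (ℚₚ.∣p+q∣≤∣p∣+∣q∣ (seq x n ℚ.- seq x′ n) (seq y n ℚ.- seq y′ n))
           (halves (closeˣ n (ℕₚ.m⊔n≤o⇒m≤o M N ≤n)) (closeʸ n (ℕₚ.m⊔n≤o⇒n≤o M N ≤n))))

  -‿cong : ∀ {x y} → x ≃ y → - x ≃ - y
  -‿cong {x} {y} x≃y ε 0<ε = let N , close = x≃y ε 0<ε in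
    N , λ n N≤n → subst (ℚ._≤ ε) (trans (∣-∣-comm (seq x n) (seq y n)) (cong ℚ.∣_∣
      (solve 2 (λ a b → b :- a := (:- a) :- (:- b)) refl (seq x n) (seq y n)))) (close n N≤n)

  scaled : ∀ {B ε} → 0ℚ ℚ.< B → 0ℚ ℚ.< ε → ∃[ η ] 0ℚ ℚ.< η ∧ B ℚ.* η ≡ ε
  scaled {B} {ε} 0<B 0<ε = ε ℚ.* ℚ.1/ B ,
    ℚₚ.positive⁻¹ _ {{ℚₚ.pos*pos⇒pos ε {{ℚ.positive 0<ε}} (ℚ.1/ B) {{ℚₚ.1/pos⇒pos B}}}} ,
    trans (solve 3 (λ B e i → B :* (e :* i) := e :* (B :* i)) refl B ε (ℚ.1/ B))
      (trans (cong (ε ℚ.*_) (ℚₚ.*-inverseʳ B)) (ℚₚ.*-identityʳ ε))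
    where
    instance
      B-pos : ℚ.Positive B
      B-pos = ℚ.positive 0<B
      B-nonZero : ℚ.NonZero B
      B-nonZero = ℚₚ.pos⇒nonZero B

  ∣*∣-mono : ∀ {a b A B} → 0ℚ ℚ.≤ A → ℚ.∣ a ∣ ℚ.≤ A → ℚ.∣ b ∣ ℚ.≤ B → ℚ.∣ a ℚ.* b ∣ ℚ.≤ A ℚ.* B
  ∣*∣-mono {a} {b} 0≤A a≤A b≤B = subst (ℚ._≤ _) (sym (ℚₚ.∣p*q∣≡∣p∣*∣q∣ a b)) (*-mono-≤₀ 0≤A (ℚₚ.0≤∣p∣ b) a≤A b≤B)

  *-cong : ∀ {x x′ y y′} → x ≃ x′ → y ≃ y′ → x * y ≃ x′ * y′
  *-cong {x} {x′} {y} {y′} x≃ y≃ ε 0<ε =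
    let A , 0<A , boundˣ = bounded x
        B , 0<B , boundʸ = bounded y′
        η , 0<η , Aη+Bη≡ε = scaled (ℚₚ.+-mono-< 0<A 0<B) 0<ε
        M , closeˣ = x≃ η 0<η
        N , closeʸ = y≃ η 0<η
    in M ℕ.⊔ N , λ n ≤n → let a = seq x n ; a′ = seq x′ n ; b = seq y n ; b′ = seq y′ n in begin
      ℚ.∣ a ℚ.* b ℚ.- a′ ℚ.* b′ ∣
        ≡⟨ cong ℚ.∣_∣ (solve 4 (λ a b c d → a :* b :- c :* d := a :* (b :- d) :+ d :* (a :- c)) refl a b a′ b′) ⟩
      ℚ.∣ a ℚ.* (b ℚ.- b′) ℚ.+ b′ ℚ.* (a ℚ.- a′) ∣
        ≤⟨ ℚₚ.∣p+q∣≤∣p∣+∣q∣ (a ℚ.* (b ℚ.- b′)) (b′ ℚ.* (a ℚ.- a′)) ⟩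
      ℚ.∣ a ℚ.* (b ℚ.- b′) ∣ ℚ.+ ℚ.∣ b′ ℚ.* (a ℚ.- a′) ∣
        ≤⟨ ℚₚ.+-mono-≤ (∣*∣-mono (ℚₚ.<⇒≤ 0<A) (boundˣ n) (closeʸ n (ℕₚ.m⊔n≤o⇒n≤o M N ≤n)))
                       (∣*∣-mono (ℚₚ.<⇒≤ 0<B) (boundʸ n) (closeˣ n (ℕₚ.m⊔n≤o⇒m≤o M N ≤n))) ⟩
      A ℚ.* η ℚ.+ B ℚ.* η
        ≡⟨ ℚₚ.*-distribʳ-+ η A B ⟨
      (A ℚ.+ B) ℚ.* η
        ≡⟨ Aη+Bη≡ε ⟩
      ε ∎
    where open ℚₚ.≤-Reasoning

  ℝ-commutativeRing : CommutativeRing 0ℓ 0ℓ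
  ℝ-commutativeRing = record
    { Carrier = ℝ ; _≈_ = _≃_ ; _+_ = _+_ ; _*_ = _*_ ; -_ = -_ ; 0# = 0ℝ ; 1# = 1ℝ
    ; isCommutativeRing = record
      { isRing = record
        { +-isAbelianGroup = record
          { isGroup = record
            { isMonoid = record
              { isSemigroup = record
                { isMagma = record
                  { isEquivalence = record { refl = λ {x} → ≃-refl {x} ; sym = λ {x} {y} → ≃-sym {x} {y} ; trans = λ {x} {y} {z} → ≃-trans {x} {y} {z} }
                  ; ∙-cong = λ {x} {x′} {y} {y′} → +-cong {x} {x′} {y} {y′} }
                ; assoc = λ x y z → pointwise {x + y + z} {x + (y + z)} (λ n → ℚₚ.+-assoc (seq x n) (seq y n) (seq z n)) }
              ; identity = (λ x → pointwise {0ℝ + x} {x} (λ n → ℚₚ.+-identityˡ (seq x n)))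
                         , (λ x → pointwise {x + 0ℝ} {x} (λ n → ℚₚ.+-identityʳ (seq x n))) }
            ; inverse = (λ x → pointwise {(- x) + x} {0ℝ} (λ n → ℚₚ.+-inverseˡ (seq x n)))
                      , (λ x → pointwise {x + (- x)} {0ℝ} (λ n → ℚₚ.+-inverseʳ (seq x n)))
            ; ⁻¹-cong = λ {x} {y} → -‿cong {x} {y} }
          ; comm = λ x y → pointwise {x + y} {y + x} (λ n → ℚₚ.+-comm (seq x n) (seq y n)) }
        ; *-cong = λ {x} {x′} {y} {y′} → *-cong {x} {x′} {y} {y′}
        ; *-assoc = λ x y z → pointwise {x * y * z} {x * (y * z)} (λ n → ℚₚ.*-assoc (seq x n) (seq y n) (seq z n))
        ; *-identity = (λ x → pointwise {1ℝ * x} {x} (λ n → ℚₚ.*-identityˡ (seq x n)))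
                     , (λ x → pointwise {x * 1ℝ} {x} (λ n → ℚₚ.*-identityʳ (seq x n)))
        ; distrib = (λ x y z → pointwise {x * (y + z)} {x * y + x * z} (λ n → ℚₚ.*-distribˡ-+ (seq x n) (seq y n) (seq z n)))
                  , (λ x y z → pointwise {(y + z) * x} {y * x + z * x} (λ n → ℚₚ.*-distribʳ-+ (seq x n) (seq y n) (seq z n))) }
      ; *-comm = λ x y → pointwise {x * y} {y * x} (λ n → ℚₚ.*-comm (seq x n) (seq y n)) } }

  p≤∣p∣ : ∀ p → p ℚ.≤ ℚ.∣ p ∣
  p≤∣p∣ p with ℚₚ.≤-total 0ℚ p
  ... | inj₁ 0≤p = ℚₚ.≤-reflexive (sym (ℚₚ.0≤p⇒∣p∣≡p 0≤p))
  ... | inj₂ p≤0 = ℚₚ.≤-trans p≤0 (ℚₚ.0≤∣p∣ p)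

  ∣a-b∣≤ε⇒a≤b+ε : ∀ {a b ε} → ℚ.∣ a ℚ.- b ∣ ℚ.≤ ε → a ℚ.≤ b ℚ.+ ε
  ∣a-b∣≤ε⇒a≤b+ε {a} {b} {ε} h = begin
    a                      ≡⟨ solve 2 (λ a b → a := b :+ (a :- b)) refl a b ⟩
    b ℚ.+ (a ℚ.- b)        ≤⟨ ℚₚ.+-monoʳ-≤ b (ℚₚ.≤-trans (p≤∣p∣ (a ℚ.- b)) h) ⟩
    b ℚ.+ ε                ∎
    where open ℚₚ.≤-Reasoning

  ≤-reflexive : ∀ {x y} → x ≃ y → x ≤ y
  ≤-reflexive x≃y ε 0<ε = let N , close = x≃y ε 0<ε in N , λ n N≤n → ∣a-b∣≤ε⇒a≤b+ε (close n N≤n)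

  ≤-trans : ∀ {x y z} → x ≤ y → y ≤ z → x ≤ z
  ≤-trans {x} {y} {z} x≤y y≤z ε 0<ε =
    let M , h = x≤y (½ ℚ.* ε) (half-pos 0<ε)
        N , k = y≤z (½ ℚ.* ε) (half-pos 0<ε)
    in M ℕ.⊔ N , λ n ≤n → begin
         seq x n                                  ≤⟨ h n (ℕₚ.m⊔n≤o⇒m≤o M N ≤n) ⟩
         seq y n ℚ.+ ½ ℚ.* ε                      ≤⟨ ℚₚ.+-monoˡ-≤ (½ ℚ.* ε) (k n (ℕₚ.m⊔n≤o⇒n≤o M N ≤n)) ⟩
         (seq z n ℚ.+ ½ ℚ.* ε) ℚ.+ ½ ℚ.* ε        ≡⟨ ℚₚ.+-assoc (seq z n) (½ ℚ.* ε) (½ ℚ.* ε) ⟩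
         seq z n ℚ.+ (½ ℚ.* ε ℚ.+ ½ ℚ.* ε)        ≡⟨ cong (seq z n ℚ.+_) (half+half ε) ⟩
         seq z n ℚ.+ ε                            ∎
    where open ℚₚ.≤-Reasoning

  +-mono-≤ : ∀ {x y u v} → x ≤ y → u ≤ v → x + u ≤ y + v
  +-mono-≤ {x} {y} {u} {v} x≤y u≤v ε 0<ε =
    let M , h = x≤y (½ ℚ.* ε) (half-pos 0<ε)
        N , k = u≤v (½ ℚ.* ε) (half-pos 0<ε)
    in M ℕ.⊔ N , λ n ≤n → begin
         seq x n ℚ.+ seq u n                                          ≤⟨ ℚₚ.+-mono-≤ (h n (ℕₚ.m⊔n≤o⇒m≤o M N ≤n)) (k n (ℕₚ.m⊔n≤o⇒n≤o M N ≤n)) ⟩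
         (seq y n ℚ.+ ½ ℚ.* ε) ℚ.+ (seq v n ℚ.+ ½ ℚ.* ε)              ≡⟨ solve 3 (λ y v e → (y :+ e) :+ (v :+ e) := (y :+ v) :+ (e :+ e)) refl (seq y n) (seq v n) (½ ℚ.* ε) ⟩
         (seq y n ℚ.+ seq v n) ℚ.+ (½ ℚ.* ε ℚ.+ ½ ℚ.* ε)              ≡⟨ cong ((seq y n ℚ.+ seq v n) ℚ.+_) (half+half ε) ⟩
         (seq y n ℚ.+ seq v n) ℚ.+ ε                                  ∎
    where open ℚₚ.≤-Reasoning

  -- A term of the sequence of `c` may be negative, but by no more than `η`; in that case the bounds
  -- for `x` and `y` control the error.
  *-monoˡ-≤ : ∀ {c x y} → 0ℝ ≤ c → x ≤ y → c * x ≤ c * y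
  *-monoˡ-≤ {c} {x} {y} 0≤c x≤y ε 0<ε =
    let C , 0<C , boundᶜ = bounded c
        X , 0<X , boundˣ = bounded x
        Y , 0<Y , boundʸ = bounded y
        η , 0<η , Bη≡ε = scaled (ℚₚ.+-mono-< 0<C (ℚₚ.+-mono-< 0<X 0<Y)) 0<ε
        M , h = 0≤c η 0<η
        N , k = x≤y η 0<η
    in M ℕ.⊔ N , λ n ≤n → ℚₚ.≤-trans
         (bound 0<C 0<X 0<Y 0<η (h n (ℕₚ.m⊔n≤o⇒m≤o M N ≤n)) (k n (ℕₚ.m⊔n≤o⇒n≤o M N ≤n)) (boundᶜ n) (boundˣ n) (boundʸ n))
         (ℚₚ.≤-reflexive (cong (seq c n ℚ.* seq y n ℚ.+_) Bη≡ε))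
    where
    bound : ∀ {C X Y η a x y} → 0ℚ ℚ.< C → 0ℚ ℚ.< X → 0ℚ ℚ.< Y → 0ℚ ℚ.< η → 0ℚ ℚ.≤ a ℚ.+ η → x ℚ.≤ y ℚ.+ η →
      ℚ.∣ a ∣ ℚ.≤ C → ℚ.∣ x ∣ ℚ.≤ X → ℚ.∣ y ∣ ℚ.≤ Y → a ℚ.* x ℚ.≤ a ℚ.* y ℚ.+ (C ℚ.+ (X ℚ.+ Y)) ℚ.* η
    bound {C} {X} {Y} {η} {a} {x} {y} 0<C 0<X 0<Y 0<η 0≤a+η x≤y+η a≤C x≤X y≤Y with ℚₚ.≤-total 0ℚ a
    ... | inj₁ 0≤a = begin
      a ℚ.* x                                      ≤⟨ ℚₚ.*-monoˡ-≤-nonNeg a {{ℚ.nonNegative 0≤a}} x≤y+η ⟩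
      a ℚ.* (y ℚ.+ η)                              ≡⟨ ℚₚ.*-distribˡ-+ a y η ⟩
      a ℚ.* y ℚ.+ a ℚ.* η                          ≤⟨ ℚₚ.+-monoʳ-≤ (a ℚ.* y) (ℚₚ.*-monoʳ-≤-nonNeg η {{ℚ.nonNegative (ℚₚ.<⇒≤ 0<η)}}
                                                        (ℚₚ.≤-trans (ℚₚ.≤-reflexive (sym (ℚₚ.0≤p⇒∣p∣≡p 0≤a))) (ℚₚ.≤-trans a≤C (x≤x+y (ℚₚ.+-mono-≤ (ℚₚ.<⇒≤ 0<X) (ℚₚ.<⇒≤ 0<Y)))))) ⟩
      a ℚ.* y ℚ.+ (C ℚ.+ (X ℚ.+ Y)) ℚ.* η          ∎
      where open ℚₚ.≤-Reasoning
    ... | inj₂ a≤0 = begin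
      a ℚ.* x                                      ≡⟨ solve 3 (λ a x y → a :* x := a :* y :+ (:- a) :* (y :- x)) refl a x y ⟩
      a ℚ.* y ℚ.+ (ℚ.- a) ℚ.* (y ℚ.- x)            ≤⟨ ℚₚ.+-monoʳ-≤ (a ℚ.* y) (ℚₚ.≤-trans (ℚₚ.*-monoˡ-≤-nonNeg (ℚ.- a) {{ℚ.nonNegative 0≤-a}} y-x≤)
                                                        (ℚₚ.*-monoʳ-≤-nonNeg (X ℚ.+ Y) {{ℚ.nonNegative 0≤X+Y}} -a≤η)) ⟩
      a ℚ.* y ℚ.+ η ℚ.* (X ℚ.+ Y)                  ≤⟨ ℚₚ.+-monoʳ-≤ (a ℚ.* y) (ℚₚ.≤-trans (ℚₚ.*-monoˡ-≤-nonNeg η {{ℚ.nonNegative (ℚₚ.<⇒≤ 0<η)}} (x≤y+x (ℚₚ.<⇒≤ 0<C)))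
                                                        (ℚₚ.≤-reflexive (ℚₚ.*-comm η _))) ⟩
      a ℚ.* y ℚ.+ (C ℚ.+ (X ℚ.+ Y)) ℚ.* η          ∎
      where
      open ℚₚ.≤-Reasoning
      0≤X+Y : 0ℚ ℚ.≤ X ℚ.+ Y
      0≤X+Y = ℚₚ.+-mono-≤ (ℚₚ.<⇒≤ 0<X) (ℚₚ.<⇒≤ 0<Y)
      0≤-a : 0ℚ ℚ.≤ ℚ.- a
      0≤-a = ℚₚ.neg-antimono-≤ a≤0
      -a≤η : ℚ.- a ℚ.≤ η
      -a≤η = subst₂ ℚ._≤_ (ℚₚ.+-identityˡ (ℚ.- a)) (solve 2 (λ a e → (a :+ e) :+ :- a := e) refl a η) (ℚₚ.+-monoˡ-≤ (ℚ.- a) 0≤a+η)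
      y-x≤ : y ℚ.- x ℚ.≤ X ℚ.+ Y
      y-x≤ = ℚₚ.≤-trans (ℚₚ.+-mono-≤ (ℚₚ.≤-trans (p≤∣p∣ y) y≤Y)
          (ℚₚ.≤-trans (p≤∣p∣ (ℚ.- x)) (ℚₚ.≤-trans (ℚₚ.≤-reflexive (ℚₚ.∣-p∣≡∣p∣ x)) x≤X)))
        (ℚₚ.≤-reflexive (ℚₚ.+-comm Y X))

  open CommutativeRing ℝ-commutativeRing using (+-rawMonoid)
  open import Algebra.Definitions.RawMonoid +-rawMonoid using (_×_)

  0≤x² : ∀ x → 0ℝ ≤ x * x
  0≤x² x ε 0<ε = 0 , λ n _ → ℚₚ.≤-trans (0≤p² (seq x n)) (x≤x+y (ℚₚ.<⇒≤ 0<ε))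
    where
    0≤p² : ∀ p → 0ℚ ℚ.≤ p ℚ.* p
    0≤p² p with ℚₚ.≤-total 0ℚ p
    ... | inj₁ 0≤p = ℚₚ.≤-trans (ℚₚ.≤-reflexive (sym (ℚₚ.*-zeroʳ p))) (ℚₚ.*-monoˡ-≤-nonNeg p {{ℚ.nonNegative 0≤p}} 0≤p)
    ... | inj₂ p≤0 = ℚₚ.≤-trans (ℚₚ.≤-reflexive (sym (ℚₚ.*-zeroʳ p))) (ℚₚ.*-monoˡ-≤-nonPos p {{ℚ.nonPositive p≤0}} p≤0)

  ×-cancel-≤ : ∀ m {x y} → suc m × x ≤ suc m × y → x ≤ y
  ×-cancel-≤ m {x} {y} h ε 0<ε = let N , k = h ε 0<ε in N , λ n N≤n → cancel n (k n N≤n)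
    where
    multiple-mono : ∀ m n → seq y n ℚ.≤ seq x n → seq (m × y) n ℚ.≤ seq (m × x) n
    multiple-mono zero    n y≤x = ℚₚ.≤-refl
    multiple-mono (suc m) n y≤x = ℚₚ.+-mono-≤ y≤x (multiple-mono m n y≤x)
    cancel : ∀ n → seq x n ℚ.+ seq (m × x) n ℚ.≤ (seq y n ℚ.+ seq (m × y) n) ℚ.+ ε → seq x n ℚ.≤ seq y n ℚ.+ ε
    cancel n k with seq x n ℚₚ.≤? seq y n ℚ.+ ε
    ... | yes x≤y+ε = x≤y+ε
    ... | no  x≰y+ε = ⊥-elim (ℚₚ.<-irrefl refl (begin-strict
      (seq y n ℚ.+ seq (m × y) n) ℚ.+ ε      ≡⟨ solve 3 (λ y z e → (y :+ z) :+ e := (y :+ e) :+ z) refl (seq y n) (seq (m × y) n) ε ⟩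
      (seq y n ℚ.+ ε) ℚ.+ seq (m × y) n      <⟨ ℚₚ.+-mono-<-≤ y+ε<x (multiple-mono m n (ℚₚ.≤-trans (x≤x+y (ℚₚ.<⇒≤ 0<ε)) (ℚₚ.<⇒≤ y+ε<x))) ⟩
      seq x n ℚ.+ seq (m × x) n              ≤⟨ k ⟩
      (seq y n ℚ.+ seq (m × y) n) ℚ.+ ε      ∎))
      where
      open ℚₚ.≤-Reasoning
      y+ε<x : seq y n ℚ.+ ε ℚ.< seq x n
      y+ε<x = ℚₚ.≰⇒> x≰y+ε

  ℝ-orderedRing : OrderedRing
  ℝ-orderedRing = record
    { commutativeRing = ℝ-commutativeRing ; _≤_ = _≤_
    ; ≤-reflexive = λ {x} {y} → ≤-reflexive {x} {y} ; ≤-trans = λ {x} {y} {z} → ≤-trans {x} {y} {z}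
    ; +-mono-≤ = λ {x} {y} {u} {v} → +-mono-≤ {x} {y} {u} {v} ; *-monoˡ-≤ = λ {c} {x} {y} → *-monoˡ-≤ {c} {x} {y}
    ; 0≤x² = 0≤x² ; ×-cancel-≤ = λ m {x} {y} → ×-cancel-≤ m {x} {y} }

  -- Whether x is zero is not decidable, but every x is small at scale ε or apart
  -- from zero, which makes equality with zero stable.
  small-or-apart : ∀ x ε → 0ℚ ℚ.< ε →
    (∃[ N ] ∀ n → N ℕ.≤ n → ℚ.∣ seq x n ∣ ℚ.≤ ε) ⊎ (∃[ N ] ∀ n → N ℕ.≤ n → ½ ℚ.* (½ ℚ.* ε) ℚ.≤ ℚ.∣ seq x n ∣)
  small-or-apart x ε 0<ε with cauchy x (½ ℚ.* (½ ℚ.* ε)) (half-pos (half-pos 0<ε))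
  ... | N , close with ℚ.∣ seq x N ∣ ℚₚ.≤? ½ ℚ.* ε
  ...   | yes small = inj₁ (N , λ n N≤n → ℚₚ.≤-trans (∣a∣≤∣a-b∣+∣b∣ (seq x n) (seq x N))
          (halves (ℚₚ.≤-trans (close N≤n ℕₚ.≤-refl) (ℚₚ.≤-trans (x≤x+y (ℚₚ.<⇒≤ (half-pos (half-pos 0<ε)))) (ℚₚ.≤-reflexive (half+half (½ ℚ.* ε))))) small))
    where
    ∣a∣≤∣a-b∣+∣b∣ : ∀ a b → ℚ.∣ a ∣ ℚ.≤ ℚ.∣ a ℚ.- b ∣ ℚ.+ ℚ.∣ b ∣
    ∣a∣≤∣a-b∣+∣b∣ a b = ℚₚ.≤-trans (ℚₚ.≤-reflexive (cong ℚ.∣_∣ (solve 2 (λ a b → a := (a :- b) :+ b) refl a b))) (ℚₚ.∣p+q∣≤∣p∣+∣q∣ (a ℚ.- b) b)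
  ...   | no  large = inj₂ (N , λ n N≤n → begin
      ½ ℚ.* (½ ℚ.* ε)                                             ≡⟨ solve 1 (λ h → h := (h :+ h) :- h) refl (½ ℚ.* (½ ℚ.* ε)) ⟩
      (½ ℚ.* (½ ℚ.* ε) ℚ.+ ½ ℚ.* (½ ℚ.* ε)) ℚ.- ½ ℚ.* (½ ℚ.* ε)   ≡⟨ cong (ℚ._- ½ ℚ.* (½ ℚ.* ε)) (half+half (½ ℚ.* ε)) ⟩
      ½ ℚ.* ε ℚ.- ½ ℚ.* (½ ℚ.* ε)                                 ≤⟨ ℚₚ.+-mono-≤ (ℚₚ.<⇒≤ (ℚₚ.≰⇒> large)) (ℚₚ.neg-antimono-≤ (close ℕₚ.≤-refl N≤n)) ⟩
      ℚ.∣ seq x N ∣ ℚ.- ℚ.∣ seq x N ℚ.- seq x n ∣                 ≤⟨ ℚₚ.+-monoˡ-≤ _ (ℚₚ.≤-trans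
          (ℚₚ.≤-reflexive (cong ℚ.∣_∣ (solve 2 (λ a b → a := (a :- b) :+ b) refl (seq x N) (seq x n)))) (ℚₚ.∣p+q∣≤∣p∣+∣q∣ (seq x N ℚ.- seq x n) (seq x n))) ⟩
      (ℚ.∣ seq x N ℚ.- seq x n ∣ ℚ.+ ℚ.∣ seq x n ∣) ℚ.- ℚ.∣ seq x N ℚ.- seq x n ∣
                                                                  ≡⟨ solve 2 (λ d a → (d :+ a) :- d := a) refl ℚ.∣ seq x N ℚ.- seq x n ∣ ℚ.∣ seq x n ∣ ⟩
      ℚ.∣ seq x n ∣                                               ∎)
    where open ℚₚ.≤-Reasoning

  ∣p-0∣ : ∀ p → ℚ.∣ p ℚ.- 0ℚ ∣ ≡ ℚ.∣ p ∣
  ∣p-0∣ p = cong ℚ.∣_∣ (ℚₚ.+-identityʳ p)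

  -- If `x` is apart from zero at some scale, then `y` is zero. That `x` is not zero does not
  -- exhibit such a scale, hence the double negation; `zero-stable` removes it.
  zero-product : ∀ {x y} → x * y ≃ 0ℝ → ¬ x ≃ 0ℝ → ¬ ¬ y ≃ 0ℝ
  zero-product {x} {y} xy≃0 x≄0 y≄0 = x≄0 λ ε 0<ε → x-small ε 0<ε (small-or-apart x ε 0<ε)
    where
    x-small : ∀ ε → 0ℚ ℚ.< ε →
      (∃[ N ] ∀ n → N ℕ.≤ n → ℚ.∣ seq x n ∣ ℚ.≤ ε) ⊎ (∃[ N ] ∀ n → N ℕ.≤ n → ½ ℚ.* (½ ℚ.* ε) ℚ.≤ ℚ.∣ seq x n ∣) →
      ∃[ N ] ∀ n → N ℕ.≤ n → ℚ.∣ seq x n ℚ.- 0ℚ ∣ ℚ.≤ ε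
    x-small ε 0<ε (inj₁ (N , small)) = N , λ n N≤n → subst (ℚ._≤ ε) (sym (∣p-0∣ (seq x n))) (small n N≤n)
    x-small ε 0<ε (inj₂ (N , apart)) = ⊥-elim (y≄0 λ η 0<η →
      let c = ½ ℚ.* (½ ℚ.* ε)
          0<c = half-pos (half-pos 0<ε)
          M , close = xy≃0 (c ℚ.* η) (ℚₚ.positive⁻¹ _ {{ℚₚ.pos*pos⇒pos c {{ℚ.positive 0<c}} η {{ℚ.positive 0<η}}}})
      in N ℕ.⊔ M , λ n ≤n → subst (ℚ._≤ η) (sym (∣p-0∣ (seq y n))) (ℚₚ.*-cancelˡ-≤-pos c {{ℚ.positive 0<c}} (begin
        c ℚ.* ℚ.∣ seq y n ∣                  ≤⟨ ℚₚ.*-monoʳ-≤-nonNeg ℚ.∣ seq y n ∣ {{ℚₚ.∣-∣-nonNeg (seq y n)}} (apart n (ℕₚ.m⊔n≤o⇒m≤o N M ≤n)) ⟩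
        ℚ.∣ seq x n ∣ ℚ.* ℚ.∣ seq y n ∣      ≡⟨ ℚₚ.∣p*q∣≡∣p∣*∣q∣ (seq x n) (seq y n) ⟨
        ℚ.∣ seq x n ℚ.* seq y n ∣            ≡⟨ ∣p-0∣ (seq x n ℚ.* seq y n) ⟨
        ℚ.∣ seq x n ℚ.* seq y n ℚ.- 0ℚ ∣     ≤⟨ close n (ℕₚ.m⊔n≤o⇒n≤o N M ≤n) ⟩
        c ℚ.* η                              ∎)))
      where open ℚₚ.≤-Reasoning

  zero-stable : ∀ {x} → ¬ ¬ x ≃ 0ℝ → x ≃ 0ℝ
  zero-stable {x} ¬x≄0 ε 0<ε with small-or-apart x ε 0<ε
  ... | inj₁ (N , small) = N , λ n N≤n → subst (ℚ._≤ ε) (sym (∣p-0∣ (seq x n))) (small n N≤n)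
  ... | inj₂ (N , apart) = ⊥-elim (¬x≄0 λ x≃0 →
    let δ = ½ ℚ.* (½ ℚ.* ε)
        0<δ = half-pos (half-pos 0<ε)
        M , close = x≃0 (½ ℚ.* δ) (half-pos 0<δ)
        n = N ℕ.⊔ M
    in ℚₚ.<-irrefl refl (begin-strict
      ½ ℚ.* δ                    <⟨ ℚₚ.≤-<-trans (ℚₚ.≤-reflexive (sym (ℚₚ.+-identityʳ (½ ℚ.* δ)))) (ℚₚ.+-monoʳ-< (½ ℚ.* δ) (half-pos 0<δ)) ⟩
      ½ ℚ.* δ ℚ.+ ½ ℚ.* δ        ≡⟨ half+half δ ⟩
      δ                          ≤⟨ apart n (ℕₚ.m≤m⊔n N M) ⟩
      ℚ.∣ seq x n ∣              ≡⟨ ∣p-0∣ (seq x n) ⟨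
      ℚ.∣ seq x n ℚ.- 0ℚ ∣       ≤⟨ close n (ℕₚ.m≤n⊔m N M) ⟩
      ½ ℚ.* δ                    ∎))
    where open ℚₚ.≤-Reasoning

  ×1≤⇒≤ : ∀ m n → m × 1ℝ ≤ n × 1ℝ → m ℕ.≤ n
  ×1≤⇒≤ m n h = let N , k = h ½ (ℚₚ.positive⁻¹ ½) in compare m n (subst₂ (λ a b → a ℚ.≤ b ℚ.+ ½) (constant m N) (constant n N) (k N ℕₚ.≤-refl))
    where
    multiple : ℕ → ℚ
    multiple zero    = 0ℚ
    multiple (suc m) = 1ℚ ℚ.+ multiple m
    constant : ∀ m N → seq (m × 1ℝ) N ≡ multiple m
    constant zero    N = refl
    constant (suc m) N = cong (1ℚ ℚ.+_) (constant m N)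
    0≤multiple : ∀ m → 0ℚ ℚ.≤ multiple m
    0≤multiple zero    = ℚₚ.≤-refl
    0≤multiple (suc m) = ℚₚ.+-mono-≤ 0≤1 (0≤multiple m)
    compare : ∀ m n → multiple m ℚ.≤ multiple n ℚ.+ ½ → m ℕ.≤ n
    compare zero    n       h = ℕ.z≤n
    compare (suc m) (suc n) h = ℕ.s≤s (compare m n (cancel (multiple m) (multiple n ℚ.+ ½) (subst (1ℚ ℚ.+ multiple m ℚ.≤_) (ℚₚ.+-assoc 1ℚ (multiple n) ½) h)))
      where
      cancel : ∀ a b → 1ℚ ℚ.+ a ℚ.≤ 1ℚ ℚ.+ b → a ℚ.≤ b
      cancel a b h = subst₂ ℚ._≤_ (solve 1 (λ a → :- con 1ℚ :+ (con 1ℚ :+ a) := a) refl a) (solve 1 (λ a → :- con 1ℚ :+ (con 1ℚ :+ a) := a) refl b) (ℚₚ.+-monoʳ-≤ (ℚ.- 1ℚ) h)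
    compare (suc m) zero    h = ⊥-elim (ℚₚ.<-irrefl refl (ℚₚ.<-≤-trans (ℚₚ.<-≤-trans ½<1 (x≤x+y (0≤multiple m))) h))
      where
      ½<1 : 0ℚ ℚ.+ ½ ℚ.< 1ℚ
      ½<1 = subst₂ ℚ._<_ refl (half+half 1ℚ) (ℚₚ.+-monoˡ-< (½ ℚ.* 1ℚ) (ℚₚ.positive⁻¹ ½))

-- Addition theorems for sine and cosine

module Exp where

  open import Data.Integer.Base as ℤ using (+_)
  open import Data.Rational.Base as ℚ using (ℚ; 0ℚ; 1ℚ; ½; _/_)
  open import Data.Rational.Solver using (module +-*-Solver)
  open import Relation.Binary.PropositionalEquality

  open import Defs
  open Reals

  open +-*-Solver

  ∑< : ℕ → (ℕ → ℚ) → ℚ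
  ∑< zero    f = 0ℚ
  ∑< (suc n) f = ∑< n f ℚ.+ f n

  ∑<-cong : ∀ n {f g : ℕ → ℚ} → (∀ i → f i ≡ g i) → ∑< n f ≡ ∑< n g
  ∑<-cong zero    f≡g = refl
  ∑<-cong (suc n) f≡g = cong₂ ℚ._+_ (∑<-cong n f≡g) (f≡g n)

  ∑<-+ : ∀ n (f g : ℕ → ℚ) → ∑< n (λ i → f i ℚ.+ g i) ≡ ∑< n f ℚ.+ ∑< n g
  ∑<-+ zero    f g = refl
  ∑<-+ (suc n) f g = trans (cong (ℚ._+ (f n ℚ.+ g n)) (∑<-+ n f g))
    (solve 4 (λ a b c d → (a :+ b) :+ (c :+ d) := (a :+ c) :+ (b :+ d)) refl (∑< n f) (∑< n g) (f n) (g n))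

  ∑<-scale : ∀ n a (f : ℕ → ℚ) → ∑< n (λ i → a ℚ.* f i) ≡ a ℚ.* ∑< n f
  ∑<-scale zero    a f = sym (ℚₚ.*-zeroʳ a)
  ∑<-scale (suc n) a f = trans (cong (ℚ._+ a ℚ.* f n) (∑<-scale n a f)) (sym (ℚₚ.*-distribˡ-+ a (∑< n f) (f n)))

  row : (ℕ → ℕ → ℚ) → ℕ → ℚ
  row f n = ∑< n (f 0)

  below : (ℕ → ℕ → ℚ) → ℕ → ℕ → ℚ
  below f i j = f (suc i) j

  -- The two sides of a Cauchy product: sums over a square are products of partial sums, sums over a
  -- triangle are partial sums of the series at `x + y`.
  rectangle : (ℕ → ℕ → ℚ) → ℕ → ℕ → ℚ
  rectangle f zero    n = 0ℚ
  rectangle f (suc m) n = row f n ℚ.+ rectangle (below f) m n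

  triangular : (ℕ → ℕ → ℚ) → ℕ → ℚ
  triangular f zero    = 0ℚ
  triangular f (suc n) = row f (suc n) ℚ.+ triangular (below f) n

  antidiagonal : (ℕ → ℕ → ℚ) → ℕ → ℚ
  antidiagonal f zero    = f 0 0
  antidiagonal f (suc n) = f 0 (suc n) ℚ.+ antidiagonal (below f) n

  antidiagonal-cong : ∀ n {f g : ℕ → ℕ → ℚ} → (∀ i j → f i j ≡ g i j) → antidiagonal f n ≡ antidiagonal g n
  antidiagonal-cong zero    f≡g = f≡g 0 0
  antidiagonal-cong (suc n) f≡g = cong₂ ℚ._+_ (f≡g 0 (suc n)) (antidiagonal-cong n (λ i → f≡g (suc i)))

  antidiagonal-+ : ∀ n (f g : ℕ → ℕ → ℚ) → antidiagonal (λ i j → f i j ℚ.+ g i j) n ≡ antidiagonal f n ℚ.+ antidiagonal g n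
  antidiagonal-+ zero    f g = refl
  antidiagonal-+ (suc n) f g = trans (cong (f 0 (suc n) ℚ.+ g 0 (suc n) ℚ.+_) (antidiagonal-+ n (below f) (below g)))
    (solve 4 (λ a b c d → (a :+ b) :+ (c :+ d) := (a :+ c) :+ (b :+ d)) refl (f 0 (suc n)) (g 0 (suc n)) (antidiagonal (below f) n) (antidiagonal (below g) n))

  antidiagonal-graded : ∀ n (a : ℕ → ℚ) (f : ℕ → ℕ → ℚ) → antidiagonal (λ i j → a (i ℕ.+ j) ℚ.* f i j) n ≡ a n ℚ.* antidiagonal f n
  antidiagonal-graded zero    a f = refl
  antidiagonal-graded (suc n) a f = trans (cong (a (suc n) ℚ.* f 0 (suc n) ℚ.+_) (antidiagonal-graded n (λ k → a (suc k)) (below f)))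
    (sym (ℚₚ.*-distribˡ-+ (a (suc n)) (f 0 (suc n)) (antidiagonal (below f) n)))

  antidiagonal-last : ∀ n (f : ℕ → ℕ → ℚ) → antidiagonal f (suc n) ≡ antidiagonal (λ i j → f i (suc j)) n ℚ.+ f (suc n) 0
  antidiagonal-last zero    f = refl
  antidiagonal-last (suc n) f = trans (cong (f 0 (suc (suc n)) ℚ.+_) (antidiagonal-last n (below f)))
    (sym (ℚₚ.+-assoc (f 0 (suc (suc n))) (antidiagonal (λ i j → f (suc i) (suc j)) n) (f (suc (suc n)) 0)))

  triangular-antidiagonal : ∀ n (f : ℕ → ℕ → ℚ) → triangular f (suc n) ≡ triangular f n ℚ.+ antidiagonal f n
  triangular-antidiagonal zero    f = solve 1 (λ a → (con 0ℚ :+ a) :+ con 0ℚ := con 0ℚ :+ a) refl (f 0 0)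
  triangular-antidiagonal (suc n) f = trans (cong (row f (suc n) ℚ.+ f 0 (suc n) ℚ.+_) (triangular-antidiagonal n (below f)))
    (solve 4 (λ a b c d → (a :+ b) :+ (c :+ d) := (a :+ c) :+ (b :+ d)) refl (row f (suc n)) (f 0 (suc n)) (triangular (below f) n) (antidiagonal (below f) n))

  rectangle-product : ∀ m n (u v : ℕ → ℚ) → rectangle (λ i j → u i ℚ.* v j) m n ≡ ∑< m u ℚ.* ∑< n v
  rectangle-product zero    n u v = sym (ℚₚ.*-zeroˡ (∑< n v))
  rectangle-product (suc m) n u v = trans (cong₂ ℚ._+_ (∑<-scale n (u 0) v) (rectangle-product m n (λ i → u (suc i)) v))
    (trans (sym (ℚₚ.*-distribʳ-+ (∑< n v) (u 0) (∑< m (λ i → u (suc i))))) (cong (ℚ._* ∑< n v) (∑<-first m u)))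
    where
    ∑<-first : ∀ m (u : ℕ → ℚ) → u 0 ℚ.+ ∑< m (λ i → u (suc i)) ≡ ∑< (suc m) u
    ∑<-first zero    u = ℚₚ.+-comm (u 0) 0ℚ
    ∑<-first (suc m) u = trans (sym (ℚₚ.+-assoc (u 0) (∑< m (λ i → u (suc i))) (u (suc m)))) (cong (ℚ._+ u (suc m)) (∑<-first m u))

  rectangle-+ : ∀ m n (f g : ℕ → ℕ → ℚ) → rectangle (λ i j → f i j ℚ.+ g i j) m n ≡ rectangle f m n ℚ.+ rectangle g m n
  rectangle-+ zero    n f g = refl
  rectangle-+ (suc m) n f g = trans (cong₂ ℚ._+_ (∑<-+ n (f 0) (g 0)) (rectangle-+ m n (below f) (below g)))
    (solve 4 (λ a b c d → (a :+ b) :+ (c :+ d) := (a :+ c) :+ (b :+ d)) refl (row f n) (row g n) (rectangle (below f) m n) (rectangle (below g) m n))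

  rectangle-cong : ∀ m n {f g : ℕ → ℕ → ℚ} → (∀ i j → f i j ≡ g i j) → rectangle f m n ≡ rectangle g m n
  rectangle-cong zero    n f≡g = refl
  rectangle-cong (suc m) n f≡g = cong₂ ℚ._+_ (∑<-cong n (f≡g 0)) (rectangle-cong m n (λ i → f≡g (suc i)))

  ∣+∣-mono : ∀ {a b c d} → ℚ.∣ a ∣ ℚ.≤ c → ℚ.∣ b ∣ ℚ.≤ d → ℚ.∣ a ℚ.+ b ∣ ℚ.≤ c ℚ.+ d
  ∣+∣-mono {a} {b} a≤c b≤d = ℚₚ.≤-trans (ℚₚ.∣p+q∣≤∣p∣+∣q∣ a b) (ℚₚ.+-mono-≤ a≤c b≤d)

  ∑<-tail : ∀ k m {f g : ℕ → ℚ} → (∀ i → ℚ.∣ f i ∣ ℚ.≤ g i) →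
    ℚ.∣ ∑< (k ℕ.+ m) f ℚ.- ∑< m f ∣ ℚ.≤ ∑< (k ℕ.+ m) g ℚ.- ∑< m g
  ∑<-tail zero    m {f} {g} f≤g = ℚₚ.≤-reflexive (trans (cong ℚ.∣_∣ (ℚₚ.+-inverseʳ (∑< m f))) (sym (ℚₚ.+-inverseʳ (∑< m g))))
  ∑<-tail (suc k) m {f} {g} f≤g = subst₂ (λ a b → ℚ.∣ a ∣ ℚ.≤ b) (swap (∑< (k ℕ.+ m) f) (∑< m f) (f (k ℕ.+ m))) (swap (∑< (k ℕ.+ m) g) (∑< m g) (g (k ℕ.+ m)))
    (∣+∣-mono {∑< (k ℕ.+ m) f ℚ.- ∑< m f} {f (k ℕ.+ m)} (∑<-tail k m f≤g) (f≤g (k ℕ.+ m)))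
    where
    swap : ∀ a b c → (a ℚ.- b) ℚ.+ c ≡ (a ℚ.+ c) ℚ.- b
    swap = solve 3 (λ a b c → (a :- b) :+ c := (a :+ c) :- b) refl

  -- The excess width `k` is for the induction over the rows: removing the first row shortens the
  -- triangle but leaves the width of the rectangle.
  rectangle-triangular : ∀ k m {f g : ℕ → ℕ → ℚ} → (∀ i j → ℚ.∣ f i j ∣ ℚ.≤ g i j) →
    ℚ.∣ rectangle f m (k ℕ.+ m) ℚ.- triangular f m ∣ ℚ.≤ rectangle g m (k ℕ.+ m) ℚ.- triangular g m
  rectangle-triangular k zero    f≤g = ℚₚ.≤-refl
  rectangle-triangular k (suc m) {f} {g} f≤g = subst₂ (λ a b → ℚ.∣ a ∣ ℚ.≤ b) (split f) (split g)
    (∣+∣-mono {row f (k ℕ.+ suc m) ℚ.- row f (suc m)} {rectangle (below f) m (suc k ℕ.+ m) ℚ.- triangular (below f) m}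
      (∑<-tail k (suc m) (f≤g 0)) (rectangle-triangular (suc k) m (λ i → f≤g (suc i))))
    where
    split : ∀ f → (row f (k ℕ.+ suc m) ℚ.- row f (suc m)) ℚ.+ (rectangle (below f) m (suc k ℕ.+ m) ℚ.- triangular (below f) m)
      ≡ rectangle f (suc m) (k ℕ.+ suc m) ℚ.- triangular f (suc m)
    split f = trans
      (cong (λ n → (row f (k ℕ.+ suc m) ℚ.- row f (suc m)) ℚ.+ (rectangle (below f) m n ℚ.- triangular (below f) m)) (sym (ℕₚ.+-suc k m)))
      (solve 4 (λ a b c d → (a :- b) :+ (c :- d) := (a :+ c) :- (b :+ d)) refl
        (row f (k ℕ.+ suc m)) (row f (suc m)) (rectangle (below f) m (k ℕ.+ suc m)) (triangular (below f) m))

  rectangle≤triangular : ∀ m n {g : ℕ → ℕ → ℚ} → (∀ i j → 0ℚ ℚ.≤ g i j) → rectangle g m n ℚ.≤ triangular g (m ℕ.+ n)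
  rectangle≤triangular zero    n {g} 0≤g = 0≤triangular n 0≤g
    where
    0≤∑< : ∀ n {f : ℕ → ℚ} → (∀ i → 0ℚ ℚ.≤ f i) → 0ℚ ℚ.≤ ∑< n f
    0≤∑< zero    0≤f = ℚₚ.≤-refl
    0≤∑< (suc n) 0≤f = ℚₚ.+-mono-≤ (0≤∑< n 0≤f) (0≤f n)
    0≤triangular : ∀ n {g : ℕ → ℕ → ℚ} → (∀ i j → 0ℚ ℚ.≤ g i j) → 0ℚ ℚ.≤ triangular g n
    0≤triangular zero    0≤g = ℚₚ.≤-refl
    0≤triangular (suc n) 0≤g = ℚₚ.+-mono-≤ (0≤∑< (suc n) (0≤g 0)) (0≤triangular n (λ i → 0≤g (suc i)))
  rectangle≤triangular (suc m) n {g} 0≤g = ℚₚ.+-mono-≤ (∑<-mono (suc m) (0≤g 0)) (rectangle≤triangular m n (λ i → 0≤g (suc i)))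
    where
    ∑<-mono : ∀ k {f : ℕ → ℚ} → (∀ i → 0ℚ ℚ.≤ f i) → ∑< n f ℚ.≤ ∑< (k ℕ.+ n) f
    ∑<-mono zero    0≤f = ℚₚ.≤-refl
    ∑<-mono (suc k) 0≤f = ℚₚ.≤-trans (∑<-mono k 0≤f) (x≤x+y (0≤f (k ℕ.+ n)))

  term : ℚ → ℕ → ℚ
  term x j = powℚ x j ℚ.* 1/ j !

  ℕℚ : ℕ → ℚ
  ℕℚ n = + n / 1

  ℕℚ-suc : ∀ n → ℕℚ (suc n) ≡ 1ℚ ℚ.+ ℕℚ n
  ℕℚ-suc n = ℚₚ.toℚᵘ-injective (ℚᵘₚ.≃-trans (ℚₚ.toℚᵘ-fromℚᵘ (ℚᵘ.mkℚᵘ (+ suc n) 0))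
    (ℚᵘₚ.≃-trans (ℚᵘ.*≡* (trans (ℤₚ.*-identityʳ (+ suc n)) (trans (sym (cong (λ k → + 1 ℤ.+ k) (ℤₚ.*-identityʳ (+ n)))) (sym (ℤₚ.*-identityʳ _)))))
      (ℚᵘₚ.≃-sym (ℚᵘₚ.≃-trans (ℚₚ.toℚᵘ-homo-+ 1ℚ (ℕℚ n)) (ℚᵘₚ.+-congʳ (ℚᵘ.mkℚᵘ (+ 1) 0) (ℚₚ.toℚᵘ-fromℚᵘ (ℚᵘ.mkℚᵘ (+ n) 0)))))))

  ℕℚ-recip : ∀ n → ℕℚ (suc n) ℚ.* (+ 1 / suc n) ≡ 1ℚ
  ℕℚ-recip n = ℚₚ.toℚᵘ-injective (ℚᵘₚ.≃-trans (ℚₚ.toℚᵘ-homo-* (ℕℚ (suc n)) (+ 1 / suc n))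
    (ℚᵘₚ.≃-trans (ℚᵘₚ.*-cong (ℚₚ.toℚᵘ-fromℚᵘ (ℚᵘ.mkℚᵘ (+ suc n) 0)) (ℚₚ.toℚᵘ-fromℚᵘ (ℚᵘ.mkℚᵘ (+ 1) n)))
      (ℚᵘ.*≡* (cong +_ (trans (trans (ℕₚ.*-identityʳ (suc n ℕ.* 1)) (ℕₚ.*-identityʳ (suc n))) (sym (trans (ℕₚ.*-identityˡ (1 ℕ.* suc n)) (ℕₚ.*-identityˡ (suc n)))))))))

  term-suc : ∀ x j → ℕℚ (suc j) ℚ.* term x (suc j) ≡ x ℚ.* term x j
  term-suc x j = trans (solve 5 (λ n p x f i → n :* (p :* x :* (f :* i)) := (n :* i) :* (x :* (p :* f))) refl (ℕℚ (suc j)) (powℚ x j) x (1/ j !) (+ 1 / suc j))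
    (trans (cong (ℚ._* (x ℚ.* term x j)) (ℕℚ-recip j)) (ℚₚ.*-identityˡ _))

  ℕℚ-+ : ∀ m n → ℕℚ (m ℕ.+ n) ≡ ℕℚ m ℚ.+ ℕℚ n
  ℕℚ-+ zero    n = sym (ℚₚ.+-identityˡ (ℕℚ n))
  ℕℚ-+ (suc m) n = trans (ℕℚ-suc (m ℕ.+ n)) (trans (cong (1ℚ ℚ.+_) (ℕℚ-+ m n)) (trans (sym (ℚₚ.+-assoc 1ℚ (ℕℚ m) (ℕℚ n))) (cong (ℚ._+ ℕℚ n) (sym (ℕℚ-suc m)))))

  -- The binomial theorem, divided by n!.
  term-binomial : ∀ x y n → antidiagonal (λ i j → term x i ℚ.* term y j) n ≡ term (x ℚ.+ y) n
  term-binomial x y zero    = refl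
  term-binomial x y (suc n) = begin
    antidiagonal f (suc n)
      ≡⟨ trans (cong (ℚ._* antidiagonal f (suc n)) (trans (ℚₚ.*-comm r (ℕℚ (suc n))) (ℕℚ-recip n))) (ℚₚ.*-identityˡ _) ⟨
    (r ℚ.* ℕℚ (suc n)) ℚ.* antidiagonal f (suc n)
      ≡⟨ ℚₚ.*-assoc r (ℕℚ (suc n)) _ ⟩
    r ℚ.* (ℕℚ (suc n) ℚ.* antidiagonal f (suc n))
      ≡⟨ cong (r ℚ.*_) multiple ⟩
    r ℚ.* (x ℚ.* term (x ℚ.+ y) n ℚ.+ y ℚ.* term (x ℚ.+ y) n)
      ≡⟨ solve 5 (λ r x y p f → r :* (x :* (p :* f) :+ y :* (p :* f)) := p :* (x :+ y) :* (f :* r)) refl r x y (powℚ (x ℚ.+ y) n) (1/ n !) ⟩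
    term (x ℚ.+ y) (suc n) ∎
    where
    open ≡-Reasoning
    f : ℕ → ℕ → ℚ
    f i j = term x i ℚ.* term y j
    r : ℚ
    r = + 1 / suc n
    multiple : ℕℚ (suc n) ℚ.* antidiagonal f (suc n) ≡ x ℚ.* term (x ℚ.+ y) n ℚ.+ y ℚ.* term (x ℚ.+ y) n
    multiple = begin
      ℕℚ (suc n) ℚ.* antidiagonal f (suc n)
        ≡⟨ antidiagonal-graded (suc n) ℕℚ f ⟨
      antidiagonal (λ i j → ℕℚ (i ℕ.+ j) ℚ.* f i j) (suc n)
        ≡⟨ antidiagonal-cong (suc n) (λ i j → trans (cong (ℚ._* f i j) (ℕℚ-+ i j)) (ℚₚ.*-distribʳ-+ (f i j) (ℕℚ i) (ℕℚ j))) ⟩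
      antidiagonal (λ i j → ℕℚ i ℚ.* f i j ℚ.+ ℕℚ j ℚ.* f i j) (suc n)
        ≡⟨ antidiagonal-+ (suc n) (λ i j → ℕℚ i ℚ.* f i j) (λ i j → ℕℚ j ℚ.* f i j) ⟩
      antidiagonal (λ i j → ℕℚ i ℚ.* f i j) (suc n) ℚ.+ antidiagonal (λ i j → ℕℚ j ℚ.* f i j) (suc n)
        ≡⟨ cong₂ ℚ._+_ left right ⟩
      x ℚ.* term (x ℚ.+ y) n ℚ.+ y ℚ.* term (x ℚ.+ y) n ∎
      where
      left : antidiagonal (λ i j → ℕℚ i ℚ.* f i j) (suc n) ≡ x ℚ.* term (x ℚ.+ y) n
      left = begin
        0ℚ ℚ.* f 0 (suc n) ℚ.+ antidiagonal (λ i j → ℕℚ (suc i) ℚ.* f (suc i) j) n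
          ≡⟨ solve 2 (λ a b → con 0ℚ :* a :+ b := b) refl (f 0 (suc n)) (antidiagonal (λ i j → ℕℚ (suc i) ℚ.* f (suc i) j) n) ⟩
        antidiagonal (λ i j → ℕℚ (suc i) ℚ.* f (suc i) j) n
          ≡⟨ antidiagonal-cong n (λ i j → trans (sym (ℚₚ.*-assoc (ℕℚ (suc i)) (term x (suc i)) (term y j)))
               (trans (cong (ℚ._* term y j) (term-suc x i)) (ℚₚ.*-assoc x (term x i) (term y j)))) ⟩
        antidiagonal (λ i j → x ℚ.* f i j) n
          ≡⟨ antidiagonal-graded n (λ _ → x) f ⟩
        x ℚ.* antidiagonal f n
          ≡⟨ cong (x ℚ.*_) (term-binomial x y n) ⟩
        x ℚ.* term (x ℚ.+ y) n ∎
      right : antidiagonal (λ i j → ℕℚ j ℚ.* f i j) (suc n) ≡ y ℚ.* term (x ℚ.+ y) n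
      right = begin
        antidiagonal (λ i j → ℕℚ j ℚ.* f i j) (suc n)
          ≡⟨ antidiagonal-last n (λ i j → ℕℚ j ℚ.* f i j) ⟩
        antidiagonal (λ i j → ℕℚ (suc j) ℚ.* f i (suc j)) n ℚ.+ 0ℚ ℚ.* f (suc n) 0
          ≡⟨ solve 2 (λ a b → b :+ con 0ℚ :* a := b) refl (f (suc n) 0) (antidiagonal (λ i j → ℕℚ (suc j) ℚ.* f i (suc j)) n) ⟩
        antidiagonal (λ i j → ℕℚ (suc j) ℚ.* f i (suc j)) n
          ≡⟨ antidiagonal-cong n (λ i j → trans (solve 3 (λ a b c → a :* (b :* c) := b :* (a :* c)) refl (ℕℚ (suc j)) (term x i) (term y (suc j)))
               (trans (cong (term x i ℚ.*_) (term-suc y j)) (solve 3 (λ a b c → a :* (b :* c) := b :* (a :* c)) refl (term x i) y (term y j)))) ⟩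
        antidiagonal (λ i j → y ℚ.* f i j) n
          ≡⟨ antidiagonal-graded n (λ _ → y) f ⟩
        y ℚ.* antidiagonal f n
          ≡⟨ cong (y ℚ.*_) (term-binomial x y n) ⟩
        y ℚ.* term (x ℚ.+ y) n ∎

  expPartial-∑ : ∀ a x n → expPartial a x n ≡ ∑< n (λ j → a j ℚ.* term x j)
  expPartial-∑ a x zero    = refl
  expPartial-∑ a x (suc n) = cong (ℚ._+ a n ℚ.* term x n) (expPartial-∑ a x n)

  expPartial-triangular : ∀ a x y n → triangular (λ i j → a (i ℕ.+ j) ℚ.* (term x i ℚ.* term y j)) n ≡ expPartial a (x ℚ.+ y) n
  expPartial-triangular a x y zero    = refl
  expPartial-triangular a x y (suc n) = trans (triangular-antidiagonal n (λ i j → a (i ℕ.+ j) ℚ.* (term x i ℚ.* term y j)))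
    (cong₂ ℚ._+_ (expPartial-triangular a x y n) (trans (antidiagonal-graded n a (λ i j → term x i ℚ.* term y j)) (cong (a n ℚ.*_) (term-binomial x y n))))

  one : ℕ → ℚ
  one _ = 1ℚ

  ∣1∣≤1 : ∀ j → ℚ.∣ one j ∣ ℚ.≤ 1ℚ
  ∣1∣≤1 _ = ℚₚ.≤-refl

  module _ {b} (0≤b : 0ℚ ℚ.≤ b) {a : ℕ → ℚ} (∣a∣≤1 : ∀ j → ℚ.∣ a j ∣ ℚ.≤ 1ℚ) where

    private
      0≤b+b : 0ℚ ℚ.≤ b ℚ.+ b
      0≤b+b = ℚₚ.+-mono-≤ 0≤b 0≤b
    module B = Tail {one} ∣1∣≤1 0≤b
    module 2B = Tail {one} ∣1∣≤1 0≤b+b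

    -- The terms of the square outside the triangle are dominated by those of the series at
    -- `b ℚ.+ b`, and the square lies in the triangle of twice the size. The error is therefore
    -- bounded by a tail of that series.
    square-close : ∀ {x y n} → ℚ.∣ x ∣ ℚ.≤ b → ℚ.∣ y ∣ ℚ.≤ b → 2B.K₀ ℕ.≤ n →
      ℚ.∣ rectangle (λ i j → a (i ℕ.+ j) ℚ.* (term x i ℚ.* term y j)) n n ℚ.- expPartial a (x ℚ.+ y) n ∣ ℚ.≤ 2B.T n ℚ.+ 2B.T n
    square-close {x} {y} {n} x≤b y≤b K₀≤n = begin
      ℚ.∣ rectangle f n n ℚ.- expPartial a (x ℚ.+ y) n ∣
        ≡⟨ cong (λ e → ℚ.∣ rectangle f n n ℚ.- e ∣) (expPartial-triangular a x y n) ⟨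
      ℚ.∣ rectangle f n n ℚ.- triangular f n ∣
        ≤⟨ rectangle-triangular 0 n f≤g ⟩
      rectangle g n n ℚ.- triangular g n
        ≤⟨ ℚₚ.+-monoˡ-≤ (ℚ.- triangular g n) (rectangle≤triangular n n (λ i j → ℚₚ.≤-trans (ℚₚ.0≤∣p∣ (f i j)) (f≤g i j))) ⟩
      triangular g (n ℕ.+ n) ℚ.- triangular g n
        ≡⟨ cong₂ ℚ._-_ (expPartial-triangular one b b (n ℕ.+ n)) (expPartial-triangular one b b n) ⟩
      expPartial one (b ℚ.+ b) (n ℕ.+ n) ℚ.- expPartial one (b ℚ.+ b) n
        ≤⟨ p≤∣p∣ _ ⟩
      ℚ.∣ expPartial one (b ℚ.+ b) (n ℕ.+ n) ℚ.- expPartial one (b ℚ.+ b) n ∣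
        ≤⟨ 2B.tail≤ (ℚₚ.≤-reflexive (ℚₚ.0≤p⇒∣p∣≡p 0≤b+b)) K₀≤n (ℕₚ.m≤m+n n n) ⟩
      2B.T n ℚ.+ 2B.T n ∎
      where
      open ℚₚ.≤-Reasoning
      f g : ℕ → ℕ → ℚ
      f i j = a (i ℕ.+ j) ℚ.* (term x i ℚ.* term y j)
      g i j = 1ℚ ℚ.* (term b i ℚ.* term b j)
      ∣term∣≤ : ∀ {x} → ℚ.∣ x ∣ ℚ.≤ b → ∀ j → ℚ.∣ term x j ∣ ℚ.≤ term b j
      ∣term∣≤ {x} x≤b j = subst (λ t → ℚ.∣ t ∣ ℚ.≤ term b j) (ℚₚ.*-identityˡ (term x j)) (∣expTerm∣≤ {one} ∣1∣≤1 x≤b 0≤b j)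
      f≤g : ∀ i j → ℚ.∣ f i j ∣ ℚ.≤ g i j
      f≤g i j = ∣*∣-mono {a (i ℕ.+ j)} {term x i ℚ.* term y j} 0≤1 (∣a∣≤1 (i ℕ.+ j)) (∣*∣-mono {term x i} {term y j} (B.0≤T i) (∣term∣≤ x≤b i) (∣term∣≤ y≤b j))

  T-antitone : ∀ {b} (0≤b : 0ℚ ℚ.≤ b) → let open Tail {one} ∣1∣≤1 0≤b in ∀ {K} → K₀ ℕ.≤ K → ∀ i → T (i ℕ.+ K) ℚ.≤ T K
  T-antitone 0≤b         K₀≤K zero    = ℚₚ.≤-refl
  T-antitone 0≤b {K = K} K₀≤K (suc i) = ℚₚ.≤-trans (T-halves {i ℕ.+ K} (ℕₚ.≤-trans K₀≤K (ℕₚ.m≤n+m K i)))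
    (ℚₚ.≤-trans (subst (½ ℚ.* T (i ℕ.+ K) ℚ.≤_) (half+half (T (i ℕ.+ K))) (x≤x+y (ℚₚ.≤-trans (ℚₚ.≤-reflexive (sym (ℚₚ.*-zeroʳ ½))) (ℚₚ.*-monoˡ-≤-nonNeg ½ (0≤T (i ℕ.+ K))))))
      (T-antitone 0≤b K₀≤K i))
    where open Tail {one} ∣1∣≤1 0≤b

  -- Coefficients that split into two products cover both addition theorems: real and imaginary part
  -- of a product of powers of the imaginary unit have this shape.
  expSeries-+ : ∀ {a c₁ d₁ c₂ d₂ : ℕ → ℚ} (∣a∣≤1 : ∀ j → ℚ.∣ a j ∣ ℚ.≤ 1ℚ)
    {∣c₁∣≤1 : ∀ j → ℚ.∣ c₁ j ∣ ℚ.≤ 1ℚ} {∣d₁∣≤1 : ∀ j → ℚ.∣ d₁ j ∣ ℚ.≤ 1ℚ} {∣c₂∣≤1 : ∀ j → ℚ.∣ c₂ j ∣ ℚ.≤ 1ℚ} {∣d₂∣≤1 : ∀ j → ℚ.∣ d₂ j ∣ ℚ.≤ 1ℚ} →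
    (∀ i j → a (i ℕ.+ j) ≡ c₁ i ℚ.* d₁ j ℚ.+ c₂ i ℚ.* d₂ j) →
    ∀ x y → expSeries a ∣a∣≤1 (x + y) ≃ expSeries c₁ ∣c₁∣≤1 x * expSeries d₁ ∣d₁∣≤1 y + expSeries c₂ ∣c₂∣≤1 x * expSeries d₂ ∣d₂∣≤1 y
  expSeries-+ {a} {c₁} {d₁} {c₂} {d₂} ∣a∣≤1 addition x y ε 0<ε =
    let B , 0<B , boundˣ = bounded x
        C , 0<C , boundʸ = bounded y
    in close (ℚₚ.<⇒≤ (ℚₚ.+-mono-< 0<B 0<C)) (λ n → ℚₚ.≤-trans (boundˣ n) (x≤x+y (ℚₚ.<⇒≤ 0<C))) (λ n → ℚₚ.≤-trans (boundʸ n) (x≤y+x (ℚₚ.<⇒≤ 0<B)))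
    where
    product : ∀ x y n → rectangle (λ i j → a (i ℕ.+ j) ℚ.* (term x i ℚ.* term y j)) n n
      ≡ expPartial c₁ x n ℚ.* expPartial d₁ y n ℚ.+ expPartial c₂ x n ℚ.* expPartial d₂ y n
    product x y n = begin
      rectangle (λ i j → a (i ℕ.+ j) ℚ.* (term x i ℚ.* term y j)) n n
        ≡⟨ rectangle-cong n n (λ i j → trans (cong (ℚ._* (term x i ℚ.* term y j)) (addition i j))
             (solve 6 (λ c d e f s t → (c :* d :+ e :* f) :* (s :* t) := (c :* s) :* (d :* t) :+ (e :* s) :* (f :* t)) refl (c₁ i) (d₁ j) (c₂ i) (d₂ j) (term x i) (term y j))) ⟩
      rectangle (λ i j → (c₁ i ℚ.* term x i) ℚ.* (d₁ j ℚ.* term y j) ℚ.+ (c₂ i ℚ.* term x i) ℚ.* (d₂ j ℚ.* term y j)) n n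
        ≡⟨ rectangle-+ n n (λ i j → (c₁ i ℚ.* term x i) ℚ.* (d₁ j ℚ.* term y j)) (λ i j → (c₂ i ℚ.* term x i) ℚ.* (d₂ j ℚ.* term y j)) ⟩
      rectangle (λ i j → (c₁ i ℚ.* term x i) ℚ.* (d₁ j ℚ.* term y j)) n n ℚ.+ rectangle (λ i j → (c₂ i ℚ.* term x i) ℚ.* (d₂ j ℚ.* term y j)) n n
        ≡⟨ cong₂ ℚ._+_ (part c₁ d₁) (part c₂ d₂) ⟩
      expPartial c₁ x n ℚ.* expPartial d₁ y n ℚ.+ expPartial c₂ x n ℚ.* expPartial d₂ y n ∎
      where
      open ≡-Reasoning
      part : ∀ c d → rectangle (λ i j → (c i ℚ.* term x i) ℚ.* (d j ℚ.* term y j)) n n ≡ expPartial c x n ℚ.* expPartial d y n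
      part c d = trans (rectangle-product n n (λ i → c i ℚ.* term x i) (λ j → d j ℚ.* term y j))
        (sym (cong₂ ℚ._*_ (expPartial-∑ c x n) (expPartial-∑ d y n)))
    close : ∀ {b} → 0ℚ ℚ.≤ b → (∀ n → ℚ.∣ seq x n ∣ ℚ.≤ b) → (∀ n → ℚ.∣ seq y n ∣ ℚ.≤ b) →
      ∃[ N ] ∀ n → N ℕ.≤ n → ℚ.∣ expPartial a (seq x n ℚ.+ seq y n) n ℚ.- (expPartial c₁ (seq x n) n ℚ.* expPartial d₁ (seq y n) n ℚ.+ expPartial c₂ (seq x n) n ℚ.* expPartial d₂ (seq y n) n) ∣ ℚ.≤ ε
    close {b} 0≤b boundˣ boundʸ =
      let K , K₀≤K , small = Tail.T-small {one} ∣1∣≤1 (ℚₚ.+-mono-≤ 0≤b 0≤b) (½ ℚ.* ε) (half-pos 0<ε) in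
      K , λ n K≤n →
        let T≤ = ℚₚ.≤-trans (subst (λ m → Tail.T {one} ∣1∣≤1 (ℚₚ.+-mono-≤ 0≤b 0≤b) m ℚ.≤ Tail.T {one} ∣1∣≤1 (ℚₚ.+-mono-≤ 0≤b 0≤b) K) (ℕₚ.m∸n+n≡m K≤n)
                   (T-antitone (ℚₚ.+-mono-≤ 0≤b 0≤b) K₀≤K (n ℕ.∸ K))) small
        in ℚₚ.≤-trans (ℚₚ.≤-reflexive (trans (∣-∣-comm (expPartial a (seq x n ℚ.+ seq y n) n) (expPartial c₁ (seq x n) n ℚ.* expPartial d₁ (seq y n) n ℚ.+ expPartial c₂ (seq x n) n ℚ.* expPartial d₂ (seq y n) n))
               (cong (λ e → ℚ.∣ e ℚ.- expPartial a (seq x n ℚ.+ seq y n) n ∣) (sym (product (seq x n) (seq y n) n)))))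
             (ℚₚ.≤-trans (square-close 0≤b ∣a∣≤1 (boundˣ n) (boundʸ n) (ℕₚ.≤-trans K₀≤K K≤n)) (halves {ε = ε} T≤ T≤))

  Re-suc : ∀ j → Re-i^ (suc j) ≡ ℚ.- Im-i^ j
  Re-suc 0 = refl
  Re-suc 1 = refl
  Re-suc 2 = refl
  Re-suc 3 = refl
  Re-suc (suc (suc (suc (suc j)))) = Re-suc j

  Im-suc : ∀ j → Im-i^ (suc j) ≡ Re-i^ j
  Im-suc 0 = refl
  Im-suc 1 = refl
  Im-suc 2 = refl
  Im-suc 3 = refl
  Im-suc (suc (suc (suc (suc j)))) = Im-suc j

  Re-+ : ∀ i j → Re-i^ (i ℕ.+ j) ≡ Re-i^ i ℚ.* Re-i^ j ℚ.+ (ℚ.- Im-i^ i) ℚ.* Im-i^ j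
  Im-+ : ∀ i j → Im-i^ (i ℕ.+ j) ≡ Im-i^ i ℚ.* Re-i^ j ℚ.+ Re-i^ i ℚ.* Im-i^ j
  Re-+ zero    j = solve 2 (λ r s → r := con 1ℚ :* r :+ (:- con 0ℚ) :* s) refl (Re-i^ j) (Im-i^ j)
  Re-+ (suc i) j = begin
    Re-i^ (suc (i ℕ.+ j))                                  ≡⟨ Re-suc (i ℕ.+ j) ⟩
    ℚ.- Im-i^ (i ℕ.+ j)                                    ≡⟨ cong ℚ.-_ (Im-+ i j) ⟩
    ℚ.- (Im-i^ i ℚ.* Re-i^ j ℚ.+ Re-i^ i ℚ.* Im-i^ j)      ≡⟨ solve 4 (λ a b c d → :- (a :* b :+ c :* d) := (:- a) :* b :+ (:- c) :* d) refl (Im-i^ i) (Re-i^ j) (Re-i^ i) (Im-i^ j) ⟩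
    (ℚ.- Im-i^ i) ℚ.* Re-i^ j ℚ.+ (ℚ.- Re-i^ i) ℚ.* Im-i^ j
                                                           ≡⟨ cong₂ (λ a b → a ℚ.* Re-i^ j ℚ.+ (ℚ.- b) ℚ.* Im-i^ j) (Re-suc i) (Im-suc i) ⟨
    Re-i^ (suc i) ℚ.* Re-i^ j ℚ.+ (ℚ.- Im-i^ (suc i)) ℚ.* Im-i^ j ∎
    where open ≡-Reasoning
  Im-+ zero    j = solve 2 (λ r s → s := con 0ℚ :* r :+ con 1ℚ :* s) refl (Re-i^ j) (Im-i^ j)
  Im-+ (suc i) j = begin
    Im-i^ (suc (i ℕ.+ j))                                          ≡⟨ trans (Im-suc (i ℕ.+ j)) (Re-+ i j) ⟩
    Re-i^ i ℚ.* Re-i^ j ℚ.+ (ℚ.- Im-i^ i) ℚ.* Im-i^ j              ≡⟨ cong₂ (λ a b → a ℚ.* Re-i^ j ℚ.+ b ℚ.* Im-i^ j) (Im-suc i) (Re-suc i) ⟨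
    Im-i^ (suc i) ℚ.* Re-i^ j ℚ.+ Re-i^ (suc i) ℚ.* Im-i^ j        ∎
    where open ≡-Reasoning

  cos-+ : ∀ x y → cos (x + y) ≃ cos x * cos y - sin x * sin y
  cos-+ x y = ≃-trans {cos (x + y)} {cos x * cos y + expSeries -Im ∣-Im∣≤1 x * sin y} {cos x * cos y - sin x * sin y}
    (expSeries-+ {c₁ = Re-i^} {Re-i^} { -Im } {Im-i^} ∣Re-i^∣≤1 {∣Re-i^∣≤1} {∣Re-i^∣≤1} {∣-Im∣≤1} {∣Im-i^∣≤1} Re-+ x y)
    (pointwise {cos x * cos y + expSeries -Im ∣-Im∣≤1 x * sin y} {cos x * cos y - sin x * sin y} (λ n → cong (seq (cos x * cos y) n ℚ.+_)
      (trans (cong (ℚ._* seq (sin y) n) (negate (seq x n) n)) (sym (ℚₚ.neg-distribˡ-* (seq (sin x) n) (seq (sin y) n))))))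
    where
    -Im : ℕ → ℚ
    -Im i = ℚ.- Im-i^ i
    ∣-Im∣≤1 : ∀ i → ℚ.∣ -Im i ∣ ℚ.≤ 1ℚ
    ∣-Im∣≤1 i = subst (ℚ._≤ 1ℚ) (sym (ℚₚ.∣-p∣≡∣p∣ (Im-i^ i))) (∣Im-i^∣≤1 i)
    negate : ∀ x n → expPartial -Im x n ≡ ℚ.- expPartial Im-i^ x n
    negate x zero    = refl
    negate x (suc n) = trans (cong (ℚ._+ -Im n ℚ.* term x n) (negate x n))
      (solve 3 (λ s i t → (:- s) :+ (:- i) :* t := :- (s :+ i :* t)) refl (expPartial Im-i^ x n) (Im-i^ n) (term x n))

  sin-+ : ∀ x y → sin (x + y) ≃ sin x * cos y + cos x * sin y
  sin-+ = expSeries-+ {c₁ = Im-i^} {Re-i^} {Re-i^} {Im-i^} ∣Im-i^∣≤1 {∣Im-i^∣≤1} {∣Re-i^∣≤1} {∣Re-i^∣≤1} {∣Im-i^∣≤1} Im-+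

  cos-pointwise : ∀ {x y} → (∀ n → seq x n ≡ seq y n) → cos x ≃ cos y
  cos-pointwise {x} {y} x≡y = pointwise {cos x} {cos y} (λ n → cong (λ z → expPartial Re-i^ z n) (x≡y n))

  sin-pointwise : ∀ {x y} → (∀ n → seq x n ≡ seq y n) → sin x ≃ sin y
  sin-pointwise {x} {y} x≡y = pointwise {sin x} {sin y} (λ n → cong (λ z → expPartial Im-i^ z n) (x≡y n))

  Re-pow-neg : ∀ x j → Re-i^ j ℚ.* powℚ (ℚ.- x) j ≡ Re-i^ j ℚ.* powℚ x j
  Re-pow-neg x 0 = refl
  Re-pow-neg x 1 = trans (ℚₚ.*-zeroˡ (powℚ (ℚ.- x) 1)) (sym (ℚₚ.*-zeroˡ (powℚ x 1)))
  Re-pow-neg x 2 = cong (ℚ.- 1ℚ ℚ.*_) (solve 1 (λ x → con 1ℚ :* (:- x) :* (:- x) := con 1ℚ :* x :* x) refl x)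
  Re-pow-neg x 3 = trans (ℚₚ.*-zeroˡ (powℚ (ℚ.- x) 3)) (sym (ℚₚ.*-zeroˡ (powℚ x 3)))
  Re-pow-neg x (suc (suc (suc (suc j)))) = trans (fourth (Re-i^ j) (powℚ (ℚ.- x) j)) (trans (cong (λ a → a ℚ.* x ℚ.* x ℚ.* x ℚ.* x) (Re-pow-neg x j)) (assoc (Re-i^ j) (powℚ x j)))
    where
    fourth : ∀ r p → r ℚ.* (p ℚ.* (ℚ.- x) ℚ.* (ℚ.- x) ℚ.* (ℚ.- x) ℚ.* (ℚ.- x)) ≡ (r ℚ.* p) ℚ.* x ℚ.* x ℚ.* x ℚ.* x
    fourth r p = solve 3 (λ r p x → r :* (p :* (:- x) :* (:- x) :* (:- x) :* (:- x)) := (r :* p) :* x :* x :* x :* x) refl r p x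
    assoc : ∀ r p → (r ℚ.* p) ℚ.* x ℚ.* x ℚ.* x ℚ.* x ≡ r ℚ.* (p ℚ.* x ℚ.* x ℚ.* x ℚ.* x)
    assoc r p = solve 3 (λ r p x → (r :* p) :* x :* x :* x :* x := r :* (p :* x :* x :* x :* x)) refl r p x

  Im-pow-neg : ∀ x j → Im-i^ j ℚ.* powℚ (ℚ.- x) j ≡ ℚ.- (Im-i^ j ℚ.* powℚ x j)
  Im-pow-neg x zero    = refl
  Im-pow-neg x (suc j) = begin
    Im-i^ (suc j) ℚ.* (powℚ (ℚ.- x) j ℚ.* (ℚ.- x))     ≡⟨ cong (ℚ._* (powℚ (ℚ.- x) j ℚ.* (ℚ.- x))) (Im-suc j) ⟩
    Re-i^ j ℚ.* (powℚ (ℚ.- x) j ℚ.* (ℚ.- x))           ≡⟨ ℚₚ.*-assoc (Re-i^ j) (powℚ (ℚ.- x) j) (ℚ.- x) ⟨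
    Re-i^ j ℚ.* powℚ (ℚ.- x) j ℚ.* (ℚ.- x)             ≡⟨ cong (ℚ._* (ℚ.- x)) (Re-pow-neg x j) ⟩
    Re-i^ j ℚ.* powℚ x j ℚ.* (ℚ.- x)                   ≡⟨ solve 3 (λ r p x → r :* p :* (:- x) := :- (r :* (p :* x))) refl (Re-i^ j) (powℚ x j) x ⟩
    ℚ.- (Re-i^ j ℚ.* (powℚ x j ℚ.* x))                 ≡⟨ cong (λ r → ℚ.- (r ℚ.* (powℚ x j ℚ.* x))) (Im-suc j) ⟨
    ℚ.- (Im-i^ (suc j) ℚ.* (powℚ x j ℚ.* x))           ∎
    where open ≡-Reasoning

  cos-even : ∀ x → cos (- x) ≃ cos x
  cos-even x = pointwise {cos (- x)} {cos x} (λ n → even (seq x n) n)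
    where
    even : ∀ x n → expPartial Re-i^ (ℚ.- x) n ≡ expPartial Re-i^ x n
    even x zero    = refl
    even x (suc n) = cong₂ ℚ._+_ (even x n) (trans (sym (ℚₚ.*-assoc (Re-i^ n) (powℚ (ℚ.- x) n) (1/ n !)))
      (trans (cong (ℚ._* 1/ n !) (Re-pow-neg x n)) (ℚₚ.*-assoc (Re-i^ n) (powℚ x n) (1/ n !))))

  sin-odd : ∀ x → sin (- x) ≃ - sin x
  sin-odd x = pointwise {sin (- x)} { - sin x} (λ n → odd (seq x n) n)
    where
    odd : ∀ x n → expPartial Im-i^ (ℚ.- x) n ≡ ℚ.- expPartial Im-i^ x n
    odd x zero    = refl
    odd x (suc n) = trans (cong₂ ℚ._+_ (odd x n) (trans (sym (ℚₚ.*-assoc (Im-i^ n) (powℚ (ℚ.- x) n) (1/ n !))) (cong (ℚ._* 1/ n !) (Im-pow-neg x n))))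
      (solve 4 (λ s i p f → (:- s) :+ (:- (i :* p)) :* f := :- (s :+ i :* (p :* f))) refl (expPartial Im-i^ x n) (Im-i^ n) (powℚ x n) (1/ n !))

  cos-0 : ∀ {x} → (∀ n → seq x n ≡ 0ℚ) → cos x ≃ 1ℝ
  -- The partial sum at index 0 is empty and has the wrong value 0.
  cos-0 {x} x≡0 ε 0<ε = 1 , λ { (suc n) _ → subst (λ c → ℚ.∣ c ℚ.- 1ℚ ∣ ℚ.≤ ε) (sym (trans (cong (λ z → expPartial Re-i^ z (suc n)) (x≡0 (suc n))) (constant n)))
      (subst (ℚ._≤ ε) (cong ℚ.∣_∣ (sym (ℚₚ.+-inverseʳ 1ℚ))) (ℚₚ.<⇒≤ 0<ε)) }
    where
    constant : ∀ n → expPartial Re-i^ 0ℚ (suc n) ≡ 1ℚ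
    constant zero    = refl
    constant (suc n) = trans (cong₂ ℚ._+_ (constant n) (solve 3 (λ r p f → r :* (p :* con 0ℚ :* f) := con 0ℚ) refl (Re-i^ (suc n)) (powℚ 0ℚ n) (1/ suc n !))) (ℚₚ.+-identityʳ 1ℚ)

  infixr 7 _·_
  _·_ : ℕ → ℚ → ℚ
  zero  · r = 0ℚ
  suc m · r = r ℚ.+ m · r

  ·-+ : ∀ m n r → (m ℕ.+ n) · r ≡ m · r ℚ.+ n · r
  ·-+ zero    n r = sym (ℚₚ.+-identityˡ (n · r))
  ·-+ (suc m) n r = trans (cong (r ℚ.+_) (·-+ m n r)) (sym (ℚₚ.+-assoc r (m · r) (n · r)))

  ·-distrib : ∀ m r t → m · (r ℚ.+ t) ≡ m · r ℚ.+ m · t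
  ·-distrib zero    r t = refl
  ·-distrib (suc m) r t = trans (cong (r ℚ.+ t ℚ.+_) (·-distrib m r t))
    (solve 4 (λ a b c d → (a :+ b) :+ (c :+ d) := (a :+ c) :+ (b :+ d)) refl r t (m · r) (m · t))

-- Roots of unity as characters

module Roots {p : ℕ} .{{_ : NonZero p}} (prime : Prime p) (O : OrderedRing) where

  open import Data.Nat.DivMod using (_%_; _/_; m≡m%n+[m/n]*n; m<n⇒m%n≡m)
  open import Data.Product.Base using () renaming (_×_ to _∧_)
  open import Data.Rational.Base as ℚ using (ℚ; 0ℚ; 1ℚ; ½)
  import Relation.Binary.PropositionalEquality as ≡
  open ≡ using (_≡_)

  open import Defs using (𝔽; _+ᶠ_; 1ᶠ; half+half; half-pos)
  open Concrete
  open Exp using (_·_; ·-+; ·-distrib)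
  open OrderedRing O hiding (zero)
  open CharSum (𝔽-primeField prime) O using (Character)
  open IntegerSolver commutativeRing using (solve; _:=_; _:+_; _:*_; _:-_; :-_)
  open import Algebra.Properties.Ring ring using (-0#≈0#)
  open import Relation.Binary.Reasoning.Setoid setoid

  -- c r + i s r stands for e^(iπr).
  record Rotation : Set where
    field
      c s          : ℚ → Carrier
      c-+          : ∀ r t → c (r ℚ.+ t) ≈ c r * c t - s r * s t
      s-+          : ∀ r t → s (r ℚ.+ t) ≈ s r * c t + c r * s t
      c-0          : c 0ℚ ≈ 1#
      c-even       : ∀ r → c (ℚ.- r) ≈ c r
      s-odd        : ∀ r → s (ℚ.- r) ≈ - s r
      quarter      : c ½ ≈ 0#
      first        : ∀ r → 0ℚ ℚ.< r → r ℚ.< ½ → ¬ c r ≈ 0#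
      zero-product : ∀ {x y} → x * y ≈ 0# → ¬ x ≈ 0# → y ≈ 0#
      zero-stable  : ∀ {x} → ¬ ¬ x ≈ 0# → x ≈ 0#
      2≉0          : ¬ 1# + 1# ≈ 0#

  module Rotations (z : Rotation) where

    open Rotation z

    halve : ∀ {x} → x + x ≈ 0# → x ≈ 0#
    halve {x} x+x≈0 = zero-product (trans (trans (distribʳ x 1# 1#) (+-cong (*-identityˡ x) (*-identityˡ x))) x+x≈0) 2≉0

    square-zero : ∀ {x} → x * x ≈ 0# → x ≈ 0#
    square-zero xx≈0 = zero-stable (λ x≉0 → x≉0 (zero-product xx≈0 x≉0))

    s-0 : s 0ℚ ≈ 0#
    s-0 = halve (trans (+-congʳ (s-odd 0ℚ)) (-‿inverseˡ (s 0ℚ)))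

    norm : ∀ r → c r * c r + s r * s r ≈ 1#
    norm r = begin
      c r * c r + s r * s r                  ≈⟨ solve 2 (λ c s → c :* c :+ s :* s := c :* c :- s :* (:- s)) refl (c r) (s r) ⟩
      c r * c r - s r * (- s r)              ≈⟨ +-cong (*-congˡ (c-even r)) (-‿cong (*-congˡ (s-odd r))) ⟨
      c r * c (ℚ.- r) - s r * s (ℚ.- r)      ≈⟨ c-+ r (ℚ.- r) ⟨
      c (r ℚ.- r)                            ≡⟨ ≡.cong c (ℚₚ.+-inverseʳ r) ⟩
      c 0ℚ                                   ≈⟨ c-0 ⟩
      1#                                     ∎

    double-c : ∀ r → c (r ℚ.+ r) + s r * s r ≈ c r * c r
    double-c r = trans (+-congʳ (c-+ r r)) (solve 2 (λ c s → (c :- s) :+ s := c) refl (c r * c r) (s r * s r))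

    c-1 : c 1ℚ ≈ - 1#
    c-1 = begin
      c (½ ℚ.+ ½)                                          ≈⟨ c-+ ½ ½ ⟩
      c ½ * c ½ - s ½ * s ½                                ≈⟨ solve 2 (λ c s → c :- s := (c :+ c) :- (c :+ s)) refl (c ½ * c ½) (s ½ * s ½) ⟩
      (c ½ * c ½ + c ½ * c ½) - (c ½ * c ½ + s ½ * s ½)    ≈⟨ +-cong (+-cong zero² zero²) (-‿cong (norm ½)) ⟩
      (0# + 0#) - 1#                                       ≈⟨ trans (+-congʳ (+-identityˡ 0#)) (+-identityˡ (- 1#)) ⟩
      - 1#                                                 ∎
      where
      zero² : c ½ * c ½ ≈ 0#
      zero² = trans (*-congʳ quarter) (zeroˡ (c ½))

    s-1 : s 1ℚ ≈ 0#
    s-1 = trans (s-+ ½ ½) (trans (+-cong (trans (*-congˡ quarter) (zeroʳ _)) (trans (*-congʳ quarter) (zeroˡ _))) (+-identityˡ 0#))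

    c-shift : ∀ r → c (1ℚ ℚ.+ r) ≈ - c r
    c-shift r = trans (c-+ 1ℚ r) (trans (+-cong (*-congʳ c-1) (-‿cong (trans (*-congʳ s-1) (zeroˡ _))))
      (trans (+-cong (solve 2 (λ u x → (:- u) :* x := :- (u :* x)) refl 1# (c r)) -0#≈0#) (trans (+-identityʳ _) (-‿cong (*-identityˡ (c r))))))

    s-shift : ∀ r → s (1ℚ ℚ.+ r) ≈ - s r
    s-shift r = trans (s-+ 1ℚ r) (trans (+-cong (trans (*-congʳ s-1) (zeroˡ _)) (*-congʳ c-1))
      (trans (+-identityˡ _) (trans (solve 2 (λ u x → (:- u) :* x := :- (u :* x)) refl 1# (s r)) (-‿cong (*-identityˡ (s r))))))

    -- The powers of the complex number with parts `x` and `y`, known through the recursion of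
    -- complex multiplication only.
    record Recurrence (r : ℚ) (x y : Carrier) (X Y : ℕ → Carrier) : Set where
      field
        x≈c   : x ≈ c r
        y≈s   : y ≈ s r
        X-0   : X 0 ≈ 1#
        Y-0   : Y 0 ≈ 0#
        X-suc : ∀ m → X (suc m) ≈ x * X m - y * Y m
        Y-suc : ∀ m → Y (suc m) ≈ x * Y m + y * X m

    powers : ∀ {r x y X Y} → Recurrence r x y X Y → ∀ m → X m ≈ c (m · r) ∧ Y m ≈ s (m · r)
    powers             R zero    = trans (Recurrence.X-0 R) (sym c-0) , trans (Recurrence.Y-0 R) (sym s-0)
    powers {r} {X = X} R (suc m) = let Xm , Ym = powers R m in
      trans (X-suc m) (trans (+-cong (*-cong x≈c Xm) (-‿cong (*-cong y≈s Ym))) (sym (c-+ r (m · r)))) ,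
      trans (Y-suc m) (trans (trans (+-cong (*-cong x≈c Ym) (*-cong y≈s Xm)) (+-comm _ _)) (sym (s-+ r (m · r))))
      where open Recurrence R

    module _ {t : ℚ} (0<t : 0ℚ ℚ.< t) (t<1 : t ℚ.< 1ℚ) (pt≡1 : p · t ≡ 1ℚ) where

      1≉-1 : ¬ 1# ≈ - 1#
      1≉-1 1≈-1 = 2≉0 (trans (+-congʳ 1≈-1) (-‿inverseˡ 1#))

      -- Otherwise the sine of the angle is 0, and all its multiples have cosine 1; but `p · t` is
      -- the half turn, whose cosine is -1.
      c-t≉1 : ¬ c t ≈ 1#
      c-t≉1 c≈1 = 1≉-1 (trans (sym (c-multiple p)) (trans (reflexive (≡.cong c pt≡1)) c-1))
        where
        s≈0 : s t ≈ 0#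
        s≈0 = square-zero (begin
          s t * s t                                ≈⟨ solve 2 (λ c s → s := (c :+ s) :- c) refl (c t * c t) (s t * s t) ⟩
          (c t * c t + s t * s t) - c t * c t      ≈⟨ +-cong (norm t) (-‿cong (trans (*-cong c≈1 c≈1) (*-identityˡ 1#))) ⟩
          1# - 1#                                  ≈⟨ -‿inverseʳ 1# ⟩
          0#                                       ∎)
        c-multiple : ∀ m → c (m · t) ≈ 1#
        c-multiple zero    = c-0
        c-multiple (suc m) = begin
          c (t ℚ.+ m · t)                          ≈⟨ c-+ t (m · t) ⟩
          c t * c (m · t) - s t * s (m · t)        ≈⟨ +-cong (*-cong c≈1 (c-multiple m)) (-‿cong (trans (*-congʳ s≈0) (zeroˡ _))) ⟩
          1# * 1# - 0#                             ≈⟨ trans (+-cong (*-identityˡ 1#) -0#≈0#) (+-identityʳ 1#) ⟩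
          1#                                       ∎

      -- The cosine squared of half the angle would be zero, by the formula for the double angle,
      -- although that half lies strictly before the first zero.
      c-t≉-1 : ¬ c t ≈ - 1#
      c-t≉-1 c≈-1 = first h (half-pos 0<t) h<½ (square-zero (halve (begin
        c h * c h + c h * c h                      ≈⟨ +-congˡ (double-c h) ⟨
        c h * c h + (c (h ℚ.+ h) + s h * s h)      ≈⟨ solve 3 (λ c d s → c :+ (d :+ s) := d :+ (c :+ s)) refl (c h * c h) (c (h ℚ.+ h)) (s h * s h) ⟩
        c (h ℚ.+ h) + (c h * c h + s h * s h)      ≈⟨ +-cong (trans (reflexive (≡.cong c (half+half t))) c≈-1) (norm h) ⟩
        - 1# + 1#                                  ≈⟨ -‿inverseˡ 1# ⟩
        0#                                         ∎)))
        where
        h : ℚ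
        h = ½ ℚ.* t
        h<½ : h ℚ.< ½
        h<½ = ≡.subst (h ℚ.<_) (ℚₚ.*-identityʳ ½) (ℚₚ.*-monoʳ-<-pos ½ t<1)

      -- Cosine 1 at the double angle forces sine 0, hence cosine 1 or -1, at the angle itself. The
      -- double angle is that of the root of unity in question.
      c-2t≉1 : ¬ c (t ℚ.+ t) ≈ 1#
      c-2t≉1 c≈1 = c-t≉-1 (begin
        c t                    ≈⟨ solve 2 (λ c u → c := (u :+ c) :- u) refl (c t) 1# ⟩
        (1# + c t) - 1#        ≈⟨ +-congʳ (zero-product {1# - c t} product 1-c≉0) ⟩
        0# - 1#                ≈⟨ +-identityˡ (- 1#) ⟩
        - 1#                   ∎)
        where
        s²≈0 : s t * s t ≈ 0#
        s²≈0 = halve (begin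
          s t * s t + s t * s t                        ≈⟨ solve 2 (λ c s → s :+ s := (c :+ s) :- (c :- s)) refl (c t * c t) (s t * s t) ⟩
          (c t * c t + s t * s t) - (c t * c t - s t * s t)
                                                       ≈⟨ +-cong (norm t) (-‿cong (trans (sym (c-+ t t)) c≈1)) ⟩
          1# - 1#                                      ≈⟨ -‿inverseʳ 1# ⟩
          0#                                           ∎)
        product : (1# - c t) * (1# + c t) ≈ 0#
        product = begin
          (1# - c t) * (1# + c t)                      ≈⟨ solve 2 (λ u c → (u :- c) :* (u :+ c) := u :* u :- c :* c) refl 1# (c t) ⟩
          1# * 1# - c t * c t                          ≈⟨ +-congʳ (trans (*-identityˡ 1#) (sym (norm t))) ⟩
          (c t * c t + s t * s t) - c t * c t          ≈⟨ solve 2 (λ c s → (c :+ s) :- c := s) refl (c t * c t) (s t * s t) ⟩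
          s t * s t                                    ≈⟨ s²≈0 ⟩
          0#                                           ∎
        1-c≉0 : ¬ 1# - c t ≈ 0#
        1-c≉0 1-c≈0 = c-t≉1 (begin
          c t                  ≈⟨ solve 2 (λ c u → c := u :- (u :- c)) refl (c t) 1# ⟩
          1# - (1# - c t)      ≈⟨ +-congˡ (trans (-‿cong 1-c≈0) -0#≈0#) ⟩
          1# + 0#              ≈⟨ +-identityʳ 1# ⟩
          1#                   ∎)

      private
        r : ℚ
        r = t ℚ.+ t

      pr≡2 : p · r ≡ 1ℚ ℚ.+ 1ℚ
      pr≡2 = ≡.trans (·-distrib p t t) (≡.cong₂ ℚ._+_ pt≡1 pt≡1)

      turn : ∀ m → (p ℕ.+ m) · r ≡ 1ℚ ℚ.+ (1ℚ ℚ.+ m · r)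
      turn m = ≡.trans (·-+ p m r) (≡.trans (≡.cong (ℚ._+ m · r) pr≡2) (ℚₚ.+-assoc 1ℚ 1ℚ (m · r)))

      -involutive : ∀ x → - - x ≈ x
      -involutive = solve 1 (λ x → :- (:- x) := x) refl

      c-periodic : ∀ k m → c ((k ℕ.* p ℕ.+ m) · r) ≈ c (m · r)
      c-periodic zero    m = refl
      c-periodic (suc k) m = trans (reflexive (≡.cong (λ n → c (n · r)) (ℕₚ.+-assoc p (k ℕ.* p) m)))
        (trans (trans (reflexive (≡.cong c (turn (k ℕ.* p ℕ.+ m)))) (trans (c-shift _) (trans (-‿cong (c-shift _)) (-involutive _)))) (c-periodic k m))

      s-periodic : ∀ k m → s ((k ℕ.* p ℕ.+ m) · r) ≈ s (m · r)
      s-periodic zero    m = refl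
      s-periodic (suc k) m = trans (reflexive (≡.cong (λ n → s (n · r)) (ℕₚ.+-assoc p (k ℕ.* p) m)))
        (trans (trans (reflexive (≡.cong s (turn (k ℕ.* p ℕ.+ m)))) (trans (s-shift _) (trans (-‿cong (s-shift _)) (-involutive _)))) (s-periodic k m))

      residue : ∀ m → m ≡ (m / p) ℕ.* p ℕ.+ m % p
      residue m = ≡.trans (m≡m%n+[m/n]*n m p) (ℕₚ.+-comm (m % p) _)

      toℕ-+ : ∀ (a b : 𝔽 p) → toℕ (a +ᶠ b) ≡ (toℕ a ℕ.+ toℕ b) % p
      toℕ-+ a b = toℕ-[] (toℕ a ℕ.+ toℕ b)

      c-sum : ∀ (a b : 𝔽 p) → c (toℕ (a +ᶠ b) · r) ≈ c (toℕ a · r ℚ.+ toℕ b · r)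
      c-sum a b = begin
        c (toℕ (a +ᶠ b) · r)                       ≡⟨ ≡.cong (λ m → c (m · r)) (toℕ-+ a b) ⟩
        c (((toℕ a ℕ.+ toℕ b) % p) · r)            ≈⟨ c-periodic ((toℕ a ℕ.+ toℕ b) / p) ((toℕ a ℕ.+ toℕ b) % p) ⟨
        c (((toℕ a ℕ.+ toℕ b) / p ℕ.* p ℕ.+ (toℕ a ℕ.+ toℕ b) % p) · r)
                                                   ≡⟨ ≡.cong (λ m → c (m · r)) (residue (toℕ a ℕ.+ toℕ b)) ⟨
        c ((toℕ a ℕ.+ toℕ b) · r)                  ≡⟨ ≡.cong c (·-+ (toℕ a) (toℕ b) r) ⟩
        c (toℕ a · r ℚ.+ toℕ b · r)                ∎

      s-sum : ∀ (a b : 𝔽 p) → s (toℕ (a +ᶠ b) · r) ≈ s (toℕ a · r ℚ.+ toℕ b · r)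
      s-sum a b = begin
        s (toℕ (a +ᶠ b) · r)                       ≡⟨ ≡.cong (λ m → s (m · r)) (toℕ-+ a b) ⟩
        s (((toℕ a ℕ.+ toℕ b) % p) · r)            ≈⟨ s-periodic ((toℕ a ℕ.+ toℕ b) / p) ((toℕ a ℕ.+ toℕ b) % p) ⟨
        s (((toℕ a ℕ.+ toℕ b) / p ℕ.* p ℕ.+ (toℕ a ℕ.+ toℕ b) % p) · r)
                                                   ≡⟨ ≡.cong (λ m → s (m · r)) (residue (toℕ a ℕ.+ toℕ b)) ⟨
        s ((toℕ a ℕ.+ toℕ b) · r)                  ≡⟨ ≡.cong s (·-+ (toℕ a) (toℕ b) r) ⟩
        s (toℕ a · r ℚ.+ toℕ b · r)                ∎

      1·r : toℕ (1ᶠ {p}) · r ≡ r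
      1·r = ≡.trans (≡.cong (_· r) (≡.trans (toℕ-[] 1) (m<n⇒m%n≡m (ℕ.nonTrivial⇒n>1 p {{prime⇒nonTrivial prime}})))) (ℚₚ.+-identityʳ r)

      -- The two equations say (ω - 1)(x + iy) = 0, and |ω - 1|² = 2(1 - c).
      no-fixed-vector : ∀ {x y} → c r * x - s r * y ≈ x → s r * x + c r * y ≈ y → x ≈ 0#
      no-fixed-vector {x} {y} e₁ e₂ = zero-product {1# - c r} (halve (begin
        (1# - c r) * x + (1# - c r) * x
          ≈⟨ solve 3 (λ u c x → (u :- c) :* x :+ (u :- c) :* x := u :* x :+ (u :* x :- (c :* x :+ c :* x))) refl 1# (c r) x ⟩
        1# * x + (1# * x - (c r * x + c r * x))
          ≈⟨ +-cong (*-congʳ (sym (norm r))) (+-congʳ (*-identityˡ x)) ⟩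
        (c r * c r + s r * s r) * x + (x - (c r * x + c r * x))
          ≈⟨ solve 4 (λ c s x y → (c :* c :+ s :* s) :* x :+ (x :- (c :* x :+ c :* x))
               := (c :* ((c :* x :- s :* y) :- x) :- ((c :* x :- s :* y) :- x)) :+ s :* ((s :* x :+ c :* y) :- y)) refl (c r) (s r) x y ⟩
        (c r * ((c r * x - s r * y) - x) - ((c r * x - s r * y) - x)) + s r * ((s r * x + c r * y) - y)
          ≈⟨ +-cong (+-cong (trans (*-congˡ d₁) (zeroʳ _)) (trans (-‿cong d₁) -0#≈0#)) (trans (*-congˡ d₂) (zeroʳ _)) ⟩
        (0# + 0#) + 0#
          ≈⟨ trans (+-identityʳ _) (+-identityʳ _) ⟩
        0# ∎)) 1-c≉0
        where
        d₁ : (c r * x - s r * y) - x ≈ 0#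
        d₁ = trans (+-congʳ e₁) (-‿inverseʳ x)
        d₂ : (s r * x + c r * y) - y ≈ 0#
        d₂ = trans (+-congʳ e₂) (-‿inverseʳ y)
        1-c≉0 : ¬ 1# - c r ≈ 0#
        1-c≉0 1-c≈0 = c-2t≉1 (begin
          c r                  ≈⟨ solve 2 (λ c u → c := u :- (u :- c)) refl (c r) 1# ⟩
          1# - (1# - c r)      ≈⟨ +-congˡ (trans (-‿cong 1-c≈0) -0#≈0#) ⟩
          1# + 0#              ≈⟨ +-identityʳ 1# ⟩
          1#                   ∎)

      character : Character
      character = record
        { c = λ a → c (toℕ a · r)
        ; s = λ a → s (toℕ a · r)
        ; c-+ = λ a b → trans (c-sum a b) (c-+ (toℕ a · r) (toℕ b · r))
        ; s-+ = λ a b → trans (s-sum a b) (s-+ (toℕ a · r) (toℕ b · r))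
        ; norm = λ a → norm (toℕ a · r)
        ; nontrivial = λ {x} {y} → ≡.subst (λ q → c q * x - s q * y ≈ x → s q * x + c q * y ≈ y → x ≈ 0#) (≡.sym 1·r) no-fixed-vector
        }

      character-c : ∀ {x y X Y} → Recurrence r x y X Y → ∀ a → X (toℕ a) ≈ Character.c character a
      character-c R a = proj₁ (powers R (toℕ a))

      character-s : ∀ {x y X Y} → Recurrence r x y X Y → ∀ a → Y (toℕ a) ≈ Character.s character a
      character-s R a = proj₂ (powers R (toℕ a))

-- The theorem over the Cauchy reals

open import Data.Integer.Base as ℤ using (+_)
open import Data.Integer.Solver using () renaming (module +-*-Solver to ℤ-solver)
open import Data.List.Base as List using (List; []; _∷_)
open import Data.Product.Base using (_×_)
open import Data.Rational.Base as ℚ using (ℚ; 0ℚ; 1ℚ; ½; _/_)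
open import Data.Rational.Solver using (module +-*-Solver)
open import Data.Vec.Base using (Vec)
open import Relation.Binary.PropositionalEquality
open import Relation.Nullary.Decidable using (from-no)

open import Defs
open Reals
open Exp
open Concrete using (𝔽-primeField)
open PolyBound using (total-bounded)
open Accumulate
open Costs

open +-*-Solver

module OP = OrderedProperties ℝ-orderedRing

seq-ofℕ : ∀ m k → seq (OP.ofℕ m) k ≡ ℕℚ m
seq-ofℕ zero    k = refl
seq-ofℕ (suc m) k = trans (cong (1ℚ ℚ.+_) (seq-ofℕ m k)) (sym (ℕℚ-suc m))

fromℕ≃ofℕ : ∀ m → fromℕ m ≃ OP.ofℕ m
fromℕ≃ofℕ m = pointwise {fromℕ m} {OP.ofℕ m} (λ k → sym (seq-ofℕ m k))

-- Descends from a crude bound `M`; comparing rationals is decidable, comparing reals is not.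
natural-above : ∀ M q → 0ℚ ℚ.≤ q → q ℚ.≤ ℕℚ M → ∃[ m ] q ℚ.≤ ℕℚ m × ℕℚ m ℚ.≤ q ℚ.+ 1ℚ
natural-above zero    q 0≤q q≤M = 0 , q≤M , ℚₚ.≤-trans 0≤q (x≤x+y 0≤1)
natural-above (suc M) q 0≤q q≤M with q ℚₚ.≤? ℕℚ M
... | yes q≤ = natural-above M q 0≤q q≤
... | no  q≰ = suc M , q≤M , subst (ℚ._≤ q ℚ.+ 1ℚ) (trans (ℚₚ.+-comm (ℕℚ M) 1ℚ) (sym (ℕℚ-suc M))) (ℚₚ.+-monoˡ-≤ 1ℚ (ℚₚ.<⇒≤ (ℚₚ.≰⇒> q≰)))

archimedean : ∀ x → 0ℝ ≤ x → ∃[ m ] x ≤ OP.ofℕ m × OP.ofℕ m ≤ x + OP.ofℕ 2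
archimedean x 0≤x =
  let M , 0≤x+½ = 0≤x ½ 0<½
      N , close = cauchy x ½ 0<½
      k = M ℕ.⊔ N
      -- One half absorbs the oscillation of the sequence after `k`, and also the error that
      -- nonnegativity of `x` permits at a given index.
      q = seq x k ℚ.+ ½
      m , q≤m , m≤q+1 = natural-above ℤ.∣ ℚ.↥ q ∣ q (0≤x+½ k (ℕₚ.m≤m⊔n M N)) (≤fromℕ q)
      x≤q = λ n k≤n → ∣a-b∣≤ε⇒a≤b+ε {seq x n} {seq x k} (close (ℕₚ.≤-trans (ℕₚ.m≤n⊔m M N) k≤n) (ℕₚ.m≤n⊔m M N))
      q≤x = λ n k≤n → ∣a-b∣≤ε⇒a≤b+ε {seq x k} {seq x n} (close (ℕₚ.m≤n⊔m M N) (ℕₚ.≤-trans (ℕₚ.m≤n⊔m M N) k≤n))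
  in m ,
     (λ ε 0<ε → k , λ n k≤n → ℚₚ.≤-trans (ℚₚ.≤-trans (x≤q n k≤n) q≤m) (subst (λ y → ℕℚ m ℚ.≤ y ℚ.+ ε) (sym (seq-ofℕ m n)) (x≤x+y (ℚₚ.<⇒≤ 0<ε)))) ,
     (λ ε 0<ε → k , λ n k≤n → subst₂ (λ y z → y ℚ.≤ (seq x n ℚ.+ z) ℚ.+ ε) (sym (seq-ofℕ m n)) (sym (seq-ofℕ 2 n))
       (ℚₚ.≤-trans (ℚₚ.≤-trans m≤q+1 (ℚₚ.≤-trans (ℚₚ.+-monoˡ-≤ 1ℚ (ℚₚ.+-monoˡ-≤ ½ (q≤x n k≤n))) (ℚₚ.≤-reflexive (halves+1 (seq x n))))) (x≤x+y (ℚₚ.<⇒≤ 0<ε))))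
  where
  0<½ : 0ℚ ℚ.< ½
  0<½ = ℚₚ.positive⁻¹ ½
  halves+1 : ∀ a → ((a ℚ.+ ½) ℚ.+ ½) ℚ.+ 1ℚ ≡ a ℚ.+ ℕℚ 2
  halves+1 = solve 1 (λ a → ((a :+ con ½) :+ con ½) :+ con 1ℚ := a :+ con (ℕℚ 2)) refl

ℕℚ-* : ∀ m n → ℕℚ (m ℕ.* n) ≡ ℕℚ m ℚ.* ℕℚ n
ℕℚ-* zero    n = sym (ℚₚ.*-zeroˡ (ℕℚ n))
ℕℚ-* (suc m) n = begin
  ℕℚ (n ℕ.+ m ℕ.* n)              ≡⟨ trans (ℕℚ-+ n (m ℕ.* n)) (cong (ℕℚ n ℚ.+_) (ℕℚ-* m n)) ⟩
  ℕℚ n ℚ.+ ℕℚ m ℚ.* ℕℚ n          ≡⟨ solve 2 (λ m n → n :+ m :* n := (con 1ℚ :+ m) :* n) refl (ℕℚ m) (ℕℚ n) ⟩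
  (1ℚ ℚ.+ ℕℚ m) ℚ.* ℕℚ n          ≡⟨ cong (ℚ._* ℕℚ n) (ℕℚ-suc m) ⟨
  ℕℚ (suc m) ℚ.* ℕℚ n             ∎
  where open ≡-Reasoning

module _ (k : ℕ) where

  private
    p : ℕ
    p = suc k
    t : ℚ
    t = + 1 / p

  recip-power : ∀ n → powℚ t n ℚ.* ℕℚ (p ℕ.^ n) ≡ 1ℚ
  recip-power zero    = refl
  recip-power (suc n) = begin
    powℚ t n ℚ.* t ℚ.* ℕℚ (p ℕ.* p ℕ.^ n)               ≡⟨ cong (powℚ t n ℚ.* t ℚ.*_) (ℕℚ-* p (p ℕ.^ n)) ⟩
    powℚ t n ℚ.* t ℚ.* (ℕℚ p ℚ.* ℕℚ (p ℕ.^ n))          ≡⟨ solve 4 (λ a t p b → a :* t :* (p :* b) := (p :* t) :* (a :* b)) refl (powℚ t n) t (ℕℚ p) (ℕℚ (p ℕ.^ n)) ⟩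
    (ℕℚ p ℚ.* t) ℚ.* (powℚ t n ℚ.* ℕℚ (p ℕ.^ n))        ≡⟨ cong₂ ℚ._*_ (ℕℚ-recip k) (recip-power n) ⟩
    1ℚ ℚ.* 1ℚ                                           ≡⟨⟩
    1ℚ                                                  ∎
    where open ≡-Reasoning

  double : t ℚ.+ t ≡ + 2 / p
  double = ℚₚ.toℚᵘ-injective (ℚᵘₚ.≃-trans (ℚₚ.toℚᵘ-homo-+ t t)
    (ℚᵘₚ.≃-trans (ℚᵘₚ.+-cong (ℚₚ.toℚᵘ-fromℚᵘ (ℚᵘ.mkℚᵘ (+ 1) k)) (ℚₚ.toℚᵘ-fromℚᵘ (ℚᵘ.mkℚᵘ (+ 1) k)))
      (ℚᵘₚ.≃-trans (ℚᵘ.*≡* (ℤ-solver.solve 1 (λ s → (ℤ-solver.con (+ 1) ℤ-solver.:* s ℤ-solver.:+ ℤ-solver.con (+ 1) ℤ-solver.:* s) ℤ-solver.:* s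
          ℤ-solver.:= ℤ-solver.con (+ 2) ℤ-solver.:* (s ℤ-solver.:* s)) refl (+ p)))
        (ℚᵘₚ.≃-sym (ℚₚ.toℚᵘ-fromℚᵘ (ℚᵘ.mkℚᵘ (+ 2) k))))))

+ᶜ-Re : ∀ z w → Re (z +ᶜ w) ≃ Re z + Re w
+ᶜ-Re z w = ≃-refl {Re z + Re w}

+ᶜ-Im : ∀ z w → Im (z +ᶜ w) ≃ Im z + Im w
+ᶜ-Im z w = ≃-refl {Im z + Im w}

*ᶜ-Re : ∀ z w → Re (z *ᶜ w) ≃ Re z * Re w - Im z * Im w
*ᶜ-Re z w = ≃-refl {Re z * Re w - Im z * Im w}

*ᶜ-Im : ∀ z w → Im (z *ᶜ w) ≃ Re z * Im w + Im z * Re w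
*ᶜ-Im z w = ≃-refl {Re z * Im w + Im z * Re w}

-- Stated for the sequences: comparing the reals themselves would also compare the
-- proofs that the sequences are Cauchy.
average-seq-Re : ∀ p .{{_ : NonZero p}} {n} (F : Vec (𝔽 p) n → ℂ) k → let W = List.foldr (λ a s → F a +ᶜ s) 0ᶜ (points p n) in
  seq (Re (average p F)) k ≡ powℚ (+ 1 / p) n ℚ.* seq (Re W) k ℚ.+ ℚ.- (0ℚ ℚ.* seq (Im W) k)
average-seq-Re p F k = refl

average-seq-Im : ∀ p .{{_ : NonZero p}} {n} (F : Vec (𝔽 p) n → ℂ) k → let W = List.foldr (λ a s → F a +ᶜ s) 0ᶜ (points p n) in
  seq (Im (average p F)) k ≡ powℚ (+ 1 / p) n ℚ.* seq (Im W) k ℚ.+ 0ℚ ℚ.* seq (Re W) k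
average-seq-Im p F k = refl

sumᶜ : ∀ {A : Set} → (A → ℂ) → List A → ℂ
sumᶜ = accumulate {B = ℂ} _+ᶜ_ 0ᶜ

scaledModulus : ∀ {i δ x y : ℝ} → δ * δ ≃ (i * x - 0ℝ * y) * (i * x - 0ℝ * y) + (i * y + 0ℝ * x) * (i * y + 0ℝ * x) →
  OrderedProperties.ScaledModulus ℝ-orderedRing δ i x y
scaledModulus h ε = h ε

module _ (p : ℕ) .{{_ : NonZero p}} {n} (F : Vec (𝔽 p) n → ℂ) where

  private
    i x y : ℝ
    i = fromℚ (powℚ (+ 1 / p) n)
    x = Re (sumᶜ F (points p n))
    y = Im (sumᶜ F (points p n))

  average-Re : Re (average p {n} F) ≃ i * x - 0ℝ * y
  average-Re = pointwise {Re (average p {n} F)} {i * x - 0ℝ * y} (λ k → trans (average-seq-Re p F k)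
    (cong (λ v → powℚ (+ 1 / p) n ℚ.* seq (Re v) k ℚ.+ ℚ.- (0ℚ ℚ.* seq (Im v) k)) (foldr-accumulate {B = ℂ} _+ᶜ_ 0ᶜ F (points p n))))

  average-Im : Im (average p {n} F) ≃ i * y + 0ℝ * x
  average-Im = pointwise {Im (average p {n} F)} {i * y + 0ℝ * x} (λ k → trans (average-seq-Im p F k)
    (cong (λ v → powℚ (+ 1 / p) n ℚ.* seq (Im v) k ℚ.+ 0ℚ ℚ.* seq (Re v) k) (foldr-accumulate {B = ℂ} _+ᶜ_ 0ᶜ F (points p n))))

  modulus-average : ∀ {δ} → IsModulus δ (average p {n} F) →
    OrderedProperties.ScaledModulus ℝ-orderedRing δ (fromℚ (powℚ (+ 1 / p) n))
      (Re (accumulate {B = ℂ} _+ᶜ_ 0ᶜ F (points p n))) (Im (accumulate {B = ℂ} _+ᶜ_ 0ᶜ F (points p n)))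
  modulus-average {δ} m = scaledModulus {i} {δ} {x} {y}
    (≃-trans {δ * δ} {Re (average p {n} F) * Re (average p {n} F) + Im (average p {n} F) * Im (average p {n} F)} {(i * x - 0ℝ * y) * (i * x - 0ℝ * y) + (i * y + 0ℝ * x) * (i * y + 0ℝ * x)}
      (IsModulus.square m)
      (+-cong {Re (average p {n} F) * Re (average p {n} F)} {(i * x - 0ℝ * y) * (i * x - 0ℝ * y)} {Im (average p {n} F) * Im (average p {n} F)} {(i * y + 0ℝ * x) * (i * y + 0ℝ * x)}
        (*-cong {Re (average p {n} F)} {i * x - 0ℝ * y} {Re (average p {n} F)} {i * x - 0ℝ * y} average-Re average-Re)
        (*-cong {Im (average p {n} F)} {i * y + 0ℝ * x} {Im (average p {n} F)} {i * y + 0ℝ * x} average-Im average-Im)))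

SumModulus : ∀ {p n} → ℂ → (Vec (𝔽 p) n → 𝔽 p) → ℝ → ℚ → Set
SumModulus {p} {n} ω f δ i = OrderedProperties.ScaledModulus ℝ-orderedRing δ (fromℚ i)
  (Re (accumulate {B = ℂ} _+ᶜ_ 0ᶜ (λ a → ω ^ᶜ toℕ (f a)) (points p n)))
  (Im (accumulate {B = ℂ} _+ᶜ_ 0ᶜ (λ a → ω ^ᶜ toℕ (f a)) (points p n)))

record IsReciprocal (p : ℕ) (t : ℚ) : Set where
  field
    positive : 0ℚ ℚ.< t
    <1       : t ℚ.< 1ℚ
    multiple : p · t ≡ 1ℚ
    power    : ∀ n → powℚ t n ℚ.* ℕℚ (p ℕ.^ n) ≡ 1ℚ

reciprocal : ∀ p .{{_ : NonZero p}} → 1 ℕ.< p → IsReciprocal p (+ 1 / p)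
reciprocal (suc zero)    (ℕ.s≤s ())
reciprocal (suc (suc k)) _ = record
  { positive = 0<t
  ; <1       = subst (t ℚ.<_) multiple (ℚₚ.≤-<-trans (ℚₚ.≤-reflexive (sym (ℚₚ.+-identityʳ t)))
                 (ℚₚ.+-monoʳ-< t (ℚₚ.+-mono-<-≤ 0<t (0≤· k))))
  ; multiple = multiple ; power = recip-power (suc k) }
  where
  t : ℚ
  t = + 1 / suc (suc k)
  0<t : 0ℚ ℚ.< t
  0<t = ℚₚ.positive⁻¹ t {{ℚₚ.normalize-pos 1 (suc (suc k))}}
  0≤· : ∀ m → 0ℚ ℚ.≤ m · t
  0≤· zero    = ℚₚ.≤-refl
  0≤· (suc m) = ℚₚ.+-mono-≤ (ℚₚ.<⇒≤ 0<t) (0≤· m)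
  ·≡* : ∀ m → m · t ≡ ℕℚ m ℚ.* t
  ·≡* zero    = sym (ℚₚ.*-zeroˡ t)
  ·≡* (suc m) = trans (cong (t ℚ.+_) (·≡* m)) (trans (solve 2 (λ t m → t :+ m :* t := (con 1ℚ :+ m) :* t) refl t (ℕℚ m)) (cong (ℚ._* t) (sym (ℕℚ-suc m))))
  multiple : suc (suc k) · t ≡ 1ℚ
  multiple = trans (·≡* (suc (suc k))) (ℕℚ-recip (suc k))

module _ {p : ℕ} .{{_ : NonZero p}} (prime : Prime p) {π : ℝ} (isPi : IsPi π) {t : ℚ} (t-recip : IsReciprocal p t) where

  open Roots prime ℝ-orderedRing

  angle : ℚ → ℝ
  angle r = fromℚ r * π

  angle-+ : ∀ r t n → seq (angle (r ℚ.+ t)) n ≡ seq (angle r + angle t) n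
  angle-+ r t n = ℚₚ.*-distribʳ-+ (seq π n) r t

  angle-neg : ∀ r n → seq (angle (ℚ.- r)) n ≡ seq (- angle r) n
  angle-neg r n = sym (ℚₚ.neg-distribˡ-* r (seq π n))

  rotation : Rotation
  rotation = record
    { c            = λ r → cos (angle r)
    ; s            = λ r → sin (angle r)
    ; c-+          = λ r t → ≃-trans {cos (angle (r ℚ.+ t))} {cos (angle r + angle t)} {cos (angle r) * cos (angle t) - sin (angle r) * sin (angle t)}
                       (cos-pointwise {angle (r ℚ.+ t)} {angle r + angle t} (angle-+ r t)) (cos-+ (angle r) (angle t))
    ; s-+          = λ r t → ≃-trans {sin (angle (r ℚ.+ t))} {sin (angle r + angle t)} {sin (angle r) * cos (angle t) + cos (angle r) * sin (angle t)}
                       (sin-pointwise {angle (r ℚ.+ t)} {angle r + angle t} (angle-+ r t)) (sin-+ (angle r) (angle t))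
    ; c-0          = cos-0 {angle 0ℚ} (λ n → ℚₚ.*-zeroˡ (seq π n))
    ; c-even       = λ r → ≃-trans {cos (angle (ℚ.- r))} {cos (- angle r)} {cos (angle r)}
                       (cos-pointwise {angle (ℚ.- r)} { - angle r} (angle-neg r)) (cos-even (angle r))
    ; s-odd        = λ r → ≃-trans {sin (angle (ℚ.- r))} {sin (- angle r)} { - sin (angle r)}
                       (sin-pointwise {angle (ℚ.- r)} { - angle r} (angle-neg r)) (sin-odd (angle r))
    ; quarter      = IsPi.cos-zero isPi
    ; first        = λ r 0<r r<½ → IsPi.first isPi (angle r) (0<angle 0<r) (angle<½ r<½)
    ; zero-product = λ {x} {y} xy≃0 x≄0 → zero-stable {y} (zero-product {x} {y} xy≃0 x≄0)
    ; zero-stable  = λ {x} → zero-stable {x}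
    ; 2≉0          = λ 2≃0 → let N , close = 2≃0 ½ (ℚₚ.positive⁻¹ ½) in
                       from-no (ℚ.∣ (1ℚ ℚ.+ 1ℚ) ℚ.- 0ℚ ∣ ℚₚ.≤? ½) (close N ℕₚ.≤-refl) }
    where
    scale-positive : ∀ {r} → 0ℚ ℚ.< r → ∃[ ε ] 0ℚ ℚ.< ε × (∃[ N ] ∀ n → N ℕ.≤ n → ε ℚ.≤ r ℚ.* seq π n)
    scale-positive {r} 0<r = let ε , 0<ε , N , ε≤π = IsPi.positive isPi in
      r ℚ.* ε , ℚₚ.positive⁻¹ _ {{ℚₚ.pos*pos⇒pos r {{ℚ.positive 0<r}} ε {{ℚ.positive 0<ε}}}} ,
      N , λ n N≤n → ℚₚ.*-monoˡ-≤-nonNeg r {{ℚ.nonNegative (ℚₚ.<⇒≤ 0<r)}} (subst (ℚ._≤ seq π n) (ℚₚ.+-identityˡ ε) (ε≤π n N≤n))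
    0<angle : ∀ {r} → 0ℚ ℚ.< r → 0ℝ < angle r
    0<angle 0<r = let ε , 0<ε , N , ε≤ = scale-positive 0<r in
      ε , 0<ε , N , λ n N≤n → ℚₚ.≤-trans (ℚₚ.≤-reflexive (ℚₚ.+-identityˡ ε)) (ε≤ n N≤n)
    angle<½ : ∀ {r} → r ℚ.< ½ → angle r < fromℚ ½ * π
    angle<½ {r} r<½ = let ε , 0<ε , N , ε≤ = scale-positive {½ ℚ.- r} (subst (ℚ._< ½ ℚ.- r) (ℚₚ.+-inverseʳ r) (ℚₚ.+-monoˡ-< (ℚ.- r) r<½)) in
      ε , 0<ε , N , λ n N≤n → ℚₚ.≤-trans (ℚₚ.+-monoʳ-≤ (r ℚ.* seq π n) (ε≤ n N≤n))
        (ℚₚ.≤-reflexive (solve 3 (λ r h x → r :* x :+ (h :- r) :* x := h :* x) refl r ½ (seq π n)))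

  private
    module Z = Rotations rotation
    module T = IsReciprocal t-recip
    K : PrimeField p
    K = 𝔽-primeField prime

  ofℕ-reflects-≤ : ∀ {a b} → OP.ofℕ a ≤ OP.ofℕ b → a ℕ.≤ b
  ofℕ-reflects-≤ {a} {b} = ×1≤⇒≤ a b

  module _ (ω : ℂ) (Re-ω : Re ω ≃ cos (fromℚ (t ℚ.+ t) * π)) (Im-ω : Im ω ≃ sin (fromℚ (t ℚ.+ t) * π)) where

    recurrence : Z.Recurrence (t ℚ.+ t) (Re ω) (Im ω) (λ m → Re (ω ^ᶜ m)) (λ m → Im (ω ^ᶜ m))
    recurrence = record
      { x≈c   = λ ε → Re-ω ε
      ; y≈s   = λ ε → Im-ω ε
      ; X-0   = ≃-refl {1ℝ}
      ; Y-0   = ≃-refl {0ℝ}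
      ; X-suc = λ m → *ᶜ-Re ω (ω ^ᶜ m)
      ; Y-suc = λ m → *ᶜ-Im ω (ω ^ᶜ m) }

    module _ {n} (f : Vec (𝔽 p) n → 𝔽 p) {i : ℚ} (i-size : i ℚ.* ℕℚ (p ℕ.^ n) ≡ 1ℚ) {δ : ℝ}
             (modulus : SumModulus {p} {n} ω f δ i) {ρ : ℝ} (ρδ≃p : ρ * δ ≃ fromℕ p) where

      open Forms K using (Der; Dense₁; Dense₂)

      biased⇒dense : Der 5 f → ∃[ A ] 1 ℕ.≤ A × OP.ofℕ A ≤ OP.ofℕ 3 * (((ρ * ρ) * (ρ * ρ)) * ((ρ * ρ) * (ρ * ρ))) × Dense₁ f A × Dense₂ f A
      biased⇒dense Df = Bias.biased⇒dense K ℝ-orderedRing (Roots.Rotations.character prime ℝ-orderedRing rotation T.positive T.<1 T.multiple) archimedean ofℕ-reflects-≤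
        _+ᶜ_ 0ᶜ Re Im +ᶜ-Re (≃-refl {0ℝ}) +ᶜ-Im (≃-refl {0ℝ}) (λ m → ω ^ᶜ m)
        (Roots.Rotations.character-c prime ℝ-orderedRing rotation T.positive T.<1 T.multiple {Re ω} {Im ω} {λ m → Re (ω ^ᶜ m)} {λ m → Im (ω ^ᶜ m)} recurrence)
        (Roots.Rotations.character-s prime ℝ-orderedRing rotation T.positive T.<1 T.multiple {Re ω} {Im ω} {λ m → Re (ω ^ᶜ m)} {λ m → Im (ω ^ᶜ m)} recurrence)
        f {fromℚ i} {δ} {ρ}
        (pointwise {fromℚ i * OP.ofℕ (p ℕ.^ n)} {1ℝ} (λ k → trans (cong (i ℚ.*_) (seq-ofℕ (p ℕ.^ n) k)) i-size))
        modulus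
        (≃-trans {ρ * δ} {fromℕ p} {OP.ofℕ p} ρδ≃p (fromℕ≃ofℕ p)) Df

reciprocal-twice : ∀ p .{{_ : NonZero p}} → (+ 1 / p) ℚ.+ (+ 1 / p) ≡ + 2 / p
reciprocal-twice (suc k) = double k

module _ (p : ℕ) .{{_ : NonZero p}} (π : ℝ) where

  private
    turn : ∀ k → (+ 2 / p) ℚ.* seq π k ≡ ((+ 1 / p) ℚ.+ (+ 1 / p)) ℚ.* seq π k
    turn k = cong (ℚ._* seq π k) {+ 2 / p} {+ 1 / p ℚ.+ + 1 / p} (sym (reciprocal-twice p))

  root-Re : Re (rootOfUnity p π) ≃ cos (fromℚ (+ 1 / p ℚ.+ + 1 / p) * π)
  root-Re = pointwise {Re (rootOfUnity p π)} {cos (fromℚ (+ 1 / p ℚ.+ + 1 / p) * π)} (λ k → cong (λ x → expPartial Re-i^ x k) (turn k))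

  root-Im : Im (rootOfUnity p π) ≃ sin (fromℚ (+ 1 / p ℚ.+ + 1 / p) * π)
  root-Im = pointwise {Im (rootOfUnity p π)} {sin (fromℚ (+ 1 / p ℚ.+ + 1 / p) * π)} (λ k → cong (λ x → expPartial Im-i^ x k) (turn k))

evalℝ-[] : ∀ x → evalℝ [] x ≃ 0ℝ
evalℝ-[] x = ≃-refl {0ℝ}

evalℝ-∷ : ∀ a as x → evalℝ (a ∷ as) x ≃ a + x * evalℝ as x
evalℝ-∷ a as x = ≃-refl {a + x * evalℝ as x}

-- The costs are at most `c A^e`, and `A` is at most `3 ρ⁸`: the polynomial is `c (3 x⁸)^e`.
boundingPolynomial : List ℝ
boundingPolynomial = OrderedProperties.monomial ℝ-orderedRing evalℝ evalℝ-[] evalℝ-∷ (proj₁ (proj₂ total-bounded)) (OP.ofℕ (proj₁ total-bounded))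

total≤ : ∀ {A ρ} → 1 ℕ.≤ A → OP.ofℕ A ≤ OP.ofℕ 3 * (((ρ * ρ) * (ρ * ρ)) * ((ρ * ρ) * (ρ * ρ))) →
  fromℕ (4 ℕ.* (suc (cutCost A) ℕ.+ pairCost A)) ≤ evalℝ boundingPolynomial ρ
total≤ {A} {ρ} 1≤A A≤3ρ⁸ =
  ≤-trans {fromℕ N} {OP.ofℕ N} {evalℝ boundingPolynomial ρ} (≤-reflexive {fromℕ N} {OP.ofℕ N} (fromℕ≃ofℕ N))
  (≤-trans {OP.ofℕ N} {OP.ofℕ (C ℕ.* A ℕ.^ e)} {evalℝ boundingPolynomial ρ} (OP.ofℕ-mono (proj₂ (proj₂ total-bounded) A 1≤A))
  (≤-trans {OP.ofℕ (C ℕ.* A ℕ.^ e)} {OP.ofℕ C * OP.ofℕ (A ℕ.^ e)} {evalℝ boundingPolynomial ρ}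
    (≤-reflexive {OP.ofℕ (C ℕ.* A ℕ.^ e)} {OP.ofℕ C * OP.ofℕ (A ℕ.^ e)} (OP.ofℕ-* C (A ℕ.^ e)))
    (OP.power≤monomial evalℝ evalℝ-[] evalℝ-∷ {A} {ρ} (0≤x² ((ρ * ρ) * (ρ * ρ))) A≤3ρ⁸ e {OP.ofℕ C} (OP.0≤ofℕ C))))
  where
  C e N : ℕ
  C = proj₁ total-bounded
  e = proj₁ (proj₂ total-bounded)
  N = 4 ℕ.* (suc (cutCost A) ℕ.+ pairCost A)

module _ {p : ℕ} .{{nz : NonZero p}} (isPrime : Prime p) {n} {f : Vec (𝔽 p) n → 𝔽 p} where

  private
    module P = Forms (𝔽-primeField {{nz}} isPrime)

  DenseLevel : ℝ → Set
  DenseLevel ρ = ∃[ A ] 1 ℕ.≤ A × OP.ofℕ A ≤ OP.ofℕ 3 * (((ρ * ρ) * (ρ * ρ)) * ((ρ * ρ) * (ρ * ρ))) × P.Dense₁ f A × P.Dense₂ f A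

  dense-level : P.Degree≤ 4 f → ∀ {δ} → IsBias f δ → ∀ {ρ} → ρ * δ ≃ fromℕ p → DenseLevel ρ
  dense-level f≤4 {δ} (π , isPi , m) {ρ} ρδ≃p = biased⇒dense {{nz}} isPrime isPi t-recip (rootOfUnity p {{nz}} π) (root-Re p {{nz}} π) (root-Im p {{nz}} π) f
    {powℚ (+ 1 / p) n} (IsReciprocal.power t-recip n) {δ} (modulus-average p {{nz}} {n} (λ a → rootOfUnity p {{nz}} π ^ᶜ toℕ (f a)) {δ} m) {ρ} ρδ≃p
    (P.degree⇒der {d = 4} {f} f≤4)
    where
    t-recip : IsReciprocal p (+ 1 / p)
    t-recip = reciprocal p {{nz}} (ℕ.nonTrivial⇒n>1 p {{prime⇒nonTrivial isPrime}})

  Expression : ℕ → Set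
  Expression c =
      Σ[ ℓ ∈ (Fin c → Vec (𝔽 p) n → 𝔽 p) ]
      Σ[ q ∈ (Fin c → Vec (𝔽 p) n → 𝔽 p) ]
      Σ[ q′ ∈ (Fin c → Vec (𝔽 p) n → 𝔽 p) ]
      Σ[ g ∈ (Fin c → Vec (𝔽 p) n → 𝔽 p) ]
        (∀ j → Degree≤ 1 (ℓ j) × Degree≤ 2 (q j) × Degree≤ 2 (q′ j) × Degree≤ 3 (g j)) ×
        (∀ x → f x ≡ ∑ᶠ (λ j → ℓ j x *ᶠ g j x) +ᶠ ∑ᶠ (λ j → q j x *ᶠ q′ j x))

  express : ∀ {A c} → suc (cutCost A) ℕ.≤ c → pairCost A ℕ.≤ c → P.Decomposition f A → Expression c
  express {c = c} cut≤c pair≤c D =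
    (λ j → proj₁ (P.pad c L j)) , (λ j → proj₁ (P.pad c M j)) , (λ j → proj₂ (P.pad c M j)) , (λ j → proj₂ (P.pad c L j)) ,
    (λ j → let ℓ≤1 , g≤3 = P.pad-degree c (P.cubics-degree D) j
               q≤2 , q′≤2 = P.pad-degree c (P.quadratics-degree D) j
           in ℓ≤1 , q≤2 , q′≤2 , g≤3) ,
    P.expressed D cut≤c pair≤c
    where
    L = P.cubics D
    M = P.quadratics D

  dense⇒expression : P.Degree≤ 4 f → ∀ {ρ} → DenseLevel ρ → Σ[ c ∈ ℕ ] fromℕ (4 ℕ.* c) ≤ evalℝ boundingPolynomial ρ × Expression c
  dense⇒expression f≤4 {ρ} (A , 1≤A , A≤3ρ⁸ , dense₁ , dense₂) =
    -- The lists of both kinds of products are padded with zeros to this common length.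
    suc (cutCost A) ℕ.+ pairCost A , total≤ {A} {ρ} 1≤A A≤3ρ⁸ ,
    express {A} {suc (cutCost A) ℕ.+ pairCost A} (ℕₚ.m≤m+n (suc (cutCost A)) (pairCost A)) (ℕₚ.m≤n+m (pairCost A) (suc (cutCost A)))
      (P.decomposition (P.degree⇒der {d = 4} {f} f≤4) {A} dense₁ (λ _ → dense₂))

theorem3 :
    Σ[ P ∈ List ℝ ]
      ∀ (p : ℕ) .{{_ : NonZero p}} → Prime p →
      ∀ (n : ℕ) (f : Vec (𝔽 p) n → 𝔽 p) → Degree 4 f →
      ∀ (δ : ℝ) → IsBias f δ →
      -- ρ is the quotient p / δ; in particular δ is nonzero.
      ∀ (ρ : ℝ) → ρ * δ ≃ fromℕ p →
      Σ[ c ∈ ℕ ] fromℕ (4 ℕ.* c) ≤ evalℝ P ρ ×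
      Σ[ ℓ ∈ (Fin c → Vec (𝔽 p) n → 𝔽 p) ]
      Σ[ q ∈ (Fin c → Vec (𝔽 p) n → 𝔽 p) ]
      Σ[ q′ ∈ (Fin c → Vec (𝔽 p) n → 𝔽 p) ]
      Σ[ g ∈ (Fin c → Vec (𝔽 p) n → 𝔽 p) ]
        (∀ j → Degree≤ 1 (ℓ j) × Degree≤ 2 (q j) × Degree≤ 2 (q′ j) × Degree≤ 3 (g j)) ×
        (∀ x → f x ≡ ∑ᶠ (λ j → ℓ j x *ᶠ g j x) +ᶠ ∑ᶠ (λ j → q j x *ᶠ q′ j x))
theorem3 = boundingPolynomial , λ p {{nz}} isPrime n f (f≤4 , _) δ bias ρ ρδ≃p →
  dense⇒expression {{nz}} isPrime {f = f} f≤4 {ρ} (dense-level {{nz}} isPrime {f = f} f≤4 {δ} bias {ρ} ρδ≃p)
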